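{- Let $r\ge 2$ and let $a_1,a_2,\dots,a_r,s_1,s_2,\dots,s_{r-1}$ be positive integers such that $a_1<s_1\le s_2\le\cdots\le s_{r-1}$ and $a_i\le s_{i-1}$ for each $2\le i\le r$. Then there exists a constant $c>0$ such that for every integer $p\ge c$, $$ex\big(n,K^{(r)}_{a_1,a_2,\dots,a_r},K^{(r)}_{s_1,s_2,\dots,s_{r-1},p}\big)=\Theta\!\left(n^{(a_1+a_2+\cdots+a_r)-\frac{a_1a_2\cdots a_r}{s_1s_2\cdots s_{r-1}}}\right)$$ as $n\to\infty$ (the implied constants may depend on $r,a_i,s_i,p$ but not on $n$).
   Context: For $r$-uniform hypergraphs $T$ and $H$, a hypergraph is $H$-free if it contains no (not necessarily induced) subhypergraph isomorphic to $H$, and $ex(n,T,H)$ denotes the maximum number of copies of $T$ (subhypergraphs isomorphic to $T$) in an $n$-vertex $H$-free $r$-uniform hypergraph. $K^{(r)}_{t_1,\dots,t_r}$ denotes the complete $r$-partite $r$-uniform hypergraph with parts of sizes $t_1,\dots,t_r$: its vertex set is a disjoint union of parts $V_1,\dots,V_r$ with $|V_i|=t_i$, and its edges are exactly the $r$-sets containing one vertex from each part. -}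

module Defs where

open import Data.Bool using (Bool; true; false; _∧_; _∨_; not)
open import Data.Bool.Properties using () renaming (_≟_ to _≟ᵇ_)
open import Data.Nat using (ℕ; zero; suc; _+_; _≡ᵇ_)
open import Data.Fin using (Fin; zero; suc; splitAt) renaming (_≟_ to _≟ᶠ_)
open import Data.Fin.Subset using (Subset; ∣_∣)
open import Data.List using (List; []; _∷_; map; _++_; concatMap; length; allFin)
open import Data.Bool.ListAction using (all; any)
open import Data.Vec using (Vec; []; _∷_; tabulate; lookup; sum; foldr)
open import Data.Nat using (_*_)
open import Data.Vec.Properties using (≡-dec)
open import Data.Product using (_×_; _,_)
open import Data.Sum using (inj₁; inj₂)
open import Relation.Nullary.Decidable using (⌊_⌋)
open import Relation.Binary.PropositionalEquality using (_≡_)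

Hypergraph : ℕ → Set
Hypergraph n = Subset n → Bool

Uniform : ∀ {n} → ℕ → Hypergraph n → Set
Uniform {n} r G = ∀ (e : Subset n) → G e ≡ true → ∣ e ∣ ≡ r

allSubsets : ∀ n → List (Subset n)
allSubsets zero = [] ∷ []
allSubsets (suc n) = map (true ∷_) (allSubsets n) ++ map (false ∷_) (allSubsets n)

sublists : ∀ {A : Set} → List A → List (List A)
sublists [] = [] ∷ []
sublists (x ∷ xs) = map (x ∷_) (sublists xs) ++ sublists xs

filterᵇ : ∀ {A : Set} → (A → Bool) → List A → List A
filterᵇ p [] = []
filterᵇ p (x ∷ xs) with p x
... | true = x ∷ filterᵇ p xs
... | false = filterᵇ p xs

count : ∀ {A : Set} → (A → Bool) → List A → ℕ
count p xs = length (filterᵇ p xs)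

extend : ∀ {m n} → Fin n → (Fin m → Fin n) → (Fin (suc m) → Fin n)
extend j f zero = j
extend j f (suc i) = f i

allFuns : ∀ m n → List (Fin m → Fin n)
allFuns zero n = (λ ()) ∷ []
allFuns (suc m) n = concatMap (λ f → map (λ j → extend j f) (allFin n)) (allFuns m n)

eqSub : ∀ {n} → Subset n → Subset n → Bool
eqSub u v = ⌊ ≡-dec _≟ᵇ_ u v ⌋

memb : ∀ {n} → Subset n → List (Subset n) → Bool
memb u F = any (eqSub u) F

subsetOf : ∀ {n} → Subset n → Subset n → Bool
subsetOf {n} u w = all (λ i → not (lookup u i) ∨ lookup w i) (allFin n)

image : ∀ {m n} → (Fin m → Fin n) → Subset m → Subset n
image {m} φ e = tabulate (λ v → any (λ i → lookup e i ∧ ⌊ φ i ≟ᶠ v ⌋) (allFin m))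

fullSet : ∀ m → Subset m
fullSet m = tabulate (λ _ → true)

injectiveᵇ : ∀ {m n} → (Fin m → Fin n) → Bool
injectiveᵇ {m} φ =
  all (λ i → all (λ j → not ⌊ φ i ≟ᶠ φ j ⌋ ∨ ⌊ i ≟ᶠ j ⌋) (allFin m)) (allFin m)

isIsoᵇ : ∀ {m n} → Hypergraph m → (Fin m → Fin n) → Subset n → List (Subset n) → Bool
isIsoᵇ {m} T φ W F =
  injectiveᵇ φ ∧ eqSub (image φ (fullSet m)) W ∧ all (λ f → subsetOf f W) F
  ∧ all (λ e → ⌊ T e ≟ᵇ memb (image φ e) F ⌋) (allSubsets m)

isCopyᵇ : ∀ {m n} → Hypergraph m → Subset n → List (Subset n) → Bool
isCopyᵇ {m} {n} T W F = any (λ φ → isIsoᵇ T φ W F) (allFuns m n)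

-- all subhypergraphs (W , F) of G: W a vertex subset, F a set of edges of G
-- (F ranges over sublists of the duplicate-free list of edges of G, so each
-- edge set occurs exactly once).
subhypergraphs : ∀ {n} → Hypergraph n → List (Subset n × List (Subset n))
subhypergraphs {n} G =
  concatMap (λ W → map (λ F → (W , F)) (sublists (filterᵇ G (allSubsets n)))) (allSubsets n)

copies : ∀ {m n} → Hypergraph m → Hypergraph n → ℕ
copies T G = count (λ { (W , F) → isCopyᵇ T W F }) (subhypergraphs G)

Free : ∀ {m n} → Hypergraph m → Hypergraph n → Set
Free H G = copies H G ≡ 0

partOf : ∀ {r} (t : Vec ℕ r) → Fin (sum t) → Fin r
partOf (a ∷ t) v with splitAt a v
... | inj₁ _ = zero
... | inj₂ k = suc (partOf t k)

K : ∀ {r} (t : Vec ℕ r) → Hypergraph (sum t)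
K {r} t e =
  all (λ i → count (λ v → lookup e v ∧ ⌊ partOf t v ≟ᶠ i ⌋) (allFin (sum t)) ≡ᵇ 1) (allFin r)

productV : ∀ {r} → Vec ℕ r → ℕ
productV [] = 1
productV (x ∷ xs) = x * productV xs

-- Write S = s₁ ⋯ s_{r−1}.
--
-- Upper bound: without K_{s₁,…,s_{r−1},p}, sets of sizes s₁, …, s_{r−1} have fewer than p common neighbours, which bounds
-- the number of K_{a₁,s₁,…,s_{r−1}} by a multiple of n^{s₁+⋯+s_{r−1}}. Lowering the part sizes s_{i−1} to a_i one at a time,
-- the power mean inequality gives the bound for K_a; neighbourhoods too small to contain an s_{i−1}-set contribute a
-- negligible amount because a₁ ≤ s_i for all i.
--
-- Lower bound: choose a prime q with q^S of order n; primes are dense enough by Chebyshev's argument. Let E be a field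
-- of q^D elements, a tower of quadratic extensions of ℤ/q, where D is a power of 2 with D ≥ r (S + 1), and let θ ∈ E have
-- D distinct conjugates. A vertex of part i is a polynomial in θ with coefficients in ℤ/q whose exponents lie in the i-th
-- block of S + 1 integers and whose lowest coefficient is one of B constants; r vertices form an edge if the norm of their
-- sum is a fixed popular value c. Since the norm takes at most q values, the edge density is at least 1/q, and convexity
-- then yields the right number of copies of K_a. Choosing s_i vertices in all parts but one gives S equations
-- ∏_j (y_j + h_{ij}) = c for the conjugates y_j of a vertex y of the last part. For every j the h_{ij} are distinct, because
-- the blocks are linearly independent, and any S of the y_j determine the others. Hence the system has no solution at
-- infinity, so the number of its solutions is bounded in terms of D and S only.

module Submission where

-- Both bounds are proved for the S-th power of the number of copies, which turns the exponent into
-- the integer `sum a * productV s ∸ productV a`. The lowest coefficient with its B values answers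
-- an obstacle in the convexity argument: fixing the remaining parts leaves on average a constant
-- times X / q^e common neighbours, X being the size of a part and e as large as S possibly. With X
-- = q^S this could be less than the number of vertices to be chosen; X = B q^S makes it large
-- enough. B enters the threshold for p as a mere factor, because p vertices of one part can be
-- sorted by their constant. Once the constant is fixed, S free coefficients remain, which is why S
-- conjugates determine the others. Solutions are counted by linear algebra instead of intersection
-- theory: the equations rewrite every monomial, as a function on the solutions, into monomials with
-- bounded exponents, and the number of these bounds the number of solutions.

-- Comparing the lengths of lists without repetitions

module UniqueLists where

  open import Data.Nat using (zero; suc; _≤_)
  open import Data.Fin using (Fin; zero; suc)
  import Data.Fin.Properties as Fin
  open import Data.List using (List; _∷_; length; lookup)
  open import Data.List.Membership.Propositional using (_∈_)
  open import Data.List.Membership.Propositional.Properties using (∈-lookup)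
  open import Data.List.Relation.Unary.Any using (index)
  open import Data.List.Relation.Unary.Any.Properties using (lookup-index)
  open import Data.List.Relation.Unary.All as All using (All; _∷_)
  open import Data.List.Relation.Unary.AllPairs using (_∷_)
  open import Data.List.Relation.Unary.Unique.Propositional using (Unique)
  open import Data.Product using (∃; _×_; _,_; proj₁; proj₂)
  open import Data.Empty using (⊥-elim)
  open import Relation.Binary.PropositionalEquality

  lookup-injective : ∀ {A : Set} {xs : List A} → Unique xs → ∀ {i j} → lookup xs i ≡ lookup xs j → i ≡ j
  lookup-injective (ne ∷ u) {zero} {zero} e = refl
  lookup-injective (ne ∷ u) {zero} {suc j} e = ⊥-elim (All.lookup ne (∈-lookup j) e)
  lookup-injective (ne ∷ u) {suc i} {zero} e = ⊥-elim (All.lookup ne (∈-lookup i) (sym e))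
  lookup-injective (ne ∷ u) {suc i} {suc j} e = cong suc (lookup-injective u e)

  -- Sending each `x` to the position of its partner in `ys` is injective, so the pigeonhole
  -- principle for `Fin` applies. A relation in place of a function suits copies and tuples: a
  -- partner is only known to exist, and what is known about it is exactly what determines `x`
  -- again.
  length-≤-injective-relation : ∀ {A B : Set} {xs : List A} {ys : List B} (R : A → B → Set) → Unique xs →
    (∀ x → x ∈ xs → ∃ λ y → y ∈ ys × R x y) →
    (∀ {x x′ y} → x ∈ xs → x′ ∈ xs → R x y → R x′ y → x ≡ x′) → length xs ≤ length ys
  length-≤-injective-relation {xs = xs} {ys} R uniq total inj = Fin.injective⇒≤ {f = f} f-injective
    where
    image : ∀ i → ∃ λ y → y ∈ ys × R (lookup xs i) y
    image i = total (lookup xs i) (∈-lookup i)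
    f : Fin (length xs) → Fin (length ys)
    f i = index (proj₁ (proj₂ (image i)))
    f-injective : ∀ {i j} → f i ≡ f j → i ≡ j
    f-injective {i} {j} e = lookup-injective uniq (inj (∈-lookup i) (∈-lookup j) (proj₂ (proj₂ (image i)))
      (subst (R (lookup xs j)) (sym y≡) (proj₂ (proj₂ (image j)))))
      where
      y≡ : proj₁ (image i) ≡ proj₁ (image j)
      y≡ = trans (lookup-index (proj₁ (proj₂ (image i)))) (trans (cong (lookup ys) e) (sym (lookup-index (proj₁ (proj₂ (image j))))))

  unique-⊆-length : ∀ {A : Set} {xs ys : List A} → Unique xs → (∀ {x} → x ∈ xs → x ∈ ys) → length xs ≤ length ys
  unique-⊆-length uniq sub = length-≤-injective-relation _≡_ uniq (λ x x∈ → x , sub x∈ , refl) (λ _ _ e e′ → trans e (sym e′))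

-- Binomial coefficients, primorials, and a prime between consecutive powers of 4

module Primes where

  open import Data.Nat
  open import Data.Nat.Properties
  open import Data.Nat.Divisibility
  open import Data.Nat.Primality
  open import Data.Nat.Primality.Factorisation using (factorise)
  open import Data.Nat.Induction using (<-rec)
  open import Data.Nat.Tactic.RingSolver using (solve-∀)
  open import Data.List using ([]; _∷_)
  open import Data.Nat.ListAction using (product)
  open import Data.List.Relation.Unary.All using ([]; _∷_)
  open import Data.Product using (∃; _×_; _,_)
  open import Data.Sum using (_⊎_; inj₁; inj₂)
  open import Data.Empty using (⊥-elim)
  open import Relation.Nullary using (¬_; yes; no)
  open import Relation.Binary.PropositionalEquality

  -- Pascal's rule is also the recursion of `combos`, whose members these numbers count.
  bin : ℕ → ℕ → ℕ
  bin n zero = 1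
  bin zero (suc k) = 0
  bin (suc n) (suc k) = bin n k + bin n (suc k)

  bin-absorb : ∀ n k → suc k * bin (suc n) (suc k) ≡ suc n * bin n k
  bin-absorb zero zero = refl
  bin-absorb zero (suc k) = *-zeroʳ (suc (suc k))
  bin-absorb (suc n) zero = begin
    1 * (1 + bin (suc n) 1)     ≡⟨ *-distribˡ-+ 1 1 (bin (suc n) 1) ⟩
    1 + 1 * bin (suc n) 1       ≡⟨ cong (1 +_) (bin-absorb n 0) ⟩
    1 + suc n * 1               ∎
    where open ≡-Reasoning
  bin-absorb (suc n) (suc k) = begin
    suc (suc k) * (B₁ + B₂)                      ≡⟨ split k B₁ B₂ ⟩
    B₁ + (suc k * B₁ + suc (suc k) * B₂)          ≡⟨ cong₂ (λ u v → B₁ + (u + v)) (bin-absorb n k) (bin-absorb n (suc k)) ⟩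
    B₁ + (suc n * bin n k + suc n * bin n (suc k)) ≡⟨ cong (B₁ +_) (*-distribˡ-+ (suc n) (bin n k) (bin n (suc k))) ⟨
    suc (suc n) * B₁                              ∎
    where
    open ≡-Reasoning
    B₁ = bin (suc n) (suc k)
    B₂ = bin (suc n) (suc (suc k))
    split : ∀ k x y → suc (suc k) * (x + y) ≡ x + (suc k * x + suc (suc k) * y)
    split = solve-∀

  bin-! : ∀ a b → bin (a + b) a * (a ! * b !) ≡ (a + b) !
  bin-! zero b = trans (*-identityˡ _) (*-identityˡ _)
  bin-! (suc a) b = begin
    B * ((suc a * a !) * b !)           ≡⟨ shuffle B a (a !) (b !) ⟩
    (suc a * B) * (a ! * b !)           ≡⟨ cong (_* (a ! * b !)) (bin-absorb (a + b) a) ⟩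
    (suc (a + b) * bin (a + b) a) * (a ! * b !) ≡⟨ *-assoc (suc (a + b)) (bin (a + b) a) (a ! * b !) ⟩
    suc (a + b) * (bin (a + b) a * (a ! * b !)) ≡⟨ cong (suc (a + b) *_) (bin-! a b) ⟩
    suc (a + b) * (a + b) !             ∎
    where
    open ≡-Reasoning
    B = bin (suc (a + b)) (suc a)
    shuffle : ∀ x a y z → x * ((suc a * y) * z) ≡ (suc a * x) * (y * z)
    shuffle = solve-∀

  bin≤2^ : ∀ n k → bin n k ≤ 2 ^ n
  bin≤2^ n zero = m^n>0 2 n
  bin≤2^ zero (suc k) = z≤n
  bin≤2^ (suc n) (suc k) = ≤-trans (+-mono-≤ (bin≤2^ n k) (bin≤2^ n (suc k)))
    (≤-reflexive (cong (2 ^ n +_) (sym (+-identityʳ (2 ^ n)))))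

  rowSum : ℕ → ℕ → ℕ
  rowSum n zero = 0
  rowSum n (suc m) = rowSum n m + bin n m

  rowSum-suc : ∀ n m → rowSum (suc n) (suc m) ≡ rowSum n m + rowSum n (suc m)
  rowSum-suc n zero = refl
  rowSum-suc n (suc m) = begin
    rowSum (suc n) (suc m) + (bin n m + bin n (suc m))       ≡⟨ cong (_+ (bin n m + bin n (suc m))) (rowSum-suc n m) ⟩
    rowSum n m + rowSum n (suc m) + (bin n m + bin n (suc m)) ≡⟨ shuffle (rowSum n m) (rowSum n (suc m)) (bin n m) (bin n (suc m)) ⟩
    rowSum n m + bin n m + (rowSum n (suc m) + bin n (suc m)) ∎
    where
    open ≡-Reasoning
    shuffle : ∀ a b c d → a + b + (c + d) ≡ a + c + (b + d)
    shuffle = solve-∀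

  2^≤rowSum : ∀ n → 2 ^ n ≤ rowSum n (suc n)
  2^≤rowSum zero = s≤s z≤n
  2^≤rowSum (suc n) = begin
    2 ^ n + (2 ^ n + 0)                           ≡⟨ cong (2 ^ n +_) (+-identityʳ (2 ^ n)) ⟩
    2 ^ n + 2 ^ n                                 ≤⟨ +-mono-≤ (2^≤rowSum n) (≤-trans (2^≤rowSum n) (m≤m+n _ _)) ⟩
    rowSum n (suc n) + rowSum n (suc (suc n))     ≡⟨ rowSum-suc n (suc n) ⟨
    rowSum (suc n) (suc (suc n))                  ∎
    where open ≤-Reasoning

  -- Leibniz's harmonic triangle: L / ((k+1) C(n,k+1)) = L / (k C(n−1,k)) − L / (k C(n,k)) stays integral.
  k*bin∣common-multiple : ∀ k n L → (∀ i → 1 ≤ i → i ≤ n → i ∣ L) → suc k ≤ n → suc k * bin n (suc k) ∣ L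
  k*bin∣common-multiple zero (suc n) L mult _ =
    subst (_∣ L) (trans (sym (*-identityʳ (suc n))) (sym (bin-absorb n 0))) (mult (suc n) (s≤s z≤n) ≤-refl)
  k*bin∣common-multiple (suc k) (suc n) L mult (s≤s k<n)
    with k*bin∣common-multiple k (suc n) L mult (m≤n⇒m≤1+n k<n)
       | k*bin∣common-multiple k n L (λ i p q → mult i p (m≤n⇒m≤1+n q)) k<n
  ... | divides A eqA | divides A' eqA' =
    subst (_∣ L) (sym (bin-absorb n (suc k)))
      (∣m+n∣m⇒∣n {m = A * (suc n * u)} {n = L}
        (subst (suc n * u ∣_) (sym key') (n∣m*n A'))
        (n∣m*n A))
    where
    u = bin n (suc k)
    v = bin n k
    absorbed : suc k * (v + u) ≡ suc n * v
    absorbed = bin-absorb n k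
    r₁ : ∀ k A n u v → suc k * (A * (suc n * u) + A * (suc n * v)) ≡ suc n * (A * (suc k * (v + u)))
    r₁ = solve-∀
    r₂ : ∀ n A k u → suc n * (A * (suc k * u)) ≡ suc k * (A * (suc n * u))
    r₂ = solve-∀
    open ≡-Reasoning
    key : suc k * (A * (suc n * u) + L) ≡ suc k * (A' * (suc n * u))
    key = begin
      suc k * (A * (suc n * u) + L)          ≡⟨ cong (λ z → suc k * (A * (suc n * u) + z)) (trans eqA (cong (A *_) absorbed)) ⟩
      suc k * (A * (suc n * u) + A * (suc n * v)) ≡⟨ r₁ k A n u v ⟩
      suc n * (A * (suc k * (v + u)))        ≡⟨ cong (suc n *_) eqA ⟨
      suc n * L                              ≡⟨ cong (suc n *_) eqA' ⟩
      suc n * (A' * (suc k * u))             ≡⟨ r₂ n A' k u ⟩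
      suc k * (A' * (suc n * u))             ∎
    key' : A * (suc n * u) + L ≡ A' * (suc n * u)
    key' = *-cancelˡ-≡ _ _ (suc k) key

  -- Nair's bound for the least common multiple: `2 ^ n` is the sum of the n + 1 entries of row n of
  -- Pascal's triangle, and each entry is at most `L` because k C(n, k) divides `L`.
  2^≤common-multiple : ∀ n L → 0 < L → (∀ i → 1 ≤ i → i ≤ n → i ∣ L) → 2 ^ n ≤ suc n * L
  2^≤common-multiple n L L>0 mult = ≤-trans (2^≤rowSum n) (go (suc n) ≤-refl)
    where
    instance L≢0 : NonZero L
    L≢0 = >-nonZero L>0
    term : ∀ k → k ≤ n → bin n k ≤ L
    term zero _ = L>0
    term (suc k) k<n = ≤-trans (m≤m+n _ (k * bin n (suc k))) (∣⇒≤ (k*bin∣common-multiple k n L mult k<n))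
    go : ∀ m → m ≤ suc n → rowSum n m ≤ m * L
    go zero _ = z≤n
    go (suc m) (s≤s m≤n) = subst (rowSum n m + bin n m ≤_) (+-comm (m * L) L) (+-mono-≤ (go m (m≤n⇒m≤1+n m≤n)) (term m m≤n))

  prime>0 : ∀ {p} → Prime p → 0 < p
  prime>0 {p} pp = >-nonZero⁻¹ p {{prime⇒nonZero pp}}

  prime>1 : ∀ {p} → Prime p → 1 < p
  prime>1 {p} pp = nonTrivial⇒n>1 p {{prime⇒nonTrivial pp}}

  prime-∣-prime : ∀ {p r} → Prime p → 1 < r → r ∣ p → r ≡ p
  prime-∣-prime pp 1<r r∣p with prime⇒irreducible pp r∣p
  ... | inj₁ refl = ⊥-elim (<-irrefl refl 1<r)
  ... | inj₂ e = e

  prime-∣-^ : ∀ {p} m e → Prime p → p ∣ m ^ e → p ∣ m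
  prime-∣-^ m zero pp p∣1 = ⊥-elim (<-irrefl (sym (∣1⇒≡1 p∣1)) (prime>1 pp))
  prime-∣-^ m (suc e) pp d with euclidsLemma m (m ^ e) pp d
  ... | inj₁ q = q
  ... | inj₂ q = prime-∣-^ m e pp q

  prime∤! : ∀ {p} n → Prime p → n < p → ¬ p ∣ n !
  prime∤! zero pp n<p d = <-irrefl (sym (∣1⇒≡1 d)) (prime>1 pp)
  prime∤! {p} (suc n) pp n<p d with euclidsLemma (suc n) (n !) pp d
  ... | inj₁ q = <-irrefl refl (<-≤-trans n<p (∣⇒≤ q))
  ... | inj₂ q = prime∤! n pp (<-trans (n<1+n n) n<p) q

  ∣! : ∀ {m} n → 0 < m → m ≤ n → m ∣ n !
  ∣! {suc m} n _ m≤n = ∣-trans (m∣m*n (m !)) (m≤n⇒m!∣n! m≤n)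

  ∃primeFactor : ∀ n → 1 < n → ∃ λ r → Prime r × r ∣ n
  ∃primeFactor n 1<n with factorise n {{>-nonZero (<-trans (s≤s z≤n) 1<n)}}
  ... | record { factors = [] ; isFactorisation = eq } = ⊥-elim (<-irrefl (sym eq) 1<n)
  ... | record { factors = r ∷ rs ; isFactorisation = eq ; factorsPrime = pr ∷ _ } =
    r , pr , subst (r ∣_) (sym eq) (m∣m*n (product rs))

  split-off-power : ∀ p → Prime p → ∀ i → 0 < i → ∃ λ v → ∃ λ j → i ≡ p ^ v * j × ¬ p ∣ j
  split-off-power p pp = <-rec _ step
    where
    step : ∀ i → (∀ {j} → j < i → 0 < j → ∃ λ v → ∃ λ k → j ≡ p ^ v * k × ¬ p ∣ k) →
           0 < i → ∃ λ v → ∃ λ j → i ≡ p ^ v * j × ¬ p ∣ j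
    step i rec i>0 with p ∣? i
    ... | no p∤i = 0 , i , sym (*-identityˡ i) , p∤i
    ... | yes (divides zero eq) = ⊥-elim (<-irrefl (sym eq) i>0)
    ... | yes (divides q@(suc _) eq) with rec q<i (s≤s z≤n)
      where
      q<i : q < i
      q<i = subst (q <_) (sym eq) (m<m*n q p (prime>1 pp))
    ... | v , k , eq' , p∤k = suc v , k , trans eq (trans (cong (_* p) eq') (shuffle (p ^ v) k p)) , p∤k
      where
      shuffle : ∀ a b c → a * b * c ≡ c * a * b
      shuffle = solve-∀

  ^-∣-^ : ∀ p {u v} → u ≤ v → p ^ u ∣ p ^ v
  ^-∣-^ p {u} {v} u≤v = subst (p ^ u ∣_) (trans (sym (^-distribˡ-+-* p u (v ∸ u))) (cong (p ^_) (m+[n∸m]≡n u≤v))) (m∣m*n _)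

  n<p^n : ∀ p → 1 < p → ∀ n → n < p ^ n
  n<p^n p 1<p zero = s≤s z≤n
  n<p^n p@(suc _) 1<p (suc n) = ≤-<-trans (n<p^n p 1<p n) (m<n*m (p ^ n) p {{m^n≢0 p n}} 1<p)
    where
    m<n*m : ∀ m n .{{_ : NonZero m}} → 1 < n → m < n * m
    m<n*m m n 1<n = subst (m <_) (*-comm m n) (m<m*n m n 1<n)

  largest-power : ∀ p X → 1 < p → 0 < X → ∃ λ e → p ^ e ≤ X × X < p ^ suc e
  largest-power p X 1<p X>0 = go X (<-trans (n<p^n p 1<p X) (^-monoʳ-< p 1<p (n<1+n X)))
    where
    go : ∀ f → X < p ^ suc f → ∃ λ e → p ^ e ≤ X × X < p ^ suc e
    go f lt with p ^ f ≤? X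
    ... | yes le = f , le , lt
    go zero lt | no nle = ⊥-elim (nle X>0)
    go (suc f) lt | no nle = go f (≰⇒> nle)

  primorial : ℕ → ℕ
  primorial zero = 1
  primorial (suc k) with prime? (suc k)
  ... | yes _ = suc k * primorial k
  ... | no _ = primorial k

  Smooth : ℕ → ℕ → Set
  Smooth n i = ∀ r → Prime r → r ∣ i → r ≤ n

  -- `L` is the product, over the primes p ≤ n, of the largest power of p not exceeding `X`. A prime
  -- above `y` contributes itself at most, since p² > y² ≥ X; a prime up to `y` contributes at most
  -- `X`. Bounding the number of small primes by the number of integers up to `y` is affordable, as
  -- `y` will be the square root of `X`.
  smooth-multiple : ∀ X y → 0 < X → X ≤ y * y → ∀ n → ∃ λ L →
    0 < L × L ≤ X ^ (n ⊓ y) * primorial n × (∀ i → 1 ≤ i → i ≤ X → Smooth n i → i ∣ L)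
  smooth-multiple X y X>0 X≤y² zero = 1 , s≤s z≤n , ≤-refl , base
    where
    base : ∀ i → 1 ≤ i → i ≤ X → Smooth 0 i → i ∣ 1
    base (suc zero) _ _ _ = ∣-refl
    base i@(suc (suc _)) _ _ sm with ∃primeFactor i (s≤s (s≤s z≤n))
    ... | r , pr , r∣i = ⊥-elim (<-irrefl refl (<-≤-trans (prime>0 pr) (sm r pr r∣i)))
  smooth-multiple X y X>0 X≤y² (suc k) with smooth-multiple X y X>0 X≤y² k | prime? (suc k)
  ... | L , L>0 , L≤ , mult | no np = L , L>0 , ≤-trans L≤ (*-monoˡ-≤ (primorial k) (^-monoʳ-≤ X {{>-nonZero X>0}} (⊓-monoˡ-≤ y (n≤1+n k)))) ,
    λ i 1≤i i≤X sm → mult i 1≤i i≤X (λ r pr r∣i → s≤s⁻¹ (≤∧≢⇒< (sm r pr r∣i) λ { refl → np pr }))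
  ... | L , L>0 , L≤ , mult | yes pp with largest-power (suc k) X (prime>1 pp) X>0
  ... | e , p^e≤X , X<p^e+1 = p ^ e * L , *-mono-≤ (m^n>0 p e) L>0 , bound , mult'
    where
    p = suc k
    open ≤-Reasoning
    instance X≢0 : NonZero X
    X≢0 = >-nonZero X>0
    bound : p ^ e * L ≤ X ^ (p ⊓ y) * (p * primorial k)
    bound with p ≤? y
    ... | yes p≤y = begin
      p ^ e * L                              ≤⟨ *-mono-≤ p^e≤X L≤ ⟩
      X * (X ^ (k ⊓ y) * primorial k)        ≡⟨ *-assoc X (X ^ (k ⊓ y)) (primorial k) ⟨
      X ^ suc (k ⊓ y) * primorial k          ≡⟨ cong (λ z → X ^ z * primorial k) (trans (cong suc (m≤n⇒m⊓n≡m (≤-trans (n≤1+n k) p≤y))) (sym (m≤n⇒m⊓n≡m p≤y))) ⟩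
      X ^ (p ⊓ y) * primorial k              ≤⟨ *-monoʳ-≤ (X ^ (p ⊓ y)) (m≤n*m (primorial k) p) ⟩
      X ^ (p ⊓ y) * (p * primorial k)        ∎
    ... | no p≰y = begin
      p ^ e * L                              ≤⟨ *-mono-≤ p^e≤p L≤ ⟩
      p * (X ^ (k ⊓ y) * primorial k)        ≡⟨ shuffle p (X ^ (k ⊓ y)) (primorial k) ⟩
      X ^ (k ⊓ y) * (p * primorial k)        ≤⟨ *-monoˡ-≤ (p * primorial k) (^-monoʳ-≤ X (⊓-monoˡ-≤ y (n≤1+n k))) ⟩
      X ^ (p ⊓ y) * (p * primorial k)        ∎
      where
      shuffle : ∀ a b c → a * (b * c) ≡ b * (a * c)
      shuffle = solve-∀
      e≤1 : e ≤ 1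
      e≤1 with e ≤? 1
      ... | yes q = q
      ... | no e≰1 = ⊥-elim (<-irrefl refl (begin-strict
        X             ≤⟨ X≤y² ⟩
        y * y         <⟨ *-mono-< (≰⇒> p≰y) (≰⇒> p≰y) ⟩
        p * p         ≡⟨ cong (p *_) (*-identityʳ p) ⟨
        p ^ 2         ≤⟨ ^-monoʳ-≤ p (≰⇒> e≰1) ⟩
        p ^ e         ≤⟨ p^e≤X ⟩
        X             ∎))
      p^e≤p : p ^ e ≤ p
      p^e≤p = ≤-trans (^-monoʳ-≤ p e≤1) (≤-reflexive (*-identityʳ p))
    mult' : ∀ i → 1 ≤ i → i ≤ X → Smooth p i → i ∣ p ^ e * L
    mult' i 1≤i i≤X sm with split-off-power p pp i 1≤i
    ... | v , j , eq , p∤j = subst (_∣ p ^ e * L) (sym eq) (*-pres-∣ (^-∣-^ p v≤e) (mult j j>0 j≤X smj))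
      where
      i≢0 : ¬ i ≡ 0
      i≢0 refl = <-irrefl refl 1≤i
      j>0 : 0 < j
      j>0 = n≢0⇒n>0 λ { refl → i≢0 (trans eq (*-zeroʳ (p ^ v))) }
      instance j≢0 : NonZero j
      j≢0 = >-nonZero j>0
      j≤X : j ≤ X
      j≤X = ≤-trans (subst (j ≤_) (sym eq) (m≤n*m j (p ^ v) {{m^n≢0 p v}})) i≤X
      p^v≤X : p ^ v ≤ X
      p^v≤X = ≤-trans (subst (p ^ v ≤_) (sym eq) (m≤m*n (p ^ v) j)) i≤X
      v≤e : v ≤ e
      v≤e with v ≤? e
      ... | yes q = q
      ... | no v≰e = ⊥-elim (<-irrefl refl (≤-<-trans p^v≤X (<-≤-trans X<p^e+1 (^-monoʳ-≤ p (≰⇒> v≰e)))))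
      smj : Smooth k j
      smj r pr r∣j = s≤s⁻¹ (≤∧≢⇒< (sm r pr (subst (r ∣_) (sym eq) (∣n⇒∣m*n (p ^ v) r∣j))) λ { refl → p∤j r∣j })

  -- Chebyshev's observation: a prime p with m < p ≤ 2m divides (2m)! but not m!, hence divides
  -- C(2m, m). The bound on the prime factors of `Q` is carried along to keep the next prime coprime
  -- to `Q`, so that their product still divides.
  primorial-split : ∀ m j → j ≤ m → ∃ λ Q →
    primorial (j + m) ≡ Q * primorial m × Q ∣ bin (m + m) m × (∀ r → Prime r → r ∣ Q → r ≤ j + m)
  primorial-split m zero _ = 1 , sym (*-identityˡ _) , 1∣ _ ,
    λ r pr r∣1 → ⊥-elim (<-irrefl (sym (∣1⇒≡1 r∣1)) (prime>1 pr))
  primorial-split m (suc j) j<m with primorial-split m j (<⇒≤ j<m) | prime? (suc (j + m))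
  ... | Q , eq , Q∣B , bd | no np = Q , eq , Q∣B , λ r pr r∣Q → m≤n⇒m≤1+n (bd r pr r∣Q)
  ... | Q , eq , divides t B≡ , bd | yes pp = p * Q , trans (cong (p *_) eq) (sym (*-assoc p Q _)) , pQ∣B , bd'
    where
    p = suc (j + m)
    p∣B : p ∣ bin (m + m) m
    p∣B with euclidsLemma (bin (m + m) m) (m ! * m !) pp
               (subst (p ∣_) (sym (bin-! m m)) (∣! (m + m) (s≤s z≤n) (+-monoˡ-≤ m j<m)))
    ... | inj₁ d = d
    ... | inj₂ d with euclidsLemma (m !) (m !) pp d
    ...   | inj₁ d' = ⊥-elim (prime∤! m pp (s≤s (m≤n+m m j)) d')
    ...   | inj₂ d' = ⊥-elim (prime∤! m pp (s≤s (m≤n+m m j)) d')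
    p∤Q : ¬ p ∣ Q
    p∤Q d = <-irrefl refl (bd p pp d)
    pQ∣B : p * Q ∣ bin (m + m) m
    pQ∣B with euclidsLemma t Q pp (subst (p ∣_) B≡ p∣B)
    ... | inj₁ d = subst (p * Q ∣_) (sym B≡) (*-monoˡ-∣ Q d)
    ... | inj₂ d = ⊥-elim (p∤Q d)
    bd' : ∀ r → Prime r → r ∣ p * Q → r ≤ p
    bd' r pr d with euclidsLemma p Q pr d
    ... | inj₁ d' = ∣⇒≤ d'
    ... | inj₂ d' = m≤n⇒m≤1+n (bd r pr d')

  bin>0 : ∀ n k → k ≤ n → 0 < bin n k
  bin>0 n zero _ = s≤s z≤n
  bin>0 (suc n) (suc k) (s≤s k≤n) = ≤-trans (bin>0 n k k≤n) (m≤m+n _ _)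

  -- Doubling m multiplies the primorial by a divisor of C(2m, m), which is at most 2^(2m). Powers
  -- of two suffice here, as the primes are sought between powers of 4.
  primorial-2^ : ∀ k → primorial (2 ^ k) ≤ 2 ^ (2 * 2 ^ k)
  primorial-2^ zero = s≤s z≤n
  primorial-2^ (suc k) with primorial-split (2 ^ k) (2 ^ k) ≤-refl
  ... | Q , eq , Q∣B , _ = begin
    primorial (2 * m)       ≡⟨ cong primorial 2m ⟩
    primorial (m + m)       ≡⟨ eq ⟩
    Q * primorial m         ≤⟨ *-mono-≤ (∣⇒≤ {{>-nonZero (bin>0 (m + m) m (m≤m+n m m))}} Q∣B) (primorial-2^ k) ⟩
    bin (m + m) m * 2 ^ (2 * m) ≤⟨ *-monoˡ-≤ (2 ^ (2 * m)) (bin≤2^ (m + m) m) ⟩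
    2 ^ (m + m) * 2 ^ (2 * m) ≡⟨ cong (λ z → 2 ^ z * 2 ^ (2 * m)) 2m ⟨
    2 ^ (2 * m) * 2 ^ (2 * m) ≡⟨ ^-distribˡ-+-* 2 (2 * m) (2 * m) ⟨
    2 ^ (2 * m + 2 * m)     ≡⟨ cong (λ z → 2 ^ (2 * m + z)) (+-identityʳ (2 * m)) ⟨
    2 ^ (2 * (2 * m))       ∎
    where
    open ≤-Reasoning
    m = 2 ^ k
    2m : 2 * m ≡ m + m
    2m = cong (m +_) (+-identityʳ m)

  prime-in-range? : ∀ a b → (∃ λ p → Prime p × a < p × p ≤ b) ⊎ (∀ p → Prime p → p ≤ b → p ≤ a)
  prime-in-range? a zero = inj₂ λ p pp p≤0 → ≤-trans p≤0 z≤n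
  prime-in-range? a (suc b) with prime-in-range? a b
  ... | inj₁ (p , pp , a<p , p≤b) = inj₁ (p , pp , a<p , m≤n⇒m≤1+n p≤b)
  ... | inj₂ none with prime? (suc b) | a <? suc b
  ...   | yes pp | yes a<b = inj₁ (suc b , pp , a<b , ≤-refl)
  ...   | yes pp | no a≮b = inj₂ λ p _ p≤b → ≤-trans p≤b (≮⇒≥ a≮b)
  ...   | no np | _ = inj₂ λ p pp p≤b → none p pp (s≤s⁻¹ (≤∧≢⇒< p≤b λ { refl → np pp }))

  -- The origin of the 5 in the range of primes: the inequality fails for the exponent 4, where it
  -- would read 18 ≤ 16.
  3h+6≤2^h : ∀ j → 3 * (j + 5) + 6 ≤ 2 ^ (j + 5)
  3h+6≤2^h zero = ≤ᵇ⇒≤ _ _ _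
  3h+6≤2^h (suc j) = begin
    3 * suc (j + 5) + 6            ≡⟨ e j ⟩
    (3 * (j + 5) + 6) + 3          ≤⟨ +-mono-≤ (3h+6≤2^h j) (≤-trans (≤-trans (≤ᵇ⇒≤ 3 6 _) (m≤n+m 6 (3 * (j + 5)))) (3h+6≤2^h j)) ⟩
    2 ^ (j + 5) + 2 ^ (j + 5)      ≡⟨ cong (2 ^ (j + 5) +_) (+-identityʳ (2 ^ (j + 5))) ⟨
    2 ^ suc (j + 5)                ∎
    where
    open ≤-Reasoning
    e : ∀ j → 3 * suc (j + 5) + 6 ≡ (3 * (j + 5) + 6) + 3
    e = solve-∀

  -- Without such a prime every i ≤ X = 4^(h+1) is 4^h-smooth, so the common multiple of the smooth
  -- numbers is a multiple of all i ≤ X and 2^X ≤ (X + 1) L. On the other side log₂ L is at most 2 ·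
  -- 4^h = X / 2 plus a term of order h · 2^h, coming from the primes up to the square root of X.
  -- The factor 4 between the ends of the interval is what makes X / 2 smaller than X by enough.
  ∃prime-between-powers-of-4 : ∀ j → let h = j + 5 in ∃ λ p → Prime p × 4 ^ h < p × p ≤ 4 ^ suc h
  ∃prime-between-powers-of-4 j with prime-in-range? (4 ^ (j + 5)) (4 ^ suc (j + 5))
  ... | inj₁ r = r
  ... | inj₂ none = ⊥-elim (absurd (smooth-multiple X y (m^n>0 4 (suc h)) X≤y² (4 ^ h)))
    where
    h = j + 5
    X = 4 ^ suc h
    y = 2 ^ suc h
    t = 2 ^ h
    open ≤-Reasoning
    4^≡ : ∀ i → 4 ^ i ≡ 2 ^ (2 * i)
    4^≡ i = ^-*-assoc 2 2 i
    4^≡² : ∀ i → 4 ^ i ≡ 2 ^ i * 2 ^ i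
    4^≡² i = trans (4^≡ i) (trans (cong (2 ^_) (cong (i +_) (+-identityʳ i))) (^-distribˡ-+-* 2 i i))
    X≤y² : X ≤ y * y
    X≤y² = ≤-reflexive (4^≡² (suc h))
    absurd : ¬ ∃ λ L → 0 < L × L ≤ X ^ (4 ^ h ⊓ y) * primorial (4 ^ h) × (∀ i → 1 ≤ i → i ≤ X → Smooth (4 ^ h) i → i ∣ L)
    absurd (L , L>0 , L≤ , mult) = <-irrefl refl (<-≤-trans contra' exps)
      where
      mult' : ∀ i → 1 ≤ i → i ≤ X → i ∣ L
      mult' i 1≤i i≤X = mult i 1≤i i≤X λ r pr r∣i → none r pr (≤-trans (∣⇒≤ {{>-nonZero 1≤i}} r∣i) i≤X)
      E = 2 * suc h * y + 2 * 4 ^ h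
      L≤2^ : L ≤ 2 ^ E
      L≤2^ = begin
        L                                             ≤⟨ L≤ ⟩
        X ^ (4 ^ h ⊓ y) * primorial (4 ^ h)           ≤⟨ *-mono-≤ (^-monoʳ-≤ X {{m^n≢0 4 (suc h)}} (m⊓n≤n (4 ^ h) y))
                                                           (subst (λ z → primorial z ≤ 2 ^ (2 * z)) (sym (4^≡ h)) (primorial-2^ (2 * h))) ⟩
        X ^ y * 2 ^ (2 * 4 ^ h)                       ≡⟨ cong (λ z → z ^ y * 2 ^ (2 * 4 ^ h)) (4^≡ (suc h)) ⟩
        (2 ^ (2 * suc h)) ^ y * 2 ^ (2 * 4 ^ h)       ≡⟨ cong (_* 2 ^ (2 * 4 ^ h)) (^-*-assoc 2 (2 * suc h) y) ⟩
        2 ^ (2 * suc h * y) * 2 ^ (2 * 4 ^ h)         ≡⟨ ^-distribˡ-+-* 2 (2 * suc h * y) (2 * 4 ^ h) ⟨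
        2 ^ E                                         ∎
      1+X≤ : suc X ≤ 2 ^ (2 * suc (suc h))
      1+X≤ = subst (suc X ≤_) (4^≡ (suc (suc h))) (^-monoʳ-< 4 (≤ᵇ⇒≤ _ _ _) (n<1+n (suc h)))
      powers : 2 ^ X ≤ 2 ^ (2 * suc (suc h) + E)
      powers = begin
        2 ^ X                             ≤⟨ 2^≤common-multiple X L L>0 mult' ⟩
        suc X * L                         ≤⟨ *-mono-≤ 1+X≤ L≤2^ ⟩
        2 ^ (2 * suc (suc h)) * 2 ^ E     ≡⟨ ^-distribˡ-+-* 2 (2 * suc (suc h)) E ⟨
        2 ^ (2 * suc (suc h) + E)         ∎
      exps : X ≤ 2 * suc (suc h) + E
      exps = ≮⇒≥ λ lt → <-irrefl refl (<-≤-trans (^-monoʳ-< 2 (≤ᵇ⇒≤ _ _ _) lt) powers)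
      contra : h + 2 + 2 * suc h * t < t * t
      contra = begin-strict
        h + 2 + 2 * suc h * t             ≡⟨ cong (_+ 2 * suc h * t) (*-identityʳ (h + 2)) ⟨
        (h + 2) * 1 + 2 * suc h * t       ≤⟨ +-monoˡ-≤ (2 * suc h * t) (*-monoʳ-≤ (h + 2) (m^n>0 2 h)) ⟩
        (h + 2) * t + 2 * suc h * t       ≡⟨ e₁ h t ⟩
        (3 * h + 4) * t                   <⟨ *-monoˡ-< t {{m^n≢0 2 h}} (+-monoʳ-< (3 * h) (≤ᵇ⇒≤ 5 6 _)) ⟩
        (3 * h + 6) * t                   ≤⟨ *-monoˡ-≤ t (3h+6≤2^h j) ⟩
        t * t                             ∎
        where
        e₁ : ∀ h t → (h + 2) * t + 2 * suc h * t ≡ (3 * h + 4) * t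
        e₁ = solve-∀
      contra' : 2 * suc (suc h) + E < X
      contra' = begin-strict
        2 * suc (suc h) + (2 * suc h * (2 * t) + 2 * 4 ^ h)   ≡⟨ cong (λ z → 2 * suc (suc h) + (2 * suc h * (2 * t) + 2 * z)) (4^≡² h) ⟩
        2 * suc (suc h) + (2 * suc h * (2 * t) + 2 * (t * t)) ≡⟨ e₂ h t ⟩
        2 * (h + 2 + 2 * suc h * t) + 2 * (t * t)             <⟨ +-monoˡ-< (2 * (t * t)) (*-monoʳ-< 2 contra) ⟩
        2 * (t * t) + 2 * (t * t)                             ≡⟨ e₃ t ⟩
        4 * (t * t)                                           ≡⟨ cong (4 *_) (4^≡² h) ⟨
        X                                                     ∎
        where
        e₂ : ∀ h t → 2 * suc (suc h) + (2 * suc h * (2 * t) + 2 * (t * t)) ≡ 2 * (h + 2 + 2 * suc h * t) + 2 * (t * t)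
        e₂ = solve-∀
        e₃ : ∀ t → 2 * (t * t) + 2 * (t * t) ≡ 4 * (t * t)
        e₃ = solve-∀

-- Finite fields: polynomials, roots, interpolation, and the Frobenius map

module FiniteFields where

  open import Level using (0ℓ)
  open import Algebra.Bundles using (CommutativeRing; CommutativeSemiring)
  open import Algebra.Core using (Op₁; Op₂)
  import Algebra.Properties.Ring
  import Algebra.Properties.Semiring.Exp
  import Algebra.Properties.Semiring.Mult
  import Algebra.Properties.Semiring.Sum
  import Algebra.Properties.CommutativeSemiring.Binomial
  import Algebra.Solver.Ring.NaturalCoefficients.Default
  open import Algebra.Structures using (IsCommutativeRing)
  open import Data.Nat as ℕ using (ℕ; zero; suc; _∸_; _<_; _≤_; z≤n; s≤s)
  import Data.Nat.Properties as ℕ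
  open import Data.Nat.Divisibility using (_∣_; divides; ∣⇒≤; m∣m*n)
  open import Data.Nat.Primality using (Prime; euclidsLemma)
  open import Data.Nat.Combinatorics using (_C_; nCk≡nC[n∸k]; nCn≡1; nCk+nC[k+1]≡[n+1]C[k+1]; k>n⇒nCk≡0)
  open import Data.Fin using (Fin; zero; suc; toℕ; fromℕ; inject₁; punchOut)
  import Data.Fin.Properties as Fin
  open import Data.Vec using (Vec; []; _∷_; lookup)
  open import Data.Product using (Σ; ∃; _×_; _,_; proj₁; proj₂)
  open import Data.Sum using (inj₁; inj₂)
  open import Data.Empty using (⊥-elim)
  open import Relation.Nullary using (¬_; Dec; yes; no)
  open import Relation.Nullary.Decidable using (map′)
  open import Relation.Binary.PropositionalEquality
  open import Function using (_∘_)
  open Primes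

  injective⇒surjective : ∀ {n} (f : Fin n → Fin n) → (∀ {x y} → f x ≡ f y → x ≡ y) → ∀ y → ∃ λ x → f x ≡ y
  injective⇒surjective {suc n} f inj y with Fin.any? (λ x → f x Fin.≟ y)
  ... | yes r = r
  ... | no avoids = ⊥-elim (ℕ.<-irrefl refl (Fin.injective⇒≤ {f = g} λ e → inj (Fin.punchOut-injective (ne _) (ne _) e)))
    where
    ne : ∀ x → ¬ y ≡ f x
    ne x e = avoids (x , sym e)
    g : Fin (suc n) → Fin n
    g x = punchOut (ne x)

  bin≡C : ∀ n k → bin n k ≡ n C k
  bin≡C n zero = sym (trans (nCk≡nC[n∸k] {0} {n} z≤n) (nCn≡1 n))
  bin≡C zero (suc k) = sym (k>n⇒nCk≡0 {0} {suc k} (s≤s z≤n))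
  bin≡C (suc n) (suc k) = trans (cong₂ ℕ._+_ (bin≡C n k) (bin≡C n (suc k))) (nCk+nC[k+1]≡[n+1]C[k+1] n k)

  prime∣bin : ∀ q k → Prime q → 0 < k → k < q → q ∣ bin q k
  prime∣bin (suc q) (suc k) pq _ k<q with euclidsLemma (suc k) (bin (suc q) (suc k)) pq
      (subst (suc q ∣_) (sym (bin-absorb q k)) (m∣m*n (bin q k)))
  ... | inj₁ d = ⊥-elim (ℕ.<-irrefl refl (ℕ.<-≤-trans k<q (∣⇒≤ d)))
  ... | inj₂ d = d

  -- The solver works with natural coefficients, so negatives enter these identities as independent
  -- variables; relations such as x + (-x) = 0 are applied where an identity is used.
  module SemiringIdentities (R : CommutativeSemiring 0ℓ 0ℓ) where
    open CommutativeSemiring R using (_≈_; _+_; _*_) renaming (refl to ≈-refl)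
    private module S = Algebra.Solver.Ring.NaturalCoefficients.Default R
    open S using (solve; _:+_; _:*_; _:=_)

    quo-step₁ : ∀ d r c Q E → (d + r) * (c + (d * Q + r * E)) ≈ (d * (c + r * E) + d * (d * Q + r * Q)) + (r * c + r * (r * E))
    quo-step₁ = solve 5 (λ d r c Q E → (d :+ r) :* (c :+ (d :* Q :+ r :* E)) := (d :* (c :+ r :* E) :+ d :* (d :* Q :+ r :* Q)) :+ (r :* c :+ r :* (r :* E))) ≈-refl

    quo-step₂ : ∀ d r c Q E → (d * (c + r * E) + d * (d * Q + r * Q)) + (r * c + r * (r * E)) ≈ d * ((c + r * E) + (d + r) * Q) + r * (c + r * E)
    quo-step₂ = solve 5 (λ d r c Q E → (d :* (c :+ r :* E) :+ d :* (d :* Q :+ r :* Q)) :+ (r :* c :+ r :* (r :* E)) := d :* ((c :+ r :* E) :+ (d :+ r) :* Q) :+ r :* (c :+ r :* E)) ≈-refl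

    +-swap : ∀ a b c → a + (b + c) ≈ b + (a + c)
    +-swap = solve 3 (λ a b c → a :+ (b :+ c) := b :+ (a :+ c)) ≈-refl

    *-interchange : ∀ a b c d → (a * b) * (c * d) ≈ (a * c) * (b * d)
    *-interchange = solve 4 (λ a b c d → (a :* b) :* (c :* d) := (a :* c) :* (b :* d)) ≈-refl

    foil : ∀ a b c d → (a + b) * (c + d) ≈ a * c + (b * c + (a * d + b * d))
    foil = solve 4 (λ a b c d → (a :+ b) :* (c :+ d) := a :* c :+ (b :* c :+ (a :* d :+ b :* d))) ≈-refl

    -- o and n stand for 1 and −1.
    eliminate : ∀ f g g′ y a b o n → g′ * (f * ((o * y + o * a) * g)) + n * (g * (f * ((y + b) * g′)))
      ≈ (o * a + n * b) * ((f * g) * g′) + ((o + n) * y) * ((f * g) * g′)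
    eliminate = solve 8 (λ f g g′ y a b o n → g′ :* (f :* ((o :* y :+ o :* a) :* g)) :+ n :* (g :* (f :* ((y :+ b) :* g′)))
      := (o :* a :+ n :* b) :* ((f :* g) :* g′) :+ ((o :+ n) :* y) :* ((f :* g) :* g′)) ≈-refl

    residue : ∀ e l g o n → (e + o * l) * g + n * (g * l) ≈ g * e + (o + n) * (g * l)
    residue = solve 5 (λ e l g o n → (e :+ o :* l) :* g :+ n :* (g :* l) := g :* e :+ (o :+ n) :* (g :* l)) ≈-refl

    +-interchange : ∀ a b c d → (a + b) + (c + d) ≈ (a + c) + (b + d)
    +-interchange = solve 4 (λ a b c d → (a :+ b) :+ (c :+ d) := (a :+ c) :+ (b :+ d)) ≈-refl

    rearrange : ∀ p n c a y → p + ((n + c + a) + y) ≈ (y + (p + (n + a))) + c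
    rearrange = solve 5 (λ p n c a y → p :+ ((n :+ c :+ a) :+ y) := (y :+ (p :+ (n :+ a))) :+ c) ≈-refl

    regroup : ∀ u l i v e → u * (l * i) * (v * e) ≈ (v * i) * (u * (l * e))
    regroup = solve 5 (λ u l i v e → u :* (l :* i) :* (v :* e) := (v :* i) :* (u :* (l :* e))) ≈-refl

    collect : ∀ o a b c → a + b * c + o * c ≈ (o + b) * c + a
    collect = solve 4 (λ o a b c → a :+ b :* c :+ o :* c := (o :+ b) :* c :+ a) ≈-refl

    distribute : ∀ d m i e e' → d * (m * (i * (e + e'))) ≈ d * (m * i) * e + d * (m * i) * e'
    distribute = solve 5 (λ d m i e e' → d :* (m :* (i :* (e :+ e'))) := d :* (m :* i) :* e :+ d :* (m :* i) :* e') ≈-refl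

    ext-assoc₁ : ∀ a b c d e f g → (a * c + g * (b * d)) * e + g * ((a * d + b * c) * f) ≈ a * (c * e + g * (d * f)) + g * (b * (c * f + d * e))
    ext-assoc₁ = solve 7 (λ a b c d e f g → (a :* c :+ g :* (b :* d)) :* e :+ g :* ((a :* d :+ b :* c) :* f) := a :* (c :* e :+ g :* (d :* f)) :+ g :* (b :* (c :* f :+ d :* e))) ≈-refl

    ext-assoc₂ : ∀ a b c d e f g → (a * c + g * (b * d)) * f + (a * d + b * c) * e ≈ a * (c * f + d * e) + b * (c * e + g * (d * f))
    ext-assoc₂ = solve 7 (λ a b c d e f g → (a :* c :+ g :* (b :* d)) :* f :+ (a :* d :+ b :* c) :* e := a :* (c :* f :+ d :* e) :+ b :* (c :* e :+ g :* (d :* f))) ≈-refl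

    ext-comm₁ : ∀ a b c d g → a * c + g * (b * d) ≈ c * a + g * (d * b)
    ext-comm₁ = solve 5 (λ a b c d g → a :* c :+ g :* (b :* d) := c :* a :+ g :* (d :* b)) ≈-refl

    ext-comm₂ : ∀ a b c d → a * d + b * c ≈ c * b + d * a
    ext-comm₂ = solve 4 (λ a b c d → a :* d :+ b :* c := c :* b :+ d :* a) ≈-refl

    ext-distrib₁ : ∀ a b c d e f g → a * (c + e) + g * (b * (d + f)) ≈ (a * c + g * (b * d)) + (a * e + g * (b * f))
    ext-distrib₁ = solve 7 (λ a b c d e f g → a :* (c :+ e) :+ g :* (b :* (d :+ f)) := (a :* c :+ g :* (b :* d)) :+ (a :* e :+ g :* (b :* f))) ≈-refl

    ext-distrib₂ : ∀ a b c d e f → a * (d + f) + b * (c + e) ≈ (a * d + b * c) + (a * f + b * e)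
    ext-distrib₂ = solve 6 (λ a b c d e f → a :* (d :+ f) :+ b :* (c :+ e) := (a :* d :+ b :* c) :+ (a :* f :+ b :* e)) ≈-refl

    squares : ∀ a i → (a * i) * (a * i) ≈ (a * a) * (i * i)
    squares = solve 2 (λ a i → (a :* i) :* (a :* i) := (a :* a) :* (i :* i)) ≈-refl

    squares′ : ∀ g b i → (g * (b * b)) * (i * i) ≈ g * ((b * i) * (b * i))
    squares′ = solve 3 (λ g b i → (g :* (b :* b)) :* (i :* i) := g :* ((b :* i) :* (b :* i))) ≈-refl

    ext-inverse₁ : ∀ a b c i g → a * (a * i) + g * (b * (c * i)) ≈ (a * a + g * (b * c)) * i
    ext-inverse₁ = solve 5 (λ a b c i g → a :* (a :* i) :+ g :* (b :* (c :* i)) := (a :* a :+ g :* (b :* c)) :* i) ≈-refl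

    ext-inverse₂ : ∀ a b c i → a * (c * i) + b * (a * i) ≈ (c + b) * (a * i)
    ext-inverse₂ = solve 4 (λ a b c i → a :* (c :* i) :+ b :* (a :* i) := (c :+ b) :* (a :* i)) ≈-refl

  -- Finiteness is a bijection with `Fin size`. It gives decidable equality, search through all
  -- elements, and the count of vectors over the field on which the bound for the number of
  -- solutions rests.
  record FiniteField : Set₁ where
    infixl 7 _*_
    infixl 6 _+_
    infix 8 -_
    infix 4 _≟_
    field
      Carrier : Set
      _+_ _*_ : Op₂ Carrier
      -_ : Op₁ Carrier
      0# 1# : Carrier
      isCommutativeRing : IsCommutativeRing _≡_ _+_ _*_ -_ 0# 1#
      inverse : ∀ x → ¬ x ≡ 0# → ∃ λ y → x * y ≡ 1#
      0≢1 : ¬ 0# ≡ 1#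
      size : ℕ
      index : Carrier → Fin size
      element : Fin size → Carrier
      element-index : ∀ x → element (index x) ≡ x
      index-element : ∀ i → index (element i) ≡ i

    commutativeRing : CommutativeRing 0ℓ 0ℓ
    commutativeRing = record { isCommutativeRing = isCommutativeRing }

    open CommutativeRing commutativeRing public
      using (+-assoc; +-comm; +-identityˡ; +-identityʳ; -‿inverseˡ; -‿inverseʳ; *-assoc; *-comm; *-identityˡ; *-identityʳ; distribˡ; distribʳ; zeroˡ; zeroʳ; semiring; commutativeSemiring; ring)

    infixr 8 _^_
    _^_ : Carrier → ℕ → Carrier
    x ^ zero = 1#
    x ^ suc n = x * x ^ n

    nat : ℕ → Carrier
    nat zero = 0#
    nat (suc n) = 1# + nat n

    sum : ∀ {n} → (Fin n → Carrier) → Carrier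
    sum = Algebra.Properties.Semiring.Sum.sum semiring

    -‿distribˡ-* = Algebra.Properties.Ring.-‿distribˡ-* ring
    -‿distribʳ-* = Algebra.Properties.Ring.-‿distribʳ-* ring
    -‿involutive = Algebra.Properties.Ring.-‿involutive ring

    ^-homo-* : ∀ x m n → x ^ (m ℕ.+ n) ≡ x ^ m * x ^ n
    ^-homo-* x zero n = sym (*-identityˡ (x ^ n))
    ^-homo-* x (suc m) n = trans (cong (x *_) (^-homo-* x m n)) (sym (*-assoc x (x ^ m) (x ^ n)))

    ^-assocʳ : ∀ x m n → (x ^ m) ^ n ≡ x ^ (m ℕ.* n)
    ^-assocʳ x m zero = cong (x ^_) (sym (ℕ.*-zeroʳ m))
    ^-assocʳ x m (suc n) = begin
      x ^ m * (x ^ m) ^ n     ≡⟨ cong (x ^ m *_) (^-assocʳ x m n) ⟩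
      x ^ m * x ^ (m ℕ.* n)   ≡⟨ ^-homo-* x m (m ℕ.* n) ⟨
      x ^ (m ℕ.+ m ℕ.* n)     ≡⟨ cong (x ^_) (ℕ.*-suc m n) ⟨
      x ^ (m ℕ.* suc n)       ∎
      where open ≡-Reasoning

    ^-distrib-* : ∀ x y n → (x * y) ^ n ≡ x ^ n * y ^ n
    ^-distrib-* x y zero = sym (*-identityˡ 1#)
    ^-distrib-* x y (suc n) = trans (cong (x * y *_) (^-distrib-* x y n))
      (SemiringIdentities.*-interchange commutativeSemiring x y (x ^ n) (y ^ n))

    sum-cong : ∀ {n} {f g : Fin n → Carrier} → (∀ i → f i ≡ g i) → sum f ≡ sum g
    sum-cong = Algebra.Properties.Semiring.Sum.sum-cong-≗ semiring

    sum-init-last : ∀ {n} (t : Fin (suc n) → Carrier) → sum t ≡ sum (t ∘ inject₁) + t (fromℕ n)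
    sum-init-last = Algebra.Properties.Semiring.Sum.sum-init-last semiring

    sum-replicate-zero = Algebra.Properties.Semiring.Sum.sum-replicate-zero semiring

    sum-+ : ∀ {n} (f g : Fin n → Carrier) → sum (λ i → f i + g i) ≡ sum f + sum g
    sum-+ = Algebra.Properties.Semiring.Sum.∑-distrib-+ semiring

    *-distribˡ-sum : ∀ {n} x (f : Fin n → Carrier) → x * sum f ≡ sum (λ i → x * f i)
    *-distribˡ-sum = Algebra.Properties.Semiring.Sum.*-distribˡ-sum semiring

    *-distribʳ-sum : ∀ {n} x (f : Fin n → Carrier) → sum f * x ≡ sum (λ i → f i * x)
    *-distribʳ-sum = Algebra.Properties.Semiring.Sum.*-distribʳ-sum semiring

    index-injective : ∀ {x y} → index x ≡ index y → x ≡ y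
    index-injective {x} {y} e = trans (sym (element-index x)) (trans (cong element e) (element-index y))

    element-injective : ∀ {i j} → element i ≡ element j → i ≡ j
    element-injective {i} {j} e = trans (sym (index-element i)) (trans (cong index e) (index-element j))

    _≟_ : (x y : Carrier) → Dec (x ≡ y)
    x ≟ y = map′ index-injective (cong index) (index x Fin.≟ index y)

    nat-+ : ∀ m n → nat (m ℕ.+ n) ≡ nat m + nat n
    nat-+ zero n = sym (+-identityˡ (nat n))
    nat-+ (suc m) n = trans (cong (1# +_) (nat-+ m n)) (sym (+-assoc 1# (nat m) (nat n)))

    nat-* : ∀ m n → nat (m ℕ.* n) ≡ nat m * nat n
    nat-* zero n = sym (zeroˡ (nat n))
    nat-* (suc m) n = trans (nat-+ n (m ℕ.* n))
      (trans (cong₂ _+_ (sym (*-identityˡ (nat n))) (nat-* m n)) (sym (distribʳ (nat n) 1# (nat m))))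

    private
      _·_ : ℕ → Carrier → Carrier
      _·_ = Algebra.Properties.Semiring.Mult._×_ semiring

      _^′_ : Carrier → ℕ → Carrier
      _^′_ = Algebra.Properties.Semiring.Exp._^_ semiring

    ^≡^′ : ∀ x n → x ^ n ≡ x ^′ n
    ^≡^′ x zero = refl
    ^≡^′ x (suc n) = cong (x *_) (^≡^′ x n)

    ·≡nat* : ∀ n x → n · x ≡ nat n * x
    ·≡nat* zero x = sym (zeroˡ x)
    ·≡nat* (suc n) x = trans (cong₂ _+_ (sym (*-identityˡ x)) (·≡nat* n x)) (sym (distribʳ x 1# (nat n)))

    1^ : ∀ n → 1# ^ n ≡ 1#
    1^ zero = refl
    1^ (suc n) = trans (*-identityˡ _) (1^ n)

    *-cancelˡ : ∀ x {y z} → ¬ x ≡ 0# → x * y ≡ x * z → y ≡ z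
    *-cancelˡ x {y} {z} x≢0 e with inverse x x≢0
    ... | i , xi≡1 = trans (expand y) (trans (cong (i *_) e) (sym (expand z)))
      where
      expand : ∀ y → y ≡ i * (x * y)
      expand y = trans (sym (*-identityˡ y)) (trans (cong (_* y) (trans (sym xi≡1) (*-comm x i))) (*-assoc i x y))

    integral : ∀ x {y} → ¬ x ≡ 0# → x * y ≡ 0# → y ≡ 0#
    integral x x≢0 e = *-cancelˡ x x≢0 (trans e (sym (zeroʳ x)))

    x+-y+y : ∀ x y → (x + - y) + y ≡ x
    x+-y+y x y = trans (+-assoc x (- y) y) (trans (cong (x +_) (-‿inverseˡ y)) (+-identityʳ x))

    x-y≡0⇒x≡y : ∀ {x y} → x + - y ≡ 0# → x ≡ y
    x-y≡0⇒x≡y {x} {y} e = trans (sym (x+-y+y x y)) (trans (cong (_+ y) e) (+-identityˡ y))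

    +-cancelʳ : ∀ {x y} z → x + z ≡ y + z → x ≡ y
    +-cancelʳ {x} {y} z e = trans (strip x) (trans (cong (_+ - z) e) (sym (strip y)))
      where
      strip : ∀ x → x ≡ (x + z) + - z
      strip x = sym (trans (+-assoc x z (- z)) (trans (cong (x +_) (-‿inverseʳ z)) (+-identityʳ x)))

    +-cancelˡ : ∀ z {x y} → z + x ≡ z + y → x ≡ y
    +-cancelˡ z {x} {y} e = +-cancelʳ z (trans (+-comm x z) (trans e (+-comm z y)))

    sum-zero : ∀ {n} (t : Fin n → Carrier) → (∀ i → t i ≡ 0#) → sum t ≡ 0#
    sum-zero {n} t z = trans (sum-cong z) (sum-replicate-zero n)

    eval : ∀ {n} → Vec Carrier n → Carrier → Carrier
    eval [] x = 0#
    eval (c ∷ cs) x = c + x * eval cs x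

    quo : ∀ {n} → Carrier → Vec Carrier n → Vec Carrier n
    quo r [] = []
    quo r (c ∷ cs) = eval (c ∷ cs) r ∷ quo r cs

    -- Division of c₀ + X·cs by X − r has quotient quo r cs; writing x = d + r avoids subtraction.
    quo-correct : ∀ {n} (cs : Vec Carrier n) d r →
      (d + r) * eval cs (d + r) ≡ d * eval (quo r cs) (d + r) + r * eval cs r
    quo-correct [] d r = trans (zeroʳ _) (sym (trans (cong₂ _+_ (zeroʳ d) (zeroʳ r)) (+-identityˡ 0#)))
    quo-correct (c ∷ cs) d r = begin
      (d + r) * (c + (d + r) * E)                     ≡⟨ cong (λ z → (d + r) * (c + z)) (quo-correct cs d r) ⟩
      (d + r) * (c + (d * Q + r * E'))                ≡⟨ SemiringIdentities.quo-step₁ commutativeSemiring d r c Q E' ⟩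
      (d * (c + r * E') + d * (d * Q + r * Q)) + (r * c + r * (r * E')) ≡⟨ SemiringIdentities.quo-step₂ commutativeSemiring d r c Q E' ⟩
      d * ((c + r * E') + (d + r) * Q) + r * (c + r * E') ∎
      where
      open ≡-Reasoning
      E = eval cs (d + r)
      E' = eval cs r
      Q = eval (quo r cs) (d + r)

    eval-split : ∀ {n} c (cs : Vec Carrier n) x r →
      eval (c ∷ cs) x ≡ (x + - r) * eval (quo r cs) x + eval (c ∷ cs) r
    eval-split c cs x r = begin
      c + x * eval cs x                                    ≡⟨ cong (λ z → c + z * eval cs z) (x+-y+y x r) ⟨
      c + (d + r) * eval cs (d + r)                        ≡⟨ cong (c +_) (quo-correct cs d r) ⟩
      c + (d * eval (quo r cs) (d + r) + r * eval cs r)    ≡⟨ cong (λ z → c + (d * eval (quo r cs) z + r * eval cs r)) (x+-y+y x r) ⟩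
      c + (d * eval (quo r cs) x + r * eval cs r)          ≡⟨ SemiringIdentities.+-swap commutativeSemiring c (d * eval (quo r cs) x) (r * eval cs r) ⟩
      d * eval (quo r cs) x + (c + r * eval cs r)          ∎
      where
      open ≡-Reasoning
      d = x + - r

    Zero : ∀ {n} → Vec Carrier n → Set
    Zero cs = ∀ i → lookup cs i ≡ 0#

    eval-Zero : ∀ {n} (cs : Vec Carrier n) x → Zero cs → eval cs x ≡ 0#
    eval-Zero [] x z = refl
    eval-Zero (c ∷ cs) x z = trans (cong₂ _+_ (z zero) (trans (cong (x *_) (eval-Zero cs x (z ∘ suc))) (zeroʳ x))) (+-identityʳ 0#)

    quo-Zero : ∀ {n} r (cs : Vec Carrier n) → Zero (quo r cs) → Zero cs
    quo-Zero r (c ∷ cs) z (suc i) = quo-Zero r cs (z ∘ suc) i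
    quo-Zero r (c ∷ cs) z zero = trans (sym (+-identityʳ c))
      (trans (cong (c +_) (sym (trans (cong (r *_) (eval-Zero cs r (quo-Zero r cs (z ∘ suc)))) (zeroʳ r)))) (z zero))

    -- For the first root r, `quo r (c ∷ cs)` consists of the remainder followed by the quotient of
    -- the division by X - r. The remainder vanishes because r is a root, the quotient by induction
    -- because the other roots are distinct from r; `quo-Zero` then recovers the polynomial itself.
    many-roots⇒Zero : ∀ {n} (cs : Vec Carrier n) (f : Fin n → Carrier) → (∀ {i j} → f i ≡ f j → i ≡ j) →
      (∀ i → eval cs (f i) ≡ 0#) → Zero cs
    many-roots⇒Zero [] f inj roots ()
    many-roots⇒Zero (c ∷ cs) f inj roots = quo-Zero r (c ∷ cs) λ { zero → roots zero ; (suc i) → IH i }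
      where
      r = f zero
      IH : Zero (quo r cs)
      IH = many-roots⇒Zero (quo r cs) (f ∘ suc) (Fin.suc-injective ∘ inj) λ i →
        integral (f (suc i) + - r) (λ e → case-suc i (inj (x-y≡0⇒x≡y e)))
          (trans (sym (trans (cong ((f (suc i) + - r) * eval (quo r cs) (f (suc i)) +_) (roots zero)) (+-identityʳ _)))
            (trans (sym (eval-split c cs (f (suc i)) r)) (roots (suc i))))
        where
        case-suc : ∀ {n} (i : Fin n) → ¬ Fin.suc i ≡ zero
        case-suc i ()

    -- The weights depend on the nodes and on `x` but not on the polynomial, so one linear relation
    -- serves all vertices at once. The recursion is that of Newton: f(x) = f(r) + (x - r) Q(x),
    -- where Q is interpolated at the remaining nodes and its value at a node U is the divided
    -- difference (f(U) - f(r)) / (U - r).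
    interpolation : ∀ n (U : Fin n → Carrier) → (∀ {i j} → U i ≡ U j → i ≡ j) → ∀ x →
      Σ (Fin n → Carrier) λ l → ∀ (cs : Vec Carrier n) → eval cs x ≡ sum (λ t → l t * eval cs (U t))
    interpolation zero U inj x = (λ ()) , λ { [] → refl }
    interpolation (suc n) U inj x with interpolation n (U ∘ suc) (Fin.suc-injective ∘ inj) x
    ... | μ , IH = l , correct
      where
      r = U zero
      d = x + - r
      dt≢0 : ∀ t → ¬ U (suc t) + - r ≡ 0#
      dt≢0 t e with inj (x-y≡0⇒x≡y e)
      ... | ()
      inv : Fin n → Carrier
      inv t = proj₁ (inverse _ (dt≢0 t))
      ν : Fin n → Carrier
      ν t = d * (μ t * inv t)
      l : Fin (suc n) → Carrier
      l zero = 1# + - sum ν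
      l (suc t) = ν t
      correct : ∀ cs → eval cs x ≡ sum (λ t → l t * eval cs (U t))
      correct (c ∷ cs) = begin
        eval (c ∷ cs) x                                   ≡⟨ eval-split c cs x r ⟩
        d * eval (quo r cs) x + E₀                        ≡⟨ cong (λ z → d * z + E₀) (IH (quo r cs)) ⟩
        d * sum (λ t → μ t * Q t) + E₀                    ≡⟨ cong (_+ E₀) (*-distribˡ-sum d (λ t → μ t * Q t)) ⟩
        sum (λ t → d * (μ t * Q t)) + E₀                  ≡⟨ cong (_+ E₀) (sum-cong term) ⟩
        sum (λ t → ν t * E t + ν t * - E₀) + E₀           ≡⟨ cong (_+ E₀) (sum-+ (λ t → ν t * E t) (λ t → ν t * - E₀)) ⟩
        sum (λ t → ν t * E t) + sum (λ t → ν t * - E₀) + E₀ ≡⟨ cong (λ z → sum (λ t → ν t * E t) + z + E₀) (*-distribʳ-sum (- E₀) ν) ⟨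
        sum (λ t → ν t * E t) + sum ν * - E₀ + E₀         ≡⟨ cong (λ z → sum (λ t → ν t * E t) + z + E₀) (trans (sym (-‿distribʳ-* (sum ν) E₀)) (-‿distribˡ-* (sum ν) E₀)) ⟩
        sum (λ t → ν t * E t) + - sum ν * E₀ + E₀         ≡⟨ cong (sum (λ t → ν t * E t) + - sum ν * E₀ +_) (*-identityˡ E₀) ⟨
        sum (λ t → ν t * E t) + - sum ν * E₀ + 1# * E₀    ≡⟨ SemiringIdentities.collect commutativeSemiring 1# (sum (λ t → ν t * E t)) (- sum ν) E₀ ⟩
        (1# + - sum ν) * E₀ + sum (λ t → ν t * E t)       ∎
        where
        open ≡-Reasoning
        E₀ = eval (c ∷ cs) r
        E : Fin n → Carrier
        E t = eval (c ∷ cs) (U (suc t))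
        Q : Fin n → Carrier
        Q t = eval (quo r cs) (U (suc t))
        Q≡ : ∀ t → Q t ≡ inv t * (E t + - E₀)
        Q≡ t = sym (begin
          inv t * (E t + - E₀)                      ≡⟨ cong (λ z → inv t * (z + - E₀)) (eval-split c cs (U (suc t)) r) ⟩
          inv t * (dt * Q t + E₀ + - E₀)            ≡⟨ cong (inv t *_) (trans (+-assoc _ E₀ (- E₀)) (trans (cong (dt * Q t +_) (-‿inverseʳ E₀)) (+-identityʳ _))) ⟩
          inv t * (dt * Q t)                        ≡⟨ *-assoc (inv t) dt (Q t) ⟨
          (inv t * dt) * Q t                        ≡⟨ cong (_* Q t) (trans (*-comm (inv t) dt) (proj₂ (inverse _ (dt≢0 t)))) ⟩
          1# * Q t                                  ≡⟨ *-identityˡ (Q t) ⟩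
          Q t                                       ∎)
          where
          dt = U (suc t) + - r
        term : ∀ t → d * (μ t * Q t) ≡ ν t * E t + ν t * - E₀
        term t = begin
          d * (μ t * Q t)                           ≡⟨ cong (λ z → d * (μ t * z)) (Q≡ t) ⟩
          d * (μ t * (inv t * (E t + - E₀)))        ≡⟨ SemiringIdentities.distribute commutativeSemiring d (μ t) (inv t) (E t) (- E₀) ⟩
          ν t * E t + ν t * - E₀                    ∎

    module Characteristic {q} (q-prime : Prime q) (q≡0 : nat q ≡ 0#) where

      nat-multiple : ∀ n → q ∣ n → nat n ≡ 0#
      nat-multiple n (divides c refl) = trans (nat-* c q) (trans (cong (nat c *_) q≡0) (zeroʳ (nat c)))

      freshman : ∀ x y → (x + y) ^ q ≡ x ^ q + y ^ q
      freshman x y = go q refl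
        where
        coefficient : ∀ k → 0 < k → k < q → ∀ z → (q C k) · z ≡ 0#
        coefficient k 0<k k<q z = trans (·≡nat* (q C k) z) (trans (cong (_* z) (nat-multiple (q C k) (subst (q ∣_) (bin≡C q k) (prime∣bin q k q-prime 0<k k<q)))) (zeroˡ z))
        go : ∀ m → m ≡ q → (x + y) ^ m ≡ x ^ m + y ^ m
        go zero e = ⊥-elim (ℕ.<-irrefl e (prime>0 q-prime))
        go (suc m) refl = begin
          (x + y) ^ suc m                             ≡⟨ ^≡^′ (x + y) (suc m) ⟩
          (x + y) ^′ suc m                            ≡⟨ Algebra.Properties.CommutativeSemiring.Binomial.theorem commutativeSemiring (suc m) x y ⟩
          t zero + sum (t ∘ suc)                      ≡⟨ cong₂ _+_ first (sum-init-last (t ∘ suc)) ⟩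
          y ^ suc m + (sum (λ i → t (suc (inject₁ i))) + t (suc (fromℕ m))) ≡⟨ cong (y ^ suc m +_) (cong₂ _+_ (sum-zero _ middle) final) ⟩
          y ^ suc m + (0# + x ^ suc m)                ≡⟨ cong (y ^ suc m +_) (+-identityˡ _) ⟩
          y ^ suc m + x ^ suc m                       ≡⟨ +-comm _ _ ⟩
          x ^ suc m + y ^ suc m                       ∎
          where
          open ≡-Reasoning
          t : Fin (suc (suc m)) → Carrier
          t = Algebra.Properties.CommutativeSemiring.Binomial.binomialTerm commutativeSemiring x y (suc m)
          first : t zero ≡ y ^ suc m
          first = trans (cong (_· (1# * y ^′ suc m)) (sym (bin≡C (suc m) 0))) (trans (+-identityʳ _) (trans (*-identityˡ _) (sym (^≡^′ y (suc m)))))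
          middle : ∀ i → t (suc (inject₁ i)) ≡ 0#
          middle i = coefficient (suc (toℕ (inject₁ i))) (s≤s z≤n) (s≤s (subst (_< m) (sym (Fin.toℕ-inject₁ i)) (Fin.toℕ<n i))) _
          final : t (suc (fromℕ m)) ≡ x ^ suc m
          final = begin
            (suc m C suc (toℕ (fromℕ m))) · (x ^′ suc (toℕ (fromℕ m)) * y ^′ (m ∸ toℕ (fromℕ m))) ≡⟨ cong (λ k → (suc m C suc k) · (x ^′ suc k * y ^′ (m ∸ k))) (Fin.toℕ-fromℕ m) ⟩
            (suc m C suc m) · (x ^′ suc m * y ^′ (m ∸ m))  ≡⟨ cong₂ (λ a b → a · (x ^′ suc m * y ^′ b)) (nCn≡1 (suc m)) (ℕ.n∸n≡0 m) ⟩
            1 · (x ^′ suc m * 1#)                         ≡⟨ trans (+-identityʳ _) (*-identityʳ _) ⟩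
            x ^′ suc m                                    ≡⟨ ^≡^′ x (suc m) ⟨
            x ^ suc m                                     ∎

      Fr : ℕ → Carrier → Carrier
      Fr j x = x ^ (q ℕ.^ j)

      Fr-zero : ∀ x → Fr 0 x ≡ x
      Fr-zero x = *-identityʳ x

      Fr-∘ : ∀ i j x → Fr (i ℕ.+ j) x ≡ Fr i (Fr j x)
      Fr-∘ i j x = trans (cong (x ^_) (trans (ℕ.^-distribˡ-+-* q i j) (ℕ.*-comm (q ℕ.^ i) (q ℕ.^ j)))) (sym (^-assocʳ x (q ℕ.^ j) (q ℕ.^ i)))

      Fr-suc : ∀ j x → Fr (suc j) x ≡ Fr j x ^ q
      Fr-suc j x = trans (cong (x ^_) (ℕ.*-comm q (q ℕ.^ j))) (sym (^-assocʳ x (q ℕ.^ j) q))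

      Fr-* : ∀ j x y → Fr j (x * y) ≡ Fr j x * Fr j y
      Fr-* j x y = ^-distrib-* x y (q ℕ.^ j)

      Fr-+ : ∀ j x y → Fr j (x + y) ≡ Fr j x + Fr j y
      Fr-+ zero x y = trans (*-identityʳ _) (sym (cong₂ _+_ (*-identityʳ x) (*-identityʳ y)))
      Fr-+ (suc j) x y = begin
        Fr (suc j) (x + y)              ≡⟨ Fr-suc j (x + y) ⟩
        Fr j (x + y) ^ q                ≡⟨ cong (_^ q) (Fr-+ j x y) ⟩
        (Fr j x + Fr j y) ^ q           ≡⟨ freshman (Fr j x) (Fr j y) ⟩
        Fr j x ^ q + Fr j y ^ q         ≡⟨ cong₂ _+_ (Fr-suc j x) (Fr-suc j y) ⟨
        Fr (suc j) x + Fr (suc j) y     ∎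
        where open ≡-Reasoning

      Fr-0 : ∀ j → Fr j 0# ≡ 0#
      Fr-0 j = +-cancelˡ (Fr j 0#) (trans (sym (Fr-+ j 0# 0#)) (trans (cong (Fr j) (+-identityʳ 0#)) (sym (+-identityʳ _))))

      Fr-nat : ∀ j n → Fr j (nat n) ≡ nat n
      Fr-nat j zero = Fr-0 j
      Fr-nat j (suc n) = trans (Fr-+ j 1# (nat n)) (cong₂ _+_ (1^ (q ℕ.^ j)) (Fr-nat j n))

    monomial : (n : ℕ) → Vec Carrier (suc n)
    monomial zero = 1# ∷ []
    monomial (suc n) = 0# ∷ monomial n

    eval-monomial : ∀ n x → eval (monomial n) x ≡ x ^ n
    eval-monomial zero x = trans (cong (1# +_) (zeroʳ x)) (+-identityʳ 1#)
    eval-monomial (suc n) x = trans (+-identityˡ _) (cong (x *_) (eval-monomial n x))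

    monomial-nonzero : ∀ n → ¬ Zero (monomial n)
    monomial-nonzero zero z = 0≢1 (sym (z zero))
    monomial-nonzero (suc n) z = monomial-nonzero n (z ∘ suc)

    -- The list `cs` holds the n + 3 coefficients of X^(n+2) - X. As many distinct roots would make
    -- all of them zero, yet the leading one is 1. The exponent starts at 2 because X^1 - X is the
    -- zero polynomial.
    power-minus-id-roots : ∀ n (f : Fin (suc (suc (suc n))) → Carrier) → (∀ {i j} → f i ≡ f j → i ≡ j) →
      ¬ (∀ i → f i ^ suc (suc n) ≡ f i)
    power-minus-id-roots n f inj fixed = monomial-nonzero n λ i → many-roots⇒Zero cs f inj root (suc (suc i))
      where
      cs = 0# ∷ - 1# ∷ monomial n
      root : ∀ i → eval cs (f i) ≡ 0#
      root i = begin
        0# + x * (- 1# + x * eval (monomial n) x)  ≡⟨ +-identityˡ _ ⟩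
        x * (- 1# + x * eval (monomial n) x)       ≡⟨ cong (λ z → x * (- 1# + x * z)) (eval-monomial n x) ⟩
        x * (- 1# + x * x ^ n)                     ≡⟨ distribˡ x (- 1#) (x * x ^ n) ⟩
        x * - 1# + x ^ suc (suc n)                 ≡⟨ cong₂ _+_ (trans (sym (-‿distribʳ-* x 1#)) (cong -_ (*-identityʳ x))) (fixed i) ⟩
        - x + x                                    ≡⟨ -‿inverseˡ x ⟩
        0#                                         ∎
        where
        open ≡-Reasoning
        x = f i

    fixed-points-bound : ∀ n m → 1 < n → (f : Fin m → Carrier) → (∀ {i j} → f i ≡ f j → i ≡ j) →
      (∀ i → f i ^ n ≡ f i) → m ≤ n
    fixed-points-bound (suc (suc n)) m _ f inj fixed with m ℕ.≤? suc (suc n)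
    ... | yes le = le
    ... | no nle = ⊥-elim (power-minus-id-roots n (f ∘ ι) (Fin.inject≤-injective _ _ _ _ ∘ inj) (fixed ∘ ι))
      where
      ι : Fin (suc (suc (suc n))) → Fin m
      ι = λ i → Data.Fin.inject≤ i (ℕ.≰⇒> nle)
    fixed-points-bound (suc zero) m (s≤s ())

-- Fields of q^(2^k) elements by repeated adjunction of square roots

module QuadraticTowers where

  open import Algebra.Core using (Op₁; Op₂)
  open import Algebra.Structures using (IsCommutativeRing)
  open import Data.Nat as ℕ using (ℕ; zero; suc; _∸_; _<_; z≤n; s≤s)
  import Data.Nat.Properties as ℕ
  open import Data.Nat.DivMod using (_%_; _mod_; %-distribˡ-+; %-distribˡ-*; m%n<n; m<n⇒m%n≡m; n%n≡0)
  open import Data.Nat.Divisibility using (_∣_; divides; m%n≡0⇒n∣m; n∣m⇒m%n≡0; ∣⇒≤; n∣n)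
  open import Data.Nat.Primality using (Prime; euclidsLemma)
  open import Data.Nat.Tactic.RingSolver using (solve-∀)
  open import Data.Fin using (Fin; zero; suc; toℕ; combine; remQuot)
  import Data.Fin.Properties as Fin
  open import Data.Product using (∃; ∃₂; _,_; proj₁; proj₂)
  open import Data.Sum using (_⊎_; inj₁; inj₂)
  open import Data.Empty using (⊥-elim)
  open import Relation.Nullary using (¬_; Dec; yes; no)
  open import Relation.Binary.PropositionalEquality hiding ([_])
  open import Function using (_∘_; id)
  open Primes
  open FiniteFields

  isCommutativeRing-from : ∀ {A : Set} (_+_ _*_ : Op₂ A) (-_ : Op₁ A) (0# 1# : A) →
    (∀ x y z → (x + y) + z ≡ x + (y + z)) → (∀ x y → x + y ≡ y + x) →
    (∀ x → 0# + x ≡ x) → (∀ x → (- x) + x ≡ 0#) →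
    (∀ x y z → (x * y) * z ≡ x * (y * z)) → (∀ x y → x * y ≡ y * x) →
    (∀ x → 1# * x ≡ x) → (∀ x y z → x * (y + z) ≡ (x * y) + (x * z)) →
    IsCommutativeRing _≡_ _+_ _*_ -_ 0# 1#
  isCommutativeRing-from _+_ _*_ -_ 0# 1# +-assoc +-comm +-idˡ +-invˡ *-assoc *-comm *-idˡ distribˡ = record
    { isRing = record
      { +-isAbelianGroup = record
        { isGroup = record
          { isMonoid = record
            { isSemigroup = record
              { isMagma = record { isEquivalence = isEquivalence ; ∙-cong = cong₂ _+_ }
              ; assoc = +-assoc }
            ; identity = +-idˡ , λ x → trans (+-comm x 0#) (+-idˡ x) }
          ; inverse = +-invˡ , λ x → trans (+-comm x (- x)) (+-invˡ x)
          ; ⁻¹-cong = cong -_ }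
        ; comm = +-comm }
      ; *-cong = cong₂ _*_
      ; *-assoc = *-assoc
      ; *-identity = *-idˡ , λ x → trans (*-comm x 1#) (*-idˡ x)
      ; distrib = distribˡ , λ x y z → trans (*-comm (y + z) x) (trans (distribˡ x y z) (cong₂ _+_ (*-comm x y) (*-comm x z))) }
    ; *-comm = *-comm }

  -- `fixed` is carried up the tower together with the size: it passes directly through a quadratic
  -- extension, so the multiplicative group need not be examined. `characteristic` separates the
  -- constants used as labels and digits, and also shows that 2 is nonzero, as a nonsquare requires.
  record Tower (q k : ℕ) : Set₁ where
    field
      field′ : FiniteField
    open FiniteField field′
    field
      q≡0 : nat q ≡ 0#
      characteristic : ∀ n → nat n ≡ 0# → q ∣ n
      size≡ : size ≡ q ℕ.^ (2 ℕ.^ k)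
      fixed : ∀ x → x ^ (q ℕ.^ (2 ℕ.^ k)) ≡ x

  module PrimeField (m : ℕ) (q-prime : Prime (suc m)) where
    q : ℕ
    q = suc m

    [_] : ℕ → Fin q
    [ n ] = n mod q

    toℕ[] : ∀ a → toℕ [ a ] ≡ a % q
    toℕ[] a = Fin.toℕ-fromℕ< (m%n<n a q)

    []-cong : ∀ a b → a % q ≡ b % q → [ a ] ≡ [ b ]
    []-cong a b e = Fin.toℕ-injective (trans (toℕ[] a) (trans e (sym (toℕ[] b))))

    [toℕ] : ∀ x → [ toℕ x ] ≡ x
    [toℕ] x = Fin.toℕ-injective (trans (toℕ[] (toℕ x)) (m<n⇒m%n≡m (Fin.toℕ<n x)))

    infixl 6 _⊕_
    infixl 7 _⊗_
    _⊕_ _⊗_ : Op₂ (Fin q)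
    x ⊕ y = [ toℕ x ℕ.+ toℕ y ]
    x ⊗ y = [ toℕ x ℕ.* toℕ y ]

    ⊝_ : Op₁ (Fin q)
    ⊝ x = [ q ∸ toℕ x ]

    ⊕[] : ∀ a b → [ a ] ⊕ [ b ] ≡ [ a ℕ.+ b ]
    ⊕[] a b = []-cong (toℕ [ a ] ℕ.+ toℕ [ b ]) (a ℕ.+ b) (trans (cong₂ (λ u v → (u ℕ.+ v) % q) (toℕ[] a) (toℕ[] b)) (sym (%-distribˡ-+ a b q)))

    ⊗[] : ∀ a b → [ a ] ⊗ [ b ] ≡ [ a ℕ.* b ]
    ⊗[] a b = []-cong (toℕ [ a ] ℕ.* toℕ [ b ]) (a ℕ.* b) (trans (cong₂ (λ u v → (u ℕ.* v) % q) (toℕ[] a) (toℕ[] b)) (sym (%-distribˡ-* a b q)))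

    -- Every residue is the class of a natural number, so the ring laws are inherited from ℕ once
    -- the operations commute with taking classes.
    lift₁ : (P : Fin q → Set) → (∀ a → P [ a ]) → ∀ x → P x
    lift₁ P h x = subst P ([toℕ] x) (h (toℕ x))

    lift₂ : (P : Fin q → Fin q → Set) → (∀ a b → P [ a ] [ b ]) → ∀ x y → P x y
    lift₂ P h x y = lift₁ (λ x → P x y) (λ a → lift₁ (P [ a ]) (h a) y) x

    lift₃ : (P : Fin q → Fin q → Fin q → Set) → (∀ a b c → P [ a ] [ b ] [ c ]) → ∀ x y z → P x y z
    lift₃ P h x y z = lift₁ (λ x → P x y z) (λ a → lift₂ (P [ a ]) (h a) y z) x

    ⊝-inverse : ∀ x → (⊝ x) ⊕ x ≡ [ 0 ]
    ⊝-inverse x = begin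
      [ q ∸ toℕ x ] ⊕ x                ≡⟨ cong ([ q ∸ toℕ x ] ⊕_) ([toℕ] x) ⟨
      [ q ∸ toℕ x ] ⊕ [ toℕ x ]        ≡⟨ ⊕[] (q ∸ toℕ x) (toℕ x) ⟩
      [ q ∸ toℕ x ℕ.+ toℕ x ]          ≡⟨ cong [_] (ℕ.m∸n+n≡m (ℕ.<⇒≤ (Fin.toℕ<n x))) ⟩
      [ q ]                            ≡⟨ []-cong q 0 (n%n≡0 q) ⟩
      [ 0 ]                            ∎
      where open ≡-Reasoning

    ring : IsCommutativeRing _≡_ _⊕_ _⊗_ ⊝_ [ 0 ] [ 1 ]
    ring = isCommutativeRing-from _⊕_ _⊗_ ⊝_ [ 0 ] [ 1 ]
      (lift₃ (λ x y z → (x ⊕ y) ⊕ z ≡ x ⊕ (y ⊕ z)) λ a b c → begin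
        ([ a ] ⊕ [ b ]) ⊕ [ c ]            ≡⟨ cong (_⊕ [ c ]) (⊕[] a b) ⟩
        [ a ℕ.+ b ] ⊕ [ c ]                ≡⟨ ⊕[] (a ℕ.+ b) c ⟩
        [ a ℕ.+ b ℕ.+ c ]                  ≡⟨ cong [_] (ℕ.+-assoc a b c) ⟩
        [ a ℕ.+ (b ℕ.+ c) ]                ≡⟨ ⊕[] a (b ℕ.+ c) ⟨
        [ a ] ⊕ [ b ℕ.+ c ]                ≡⟨ cong ([ a ] ⊕_) (⊕[] b c) ⟨
        [ a ] ⊕ ([ b ] ⊕ [ c ])            ∎)
      (λ x y → cong [_] (ℕ.+-comm (toℕ x) (toℕ y)))
      (lift₁ (λ x → [ 0 ] ⊕ x ≡ x) λ a → ⊕[] 0 a)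
      ⊝-inverse
      (lift₃ (λ x y z → (x ⊗ y) ⊗ z ≡ x ⊗ (y ⊗ z)) λ a b c → begin
        ([ a ] ⊗ [ b ]) ⊗ [ c ]            ≡⟨ cong (_⊗ [ c ]) (⊗[] a b) ⟩
        [ a ℕ.* b ] ⊗ [ c ]                ≡⟨ ⊗[] (a ℕ.* b) c ⟩
        [ a ℕ.* b ℕ.* c ]                  ≡⟨ cong [_] (ℕ.*-assoc a b c) ⟩
        [ a ℕ.* (b ℕ.* c) ]                ≡⟨ ⊗[] a (b ℕ.* c) ⟨
        [ a ] ⊗ [ b ℕ.* c ]                ≡⟨ cong ([ a ] ⊗_) (⊗[] b c) ⟨
        [ a ] ⊗ ([ b ] ⊗ [ c ])            ∎)
      (λ x y → cong [_] (ℕ.*-comm (toℕ x) (toℕ y)))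
      (lift₁ (λ x → [ 1 ] ⊗ x ≡ x) λ a → trans (⊗[] 1 a) (cong [_] (ℕ.*-identityˡ a)))
      (lift₃ (λ x y z → x ⊗ (y ⊕ z) ≡ (x ⊗ y) ⊕ (x ⊗ z)) λ a b c → begin
        [ a ] ⊗ ([ b ] ⊕ [ c ])            ≡⟨ cong ([ a ] ⊗_) (⊕[] b c) ⟩
        [ a ] ⊗ [ b ℕ.+ c ]                ≡⟨ ⊗[] a (b ℕ.+ c) ⟩
        [ a ℕ.* (b ℕ.+ c) ]                ≡⟨ cong [_] (ℕ.*-distribˡ-+ a b c) ⟩
        [ a ℕ.* b ℕ.+ a ℕ.* c ]            ≡⟨ ⊕[] (a ℕ.* b) (a ℕ.* c) ⟨
        [ a ℕ.* b ] ⊕ [ a ℕ.* c ]          ≡⟨ cong₂ _⊕_ (⊗[] a b) (⊗[] a c) ⟨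
        ([ a ] ⊗ [ b ]) ⊕ ([ a ] ⊗ [ c ])  ∎)
      where open ≡-Reasoning

    open IsCommutativeRing ring using (+-assoc; +-identityʳ; +-identityˡ; -‿inverseʳ; -‿inverseˡ; distribˡ; zeroʳ)

    []≡0⇒∣ : ∀ a → [ a ] ≡ [ 0 ] → q ∣ a
    []≡0⇒∣ a e = m%n≡0⇒n∣m a q (trans (sym (toℕ[] a)) (trans (cong toℕ e) (toℕ[] 0)))

    ∣⇒[]≡0 : ∀ a → q ∣ a → [ a ] ≡ [ 0 ]
    ∣⇒[]≡0 a d = []-cong a 0 (n∣m⇒m%n≡0 a q d)

    domain : ∀ x y → x ⊗ y ≡ [ 0 ] → x ≡ [ 0 ] ⊎ y ≡ [ 0 ]
    domain = lift₂ (λ x y → x ⊗ y ≡ [ 0 ] → x ≡ [ 0 ] ⊎ y ≡ [ 0 ]) λ a b e → helper a b (euclidsLemma a b q-prime ([]≡0⇒∣ (a ℕ.* b) (trans (sym (⊗[] a b)) e)))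
      where
      helper : ∀ a b → q ∣ a ⊎ q ∣ b → [ a ] ≡ [ 0 ] ⊎ [ b ] ≡ [ 0 ]
      helper a b (inj₁ d) = inj₁ (∣⇒[]≡0 a d)
      helper a b (inj₂ d) = inj₂ (∣⇒[]≡0 b d)

    -- Multiplication by `x` has no kernel, hence is injective, hence onto on a finite set; the
    -- value 1 is therefore attained.
    inverse : ∀ x → ¬ x ≡ [ 0 ] → ∃ λ y → x ⊗ y ≡ [ 1 ]
    inverse x x≢0 = injective⇒surjective (x ⊗_) inj [ 1 ]
      where
      open ≡-Reasoning
      inj : ∀ {y z} → x ⊗ y ≡ x ⊗ z → y ≡ z
      inj {y} {z} e with domain x (y ⊕ (⊝ z)) (begin
          x ⊗ (y ⊕ (⊝ z))           ≡⟨ distribˡ x y (⊝ z) ⟩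
          (x ⊗ y) ⊕ (x ⊗ (⊝ z))     ≡⟨ cong (_⊕ (x ⊗ (⊝ z))) e ⟩
          (x ⊗ z) ⊕ (x ⊗ (⊝ z))     ≡⟨ distribˡ x z (⊝ z) ⟨
          x ⊗ (z ⊕ (⊝ z))           ≡⟨ cong (x ⊗_) (-‿inverseʳ z) ⟩
          x ⊗ [ 0 ]                 ≡⟨ zeroʳ x ⟩
          [ 0 ]                     ∎)
      ... | inj₁ x≡0 = ⊥-elim (x≢0 x≡0)
      ... | inj₂ d = begin
        y                           ≡⟨ +-identityʳ y ⟨
        y ⊕ [ 0 ]                   ≡⟨ cong (y ⊕_) (-‿inverseˡ z) ⟨
        y ⊕ ((⊝ z) ⊕ z)             ≡⟨ +-assoc y (⊝ z) z ⟨
        (y ⊕ (⊝ z)) ⊕ z             ≡⟨ cong (_⊕ z) d ⟩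
        [ 0 ] ⊕ z                   ≡⟨ +-identityˡ z ⟩
        z                           ∎

    finiteField : FiniteField
    finiteField = record
      { Carrier = Fin q ; _+_ = _⊕_ ; _*_ = _⊗_ ; -_ = ⊝_ ; 0# = [ 0 ] ; 1# = [ 1 ]
      ; isCommutativeRing = ring ; inverse = inverse
      ; 0≢1 = λ e → ℕ.<-irrefl refl (ℕ.<-≤-trans (prime>1 q-prime) (∣⇒≤ ([]≡0⇒∣ 1 (sym e))))
      ; size = q ; index = id ; element = id ; element-index = λ _ → refl ; index-element = λ _ → refl }

    open FiniteField finiteField using (nat; module Characteristic; _^_)

    nat≡[] : ∀ n → nat n ≡ [ n ]
    nat≡[] zero = refl
    nat≡[] (suc n) = trans (cong ([ 1 ] ⊕_) (nat≡[] n)) (⊕[] 1 n)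

    tower : Tower q 0
    tower = record
      { field′ = finiteField
      ; q≡0 = q≡0
      ; characteristic = λ n e → []≡0⇒∣ n (trans (sym (nat≡[] n)) e)
      ; size≡ = sym (ℕ.*-identityʳ q)
      -- Fermat's little theorem: every `x` is a sum of ones, and the Frobenius map, being additive,
      -- fixes such sums.
      ; fixed = λ x → subst (λ z → z ^ (q ℕ.^ 1) ≡ z) (trans (nat≡[] (toℕ x)) ([toℕ] x)) (Fr-nat 1 (toℕ x)) }
      where
      q≡0 : nat q ≡ [ 0 ]
      q≡0 = trans (nat≡[] q) (∣⇒[]≡0 q n∣n)
      open Characteristic q-prime q≡0 using (Fr-nat)

  module Quadratic (K : FiniteField) (g : FiniteField.Carrier K) (nonsquare : ∀ x → ¬ FiniteField._*_ K x x ≡ g) where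
    open FiniteField K

    -- A data type rather than a pair: without η the operations below do not unfold on neutral terms.
    infix 5 _⊹_
    data E : Set where
      _⊹_ : Carrier → Carrier → E

    re : E → Carrier
    re (a ⊹ b) = a

    infixl 6 _⊕_
    infixl 7 _⊗_
    _⊕_ _⊗_ : Op₂ E
    (a ⊹ b) ⊕ (c ⊹ d) = (a + c) ⊹ (b + d)
    (a ⊹ b) ⊗ (c ⊹ d) = (a * c + g * (b * d)) ⊹ (a * d + b * c)

    ⊝_ : Op₁ E
    ⊝ (a ⊹ b) = (- a) ⊹ (- b)

    0E 1E : E
    0E = 0# ⊹ 0#
    1E = 1# ⊹ 0#

    g≢0 : ¬ g ≡ 0#
    g≢0 e = nonsquare 0# (trans (zeroʳ 0#) (sym e))

    ringE : IsCommutativeRing _≡_ _⊕_ _⊗_ ⊝_ 0E 1E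
    ringE = isCommutativeRing-from _⊕_ _⊗_ ⊝_ 0E 1E
      (λ { (a ⊹ b) (c ⊹ d) (e ⊹ f) → cong₂ _⊹_ (+-assoc a c e) (+-assoc b d f) })
      (λ { (a ⊹ b) (c ⊹ d) → cong₂ _⊹_ (+-comm a c) (+-comm b d) })
      (λ { (a ⊹ b) → cong₂ _⊹_ (+-identityˡ a) (+-identityˡ b) })
      (λ { (a ⊹ b) → cong₂ _⊹_ (-‿inverseˡ a) (-‿inverseˡ b) })
      (λ { (a ⊹ b) (c ⊹ d) (e ⊹ f) → cong₂ _⊹_
        (SemiringIdentities.ext-assoc₁ commutativeSemiring a b c d e f g)
        (SemiringIdentities.ext-assoc₂ commutativeSemiring a b c d e f g) })
      (λ { (a ⊹ b) (c ⊹ d) → cong₂ _⊹_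
        (SemiringIdentities.ext-comm₁ commutativeSemiring a b c d g)
        (SemiringIdentities.ext-comm₂ commutativeSemiring a b c d) })
      (λ { (a ⊹ b) → cong₂ _⊹_
        (trans (cong₂ _+_ (*-identityˡ a) (trans (cong (g *_) (zeroˡ b)) (zeroʳ g))) (+-identityʳ a))
        (trans (cong₂ _+_ (*-identityˡ b) (zeroˡ a)) (+-identityʳ b)) })
      (λ { (a ⊹ b) (c ⊹ d) (e ⊹ f) → cong₂ _⊹_
        (SemiringIdentities.ext-distrib₁ commutativeSemiring a b c d e f g)
        (SemiringIdentities.ext-distrib₂ commutativeSemiring a b c d e f) })

    norm : E → Carrier
    norm (a ⊹ b) = a * a + g * (b * - b)

    -- The norm is a² - g b². If it vanished with b nonzero, a / b would be a square root of the
    -- nonsquare `g`; with b zero it is a², which vanishes only for a = 0.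
    norm≢0 : ∀ x → ¬ x ≡ 0E → ¬ norm x ≡ 0#
    norm≢0 (a ⊹ b) x≢0 n≡0 with b ≟ 0#
    ... | yes refl with a ≟ 0#
    ...   | yes refl = x≢0 refl
    ...   | no a≢0 = a≢0 (integral a a≢0 (trans (sym (trans (cong (a * a +_) (trans (cong (g *_) (zeroˡ (- 0#))) (zeroʳ g))) (+-identityʳ _))) n≡0))
    norm≢0 (a ⊹ b) x≢0 n≡0 | no b≢0 with inverse b b≢0
    ... | i , bi≡1 = nonsquare (a * i) (begin
      (a * i) * (a * i)          ≡⟨ SemiringIdentities.squares commutativeSemiring a i ⟩
      (a * a) * (i * i)          ≡⟨ cong (_* (i * i)) a²≡gb² ⟩
      (g * (b * b)) * (i * i)    ≡⟨ SemiringIdentities.squares′ commutativeSemiring g b i ⟩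
      g * ((b * i) * (b * i))    ≡⟨ cong (λ z → g * (z * z)) bi≡1 ⟩
      g * (1# * 1#)              ≡⟨ trans (cong (g *_) (*-identityˡ 1#)) (*-identityʳ g) ⟩
      g                          ∎)
      where
      open ≡-Reasoning
      a²≡gb² : a * a ≡ g * (b * b)
      a²≡gb² = x-y≡0⇒x≡y (trans (cong (a * a +_) (trans (-‿distribʳ-* g (b * b)) (cong (g *_) (-‿distribʳ-* b b)))) n≡0)

    inverseE : ∀ x → ¬ x ≡ 0E → ∃ λ y → x ⊗ y ≡ 1E
    inverseE x@(a ⊹ b) x≢0 with inverse (norm x) (norm≢0 x x≢0)
    ... | i , ni≡1 = (a * i ⊹ - b * i) , cong₂ _⊹_
      (trans (SemiringIdentities.ext-inverse₁ commutativeSemiring a b (- b) i g) ni≡1)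
      (trans (SemiringIdentities.ext-inverse₂ commutativeSemiring a b (- b) i)
        (trans (cong (_* (a * i)) (-‿inverseˡ b)) (zeroˡ _)))

    extension : FiniteField
    extension = record
      { Carrier = E ; _+_ = _⊕_ ; _*_ = _⊗_ ; -_ = ⊝_ ; 0# = 0E ; 1# = 1E
      ; isCommutativeRing = ringE ; inverse = inverseE ; 0≢1 = λ e → 0≢1 (cong re e)
      ; size = size ℕ.* size
      ; index = λ { (a ⊹ b) → combine (index a) (index b) }
      ; element = λ i → element (proj₁ (remQuot {size} size i)) ⊹ element (proj₂ (remQuot {size} size i))
      ; element-index = λ { (a ⊹ b) → cong₂ _⊹_
          (trans (cong (element ∘ proj₁) (Fin.remQuot-combine {size} {size} (index a) (index b))) (element-index a))
          (trans (cong (element ∘ proj₂) (Fin.remQuot-combine {size} {size} (index a) (index b))) (element-index b)) }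
      ; index-element = λ i → trans (cong₂ combine (index-element _) (index-element _)) (Fin.combine-remQuot {size} size i) }

    private module X = FiniteField extension

    ι : Carrier → E
    ι a = a ⊹ 0#

    √g : E
    √g = 0# ⊹ 1#

    ι-* : ∀ a b → ι (a * b) ≡ ι a ⊗ ι b
    ι-* a b = cong₂ _⊹_
      (sym (trans (cong (a * b +_) (trans (cong (g *_) (zeroˡ 0#)) (zeroʳ g))) (+-identityʳ _)))
      (sym (trans (cong₂ _+_ (zeroʳ a) (zeroˡ b)) (+-identityʳ 0#)))

    ι-^ : ∀ a n → ι (a ^ n) ≡ ι a X.^ n
    ι-^ a zero = refl
    ι-^ a (suc n) = trans (ι-* a (a ^ n)) (cong (ι a ⊗_) (ι-^ a n))

    √g² : √g ⊗ √g ≡ ι g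
    √g² = cong₂ _⊹_ (trans (cong₂ _+_ (zeroˡ 0#) (trans (cong (g *_) (*-identityˡ 1#)) (*-identityʳ g))) (+-identityˡ g))
      (trans (cong₂ _+_ (zeroˡ 1#) (zeroʳ 1#)) (+-identityʳ 0#))

    decompose : ∀ a b → (a ⊹ b) ≡ ι a ⊕ ι b ⊗ √g
    decompose a b = cong₂ _⊹_
      (sym (trans (cong (a +_) (trans (cong₂ _+_ (zeroʳ b) (trans (cong (g *_) (zeroˡ 1#)) (zeroʳ g))) (+-identityʳ 0#))) (+-identityʳ a)))
      (sym (trans (+-identityˡ _) (trans (cong₂ _+_ (*-identityʳ b) (zeroˡ 0#)) (+-identityʳ b))))

    nat-ι : ∀ n → X.nat n ≡ ι (nat n)
    nat-ι zero = refl
    nat-ι (suc n) = trans (cong (1E ⊕_) (nat-ι n)) (cong (1# + nat n ⊹_) (+-identityʳ 0#))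

    module _ (h : ℕ) (fixedK : ∀ x → x ^ suc (2 ℕ.* h) ≡ x)
             (additive : ∀ x y → (x ⊕ y) X.^ suc (2 ℕ.* h) ≡ x X.^ suc (2 ℕ.* h) ⊕ y X.^ suc (2 ℕ.* h)) where
      private
        Q : ℕ
        Q = suc (2 ℕ.* h)

        u : Carrier
        u = g ^ h

        √g^Q : √g X.^ Q ≡ √g ⊗ ι u
        √g^Q = cong (√g ⊗_) (trans (sym (X.^-assocʳ √g 2 h)) (trans (cong (X._^ h) (trans (cong (√g ⊗_) (X.*-identityʳ √g)) √g²)) (sym (ι-^ g h))))

        u²≡1 : u * u ≡ 1#
        u²≡1 = *-cancelˡ g g≢0 (trans (cong (g *_) (trans (sym (^-homo-* g h h)) (cong (λ z → g ^ (h ℕ.+ z)) (sym (ℕ.+-identityʳ h))))) (trans (fixedK g) (sym (*-identityʳ g))))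

        ι-fixed : ∀ a → ι a X.^ Q ≡ ι a
        ι-fixed a = trans (sym (ι-^ a Q)) (cong ι (fixedK a))

        conj : ∀ a z → (ι a ⊗ z) X.^ Q ≡ ι a ⊗ z X.^ Q
        conj a z = trans (X.^-distrib-* (ι a) z Q) (cong (_⊗ z X.^ Q) (ι-fixed a))

      -- The Q-th power map is additive and fixes the base field, so only its effect on `√g`
      -- matters. Since Q = 2h + 1, it multiplies `√g` by u = g^h; and u² = g^(Q-1) = 1, so two
      -- applications restore `√g`.
      fixed-extension : ∀ x → (x X.^ Q) X.^ Q ≡ x
      fixed-extension (a ⊹ b) = begin
        ((a ⊹ b) X.^ Q) X.^ Q                       ≡⟨ cong (λ z → (z X.^ Q) X.^ Q) (decompose a b) ⟩
        ((ι a ⊕ ι b ⊗ √g) X.^ Q) X.^ Q              ≡⟨ cong (X._^ Q) (step √g) ⟩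
        (ι a ⊕ ι b ⊗ √g X.^ Q) X.^ Q                ≡⟨ step (√g X.^ Q) ⟩
        ι a ⊕ ι b ⊗ (√g X.^ Q) X.^ Q                ≡⟨ cong (λ z → ι a ⊕ ι b ⊗ z) root ⟩
        ι a ⊕ ι b ⊗ √g                              ≡⟨ decompose a b ⟨
        (a ⊹ b)                                     ∎
        where
        open ≡-Reasoning
        step : ∀ z → (ι a ⊕ ι b ⊗ z) X.^ Q ≡ ι a ⊕ ι b ⊗ z X.^ Q
        step z = trans (additive (ι a) (ι b ⊗ z)) (cong₂ _⊕_ (ι-fixed a) (conj b z))
        root : (√g X.^ Q) X.^ Q ≡ √g
        root = begin
          (√g X.^ Q) X.^ Q       ≡⟨ cong (X._^ Q) (trans √g^Q (X.*-comm √g (ι u))) ⟩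
          (ι u ⊗ √g) X.^ Q       ≡⟨ conj u √g ⟩
          ι u ⊗ √g X.^ Q         ≡⟨ cong (ι u ⊗_) (trans √g^Q (X.*-comm √g (ι u))) ⟩
          ι u ⊗ (ι u ⊗ √g)       ≡⟨ X.*-assoc (ι u) (ι u) √g ⟨
          (ι u ⊗ ι u) ⊗ √g       ≡⟨ cong (_⊗ √g) (trans (sym (ι-* u u)) (cong ι u²≡1)) ⟩
          1E ⊗ √g                ≡⟨ X.*-identityˡ √g ⟩
          √g                     ∎

  -- Squaring identifies 1 and −1, so it is not onto a finite field of odd characteristic.
  module _ (K : FiniteField) where
    open FiniteField K

    ∃nonsquare : ¬ 1# + 1# ≡ 0# → ∃ λ g → ∀ x → ¬ x * x ≡ g
    ∃nonsquare 2≢0 with Fin.¬∀⟶∃¬ size P P? ¬all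
      where
      P : Fin size → Set
      P i = ∃ λ j → element j * element j ≡ element i
      P? : ∀ i → Dec (P i)
      P? i = Fin.any? λ j → element j * element j ≟ element i
      ¬all : ¬ ∀ i → P i
      ¬all all = 2≢0 (trans (cong (1# +_) (trans 1≡ (sym -1≡))) (-‿inverseʳ 1#))
        where
        σ : Fin size → Fin size
        σ i = proj₁ (all i)
        σ-injective : ∀ {i j} → σ i ≡ σ j → i ≡ j
        σ-injective {i} {j} e = element-injective (trans (sym (proj₂ (all i))) (trans (cong (λ k → element k * element k) e) (proj₂ (all j))))
        root-of : ∀ x → x * x ≡ 1# → x ≡ element (σ (index 1#))
        root-of x x²≡1 with injective⇒surjective σ σ-injective (index x)
        ... | i , σi≡x = trans (sym (element-index x)) (cong element (trans (sym σi≡x) (cong σ (trans (sym (index-element i)) (cong index i≡1)))))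
          where
          i≡1 : element i ≡ 1#
          i≡1 = trans (sym (proj₂ (all i))) (trans (cong₂ _*_ e e) x²≡1)
            where
            e : element (σ i) ≡ x
            e = trans (cong element σi≡x) (element-index x)
        1≡ : 1# ≡ element (σ (index 1#))
        1≡ = root-of 1# (*-identityˡ 1#)
        -1≡ : - 1# ≡ element (σ (index 1#))
        -1≡ = root-of (- 1#) (trans (sym (-‿distribˡ-* 1# (- 1#))) (trans (cong -_ (*-identityˡ (- 1#))) (-‿involutive 1#)))
    ... | i , ¬P = element i , λ x x²≡ → ¬P (index x , trans (cong₂ _*_ (element-index x) (element-index x)) x²≡)

  odd⇒ : ∀ n → ¬ 2 ∣ n → ∃ λ h → n ≡ suc (2 ℕ.* h)
  odd⇒ zero odd = ⊥-elim (odd (divides 0 refl))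
  odd⇒ (suc zero) odd = 0 , refl
  odd⇒ (suc (suc n)) odd with odd⇒ n (λ { (divides c e) → odd (divides (suc c) (cong (2 ℕ.+_) e)) })
  ... | h , e = suc h , trans (cong (2 ℕ.+_) e) (cong suc (sym (ℕ.*-suc 2 h)))

  module _ {q} (q-prime : Prime q) (q>2 : 2 < q) where

    private
      q∤2 : ¬ q ∣ 2
      q∤2 d = ℕ.<-irrefl refl (ℕ.<-≤-trans q>2 (∣⇒≤ d))

      2∤q^ : ∀ n → ¬ 2 ∣ q ℕ.^ n
      2∤q^ n d = ℕ.<-irrefl (prime-∣-prime q-prime (s≤s (s≤s z≤n)) (prime-∣-^ q n 2-prime d)) q>2
        where
        open import Data.Nat.Primality using (prime[2])
        2-prime = prime[2]

    double : ∀ {k} → Tower q k → Tower q (suc k)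
    double {k} T = record
      { field′ = extension
      ; q≡0 = q≡0E
      ; characteristic = λ n e → characteristic n (cong re (trans (sym (nat-ι n)) e))
      ; size≡ = trans (cong₂ ℕ._*_ size≡ size≡) Q²
      ; fixed = λ x → trans (trans (cong (x X.^_) (sym Q²)) (trans (sym (X.^-assocʳ x Q Q)) (cong₂ (λ u v → (x X.^ u) X.^ v) Q≡ Q≡)))
          (fixed-extension h (λ x → subst (λ z → x ^ z ≡ x) Q≡ (fixed x)) (λ x y → subst (λ z → (x ⊕ y) X.^ z ≡ x X.^ z ⊕ y X.^ z) Q≡ (Fr-+ (2 ℕ.^ k) x y)) x) }
      where
      open Tower T
      K = field′
      open FiniteField K
      two≢0 : ¬ 1# + 1# ≡ 0#
      two≢0 e = q∤2 (characteristic 2 (trans (cong (1# +_) (+-identityʳ 1#)) e))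
      nonsq = ∃nonsquare K two≢0
      open Quadratic K (proj₁ nonsq) (proj₂ nonsq)
      module X = FiniteField extension
      q≡0E : X.nat q ≡ X.0#
      q≡0E = trans (nat-ι q) (cong ι q≡0)
      open X.Characteristic q-prime q≡0E using (Fr-+)
      Q = q ℕ.^ (2 ℕ.^ k)
      Q² : Q ℕ.* Q ≡ q ℕ.^ (2 ℕ.^ suc k)
      Q² = trans (sym (ℕ.^-distribˡ-+-* q (2 ℕ.^ k) (2 ℕ.^ k))) (cong (λ z → q ℕ.^ (2 ℕ.^ k ℕ.+ z)) (sym (ℕ.+-identityʳ (2 ℕ.^ k))))
      h = proj₁ (odd⇒ Q (2∤q^ (2 ℕ.^ k)))
      Q≡ : Q ≡ suc (2 ℕ.* h)
      Q≡ = proj₂ (odd⇒ Q (2∤q^ (2 ℕ.^ k)))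

    tower : ∀ k → Tower q k
    tower zero = base q-prime
      where
      base : ∀ {q} → Prime q → Tower q 0
      base {zero} pp = ⊥-elim (ℕ.<-irrefl refl (prime>0 pp))
      base {suc m} pp = PrimeField.tower m pp
    tower (suc k) = double (tower k)

  -- In a cyclic group of order 2^(k+1) every nonzero subgroup contains the element of order two,
  -- here 2^k. Explicitly: an odd i is multiplied by 2^k, and factors 2 are removed from an even i
  -- by recursion.
  half-multiple : ∀ k i → 0 < i → i < 2 ℕ.^ suc k → ∃₂ λ c e → c ℕ.* i ≡ 2 ℕ.^ k ℕ.+ 2 ℕ.^ suc k ℕ.* e
  half-multiple k i 0<i i<2^ with 2 ∣? i
    where open import Data.Nat.Divisibility using (_∣?_)
  ... | no odd with odd⇒ i odd
  ...   | h , refl = 2 ℕ.^ k , h , r (2 ℕ.^ k) h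
    where
    r : ∀ t h → t ℕ.* suc (2 ℕ.* h) ≡ t ℕ.+ 2 ℕ.* t ℕ.* h
    r = solve-∀
  half-multiple zero i 0<i i<2^ | yes (divides zero refl) = ⊥-elim (ℕ.<-irrefl refl 0<i)
  half-multiple zero i 0<i i<2^ | yes (divides (suc j) refl) = ⊥-elim (ℕ.<-irrefl refl (ℕ.<-≤-trans i<2^ (s≤s (s≤s z≤n))))
  half-multiple (suc k) i 0<i i<2^ | yes (divides j refl)
    with half-multiple k j (ℕ.n≢0⇒n>0 λ { refl → ℕ.<-irrefl refl 0<i }) (ℕ.*-cancelˡ-< 2 _ _ (subst (ℕ._< 2 ℕ.^ suc (suc k)) (ℕ.*-comm j 2) i<2^))
  ... | c , e , eq = c , e , trans (sym (ℕ.*-assoc c j 2)) (trans (cong (ℕ._* 2) eq) (r (2 ℕ.^ k) (2 ℕ.^ suc k) e))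
    where
    r : ∀ t u e → (t ℕ.+ u ℕ.* e) ℕ.* 2 ≡ 2 ℕ.* t ℕ.+ 2 ℕ.* u ℕ.* e
    r = solve-∀

-- An element with D distinct conjugates

module FrobeniusConjugates where

  open import Data.Nat as ℕ using (ℕ; zero; suc; _∸_; _<_; _≤_; z≤n; s≤s)
  import Data.Nat.Properties as ℕ
  open import Data.Nat.Primality using (Prime; prime⇒nonZero)
  open import Data.Fin using (Fin; zero; suc; toℕ)
  import Data.Fin.Properties as Fin
  open import Data.Product using (∃; _,_; proj₁; proj₂)
  open import Data.Empty using (⊥-elim)
  open import Relation.Nullary using (¬_; yes; no)
  open import Relation.Nullary.Decidable using (¬?)
  open import Relation.Binary.PropositionalEquality hiding ([_])
  open import Relation.Binary.Definitions using (tri<; tri≈; tri>)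
  open Primes
  open FiniteFields
  open QuadraticTowers

  module Conjugates (F : FiniteField) {q} (q-prime : Prime q) (q≡0 : FiniteField.nat F q ≡ FiniteField.0# F)
    (k : ℕ) (size≡ : FiniteField.size F ≡ q ℕ.^ (2 ℕ.^ suc k)) (fixed : ∀ x → FiniteField._^_ F x (q ℕ.^ (2 ℕ.^ suc k)) ≡ x) where
    open FiniteField F using (Carrier; size; element; element-injective; _≟_; fixed-points-bound; module Characteristic)
    open Characteristic q-prime q≡0 public

    D : ℕ
    D = 2 ℕ.^ suc k

    Fr-D : ∀ x → Fr D x ≡ x
    Fr-D = fixed

    Fr-multiple : ∀ i x → Fr i x ≡ x → ∀ c → Fr (c ℕ.* i) x ≡ x
    Fr-multiple i x e zero = Fr-zero x
    Fr-multiple i x e (suc c) = trans (Fr-∘ i (c ℕ.* i) x) (trans (cong (Fr i) (Fr-multiple i x e c)) e)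

    Fr-injective : ∀ j → j ≤ D → ∀ {x y} → Fr j x ≡ Fr j y → x ≡ y
    Fr-injective j j≤D {x} {y} e = trans (undo x) (trans (cong (Fr (D ∸ j)) e) (sym (undo y)))
      where
      undo : ∀ x → x ≡ Fr (D ∸ j) (Fr j x)
      undo x = sym (trans (sym (Fr-∘ (D ∸ j) j x)) (trans (cong (λ z → Fr z x) (ℕ.m∸n+n≡m j≤D)) (Fr-D x)))

    -- The elements fixed by `Fr (2 ^ k)` are roots of X^Q - X with Q = q^(2^k), so there are at
    -- most Q of them, while the field has Q² elements.
    ∃generator : ∃ λ θ → ¬ Fr (2 ℕ.^ k) θ ≡ θ
    ∃generator with Fin.any? (λ i → ¬? (Fr (2 ℕ.^ k) (element i) ≟ element i))
    ... | yes (i , ne) = element i , ne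
    ... | no none = ⊥-elim (ℕ.<-irrefl refl (ℕ.<-≤-trans smaller
          (fixed-points-bound (q ℕ.^ (2 ℕ.^ k)) size 1<Q element element-injective all-fixed)))
      where
      1<Q : 1 < q ℕ.^ (2 ℕ.^ k)
      1<Q = ℕ.<-≤-trans (prime>1 q-prime) (subst (ℕ._≤ q ℕ.^ (2 ℕ.^ k)) (ℕ.*-identityʳ q) (ℕ.^-monoʳ-≤ q {{prime⇒nonZero q-prime}} (ℕ.m^n>0 2 k)))
      smaller : q ℕ.^ (2 ℕ.^ k) < size
      smaller = subst (q ℕ.^ (2 ℕ.^ k) <_) (sym size≡) (ℕ.^-monoʳ-< q (prime>1 q-prime) (ℕ.^-monoʳ-< 2 (s≤s (s≤s z≤n)) (ℕ.n<1+n k)))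
      all-fixed : ∀ i → Fr (2 ℕ.^ k) (element i) ≡ element i
      all-fixed i with Fr (2 ℕ.^ k) (element i) ≟ element i
      ... | yes e = e
      ... | no ne = ⊥-elim (none (i , ne))

    θ : Carrier
    θ = proj₁ ∃generator

    -- This is what a degree that is a power of two buys: one condition on θ replaces one for each
    -- proper subfield. If `Fr i` fixed θ, then so would `Fr (c * i)` for every c, in particular the
    -- power congruent to D / 2 modulo D given by `half-multiple`, against the choice of θ.
    θ-free : ∀ i → 0 < i → i < D → ¬ Fr i θ ≡ θ
    θ-free i 0<i i<D e with half-multiple k i 0<i i<D
    ... | c , d , eq = proj₂ ∃generator (begin
      Fr (2 ℕ.^ k) θ                       ≡⟨ cong (Fr (2 ℕ.^ k)) (Fr-multiple D θ (Fr-D θ) d) ⟨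
      Fr (2 ℕ.^ k) (Fr (d ℕ.* D) θ)        ≡⟨ Fr-∘ (2 ℕ.^ k) (d ℕ.* D) θ ⟨
      Fr (2 ℕ.^ k ℕ.+ d ℕ.* D) θ           ≡⟨ cong (λ z → Fr z θ) (trans (cong (2 ℕ.^ k ℕ.+_) (ℕ.*-comm d D)) (sym eq)) ⟩
      Fr (c ℕ.* i) θ                       ≡⟨ Fr-multiple i θ e c ⟩
      θ                                    ∎)
      where open ≡-Reasoning

    conjugate : Fin D → Carrier
    conjugate j = Fr (toℕ j) θ

    private
      distinct : ∀ i j → i < j → j < D → ¬ Fr i θ ≡ Fr j θ
      distinct i j i<j j<D e = θ-free (j ∸ i) (ℕ.m<n⇒0<n∸m i<j) (ℕ.≤-<-trans (ℕ.m∸n≤m j i) j<D)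
        (sym (Fr-injective i (ℕ.<⇒≤ (ℕ.<-trans i<j j<D)) (trans e (trans (cong (λ z → Fr z θ) (sym (ℕ.m+[n∸m]≡n (ℕ.<⇒≤ i<j)))) (Fr-∘ i (j ∸ i) θ)))))

    conjugate-injective : ∀ {i j} → conjugate i ≡ conjugate j → i ≡ j
    conjugate-injective {i} {j} e with ℕ.<-cmp (toℕ i) (toℕ j)
    ... | tri< i<j _ _ = ⊥-elim (distinct _ _ i<j (Fin.toℕ<n j) e)

    ... | tri≈ _ i≡j _ = Fin.toℕ-injective i≡j
    ... | tri> _ _ j<i = ⊥-elim (distinct _ _ j<i (Fin.toℕ<n i) (sym e))

-- Bounding the number of solutions of a system of product equations

module NormEquations where

  open import Data.Nat as ℕ using (ℕ; zero; suc; _∸_; _<_; _≤_; z≤n; s≤s)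
  import Data.Nat.Properties as ℕ
  open import Data.Nat.Induction using (<-rec)
  open import Data.Nat.Tactic.RingSolver using (solve-∀)
  open import Data.Fin as Fin using (Fin; zero; suc; toℕ; fromℕ<; combine; punchIn; inject≤; finToFun; funToFin)
  import Data.Fin.Properties as Fin
  open import Data.List using (List; []; _∷_; allFin; filter; length; lookup)
  open import Data.List.Properties using (length-filter; length-tabulate)
  open import Data.List.Membership.Propositional using (_∈_)
  open import Data.List.Membership.Propositional.Properties using (∈-filter⁺; ∈-filter⁻; ∈-allFin; ∈-lookup)
  open import Data.List.Relation.Unary.Any using (here; there)
  open import Data.List.Relation.Unary.All as All using ([]; _∷_)
  open import Data.List.Relation.Unary.Unique.Propositional.Properties using (filter⁺; allFin⁺)
  open import Data.Vec as Vec using (Vec; []; _∷_)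
  import Data.Vec.Properties as Vec
  open import Data.Product using (∃; ∃₂; _×_; _,_; proj₁; proj₂)
  open import Data.Empty using (⊥-elim)
  open import Data.Unit using (⊤; tt)
  open import Relation.Nullary using (¬_; Dec; yes; no)
  open import Relation.Nullary.Decidable using (¬?; _×-dec_; decidable-stable)
  open import Relation.Binary.PropositionalEquality
  open import Function using (_∘_; id)
  open UniqueLists
  open FiniteFields

  δ : ∀ {n} → Fin n → Fin n → ℕ
  δ zero zero = 1
  δ zero (suc j) = 0
  δ (suc i) zero = 0
  δ (suc i) (suc j) = δ i j

  δ-refl : ∀ {n} (i : Fin n) → δ i i ≡ 1
  δ-refl zero = refl
  δ-refl (suc i) = δ-refl i

  δ-≢ : ∀ {n} (i j : Fin n) → ¬ i ≡ j → δ i j ≡ 0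
  δ-≢ zero zero ne = ⊥-elim (ne refl)
  δ-≢ zero (suc j) ne = refl
  δ-≢ (suc i) zero ne = refl
  δ-≢ (suc i) (suc j) ne = δ-≢ i j (ne ∘ cong suc)

  δ-≤1 : ∀ {n} (i j : Fin n) → δ i j ≤ 1
  δ-≤1 zero zero = s≤s z≤n
  δ-≤1 zero (suc j) = z≤n
  δ-≤1 (suc i) zero = z≤n
  δ-≤1 (suc i) (suc j) = δ-≤1 i j

  sumℕ : ∀ {n} → (Fin n → ℕ) → ℕ
  sumℕ {zero} f = 0
  sumℕ {suc n} f = f zero ℕ.+ sumℕ (f ∘ suc)

  sumℕ-+ : ∀ {n} (f g : Fin n → ℕ) → sumℕ (λ i → f i ℕ.+ g i) ≡ sumℕ f ℕ.+ sumℕ g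
  sumℕ-+ {zero} f g = refl
  sumℕ-+ {suc n} f g = trans (cong (f zero ℕ.+ g zero ℕ.+_) (sumℕ-+ (f ∘ suc) (g ∘ suc))) (r (f zero) (g zero) _ _)
    where
    r : ∀ a b c d → a ℕ.+ b ℕ.+ (c ℕ.+ d) ≡ a ℕ.+ c ℕ.+ (b ℕ.+ d)
    r = solve-∀

  sumℕ-mono : ∀ {n} {f g : Fin n → ℕ} → (∀ i → f i ≤ g i) → sumℕ f ≤ sumℕ g
  sumℕ-mono {zero} le = z≤n
  sumℕ-mono {suc n} le = ℕ.+-mono-≤ (le zero) (sumℕ-mono (le ∘ suc))

  sumℕ-const : ∀ n c → sumℕ {n} (λ _ → c) ≡ n ℕ.* c
  sumℕ-const zero c = refl
  sumℕ-const (suc n) c = cong (c ℕ.+_) (sumℕ-const n c)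

  sumℕ-δ : ∀ {n} (i : Fin n) c → sumℕ (λ j → δ i j ℕ.* c) ≡ c
  sumℕ-δ {suc n} zero c = trans (cong (c ℕ.+ 0 ℕ.+_) (trans (sumℕ-const n 0) (ℕ.*-zeroʳ n))) (trans (ℕ.+-identityʳ _) (ℕ.+-identityʳ c))
  sumℕ-δ (suc i) c = sumℕ-δ i c

  -- The exponent vector of the product of the listed variables; a single variable has the exponent
  -- vector `δ i`.
  multiplicity : ∀ {n} → List (Fin n) → Fin n → ℕ
  multiplicity [] j = 0
  multiplicity (i ∷ is) j = δ i j ℕ.+ multiplicity is j

  multiplicity-∉ : ∀ {n} {P : Fin n → Set} (is : List (Fin n)) → (∀ i → i ∈ is → P i) → ∀ j → ¬ P j → multiplicity is j ≡ 0
  multiplicity-∉ [] all j ¬P = refl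
  multiplicity-∉ (i ∷ is) all j ¬P = cong₂ ℕ._+_ (δ-≢ i j λ { refl → ¬P (all i (here refl)) }) (multiplicity-∉ is (λ i → all i ∘ there) j ¬P)

  multiplicity-≤-length : ∀ {n} (is : List (Fin n)) j → multiplicity is j ≤ length is
  multiplicity-≤-length [] j = z≤n
  multiplicity-≤-length (i ∷ is) j = ℕ.+-mono-≤ (δ-≤1 i j) (multiplicity-≤-length is j)

  funToFin-cong : ∀ {m n} {f g : Fin m → Fin n} → (∀ i → f i ≡ g i) → funToFin f ≡ funToFin g
  funToFin-cong {zero} e = refl
  funToFin-cong {suc m} e = cong₂ combine (e zero) (funToFin-cong (e ∘ suc))

  finToFun-injective : ∀ {m n} (i j : Fin (n ℕ.^ m)) → (∀ k → finToFun {n} {m} i k ≡ finToFun j k) → i ≡ j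
  finToFun-injective {m} {n} i j e = trans (sym (Fin.funToFin-finToFin {m} {n} i)) (trans (funToFin-cong e) (Fin.funToFin-finToFin {m} {n} j))

  -- D exponents cannot meet all of the D + 1 disjoint windows (i g, (i + 1) g]. An empty window
  -- separates big exponents from small ones by a margin that the rise of the small ones during a
  -- reduction does not use up.
  gap-exists : ∀ {D} (e : Fin D → ℕ) g → ∃ λ i → i ≤ D × (∀ j → ¬ (i ℕ.* g < e j × e j ≤ suc i ℕ.* g))
  gap-exists {D} e g with Fin.any? {suc D} (λ i → ¬? (Fin.any? (hit? i)))
    where
    hit? : ∀ (i : Fin (suc D)) j → Dec (toℕ i ℕ.* g < e j × e j ≤ suc (toℕ i) ℕ.* g)
    hit? i j = (toℕ i ℕ.* g ℕ.<? e j) ×-dec (e j ℕ.≤? suc (toℕ i) ℕ.* g)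
  ... | yes (i , free) = toℕ i , ℕ.s≤s⁻¹ (Fin.toℕ<n i) , λ j r → free (j , r)
  ... | no full = ⊥-elim (crowded λ i → decidable-stable (Fin.any? λ j → (toℕ i ℕ.* g ℕ.<? e j) ×-dec (e j ℕ.≤? suc (toℕ i) ℕ.* g)) λ ¬r → full (i , ¬r))
    where
    crowded : ¬ ((i : Fin (suc D)) → ∃ λ j → toℕ i ℕ.* g < e j × e j ≤ suc (toℕ i) ℕ.* g)
    crowded hit with Fin.pigeonhole (ℕ.n<1+n D) (proj₁ ∘ hit)
    ... | i , i′ , i<i′ , same = ℕ.<-irrefl refl (ℕ.<-≤-trans lower (ℕ.≤-trans upper (ℕ.*-monoˡ-≤ g i<i′)))
      where
      upper : e (proj₁ (hit i)) ≤ suc (toℕ i) ℕ.* g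
      upper = proj₂ (proj₂ (hit i))
      lower : toℕ i′ ℕ.* g < e (proj₁ (hit i))
      lower = subst (λ j → toℕ i′ ℕ.* g < e j) (sym same) (proj₁ (proj₂ (hit i′)))

  -- The degree that `eliminate` reaches with t small coordinates, starting from generators of
  -- degree k. Removing one coordinate multiplies a generator by a polynomial of degree t, which
  -- gives t + k; the induction is then applied twice, inside and outside.
  bump : ℕ → ℕ → ℕ
  bump zero k = k
  bump (suc t) k = bump t (bump t (t ℕ.+ k))

  -- Dominates `bump t t` for all t < S, the case of t small coordinates, and also 1, the degree
  -- produced by a linear relation.
  maxBump : ℕ → ℕ
  maxBump zero = 1
  maxBump (suc t) = bump t t ℕ.+ maxBump t

  bump≤maxBump : ∀ {t S} → t < S → bump t t ≤ maxBump S
  bump≤maxBump {t} {suc S} (s≤s t≤S) with t ℕ.≟ S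
  ... | yes refl = ℕ.m≤m+n _ _
  ... | no t≢S = ℕ.≤-trans (bump≤maxBump (ℕ.≤∧≢⇒< t≤S t≢S)) (ℕ.m≤n+m _ _)

  1≤maxBump : ∀ S → 1 ≤ maxBump S
  1≤maxBump zero = s≤s z≤n
  1≤maxBump (suc S) = ℕ.≤-trans (1≤maxBump S) (ℕ.m≤n+m _ _)

  -- The summand `maxBump S` is the possible rise of a small exponent in one reduction. The summand
  -- `D` makes every big exponent at least `D`, so that the product of the big variables can be
  -- split off.
  gapSize : ℕ → ℕ → ℕ
  gapSize D S = maxBump S ℕ.+ D

  maxExponent : ℕ → ℕ → ℕ
  maxExponent D S = suc D ℕ.* gapSize D S

  -- The number of monomials in D variables with all exponents at most `maxExponent D S`. The latter
  -- is the upper end of the last of the D + 1 windows, so an exponent above it is big whichever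
  -- window is empty.
  solutionBound : ℕ → ℕ → ℕ
  solutionBound D S = suc (maxExponent D S) ℕ.^ D

  module Products (F : FiniteField) where
    open FiniteField F

    Π : ∀ {n} → (Fin n → Carrier) → Carrier
    Π {zero} f = 1#
    Π {suc n} f = f zero * Π (f ∘ suc)

    Π-cong : ∀ {n} {f g : Fin n → Carrier} → (∀ i → f i ≡ g i) → Π f ≡ Π g
    Π-cong {zero} e = refl
    Π-cong {suc n} e = cong₂ _*_ (e zero) (Π-cong (e ∘ suc))

    *-interchange : ∀ a b c d → (a * b) * (c * d) ≡ (a * c) * (b * d)
    *-interchange = SemiringIdentities.*-interchange commutativeSemiring

    Π-* : ∀ {n} (f g : Fin n → Carrier) → Π (λ i → f i * g i) ≡ Π f * Π g
    Π-* {zero} f g = sym (*-identityˡ 1#)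
    Π-* {suc n} f g = trans (cong (f zero * g zero *_) (Π-* (f ∘ suc) (g ∘ suc))) (*-interchange (f zero) (g zero) _ _)

    Π-one : ∀ {n} (f : Fin n → Carrier) → (∀ i → f i ≡ 1#) → Π f ≡ 1#
    Π-one {zero} f e = refl
    Π-one {suc n} f e = trans (cong₂ _*_ (e zero) (Π-one (f ∘ suc) (e ∘ suc))) (*-identityˡ 1#)

    Π-δ : ∀ {n} (y : Fin n → Carrier) i → Π (λ j → y j ^ δ i j) ≡ y i
    Π-δ y zero = trans (cong₂ _*_ (*-identityʳ (y zero)) (Π-one (λ j → y (suc j) ^ 0) (λ _ → refl))) (*-identityʳ (y zero))
    Π-δ y (suc i) = trans (*-identityˡ _) (Π-δ (y ∘ suc) i)

    ΠL : ∀ {A : Set} → (A → Carrier) → List A → Carrier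
    ΠL f [] = 1#
    ΠL f (x ∷ xs) = f x * ΠL f xs

    ΠL-partition : ∀ {A : Set} {P : A → Set} (P? : ∀ x → Dec (P x)) f xs →
      ΠL f xs ≡ ΠL f (filter P? xs) * ΠL f (filter (¬? ∘ P?) xs)
    ΠL-partition P? f [] = sym (*-identityˡ 1#)
    ΠL-partition P? f (x ∷ xs) with P? x
    ... | yes _ = trans (cong (f x *_) (ΠL-partition P? f xs)) (sym (*-assoc (f x) _ _))
    ... | no _ = trans (cong (f x *_) (ΠL-partition P? f xs))
      (trans (sym (*-assoc (f x) _ _)) (trans (cong (_* ΠL f (filter (¬? ∘ P?) xs)) (*-comm (f x) _)) (*-assoc _ (f x) _)))

    ΠL-tabulate : ∀ {A : Set} {n} (f : A → Carrier) (g : Fin n → A) → ΠL f (Data.List.tabulate g) ≡ Π (f ∘ g)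
    ΠL-tabulate {n = zero} f g = refl
    ΠL-tabulate {n = suc n} f g = cong (f (g zero) *_) (ΠL-tabulate f (g ∘ suc))

  module Spans (F : FiniteField) {Z : Set} {D : ℕ} (y : Fin D → Z → FiniteField.Carrier F) where
    open FiniteField F
    open Products F

    Exps : Set
    Exps = Fin D → ℕ

    mono : Exps → Z → Carrier
    mono e z = Π (λ j → y j z ^ e j)

    mono-+ : ∀ e e′ z → mono (λ j → e j ℕ.+ e′ j) z ≡ mono e z * mono e′ z
    mono-+ e e′ z = trans (Π-cong (λ j → ^-homo-* (y j z) (e j) (e′ j))) (Π-* (λ j → y j z ^ e j) (λ j → y j z ^ e′ j))

    mono-cong : ∀ {e e′} → (∀ j → e j ≡ e′ j) → ∀ z → mono e z ≡ mono e′ z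
    mono-cong eq z = Π-cong (λ j → cong (y j z ^_) (eq j))

    mono-0 : ∀ z → mono (λ _ → 0) z ≡ 1#
    mono-0 z = Π-one (λ j → y j z ^ 0) (λ _ → refl)

    mono-δ : ∀ i z → mono (δ i) z ≡ y i z
    mono-δ i z = Π-δ (λ j → y j z) i

    -- Combinations of monomials are taken as functions on `Z`, the set of solutions, and not as
    -- formal polynomials. The equations and linear relations thereby hold as identities, and the
    -- calculation takes place modulo the ideal of the solutions without naming it.
    data Span (P : Exps → Set) : (Z → Carrier) → Set where
      none : ∀ {f} → (∀ z → f z ≡ 0#) → Span P f
      term : ∀ c e {f g} → P e → Span P g → (∀ z → f z ≡ c * mono e z + g z) → Span P f

    span-resp : ∀ {P f g} → (∀ z → f z ≡ g z) → Span P f → Span P g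
    span-resp eq (none e) = none λ z → trans (sym (eq z)) (e z)
    span-resp eq (term c e p s q) = term c e p s λ z → trans (sym (eq z)) (q z)

    span-mono : ∀ {P e} → P e → Span P (mono e)
    span-mono {P} {e} p = term 1# e p (none {f = λ _ → 0#} (λ _ → refl)) λ z → sym (trans (+-identityʳ _) (*-identityˡ _))

    span-+ : ∀ {P f g} → Span P f → Span P g → Span P (λ z → f z + g z)
    span-+ (none e) t = span-resp (λ z → sym (trans (cong (_+ _) (e z)) (+-identityˡ _))) t
    span-+ {g = g} (term c e p s q) t = term c e p (span-+ s t) λ z → trans (cong (_+ g z) (q z)) (+-assoc _ _ _)

    span-scale : ∀ {P f} c → Span P f → Span P (λ z → c * f z)
    span-scale c (none e) = none λ z → trans (cong (c *_) (e z)) (zeroʳ c)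
    span-scale c (term c′ e {g = g} p s q) = term (c * c′) e p (span-scale c s) λ z →
      trans (cong (c *_) (q z)) (trans (distribˡ c _ _) (cong (_+ c * g z) (sym (*-assoc c c′ _))))

    span-bind : ∀ {P Q f} → (∀ e → P e → Span Q (mono e)) → Span P f → Span Q f
    span-bind h (none e) = none e
    span-bind h (term c e p s q) = span-resp (sym ∘ q) (span-+ (span-scale c (h e p)) (span-bind h s))

    span-weaken : ∀ {P Q f} → (∀ e → P e → Q e) → Span P f → Span Q f
    span-weaken h (none e) = none e
    span-weaken h (term c e p s q) = term c e (h e p) (span-weaken h s) q

    span-mono-* : ∀ {P Q f} e → (∀ e′ → P e′ → Q (λ j → e j ℕ.+ e′ j)) → Span P f → Span Q (λ z → mono e z * f z)
    span-mono-* e h (none eq) = none λ z → trans (cong (mono e z *_) (eq z)) (zeroʳ _)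
    span-mono-* {P} {Q} {f} e h (term c e′ {g = g} p s q) = term c (λ j → e j ℕ.+ e′ j) (h e′ p) (span-mono-* e h s) λ z → begin
      mono e z * f z                                ≡⟨ cong (mono e z *_) (q z) ⟩
      mono e z * (c * mono e′ z + g z)              ≡⟨ distribˡ (mono e z) _ _ ⟩
      mono e z * (c * mono e′ z) + mono e z * g z   ≡⟨ cong (_+ mono e z * g z) (trans (sym (*-assoc _ c _)) (trans (cong (_* mono e′ z) (*-comm _ c)) (*-assoc c _ _))) ⟩
      c * (mono e z * mono e′ z) + mono e z * g z   ≡⟨ cong (λ t → c * t + mono e z * g z) (mono-+ e e′ z) ⟨
      c * mono (λ j → e j ℕ.+ e′ j) z + mono e z * g z ∎
      where open ≡-Reasoning

    span-* : ∀ {P P′ Q f g} → (∀ e e′ → P e → P′ e′ → Q (λ j → e j ℕ.+ e′ j)) → Span P f → Span P′ g → Span Q (λ z → f z * g z)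
    span-* {g = g} h (none eq) t = none λ z → trans (cong (_* g z) (eq z)) (zeroˡ (g z))
    span-* {g = g} h (term c e {g = g′} p s q) t =
      span-resp (λ z → sym (trans (cong (_* g z) (q z)) (trans (distribʳ (g z) _ _) (cong (_+ g′ z * g z) (*-assoc c _ _)))))
        (span-+ (span-scale c (span-mono-* e (λ e′ → h e e′ p) t)) (span-* h s t))

    span-const : ∀ {P} c → P (λ _ → 0) → Span P (λ _ → c)
    span-const c p = term c (λ _ → 0) p (none {f = λ _ → 0#} (λ _ → refl)) λ z → sym (trans (+-identityʳ _) (trans (cong (c *_) (mono-0 z)) (*-identityʳ c)))

    span-sum : ∀ {P n} (f : Fin n → Z → Carrier) → (∀ i → Span P (f i)) → Span P (λ z → sum (λ i → f i z))
    span-sum {n = zero} f s = none λ _ → refl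
    span-sum {n = suc n} f s = span-+ (s zero) (span-sum (f ∘ suc) (s ∘ suc))

  module BoundedSystem (F : FiniteField) (Z : Set) (D S : ℕ)
    (y : Fin D → Z → FiniteField.Carrier F) (h : Fin S → Fin D → FiniteField.Carrier F) (c : Fin S → FiniteField.Carrier F)
    (equations : ∀ i z → Products.Π F (λ j → FiniteField._+_ F (y j z) (h i j)) ≡ c i)
    (distinct : ∀ j {i i′} → h i j ≡ h i′ j → i ≡ i′)
    (dependent : ∀ (U : Fin S → Fin D) → (∀ {s s′} → U s ≡ U s′ → s ≡ s′) → ∀ j →
      ∃ λ (l : Fin S → FiniteField.Carrier F) → ∀ z → y j z ≡ FiniteField.sum F (λ t → FiniteField._*_ F (l t) (y (U t) z)))
    where
    open FiniteField F
    open Products F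
    open Spans F y

    d g M : ℕ
    d = maxBump S
    g = gapSize D S
    M = maxExponent D S

    module Threshold (T : ℕ) (e₀ : Exps) where

      Big : Fin D → Set
      Big j = T < e₀ j

      big? : ∀ j → Dec (Big j)
      big? j = T ℕ.<? e₀ j

      bigs smalls : List (Fin D)
      bigs = filter big? (allFin D)
      smalls = filter (¬? ∘ big?) (allFin D)

      ∈bigs⇒ : ∀ i → i ∈ bigs → Big i
      ∈bigs⇒ i i∈ = proj₂ (∈-filter⁻ big? {xs = allFin D} i∈)

      ∈smalls⇒ : ∀ i → i ∈ smalls → ¬ Big i
      ∈smalls⇒ i i∈ = proj₂ (∈-filter⁻ (¬? ∘ big?) {xs = allFin D} i∈)

      EB : Exps
      EB = multiplicity bigs

      EB-small : ∀ j → ¬ Big j → EB j ≡ 0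
      EB-small = multiplicity-∉ bigs ∈bigs⇒

      EB>0⇒Big : ∀ j → 0 < EB j → Big j
      EB>0⇒Big j pos with big? j
      ... | yes b = b
      ... | no ¬b = ⊥-elim (ℕ.<-irrefl (sym (EB-small j ¬b)) pos)

      -- A `Lower` monomial is what may replace the product `mono EB` of all big variables: no big
      -- exponent is raised, one is lowered, and each small exponent is paid for by at most k.
      -- `Poly` describes the multipliers under which this is preserved, namely polynomials in the
      -- small variables.
      Poly Lower : ℕ → Exps → Set
      Poly k e = (∀ j → Big j → e j ≡ 0) × (∀ j → ¬ Big j → e j ≤ k)
      Lower k e = (∀ j → Big j → e j ≤ EB j) × (∃ λ j → Big j × e j < EB j) × (∀ j → ¬ Big j → e j ≤ k)

      Poly-+-Lower : ∀ {k l} e e′ → Poly k e → Lower l e′ → Lower (k ℕ.+ l) (λ j → e j ℕ.+ e′ j)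
      Poly-+-Lower e e′ (z , p) (le , (j , bj , lt) , q) =
        (λ j b → subst (_≤ EB j) (sym (cong (ℕ._+ e′ j) (z j b))) (le j b)) ,
        (j , bj , subst (_< EB j) (sym (cong (ℕ._+ e′ j) (z j bj))) lt) ,
        (λ j b → ℕ.+-mono-≤ (p j b) (q j b))

      Lower-mono : ∀ {k l} → k ≤ l → ∀ e → Lower k e → Lower l e
      Lower-mono k≤l e (a , b , q) = a , b , λ j s → ℕ.≤-trans (q j s) k≤l

      StrictlyBelow : List (Fin D) → Exps → Set
      StrictlyBelow js e = (∀ j → e j ≤ multiplicity js j) × ∃ λ j → e j < multiplicity js j

      -- Multiplying out, the leading monomial is isolated; every other monomial omits some factor
      -- and is therefore strictly below.
      expand : ∀ (a : Fin D → Carrier) js → ∃ λ L → Span (StrictlyBelow js) L ×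
        (∀ z → ΠL (λ j → y j z + a j) js ≡ mono (multiplicity js) z + L z)
      expand a [] = (λ _ → 0#) , none (λ _ → refl) , λ z → sym (trans (+-identityʳ _) (mono-0 z))
      expand a (i ∷ js) with expand a js
      ... | L , sL , eq = (λ z → a i * mono (multiplicity js) z + (mono (δ i) z * L z + a i * L z)) ,
        span-+ (span-scale (a i) (span-mono {e = multiplicity js} ((λ j → ℕ.m≤n+m (multiplicity js j) (δ i j)) , i , ℕ.≤-reflexive (sym (cong (ℕ._+ multiplicity js i) (δ-refl i))))))
          (span-+ (span-mono-* (δ i) (λ { e (le , j , lt) → (λ j → ℕ.+-monoʳ-≤ (δ i j) (le j)) , j , ℕ.+-monoʳ-< (δ i j) lt }) sL)
                  (span-scale (a i) (span-weaken (λ { e (le , j , lt) → (λ j → ℕ.≤-trans (le j) (ℕ.m≤n+m _ _)) , j , ℕ.<-≤-trans lt (ℕ.m≤n+m _ _) }) sL))) ,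
        λ z → begin
          (y i z + a i) * ΠL (λ j → y j z + a j) js                 ≡⟨ cong₂ (λ u v → (u + a i) * v) (sym (mono-δ i z)) (eq z) ⟩
          (mono (δ i) z + a i) * (mono (multiplicity js) z + L z)          ≡⟨ SemiringIdentities.foil commutativeSemiring (mono (δ i) z) (a i) (mono (multiplicity js) z) (L z) ⟩
          mono (δ i) z * mono (multiplicity js) z + (a i * mono (multiplicity js) z + (mono (δ i) z * L z + a i * L z)) ≡⟨ cong (_+ (a i * mono (multiplicity js) z + (mono (δ i) z * L z + a i * L z))) (mono-+ (δ i) (multiplicity js) z) ⟨
          mono (multiplicity (i ∷ js)) z + (a i * mono (multiplicity js) z + (mono (δ i) z * L z + a i * L z)) ∎
        where open ≡-Reasoning

      module _ (someBig : ∃ Big) where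

        private
          nonempty : ∀ {js : List (Fin D)} → (∃ λ j → j ∈ js) → ∃₂ λ i is → js ≡ i ∷ is
          nonempty {i ∷ is} _ = i , is , refl
          nonempty {[]} (_ , ())

          split : ∃₂ λ i is → bigs ≡ i ∷ is
          split = nonempty (proj₁ someBig , ∈-filter⁺ big? (∈-allFin _) (proj₂ someBig))

          i₀ : Fin D
          i₀ = proj₁ split

          rest : List (Fin D)
          rest = proj₁ (proj₂ split)

          bigs≡ : bigs ≡ i₀ ∷ rest
          bigs≡ = proj₂ (proj₂ split)

          i₀-big : Big i₀
          i₀-big = ∈bigs⇒ i₀ (subst (i₀ ∈_) (sym bigs≡) (here refl))

          EB≡ : ∀ j → EB j ≡ δ i₀ j ℕ.+ multiplicity rest j
          EB≡ j = cong (λ js → multiplicity js j) bigs≡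

          rest<EB : multiplicity rest i₀ < EB i₀
          rest<EB = ℕ.≤-reflexive (sym (trans (EB≡ i₀) (cong (ℕ._+ multiplicity rest i₀) (δ-refl i₀))))

          EB>0 : 0 < EB i₀
          EB>0 = ℕ.≤-<-trans z≤n rest<EB

        -- A linear relation replaces one factor y_{i₀} by small ones.
        linear-case : S ≤ length smalls → Span (Lower 1) (mono EB)
        linear-case S≤ with dependent U U-injective i₀
          where
          U : Fin S → Fin D
          U s = lookup smalls (inject≤ s S≤)
          U-injective : ∀ {s s′} → U s ≡ U s′ → s ≡ s′
          U-injective e = Fin.inject≤-injective S≤ S≤ _ _ (lookup-injective (filter⁺ (¬? ∘ big?) (allFin⁺ D)) e)
        ... | l , rel = span-resp eq (span-sum _ λ t → span-scale (l t) (span-mono (lower t)))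
          where
          U : Fin S → Fin D
          U s = lookup smalls (inject≤ s S≤)
          small : ∀ t → ¬ Big (U t)
          small t = ∈smalls⇒ (U t) (∈-lookup {xs = smalls} (inject≤ t S≤))
          E : Fin S → Exps
          E t j = δ (U t) j ℕ.+ multiplicity rest j
          δ0 : ∀ t j → Big j → δ (U t) j ≡ 0
          δ0 t j b = δ-≢ (U t) j λ { refl → small t b }
          rest≤EB : ∀ j → multiplicity rest j ≤ EB j
          rest≤EB j = subst (multiplicity rest j ≤_) (sym (EB≡ j)) (ℕ.m≤n+m (multiplicity rest j) (δ i₀ j))
          lower : ∀ t → Lower 1 (E t)
          lower t = (λ j b → subst (_≤ EB j) (sym (cong (ℕ._+ multiplicity rest j) (δ0 t j b))) (rest≤EB j)) ,
            (i₀ , i₀-big , subst (_< EB i₀) (sym (cong (ℕ._+ multiplicity rest i₀) (δ0 t i₀ i₀-big))) rest<EB) ,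
            λ j ¬b → subst (_≤ 1) (sym (trans (cong (δ (U t) j ℕ.+_) (ℕ.n≤0⇒n≡0 (subst (multiplicity rest j ≤_) (EB-small j ¬b) (rest≤EB j)))) (ℕ.+-identityʳ _))) (δ-≤1 (U t) j)
          open ≡-Reasoning
          eq : ∀ z → sum (λ t → l t * mono (E t) z) ≡ mono EB z
          eq z = begin
            sum (λ t → l t * mono (E t) z)                      ≡⟨ sum-cong (λ t → trans (cong (l t *_) (trans (mono-+ (δ (U t)) (multiplicity rest) z) (cong (_* mono (multiplicity rest) z) (mono-δ (U t) z)))) (sym (*-assoc (l t) _ _))) ⟩
            sum (λ t → (l t * y (U t) z) * mono (multiplicity rest) z) ≡⟨ *-distribʳ-sum (mono (multiplicity rest) z) (λ t → l t * y (U t) z) ⟨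
            sum (λ t → l t * y (U t) z) * mono (multiplicity rest) z   ≡⟨ cong (_* mono (multiplicity rest) z) (rel z) ⟨
            y i₀ z * mono (multiplicity rest) z                        ≡⟨ cong (_* mono (multiplicity rest) z) (mono-δ i₀ z) ⟨
            mono (δ i₀) z * mono (multiplicity rest) z                 ≡⟨ mono-+ (δ i₀) (multiplicity rest) z ⟨
            mono (λ j → δ i₀ j ℕ.+ multiplicity rest j) z              ≡⟨ mono-cong EB≡ z ⟨
            mono EB z                                           ∎

        -- The functions f for which f · ∏_{big} y_j reduces form an ideal, filtered by degree.
        Ideal : ℕ → (Z → Carrier) → Set
        Ideal k f = Span (Lower k) (λ z → f z * mono EB z)

        ideal-* : ∀ {k l u f} → Span (Poly l) u → Ideal k f → Ideal (l ℕ.+ k) (λ z → u z * f z)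
        ideal-* su if = span-resp (λ z → sym (*-assoc _ _ _)) (span-* Poly-+-Lower su if)

        ideal-scale : ∀ {k f} a → Ideal k f → Ideal k (λ z → a * f z)
        ideal-scale a if = span-resp (λ z → sym (*-assoc a _ _)) (span-scale a if)

        ideal-+ : ∀ {k f f′} → Ideal k f → Ideal k f′ → Ideal k (λ z → f z + f′ z)
        ideal-+ if if′ = span-resp (λ z → sym (distribʳ _ _ _)) (span-+ if if′)

        ideal-resp : ∀ {k f f′} → (∀ z → f z ≡ f′ z) → Ideal k f → Ideal k f′
        ideal-resp e = span-resp (λ z → cong (_* mono EB z) (e z))

        factor : Fin S → List (Fin D) → Z → Carrier
        factor i js z = ΠL (λ j → y j z + h i j) js

        factor-poly : ∀ i js → (∀ j → j ∈ js → ¬ Big j) → Span (Poly (length js)) (factor i js)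
        factor-poly i js small with expand (h i) js
        ... | L , sL , eq = span-resp (λ z → sym (eq z)) (span-+ (span-mono (within (multiplicity js) (λ j → ℕ.≤-refl))) (span-weaken (λ { e (le , _) → within e le }) sL))
          where
          within : ∀ e → (∀ j → e j ≤ multiplicity js j) → Poly (length js) e
          within e le = (λ j b → ℕ.n≤0⇒n≡0 (subst (e j ≤_) (multiplicity-∉ js small j (λ ¬b → ¬b b)) (le j))) ,
            λ j _ → ℕ.≤-trans (le j) (multiplicity-≤-length js j)

        -- With g = (y + h) g′ and k = (y + h′) k′, the combination k′ g − g′ k = (h − h′) g′ k′ eliminates y.
        eliminate : ∀ js → (∀ j → j ∈ js → ¬ Big j) → (V : Fin (suc (length js)) → Fin S) → (∀ {s s′} → V s ≡ V s′ → s ≡ s′) →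
          ∀ k f → (∀ s → Ideal k (λ z → f z * factor (V s) js z)) → Ideal (bump (length js) k) f
        eliminate [] small V inj k f gens = ideal-resp (λ z → *-identityʳ (f z)) (gens zero)
        eliminate (j ∷ js) small V inj k f gens =
          eliminate js small′ (V ∘ suc) (Fin.suc-injective ∘ inj) _ f (λ s → step (suc s))
          where
          t = length js
          small′ : ∀ i → i ∈ js → ¬ Big i
          small′ i = small i ∘ there
          pair : ∀ s s′ → ¬ s ≡ s′ → Ideal (t ℕ.+ k) (λ z → (f z * factor (V s) js z) * factor (V s′) js z)
          pair s s′ s≢s′ = ideal-resp simplify (ideal-scale w (ideal-+ (ideal-* (factor-poly (V s′) js small′) (gens s))
              (ideal-scale (- 1#) (ideal-* (factor-poly (V s) js small′) (gens s′)))))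
            where
            a = h (V s) j
            b = h (V s′) j
            a-b≢0 : ¬ a + - b ≡ 0#
            a-b≢0 e = s≢s′ (inj (distinct j (x-y≡0⇒x≡y e)))
            w = proj₁ (inverse (a + - b) a-b≢0)
            simplify : ∀ z → w * (factor (V s′) js z * (f z * factor (V s) (j ∷ js) z) + - 1# * (factor (V s) js z * (f z * factor (V s′) (j ∷ js) z)))
              ≡ (f z * factor (V s) js z) * factor (V s′) js z
            simplify z = begin
              w * (G′ * (F₀ * ((Y + a) * G)) + - 1# * (G * (F₀ * ((Y + b) * G′))))   ≡⟨ cong₂ (λ u v → w * (G′ * (F₀ * ((u + v) * G)) + - 1# * (G * (F₀ * ((Y + b) * G′))))) (*-identityˡ Y) (*-identityˡ a) ⟨
              w * (G′ * (F₀ * ((1# * Y + 1# * a) * G)) + - 1# * (G * (F₀ * ((Y + b) * G′)))) ≡⟨ cong (w *_) (SemiringIdentities.eliminate commutativeSemiring F₀ G G′ Y a b 1# (- 1#)) ⟩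
              w * ((1# * a + - 1# * b) * P + ((1# + - 1#) * Y) * P)                  ≡⟨ cong₂ (λ u v → w * (u * P + (v * Y) * P)) (cong₂ _+_ (*-identityˡ a) (trans (sym (-‿distribˡ-* 1# b)) (cong -_ (*-identityˡ b)))) (-‿inverseʳ 1#) ⟩
              w * ((a + - b) * P + (0# * Y) * P)                                     ≡⟨ cong (λ u → w * ((a + - b) * P + u)) (trans (cong (_* P) (zeroˡ Y)) (zeroˡ P)) ⟩
              w * ((a + - b) * P + 0#)                                               ≡⟨ cong (w *_) (+-identityʳ _) ⟩
              w * ((a + - b) * P)                                                    ≡⟨ *-assoc w _ P ⟨
              (w * (a + - b)) * P                                                    ≡⟨ cong (_* P) (trans (*-comm w _) (proj₂ (inverse (a + - b) a-b≢0))) ⟩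
              1# * P                                                                 ≡⟨ *-identityˡ P ⟩
              P                                                                      ∎
              where
              open ≡-Reasoning
              F₀ = f z
              G = factor (V s) js z
              G′ = factor (V s′) js z
              Y = y j z
              P = (F₀ * G) * G′
          -- With `s` fixed, the products with all other members of `V` are available, one more than
          -- there are remaining coordinates, so the induction applies to f · factor(s) in place of
          -- f. The outer call repeats this with the members after the first.
          step : ∀ s → Ideal (bump t (t ℕ.+ k)) (λ z → f z * factor (V s) js z)
          step s = eliminate js small′ (V ∘ punchIn s) (Fin.punchIn-injective s _ _ ∘ inj) (t ℕ.+ k) (λ z → f z * factor (V s) js z)
            (λ s′ → pair s (punchIn s s′) (Fin.punchInᵢ≢i s s′ ∘ sym))

        -- Expanding only the big factors of equation i gives c = (`mono EB` + L) · G with G the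
        -- product of the small factors. Hence G · `mono EB` = c - G · L, and both terms on the
        -- right are lower: the constant because `mono EB` has positive degree, and L by `expand`.
        equation-in-ideal : ∀ i → Ideal (length smalls) (λ z → 1# * factor i smalls z)
        equation-in-ideal i with expand (h i) bigs
        ... | L , sL , eq = span-resp simplify (span-+ (span-const {P = Lower (length smalls)} (c i) lower0)
              (span-scale (- 1#) (span-* (λ e e′ p q → subst (λ k → Lower k _) (ℕ.+-identityʳ _) (Poly-+-Lower e e′ p q)) (factor-poly i smalls ∈smalls⇒) (span-weaken below⇒lower sL))))
          where
          lower0 : Lower (length smalls) (λ _ → 0)
          lower0 = (λ _ _ → z≤n) , (i₀ , i₀-big , EB>0) , λ _ _ → z≤n
          below⇒lower : ∀ e → StrictlyBelow bigs e → Lower 0 e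
          below⇒lower e (le , j , lt) = (λ j _ → le j) , (j , EB>0⇒Big j (ℕ.≤-<-trans z≤n lt) , lt) , λ j ¬b → subst (e j ≤_) (EB-small j ¬b) (le j)
          simplify : ∀ z → c i + - 1# * (factor i smalls z * L z) ≡ (1# * factor i smalls z) * mono EB z
          simplify z = begin
            c i + - 1# * (G * L z)                                     ≡⟨ cong (_+ - 1# * (G * L z)) c≡ ⟩
            (mono EB z + L z) * G + - 1# * (G * L z)                   ≡⟨ cong (λ u → (mono EB z + u) * G + - 1# * (G * L z)) (*-identityˡ (L z)) ⟨
            (mono EB z + 1# * L z) * G + - 1# * (G * L z)              ≡⟨ SemiringIdentities.residue commutativeSemiring (mono EB z) (L z) G 1# (- 1#) ⟩
            G * mono EB z + (1# + - 1#) * (G * L z)                    ≡⟨ cong (λ u → G * mono EB z + u * (G * L z)) (-‿inverseʳ 1#) ⟩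
            G * mono EB z + 0# * (G * L z)                             ≡⟨ trans (cong (G * mono EB z +_) (zeroˡ _)) (+-identityʳ _) ⟩
            G * mono EB z                                              ≡⟨ cong (_* mono EB z) (*-identityˡ G) ⟨
            (1# * G) * mono EB z                                       ∎
            where
            open ≡-Reasoning
            G = factor i smalls z
            c≡ : c i ≡ (mono EB z + L z) * G
            c≡ = trans (sym (equations i z)) (trans (sym (ΠL-tabulate (λ j → y j z + h i j) id)) (trans (ΠL-partition big? (λ j → y j z + h i j) (allFin D)) (cong (_* G) (eq z))))

      -- The algebraic form of the absence of solutions whose big coordinates, and only these, are
      -- infinite. At such a point equation i would force y_j = -h_ij for some small j; as the h_ij
      -- with the same j are distinct, different i need different j, so at least S coordinates are
      -- small. But then S finite coordinates determine the infinite ones. The two branches reflect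
      -- this: with S small coordinates the linear relation is used, with fewer the elimination
      -- shows that 1 lies in the ideal.
      big-product-reduces : ∃ Big → Span (Lower d) (mono EB)
      big-product-reduces someBig with S ℕ.≤? length smalls
      ... | yes S≤ = span-weaken (Lower-mono (1≤maxBump S)) (linear-case someBig S≤)
      ... | no S≰ = span-weaken (Lower-mono (bump≤maxBump smalls<S)) (span-resp (λ z → *-identityˡ (mono EB z))
          (eliminate someBig smalls ∈smalls⇒ (λ s → inject≤ s smalls<S) (Fin.inject≤-injective _ _ _ _) (length smalls) (λ _ → 1#)
            (λ s → equation-in-ideal someBig (inject≤ s smalls<S))))
        where
        smalls<S : length smalls < S
        smalls<S = ℕ.≰⇒> S≰

    -- The base of the weight is D + 2: lowering an exponent e by one frees (D + 1) B^(e-1), whereas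
    -- the other coordinates together cost at most D B^(e-1).
    B : ℕ
    B = suc (suc D)

    -- The weight of an exponent vector; it grows so fast that lowering one big exponent outweighs the raising of small ones.
    Φ : Exps → ℕ
    Φ e = sumℕ (λ j → B ℕ.^ e j)

    Small : Exps → Set
    Small e = ∀ j → e j ≤ M

    reduce-once : ∀ e → (∃ λ j → M < e j) → Span (λ e′ → Φ e′ < Φ e) (mono e)
    reduce-once e (top , M<top) with gap-exists e g
    ... | i , i≤D , gap = span-resp (λ z → sym (trans (mono-cong (λ j → sym (ℕ.m∸n+n≡m (EB≤e j))) z) (mono-+ (λ j → e j ∸ EB j) EB z)))
        (span-mono-* (λ j → e j ∸ EB j) decreases (big-product-reduces (top , T<top)))
      where
      -- The threshold is the upper end of the empty window, so an exponent that is not big is at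
      -- most `i * g`.
      T = suc i ℕ.* g
      open Threshold T e
      T<top : T < e top
      T<top = ℕ.≤-<-trans (ℕ.*-monoˡ-≤ g (s≤s i≤D)) M<top
      EB≤D : ∀ j → EB j ≤ D
      EB≤D j = ℕ.≤-trans (multiplicity-≤-length bigs j) (subst (length bigs ≤_) (length-tabulate id) (length-filter big? (allFin D)))
      D≤T : D ≤ T
      D≤T = ℕ.≤-trans (ℕ.m≤n+m D (maxBump S)) (ℕ.m≤m+n g (i ℕ.* g))
      EB≤e : ∀ j → EB j ≤ e j
      EB≤e j with big? j
      ... | yes b = ℕ.≤-trans (EB≤D j) (ℕ.≤-trans D≤T (ℕ.<⇒≤ b))
      ... | no ¬b = subst (_≤ e j) (sym (EB-small j ¬b)) z≤n
      small≤ : ∀ j → ¬ Big j → e j ≤ i ℕ.* g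
      small≤ j ¬b with e j ℕ.≤? i ℕ.* g
      ... | yes p = p
      ... | no ¬p = ⊥-elim (gap j (ℕ.≰⇒> ¬p , ℕ.≮⇒≥ ¬b))
      decreases : ∀ e′ → Lower d e′ → Φ (λ j → e j ∸ EB j ℕ.+ e′ j) < Φ e
      decreases e′ (le , (j₀ , b₀ , lt) , q) = total
        where
        x : Exps
        x j = e j ∸ EB j ℕ.+ e′ j
        w = B ℕ.^ (e j₀ ∸ 1)
        e-split : ∀ j → e j ∸ EB j ℕ.+ EB j ≡ e j
        e-split j = ℕ.m∸n+n≡m (EB≤e j)
        e₀≡ : e j₀ ≡ suc (e j₀ ∸ 1)
        e₀≡ = sym (ℕ.m+[n∸m]≡n {1} (ℕ.≤-trans (s≤s z≤n) b₀))
        pointwise : ∀ j → B ℕ.^ x j ℕ.+ δ j₀ j ℕ.* (suc D ℕ.* w) ≤ B ℕ.^ e j ℕ.+ w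
        pointwise j with j₀ Fin.≟ j
        ... | yes refl = begin
          B ℕ.^ x j₀ ℕ.+ δ j₀ j₀ ℕ.* (suc D ℕ.* w)  ≡⟨ cong (λ u → B ℕ.^ x j₀ ℕ.+ u ℕ.* (suc D ℕ.* w)) (δ-refl j₀) ⟩
          B ℕ.^ x j₀ ℕ.+ 1 ℕ.* (suc D ℕ.* w)        ≤⟨ ℕ.+-mono-≤ (ℕ.^-monoʳ-≤ B x≤) (ℕ.≤-reflexive (ℕ.*-identityˡ (suc D ℕ.* w))) ⟩
          B ℕ.* w                                   ≡⟨ cong (B ℕ.^_) e₀≡ ⟨
          B ℕ.^ e j₀                                ≤⟨ ℕ.m≤m+n _ w ⟩
          B ℕ.^ e j₀ ℕ.+ w                          ∎
          where
          open ℕ.≤-Reasoning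
          x≤ : x j₀ ≤ e j₀ ∸ 1
          x≤ = ℕ.s≤s⁻¹ (subst (suc (x j₀) ≤_) (trans (e-split j₀) e₀≡) (ℕ.+-monoʳ-< (e j₀ ∸ EB j₀) lt))
        ... | no ne = subst (λ u → B ℕ.^ x j ℕ.+ u ℕ.* (suc D ℕ.* w) ≤ B ℕ.^ e j ℕ.+ w) (sym (δ-≢ j₀ j ne)) (subst (_≤ B ℕ.^ e j ℕ.+ w) (sym (ℕ.+-identityʳ _)) bound)
          where
          bound : B ℕ.^ x j ≤ B ℕ.^ e j ℕ.+ w
          bound with big? j
          ... | yes b = ℕ.≤-trans (ℕ.^-monoʳ-≤ B (subst (x j ≤_) (e-split j) (ℕ.+-monoʳ-≤ (e j ∸ EB j) (le j b)))) (ℕ.m≤m+n _ w)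
          -- A small exponent starts at or below the empty window and rises by at most `d` ≤ `g`, so
          -- it ends at or below `T`, which is less than the big exponent `e j₀` that has been
          -- lowered.
          ... | no ¬b = ℕ.≤-trans (ℕ.^-monoʳ-≤ B (ℕ.≤-trans x≤T (ℕ.s≤s⁻¹ (subst (T <_) e₀≡ b₀)))) (ℕ.m≤n+m w _)
            where
            x≤T : x j ≤ T
            x≤T = ℕ.≤-trans (ℕ.+-mono-≤ (ℕ.≤-trans (ℕ.m∸n≤m (e j) (EB j)) (small≤ j ¬b)) (ℕ.≤-trans (q j ¬b) (ℕ.m≤m+n d D)))
                    (ℕ.≤-reflexive (ℕ.+-comm (i ℕ.* g) g))
        summed : Φ x ℕ.+ suc D ℕ.* w ≤ Φ e ℕ.+ D ℕ.* w
        summed = begin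
          Φ x ℕ.+ suc D ℕ.* w                                        ≡⟨ cong (Φ x ℕ.+_) (sumℕ-δ j₀ (suc D ℕ.* w)) ⟨
          Φ x ℕ.+ sumℕ (λ j → δ j₀ j ℕ.* (suc D ℕ.* w))              ≡⟨ sumℕ-+ (λ j → B ℕ.^ x j) (λ j → δ j₀ j ℕ.* (suc D ℕ.* w)) ⟨
          sumℕ (λ j → B ℕ.^ x j ℕ.+ δ j₀ j ℕ.* (suc D ℕ.* w))        ≤⟨ sumℕ-mono pointwise ⟩
          sumℕ (λ j → B ℕ.^ e j ℕ.+ w)                               ≡⟨ sumℕ-+ (λ j → B ℕ.^ e j) (λ _ → w) ⟩
          Φ e ℕ.+ sumℕ {D} (λ _ → w)                                 ≡⟨ cong (Φ e ℕ.+_) (sumℕ-const D w) ⟩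
          Φ e ℕ.+ D ℕ.* w                                            ∎
          where open ℕ.≤-Reasoning
        total : Φ x < Φ e
        total = ℕ.+-cancelʳ-< (D ℕ.* w) (Φ x) (Φ e) (ℕ.<-≤-trans (ℕ.+-monoʳ-< (Φ x) (ℕ.+-monoˡ-< (D ℕ.* w) (ℕ.m^n>0 B (e j₀ ∸ 1)))) summed)

    reduce : ∀ e → Span Small (mono e)
    reduce e = <-rec (λ n → ∀ e → Φ e ≡ n → Span Small (mono e)) step (Φ e) e refl
      where
      step : ∀ n → (∀ {k} → k < n → ∀ e → Φ e ≡ k → Span Small (mono e)) → ∀ e → Φ e ≡ n → Span Small (mono e)
      step _ rec e refl with Fin.any? (λ j → M ℕ.<? e j)
      ... | yes big = span-bind (λ e′ lt → rec lt e′ refl) (reduce-once e big)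
      ... | no none-big = span-mono λ j → ℕ.≮⇒≥ λ lt → none-big (j , lt)

    numMonomials : ℕ
    numMonomials = solutionBound D S

    exponents : Fin numMonomials → Exps
    exponents i j = toℕ (finToFun {suc M} {D} i j)

    update : ∀ {n} → Fin n → Carrier → (Fin n → Carrier) → Fin n → Carrier
    update zero c b zero = c + b zero
    update zero c b (suc j) = b (suc j)
    update (suc i) c b zero = b zero
    update (suc i) c b (suc j) = update i c (b ∘ suc) j

    sum-update : ∀ {n} i c (b m : Fin n → Carrier) → sum (λ j → update i c b j * m j) ≡ c * m i + sum (λ j → b j * m j)
    sum-update zero c b m = trans (cong (_+ sum (λ j → b (suc j) * m (suc j))) (distribʳ (m zero) c (b zero))) (+-assoc _ _ _)
    sum-update (suc i) c b m = trans (cong (b zero * m zero +_) (sum-update i c (b ∘ suc) (m ∘ suc)))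
      (SemiringIdentities.+-swap commutativeSemiring (b zero * m zero) (c * m (suc i)) _)

    -- A span may list the same monomial several times; `update` adds such coefficients up, so that
    -- a function is described by `numMonomials` field elements regardless of how it was obtained.
    coefficients : ∀ {f} → Span Small f → ∃ λ (b : Fin numMonomials → Carrier) → ∀ z → f z ≡ sum (λ i → b i * mono (exponents i) z)
    coefficients (none e) = (λ _ → 0#) , λ z → trans (e z) (sym (sum-zero _ (λ i → zeroˡ (mono (exponents i) z))))
    coefficients (term c e small s q) with coefficients s
    ... | b , eq = update idx c b , λ z → trans (q z) (trans (cong₂ _+_ (cong (c *_) (mono-cong (λ j → sym (idx-exponents j)) z)) (eq z))
        (sym (sum-update idx c b (λ i → mono (exponents i) z))))
      where
      idx : Fin numMonomials
      idx = funToFin (λ j → fromℕ< (s≤s (small j)))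
      idx-exponents : ∀ j → exponents idx j ≡ e j
      idx-exponents j = trans (cong toℕ (Fin.finToFun-funToFin (λ j → fromℕ< (s≤s (small j))) j)) (Fin.toℕ-fromℕ< (s≤s (small j)))

    span-reduce : ∀ {f} → Span (λ _ → ⊤) f → Span Small f
    span-reduce = span-bind (λ e _ → reduce e)

    span-eval : ∀ {n} (cs : Vec Carrier n) i → Span (λ _ → ⊤) (λ z → eval cs (y i z))
    span-eval [] i = none (λ _ → refl)
    span-eval (c ∷ cs) i = span-+ (span-const c tt) (span-resp (λ z → cong (_* eval cs (y i z)) (mono-δ i z)) (span-mono-* (δ i) (λ _ _ → tt) (span-eval cs i)))

  1<size : ∀ F → 1 < FiniteField.size F
  1<size F = Fin.injective⇒≤ {f = f} f-injective
    where
    open FiniteField F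
    f : Fin 2 → Fin size
    f zero = index 0#
    f (suc zero) = index 1#
    f-injective : ∀ {i j} → f i ≡ f j → i ≡ j
    f-injective {zero} {zero} e = refl
    f-injective {zero} {suc zero} e = ⊥-elim (0≢1 (index-injective e))
    f-injective {suc zero} {zero} e = ⊥-elim (0≢1 (sym (index-injective e)))
    f-injective {suc zero} {suc zero} e = refl

  eval-difference : (F : FiniteField) → let open FiniteField F in ∀ {n} (cs ds : Vec Carrier n) x →
    eval (Vec.zipWith (λ c d → c + - d) cs ds) x + eval ds x ≡ eval cs x
  eval-difference F [] [] x = FiniteField.+-identityˡ F _
  eval-difference F (c ∷ cs) (d ∷ ds) x = begin
    ((c + - d) + x * E) + (d + x * eval ds x)      ≡⟨ SemiringIdentities.+-interchange commutativeSemiring (c + - d) (x * E) d (x * eval ds x) ⟩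
    ((c + - d) + d) + (x * E + x * eval ds x)      ≡⟨ cong₂ _+_ (x+-y+y c d) (sym (distribˡ x E (eval ds x))) ⟩
    c + x * (E + eval ds x)                        ≡⟨ cong (λ u → c + x * u) (eval-difference F cs ds x) ⟩
    c + x * eval cs x                              ∎
    where
    open FiniteField F
    open ≡-Reasoning
    E = eval (Vec.zipWith (λ c d → c + - d) cs ds) x

  eval-injective : (F : FiniteField) → let open FiniteField F in ∀ {n} (cs ds : Vec Carrier n) (f : Fin n → Carrier) →
    (∀ {i j} → f i ≡ f j → i ≡ j) → (∀ i → eval cs (f i) ≡ eval ds (f i)) → ∀ i → Vec.lookup cs i ≡ Vec.lookup ds i
  eval-injective F cs ds f inj same i = x-y≡0⇒x≡y (trans (sym (Vec.lookup-zipWith (λ c d → c + - d) i cs ds)) (many-roots⇒Zero (Vec.zipWith (λ c d → c + - d) cs ds) f inj root i))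
    where
    open FiniteField F
    root : ∀ i → eval (Vec.zipWith (λ c d → c + - d) cs ds) (f i) ≡ 0#
    root i = +-cancelʳ (eval ds (f i)) (trans (eval-difference F cs ds (f i)) (trans (same i) (sym (+-identityˡ _))))

  -- The polynomials of degree < m in an injective coordinate yield |F|^m functions on the m solutions, all of
  -- them combinations of numMonomials = solutionBound D S monomials; hence |F|^m ≤ |F|^numMonomials.
  number-of-solutions : (F : FiniteField) (m D S : ℕ)
    (y : Fin D → Fin m → FiniteField.Carrier F) (h : Fin S → Fin D → FiniteField.Carrier F) (c : Fin S → FiniteField.Carrier F)
    (equations : ∀ i z → Products.Π F (λ j → FiniteField._+_ F (y j z) (h i j)) ≡ c i)
    (distinct : ∀ j {i i′} → h i j ≡ h i′ j → i ≡ i′)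
    (dependent : ∀ (U : Fin S → Fin D) → (∀ {s s′} → U s ≡ U s′ → s ≡ s′) → ∀ j →
      ∃ λ (l : Fin S → FiniteField.Carrier F) → ∀ z → y j z ≡ FiniteField.sum F (λ t → FiniteField._*_ F (l t) (y (U t) z)))
    (j : Fin D) → (∀ {z z′} → y j z ≡ y j z′ → z ≡ z′) → m ≤ solutionBound D S
  number-of-solutions F m D S y h c equations distinct dependent j y-injective = ℕ.≮⇒≥ λ bound<m →
    ℕ.<-irrefl refl (ℕ.<-≤-trans (ℕ.^-monoʳ-< size (1<size F) bound<m) (Fin.injective⇒≤ {f = G} G-injective))
    where
    open FiniteField F
    open BoundedSystem F (Fin m) D S y h c equations distinct dependent
    open Spans F y
    polynomial : Fin (size ℕ.^ m) → Vec Carrier m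
    polynomial i = Vec.tabulate (λ k → element (finToFun i k))
    reduced : ∀ i → ∃ λ (b : Fin numMonomials → Carrier) → ∀ z → eval (polynomial i) (y j z) ≡ sum (λ k → b k * mono (exponents k) z)
    reduced i = coefficients (span-reduce (span-eval (polynomial i) j))
    G : Fin (size ℕ.^ m) → Fin (size ℕ.^ numMonomials)
    G i = funToFin (λ k → index (proj₁ (reduced i) k))
    G-injective : ∀ {i i′} → G i ≡ G i′ → i ≡ i′
    G-injective {i} {i′} e = finToFun-injective i i′ λ k → element-injective (begin
      element (finToFun i k)         ≡⟨ Vec.lookup∘tabulate (λ k → element (finToFun i k)) k ⟨
      Vec.lookup (polynomial i) k    ≡⟨ eval-injective F (polynomial i) (polynomial i′) (y j) y-injective same k ⟩
      Vec.lookup (polynomial i′) k   ≡⟨ Vec.lookup∘tabulate (λ k → element (finToFun i′ k)) k ⟩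
      element (finToFun i′ k)        ∎)
      where
      open ≡-Reasoning
      same-coefficients : ∀ k → proj₁ (reduced i) k ≡ proj₁ (reduced i′) k
      same-coefficients k = index-injective (trans (sym (Fin.finToFun-funToFin (λ k → index (proj₁ (reduced i) k)) k))
        (trans (cong (λ u → finToFun u k) e) (Fin.finToFun-funToFin (λ k → index (proj₁ (reduced i′) k)) k)))
      same : ∀ z → eval (polynomial i) (y j z) ≡ eval (polynomial i′) (y j z)
      same z = trans (proj₂ (reduced i) z) (trans (sum-cong (λ k → cong (_* mono (exponents k) z) (same-coefficients k))) (sym (proj₂ (reduced i′) z)))

-- Counting tuples of vertex sets; the convexity arguments for both bounds

module TupleCounting where

  open import Defs using (productV)
  open import Data.Bool using (Bool; true; false; _∧_)
  open import Data.Bool.ListAction using (all)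
  open import Data.Bool.Properties using (∧-comm; ∧-assoc)
  open import Data.Nat
  open import Data.Nat.Properties
  open import Data.Nat.DivMod using (_/_; m/n*n≤m; m≡m%n+[m/n]*n; m%n<n; /-monoˡ-≤; m*n/n≡m)
  open import Data.Nat.Tactic.RingSolver using (solve-∀)
  open import Data.Fin using (zero; suc)
  open import Data.List as List using (List; []; _∷_; map; _++_; concatMap; length)
  open import Data.Vec as Vec using (Vec; []; _∷_)
  open import Data.Product using (∃; _×_; _,_)
  open import Data.Sum using (inj₁; inj₂)
  open import Data.Unit using (⊤)
  open import Relation.Nullary using (yes; no)
  open import Relation.Binary.PropositionalEquality hiding ([_])
  open import Function using (_∘_)
  open Primes

  *-^ : ∀ x y n → (x * y) ^ n ≡ x ^ n * y ^ n
  *-^ x y zero = refl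
  *-^ x y (suc n) = trans (cong (x * y *_) (*-^ x y n)) (r x y (x ^ n) (y ^ n))
    where
    r : ∀ a b c d → a * b * (c * d) ≡ a * c * (b * d)
    r = solve-∀

  ^-comm : ∀ x m n → (x ^ m) ^ n ≡ (x ^ n) ^ m
  ^-comm x m n = trans (^-*-assoc x m n) (trans (cong (x ^_) (*-comm m n)) (sym (^-*-assoc x n m)))

  ^-cancelʳ-≤ : ∀ n {x y} → 0 < n → x ^ n ≤ y ^ n → x ≤ y
  ^-cancelʳ-≤ (suc n) _ le = ≮⇒≥ λ lt → <-irrefl refl (<-≤-trans (^-monoˡ-< (suc n) lt) le)

  root-bound : ∀ n {x y C} → 0 < n → x ^ n ≤ C * y ^ n → x ≤ suc C * y
  root-bound n {x} {y} {C} n>0 le = ^-cancelʳ-≤ n n>0 (begin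
    x ^ n               ≤⟨ le ⟩
    C * y ^ n           ≤⟨ *-monoˡ-≤ (y ^ n) (≤-trans (n≤1+n C) (≤-pow n n>0)) ⟩
    suc C ^ n * y ^ n   ≡⟨ *-^ (suc C) y n ⟨
    (suc C * y) ^ n     ∎)
    where
    open ≤-Reasoning
    ≤-pow : ∀ n → 0 < n → suc C ≤ suc C ^ n
    ≤-pow (suc n) _ = m≤m*n (suc C) (suc C ^ n) {{m^n≢0 (suc C) n}}

  sum-^ : ∀ x y n → (x + y) ^ n ≤ 2 ^ n * (x ^ n + y ^ n)
  sum-^ x y n with ≤-total x y
  ... | inj₁ x≤y = begin
    (x + y) ^ n             ≤⟨ ^-monoˡ-≤ n (+-monoˡ-≤ y x≤y) ⟩
    (y + y) ^ n             ≡⟨ cong (λ z → (y + z) ^ n) (+-identityʳ y) ⟨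
    (2 * y) ^ n             ≡⟨ *-^ 2 y n ⟩
    2 ^ n * y ^ n           ≤⟨ *-monoʳ-≤ (2 ^ n) (m≤n+m (y ^ n) (x ^ n)) ⟩
    2 ^ n * (x ^ n + y ^ n) ∎
    where open ≤-Reasoning
  ... | inj₂ y≤x = begin
    (x + y) ^ n             ≤⟨ ^-monoˡ-≤ n (+-monoʳ-≤ x y≤x) ⟩
    (x + x) ^ n             ≡⟨ cong (λ z → (x + z) ^ n) (+-identityʳ x) ⟨
    (2 * x) ^ n             ≡⟨ *-^ 2 x n ⟩
    2 ^ n * x ^ n           ≤⟨ *-monoʳ-≤ (2 ^ n) (m≤m+n (x ^ n) (y ^ n)) ⟩
    2 ^ n * (x ^ n + y ^ n) ∎
    where open ≤-Reasoning

  bin≤^ : ∀ n b → bin n b ≤ n ^ b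
  bin≤^ n zero = ≤-refl
  bin≤^ zero (suc b) = z≤n
  bin≤^ (suc n) (suc b) = begin
    bin n b + bin n (suc b)             ≤⟨ +-mono-≤ (bin≤^ n b) (bin≤^ n (suc b)) ⟩
    suc n * n ^ b                       ≤⟨ *-monoʳ-≤ (suc n) (^-monoˡ-≤ b (n≤1+n n)) ⟩
    suc n * suc n ^ b                   ∎
    where open ≤-Reasoning

  -- The familiar (d / b)^b ≤ C(d, b). In the step both parameters grow, C(d + 1, b + 1) = (d + 1) /
  -- (b + 1) · C(d, b), and (d + 1) / (b + 1) ≤ d / b because b ≤ d.
  ^≤bin : ∀ d b → b ≤ d → d ^ b ≤ b ^ b * bin d b
  ^≤bin d zero _ = ≤-refl
  ^≤bin (suc d) (suc b) (s≤s b≤d) = begin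
    suc d * suc d ^ b                   ≤⟨ *-monoʳ-≤ (suc d) (shifted b b≤d (^≤bin d b b≤d)) ⟩
    suc d * (suc b ^ b * bin d b)       ≡⟨ r₁ (suc d) (suc b ^ b) (bin d b) ⟩
    suc b ^ b * (suc d * bin d b)       ≡⟨ cong (suc b ^ b *_) (bin-absorb d b) ⟨
    suc b ^ b * (suc b * B)             ≡⟨ r₂ (suc b ^ b) (suc b) B ⟩
    suc b * suc b ^ b * B               ∎
    where
    open ≤-Reasoning
    B = bin (suc d) (suc b)
    r₁ : ∀ x y z → x * (y * z) ≡ y * (x * z)
    r₁ = solve-∀
    r₂ : ∀ x y z → x * (y * z) ≡ y * x * z
    r₂ = solve-∀
    shifted : ∀ b → b ≤ d → d ^ b ≤ b ^ b * bin d b → suc d ^ b ≤ suc b ^ b * bin d b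
    shifted zero _ _ = ≤-refl
    shifted b@(suc b′) b≤d IH = *-cancelˡ-≤ (b ^ b) {{m^n≢0 b b}} (begin
      b ^ b * suc d ^ b                 ≡⟨ *-^ b (suc d) b ⟨
      (b * suc d) ^ b                   ≡⟨ cong (_^ b) (*-suc b d) ⟩
      (b + b * d) ^ b                   ≤⟨ ^-monoˡ-≤ b (+-monoˡ-≤ (b * d) b≤d) ⟩
      (suc b * d) ^ b                   ≡⟨ *-^ (suc b) d b ⟩
      suc b ^ b * d ^ b                 ≤⟨ *-monoʳ-≤ (suc b ^ b) IH ⟩
      suc b ^ b * (b ^ b * bin d b)     ≡⟨ r₁ (suc b ^ b) (b ^ b) (bin d b) ⟩
      b ^ b * (suc b ^ b * bin d b)     ∎)

  -- The added 1 covers d < b, where the binomial coefficient vanishes; it is the source of the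
  -- additive term in `power-mean`.
  ^≤suc-bin : ∀ d b → d ^ b ≤ b ^ b * suc (bin d b)
  ^≤suc-bin d b with b ≤? d
  ... | yes b≤d = ≤-trans (^≤bin d b b≤d) (*-monoʳ-≤ (b ^ b) (n≤1+n _))
  ... | no b≰d = ≤-trans (^-monoˡ-≤ b (<⇒≤ (≰⇒> b≰d))) (m≤m*n (b ^ b) (suc (bin d b)))

  ΣL : {A : Set} → (A → ℕ) → List A → ℕ
  ΣL f [] = 0
  ΣL f (x ∷ xs) = f x + ΣL f xs

  private variable
    A B Z : Set

  ΣL-cong : ∀ {f g : A → ℕ} → (∀ x → f x ≡ g x) → ∀ xs → ΣL f xs ≡ ΣL g xs
  ΣL-cong e [] = refl
  ΣL-cong e (x ∷ xs) = cong₂ _+_ (e x) (ΣL-cong e xs)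

  ΣL-mono : ∀ {f g : A → ℕ} → (∀ x → f x ≤ g x) → ∀ xs → ΣL f xs ≤ ΣL g xs
  ΣL-mono e [] = z≤n
  ΣL-mono e (x ∷ xs) = +-mono-≤ (e x) (ΣL-mono e xs)

  ΣL-++ : ∀ (f : A → ℕ) xs ys → ΣL f (xs ++ ys) ≡ ΣL f xs + ΣL f ys
  ΣL-++ f [] ys = refl
  ΣL-++ f (x ∷ xs) ys = trans (cong (f x +_) (ΣL-++ f xs ys)) (sym (+-assoc (f x) _ _))

  ΣL-map : ∀ (f : B → ℕ) (g : A → B) xs → ΣL f (map g xs) ≡ ΣL (f ∘ g) xs
  ΣL-map f g [] = refl
  ΣL-map f g (x ∷ xs) = cong (f (g x) +_) (ΣL-map f g xs)

  ΣL-concatMap : ∀ (f : B → ℕ) (g : A → List B) xs → ΣL f (concatMap g xs) ≡ ΣL (λ x → ΣL f (g x)) xs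
  ΣL-concatMap f g [] = refl
  ΣL-concatMap f g (x ∷ xs) = trans (ΣL-++ f (g x) (concatMap g xs)) (cong (ΣL f (g x) +_) (ΣL-concatMap f g xs))

  ΣL-0 : ∀ (xs : List A) → ΣL (λ _ → 0) xs ≡ 0
  ΣL-0 [] = refl
  ΣL-0 (x ∷ xs) = ΣL-0 xs

  ΣL-+ : ∀ (f g : A → ℕ) xs → ΣL (λ x → f x + g x) xs ≡ ΣL f xs + ΣL g xs
  ΣL-+ f g [] = refl
  ΣL-+ f g (x ∷ xs) = trans (cong (f x + g x +_) (ΣL-+ f g xs)) (r (f x) (g x) _ _)
    where
    r : ∀ a b c d → a + b + (c + d) ≡ a + c + (b + d)
    r = solve-∀

  ΣL-* : ∀ c (f : A → ℕ) xs → ΣL (λ x → c * f x) xs ≡ c * ΣL f xs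
  ΣL-* c f [] = sym (*-zeroʳ c)
  ΣL-* c f (x ∷ xs) = trans (cong (c * f x +_) (ΣL-* c f xs)) (sym (*-distribˡ-+ c (f x) _))

  ΣL-const : ∀ c (xs : List A) → ΣL (λ _ → c) xs ≡ length xs * c
  ΣL-const c [] = refl
  ΣL-const c (x ∷ xs) = cong (c +_) (ΣL-const c xs)

  ΣL-swap : ∀ (f : A → B → ℕ) xs ys → ΣL (λ x → ΣL (f x) ys) xs ≡ ΣL (λ y → ΣL (λ x → f x y) xs) ys
  ΣL-swap f [] ys = sym (ΣL-0 ys)
  ΣL-swap f (x ∷ xs) ys = trans (cong (ΣL (f x) ys +_) (ΣL-swap f xs ys)) (sym (ΣL-+ (f x) (λ y → ΣL (λ x → f x y) xs) ys))

  pairs : List A → List B → List (A × B)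
  pairs xs ys = concatMap (λ x → map (x ,_) ys) xs

  ΣL-pairs : ∀ (f : A × B → ℕ) xs ys → ΣL f (pairs xs ys) ≡ ΣL (λ x → ΣL (λ y → f (x , y)) ys) xs
  ΣL-pairs f xs ys = trans (ΣL-concatMap f (λ x → map (x ,_) ys) xs) (ΣL-cong (λ x → ΣL-map f (x ,_) ys) xs)

  length-ΣL : ∀ (xs : List A) → length xs ≡ ΣL (λ _ → 1) xs
  length-ΣL [] = refl
  length-ΣL (x ∷ xs) = cong suc (length-ΣL xs)

  length-pairs : ∀ (xs : List A) (ys : List B) → length (pairs xs ys) ≡ length xs * length ys
  length-pairs xs ys = trans (length-ΣL (pairs xs ys)) (trans (ΣL-pairs (λ _ → 1) xs ys)
    (trans (ΣL-cong (λ _ → sym (length-ΣL ys)) xs) (ΣL-const (length ys) xs)))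

  ⟦_⟧ : Bool → ℕ
  ⟦ true ⟧ = 1
  ⟦ false ⟧ = 0

  countᵇ : (A → Bool) → List A → ℕ
  countᵇ p = ΣL (⟦_⟧ ∘ p)

  combos : ℕ → List A → List (List A)
  combos zero xs = [] ∷ []
  combos (suc b) [] = []
  combos (suc b) (x ∷ xs) = map (x ∷_) (combos b xs) ++ combos (suc b) xs

  count-combos : ∀ (p : A → Bool) b xs → countᵇ (all p) (combos b xs) ≡ bin (countᵇ p xs) b
  count-combos p zero xs = refl
  count-combos p (suc b) [] = refl
  count-combos p (suc b) (x ∷ xs) = trans (ΣL-++ _ (map (x ∷_) (combos b xs)) (combos (suc b) xs))
    (trans (cong₂ _+_ (ΣL-map _ (x ∷_) (combos b xs)) (count-combos p (suc b) xs)) (head (p x)))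
    where
    head : ∀ c → ΣL (λ ys → ⟦ c ∧ all p ys ⟧) (combos b xs) + bin (countᵇ p xs) (suc b) ≡ bin (⟦ c ⟧ + countᵇ p xs) (suc b)
    head true = cong (_+ bin (countᵇ p xs) (suc b)) (count-combos p b xs)
    head false = cong (_+ bin (countᵇ p xs) (suc b)) (ΣL-0 (combos b xs))

  all-true : ∀ (xs : List A) → all (λ _ → true) xs ≡ true
  all-true [] = refl
  all-true (x ∷ xs) = all-true xs

  length-combos : ∀ b (xs : List A) → length (combos b xs) ≡ bin (length xs) b
  length-combos b xs = trans (length-ΣL (combos b xs)) (trans (ΣL-cong (λ ys → sym (cong ⟦_⟧ (all-true ys))) (combos b xs))
    (trans (count-combos (λ _ → true) b xs) (cong (λ k → bin k b) (sym (length-ΣL xs)))))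

  -- The lists of a tuple may overlap. No disjointness is imposed, because in a uniform hypergraph
  -- the condition that all transversals are edges enforces it.
  tuples : ∀ {r} → Vec ℕ r → List A → List (Vec (List A) r)
  tuples [] V = [] ∷ []
  tuples (b ∷ bs) V = concatMap (λ x → map (x ∷_) (tuples bs V)) (combos b V)

  length-combos≤ : ∀ b (V : List A) n → length V ≤ n → length (combos b V) ≤ n ^ b
  length-combos≤ b V n le = subst (_≤ n ^ b) (sym (length-combos b V)) (≤-trans (bin≤^ (length V) b) (^-monoˡ-≤ b le))

  ΣL-tuples : ∀ {r} (f : Vec (List A) (suc r) → ℕ) b (bs : Vec ℕ r) V →
    ΣL f (tuples (b ∷ bs) V) ≡ ΣL (λ x → ΣL (λ t → f (x ∷ t)) (tuples bs V)) (combos b V)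
  ΣL-tuples f b bs V = trans (ΣL-concatMap f (λ x → map (x ∷_) (tuples bs V)) (combos b V)) (ΣL-cong (λ x → ΣL-map f (x ∷_) (tuples bs V)) (combos b V))

  length-tuples≤ : ∀ {r} (bs : Vec ℕ r) (V : List A) n → length V ≤ n → length (tuples bs V) ≤ n ^ Vec.sum bs
  length-tuples≤ [] V n le = ≤-refl
  length-tuples≤ (b ∷ bs) V n le = begin
    length (tuples (b ∷ bs) V)                         ≡⟨ length-ΣL (tuples (b ∷ bs) V) ⟩
    ΣL (λ _ → 1) (tuples (b ∷ bs) V)                   ≡⟨ ΣL-tuples (λ _ → 1) b bs V ⟩
    ΣL (λ x → ΣL (λ t → 1) (tuples bs V)) (combos b V) ≡⟨ ΣL-const _ (combos b V) ⟩
    length (combos b V) * ΣL (λ t → 1) (tuples bs V)   ≡⟨ cong (length (combos b V) *_) (length-ΣL (tuples bs V)) ⟨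
    length (combos b V) * length (tuples bs V)         ≤⟨ *-mono-≤ (length-combos≤ b V n le) (length-tuples≤ bs V n le) ⟩
    n ^ b * n ^ Vec.sum bs                             ≡⟨ ^-distribˡ-+-* n b (Vec.sum bs) ⟨
    n ^ (b + Vec.sum bs)                               ∎
    where open ≤-Reasoning

  -- `R` holds on all transversals. The head list is turned into a condition on the tail, which
  -- matches the way `absorb` moves a part into the parameter.
  allR : ∀ {r} → (Vec A r → Bool) → Vec (List A) r → Bool
  allR R [] = R []
  allR R (x ∷ t) = allR (λ w → all (λ v → R (v ∷ w)) x) t

  allR-cong : ∀ {r} {R R′ : Vec A r → Bool} → (∀ w → R w ≡ R′ w) → ∀ t → allR R t ≡ allR R′ t
  allR-cong e [] = e []
  allR-cong e (x ∷ t) = allR-cong (λ w → all-cong (λ v → e (v ∷ w)) x) t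
    where
    all-cong : ∀ {p q : A → Bool} → (∀ v → p v ≡ q v) → ∀ xs → all p xs ≡ all q xs
    all-cong e [] = refl
    all-cong e (x ∷ xs) = cong₂ _∧_ (e x) (all-cong e xs)

  allR-true : ∀ {r} (t : Vec (List A) r) → allR (λ _ → true) t ≡ true
  allR-true [] = refl
  allR-true (x ∷ t) = trans (allR-cong (λ w → all-true x) t) (allR-true t)

  all-∧ : ∀ (p q : A → Bool) xs → all (λ v → p v ∧ q v) xs ≡ all p xs ∧ all q xs
  all-∧ p q [] = refl
  all-∧ p q (x ∷ xs) = trans (cong ((p x ∧ q x) ∧_) (all-∧ p q xs)) (r (p x) (q x) (all p xs) (all q xs))
    where
    r : ∀ a b c d → (a ∧ b) ∧ (c ∧ d) ≡ (a ∧ c) ∧ (b ∧ d)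
    r true b c d = trans (sym (∧-assoc b c d)) (trans (cong (_∧ d) (∧-comm b c)) (∧-assoc c b d))
    r false b c d = refl

  allR-∧ : ∀ {r} (R R′ : Vec A r → Bool) t → allR (λ w → R w ∧ R′ w) t ≡ allR R t ∧ allR R′ t
  allR-∧ R R′ [] = refl
  allR-∧ R R′ (x ∷ t) = trans (allR-cong (λ w → all-∧ _ _ x) t) (allR-∧ _ _ t)

  allR-head : ∀ {r} (R : Vec A (suc r) → Bool) x t → allR R (x ∷ t) ≡ all (λ v → allR (λ w → R (v ∷ w)) t) x
  allR-head R [] t = allR-true t
  allR-head R (v ∷ x) t = trans (allR-∧ (λ w → R (v ∷ w)) (λ w → all (λ v → R (v ∷ w)) x) t) (cong (allR (λ w → R (v ∷ w)) t ∧_) (allR-head R x t))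

  module Counting (V : List A) where

    -- A member of `Zs` records the parts whose sizes are currently kept fixed, and `R z` is the
    -- relation that they leave on the other parts.
    total : ∀ {r} → List Z → (Z → Vec A r → Bool) → Vec ℕ r → ℕ
    total Zs R bs = ΣL (λ z → countᵇ (allR (R z)) (tuples bs V)) Zs

    degree : ∀ {r} → (Z → Vec A (suc r) → Bool) → Z × Vec (List A) r → ℕ
    degree R (z , t) = countᵇ (λ v → allR (λ w → R z (v ∷ w)) t) V

    absorb : ∀ {r} → (Z → Vec A (suc r) → Bool) → Z × List A → Vec A r → Bool
    absorb R (z , x) w = all (λ v → R z (v ∷ w)) x

    total-tail : ∀ {r} (Zs : List Z) (R : Z → Vec A (suc r) → Bool) b bs →
      total Zs R (b ∷ bs) ≡ total (pairs Zs (combos b V)) (absorb R) bs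
    total-tail Zs R b bs = trans (ΣL-cong (λ z → ΣL-tuples _ b bs V) Zs) (sym (ΣL-pairs _ Zs (combos b V)))

    -- Summing over the first part last: for given other parts the first one is any b-subset of
    -- their common neighbourhood. The size of a single part thereby appears only as the lower index
    -- of a binomial coefficient, and comparing two sizes becomes an inequality between two such
    -- sums.
    total-head : ∀ {r} (Zs : List Z) (R : Z → Vec A (suc r) → Bool) b bs →
      total Zs R (b ∷ bs) ≡ ΣL (λ zt → bin (degree R zt) b) (pairs Zs (tuples bs V))
    total-head Zs R b bs = trans (ΣL-cong inner Zs) (sym (ΣL-pairs _ Zs (tuples bs V)))
      where
      inner : ∀ z → countᵇ (allR (R z)) (tuples (b ∷ bs) V) ≡ ΣL (λ t → bin (degree R (z , t)) b) (tuples bs V)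
      inner z = trans (ΣL-tuples _ b bs V) (trans (ΣL-swap _ (combos b V) (tuples bs V))
        (ΣL-cong (λ t → trans (ΣL-cong (λ x → cong ⟦_⟧ (allR-head (R z) x t)) (combos b V)) (count-combos _ b V)) (tuples bs V)))

  -- An integer approximation of (P / N)^(1/b).
  approximate-root : ∀ N P b → 0 < N → 0 < b → ∃ λ τ → 0 < τ × P ≤ N * τ ^ b × N * τ ^ b ≤ 2 ^ b * (N + P)
  approximate-root N P b N>0 b>0 = search (suc P) (s≤s z≤n) enough
    where
    open ≤-Reasoning
    enough : P ≤ N * suc P ^ b
    enough = begin
      P                 ≤⟨ n≤1+n P ⟩
      suc P             ≤⟨ grow b b>0 ⟩
      suc P ^ b         ≤⟨ m≤n*m (suc P ^ b) N {{>-nonZero N>0}} ⟩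
      N * suc P ^ b     ∎
      where
      grow : ∀ b → 0 < b → suc P ≤ suc P ^ b
      grow (suc b) _ = m≤m*n (suc P) (suc P ^ b) {{m^n≢0 (suc P) b}}
    search : ∀ τ → 0 < τ → P ≤ N * τ ^ b → ∃ λ τ → 0 < τ × P ≤ N * τ ^ b × N * τ ^ b ≤ 2 ^ b * (N + P)
    search 1 _ P≤ = 1 , s≤s z≤n , P≤ , (begin
      N * 1 ^ b         ≡⟨ trans (cong (N *_) (^-zeroˡ b)) (*-identityʳ N) ⟩
      N                 ≤⟨ m≤m+n N P ⟩
      N + P             ≤⟨ m≤n*m (N + P) (2 ^ b) {{m^n≢0 2 b}} ⟩
      2 ^ b * (N + P)   ∎)
    search (suc (suc t)) _ P≤ with P ≤? N * suc t ^ b | search (suc t) (s≤s z≤n)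
    ... | yes P≤′ | found = found P≤′
    ... | no P≰ | _ = suc τ , s≤s z≤n , P≤ , (begin
      N * suc τ ^ b         ≤⟨ *-monoʳ-≤ N (^-monoˡ-≤ b (+-monoˡ-≤ τ (s≤s z≤n))) ⟩
      N * (τ + τ) ^ b       ≡⟨ cong (λ z → N * (τ + z) ^ b) (+-identityʳ τ) ⟨
      N * (2 * τ) ^ b       ≡⟨ cong (N *_) (*-^ 2 τ b) ⟩
      N * (2 ^ b * τ ^ b)   ≡⟨ r N (2 ^ b) (τ ^ b) ⟩
      2 ^ b * (N * τ ^ b)   ≤⟨ *-monoʳ-≤ (2 ^ b) (<⇒≤ (≰⇒> P≰)) ⟩
      2 ^ b * P             ≤⟨ *-monoʳ-≤ (2 ^ b) (m≤n+m P N) ⟩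
      2 ^ b * (N + P)       ∎)
      where
      τ = suc t
      r : ∀ a b c → a * (b * c) ≡ b * (a * c)
      r = solve-∀

  powerMeanConst : ℕ → ℕ → ℕ
  powerMeanConst b b′ = (2 * b′ ^ b′) ^ b′ * (2 ^ b′) ^ b

  -- Up to constants, (P / N)^(1/b) ≤ ((N + P′) / N)^(1/b′) for the sums P and P′ of C(d, b) and
  -- C(d, b′). Instead of Hölder's inequality a threshold τ near (P′ / N)^(1/b′) is used: a degree
  -- up to τ contributes at most τ^b, and for a larger degree τ^(b′-b) d^b ≤ d^b′. The summand N
  -- pays for degrees below b′, which P′ does not see.
  power-mean : ∀ (W : List A) (d : A → ℕ) N b b′ → 0 < N → length W ≤ N → 0 < b′ → b ≤ b′ →
    ΣL (λ z → bin (d z) b) W ^ b′ ≤ powerMeanConst b b′ * (N ^ (b′ ∸ b) * (N + ΣL (λ z → bin (d z) b′) W) ^ b)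
  power-mean W d N b b′ N>0 W≤N b′>0 b≤b′ with approximate-root N (ΣL (λ z → bin (d z) b′) W) b′ N>0 b′>0
  ... | τ , τ>0 , P′≤ , ≤P′ = begin
    P ^ b′                                                  ≤⟨ ^-monoˡ-≤ b′ P≤ ⟩
    (2 * K * (N * τ ^ b)) ^ b′                              ≡⟨ *-^ (2 * K) (N * τ ^ b) b′ ⟩
    (2 * K) ^ b′ * (N * τ ^ b) ^ b′                         ≡⟨ cong ((2 * K) ^ b′ *_) (trans (*-^ N (τ ^ b) b′) (cong₂ _*_ N^≡ (^-comm τ b b′))) ⟩
    (2 * K) ^ b′ * (N ^ (b′ ∸ b) * N ^ b * (τ ^ b′) ^ b)    ≡⟨ cong ((2 * K) ^ b′ *_) (trans (*-assoc (N ^ (b′ ∸ b)) (N ^ b) _) (cong (N ^ (b′ ∸ b) *_) (sym (*-^ N (τ ^ b′) b)))) ⟩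
    (2 * K) ^ b′ * (N ^ (b′ ∸ b) * (N * τ ^ b′) ^ b)        ≤⟨ *-monoʳ-≤ ((2 * K) ^ b′) (*-monoʳ-≤ (N ^ (b′ ∸ b)) (^-monoˡ-≤ b ≤P′)) ⟩
    (2 * K) ^ b′ * (N ^ (b′ ∸ b) * (2 ^ b′ * (N + P′)) ^ b) ≡⟨ cong (λ z → (2 * K) ^ b′ * (N ^ (b′ ∸ b) * z)) (*-^ (2 ^ b′) (N + P′) b) ⟩
    (2 * K) ^ b′ * (N ^ (b′ ∸ b) * ((2 ^ b′) ^ b * (N + P′) ^ b)) ≡⟨ r₁ ((2 * K) ^ b′) (N ^ (b′ ∸ b)) ((2 ^ b′) ^ b) ((N + P′) ^ b) ⟩
    powerMeanConst b b′ * (N ^ (b′ ∸ b) * (N + P′) ^ b)     ∎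
    where
    open ≤-Reasoning
    P = ΣL (λ z → bin (d z) b) W
    P′ = ΣL (λ z → bin (d z) b′) W
    K = b′ ^ b′
    c = b′ ∸ b
    instance
      τ≢0 : NonZero τ
      τ≢0 = >-nonZero τ>0
      b′≢0 : NonZero b′
      b′≢0 = >-nonZero b′>0
      K≢0 : NonZero K
      K≢0 = m^n≢0 b′ b′
    r₁ : ∀ a b c d → a * (b * (c * d)) ≡ a * c * (b * d)
    r₁ = solve-∀
    N^≡ : N ^ b′ ≡ N ^ (b′ ∸ b) * N ^ b
    N^≡ = trans (cong (N ^_) (sym (m∸n+n≡m b≤b′))) (^-distribˡ-+-* N (b′ ∸ b) b)
    τ^≡ : τ ^ b * τ ^ c ≡ τ ^ b′
    τ^≡ = trans (sym (^-distribˡ-+-* τ b c)) (cong (τ ^_) (m+[n∸m]≡n b≤b′))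
    pointwise : ∀ z → τ ^ c * bin (d z) b ≤ K * (τ ^ b′ + bin (d z) b′)
    pointwise z with d z ≤? τ
    ... | yes d≤τ = begin
      τ ^ c * bin (d z) b                 ≤⟨ *-monoʳ-≤ (τ ^ c) (≤-trans (bin≤^ (d z) b) (^-monoˡ-≤ b d≤τ)) ⟩
      τ ^ c * τ ^ b                       ≡⟨ trans (*-comm (τ ^ c) (τ ^ b)) τ^≡ ⟩
      τ ^ b′                              ≤⟨ m≤m+n _ (bin (d z) b′) ⟩
      τ ^ b′ + bin (d z) b′               ≤⟨ m≤n*m _ K ⟩
      K * (τ ^ b′ + bin (d z) b′)         ∎
    ... | no d≰τ = begin
      τ ^ c * bin (d z) b                 ≤⟨ *-mono-≤ (^-monoˡ-≤ c (<⇒≤ (≰⇒> d≰τ))) (bin≤^ (d z) b) ⟩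
      d z ^ c * d z ^ b                   ≡⟨ ^-distribˡ-+-* (d z) c b ⟨
      d z ^ (c + b)                       ≡⟨ cong (d z ^_) (m∸n+n≡m b≤b′) ⟩
      d z ^ b′                            ≤⟨ ^≤suc-bin (d z) b′ ⟩
      K * (1 + bin (d z) b′)              ≤⟨ *-monoʳ-≤ K (+-monoˡ-≤ (bin (d z) b′) (m^n>0 τ b′)) ⟩
      K * (τ ^ b′ + bin (d z) b′)         ∎
    P≤ : P ≤ 2 * K * (N * τ ^ b)
    P≤ = *-cancelˡ-≤ (τ ^ c) {{m^n≢0 τ c}} (begin
      τ ^ c * P                                           ≡⟨ ΣL-* (τ ^ c) (λ z → bin (d z) b) W ⟨
      ΣL (λ z → τ ^ c * bin (d z) b) W                    ≤⟨ ΣL-mono pointwise W ⟩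
      ΣL (λ z → K * (τ ^ b′ + bin (d z) b′)) W            ≡⟨ ΣL-* K (λ z → τ ^ b′ + bin (d z) b′) W ⟩
      K * ΣL (λ z → τ ^ b′ + bin (d z) b′) W              ≡⟨ cong (K *_) (trans (ΣL-+ (λ _ → τ ^ b′) (λ z → bin (d z) b′) W) (cong (_+ P′) (ΣL-const (τ ^ b′) W))) ⟩
      K * (length W * τ ^ b′ + P′)                        ≤⟨ *-monoʳ-≤ K (+-mono-≤ (*-monoˡ-≤ (τ ^ b′) W≤N) P′≤) ⟩
      K * (N * τ ^ b′ + N * τ ^ b′)                       ≡⟨ cong (λ z → K * (N * z + N * z)) τ^≡ ⟨
      K * (N * (τ ^ b * τ ^ c) + N * (τ ^ b * τ ^ c))     ≡⟨ r₂ K N (τ ^ b) (τ ^ c) ⟩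
      τ ^ c * (2 * K * (N * τ ^ b))                       ∎)
      where
      r₂ : ∀ k n t u → k * (n * (t * u) + n * (t * u)) ≡ u * (2 * k * (n * t))
      r₂ = solve-∀

  upperStepConst : ℕ → ℕ → ℕ → ℕ → ℕ
  upperStepConst S b b′ C = suc (powerMeanConst b b′ ^ S * (2 ^ S * (1 + C)) ^ b)

  -- The invariant says P = O(n^(m + b - w b / S)), with both sides raised to the power S. It passes
  -- from b′ to b by `power-mean`, after raising everything to the power b′ and extracting the root
  -- at the end. The condition `w≤S` says that the target for b′ is at least n^m, so the additive
  -- term N of the power mean stays within it.
  upper-step : ∀ (W : List A) (d : A → ℕ) S n m w C b b′ → 0 < n → length W ≤ n ^ m → 0 < b′ → b ≤ b′ → w ≤ S →
    ΣL (λ z → bin (d z) b′) W ^ S * n ^ (w * b′) ≤ C * n ^ (S * (m + b′)) →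
    ΣL (λ z → bin (d z) b) W ^ S * n ^ (w * b) ≤ upperStepConst S b b′ C * n ^ (S * (m + b))
  upper-step W d S n m w C b b′ n>0 W≤ b′>0 b≤b′ w≤S hyp = root-bound b′ {y = n ^ (S * (m + b))} {C = powerMeanConst b b′ ^ S * (2 ^ S * (1 + C)) ^ b} b′>0 (begin
    (P ^ S * n ^ (w * b)) ^ b′                              ≡⟨ *-^ (P ^ S) (n ^ (w * b)) b′ ⟩
    (P ^ S) ^ b′ * (n ^ (w * b)) ^ b′                       ≡⟨ cong₂ _*_ (^-comm P S b′) (trans (^-*-assoc n (w * b) b′) (trans (cong (n ^_) (e₁ w b b′)) (sym (^-*-assoc n (w * b′) b)))) ⟩
    (P ^ b′) ^ S * (n ^ (w * b′)) ^ b                       ≤⟨ *-monoˡ-≤ ((n ^ (w * b′)) ^ b) (^-monoˡ-≤ S (power-mean W d N b b′ N>0 W≤ b′>0 b≤b′)) ⟩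
    (Kp * (N ^ c * (N + P′) ^ b)) ^ S * (n ^ (w * b′)) ^ b  ≡⟨ cong (_* (n ^ (w * b′)) ^ b) (trans (*-^ Kp _ S) (cong (Kp ^ S *_) (trans (*-^ (N ^ c) _ S) (cong ((N ^ c) ^ S *_) (^-comm (N + P′) b S))))) ⟩
    Kp ^ S * ((N ^ c) ^ S * ((N + P′) ^ S) ^ b) * (n ^ (w * b′)) ^ b ≡⟨ r₁ (Kp ^ S) ((N ^ c) ^ S) (((N + P′) ^ S) ^ b) ((n ^ (w * b′)) ^ b) ⟩
    Kp ^ S * ((N ^ c) ^ S * (((N + P′) ^ S) ^ b * (n ^ (w * b′)) ^ b)) ≡⟨ cong (λ z → Kp ^ S * ((N ^ c) ^ S * z)) (*-^ ((N + P′) ^ S) (n ^ (w * b′)) b) ⟨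
    Kp ^ S * ((N ^ c) ^ S * ((N + P′) ^ S * n ^ (w * b′)) ^ b) ≤⟨ *-monoʳ-≤ (Kp ^ S) (*-monoʳ-≤ ((N ^ c) ^ S) (^-monoˡ-≤ b inner)) ⟩
    Kp ^ S * ((N ^ c) ^ S * (2 ^ S * (1 + C) * n ^ (S * (m + b′))) ^ b) ≡⟨ cong (λ z → Kp ^ S * ((N ^ c) ^ S * z)) (*-^ (2 ^ S * (1 + C)) (n ^ (S * (m + b′))) b) ⟩
    Kp ^ S * ((N ^ c) ^ S * ((2 ^ S * (1 + C)) ^ b * (n ^ (S * (m + b′))) ^ b)) ≡⟨ r₂ (Kp ^ S) ((N ^ c) ^ S) ((2 ^ S * (1 + C)) ^ b) ((n ^ (S * (m + b′))) ^ b) ⟩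
    Kp ^ S * (2 ^ S * (1 + C)) ^ b * ((N ^ c) ^ S * (n ^ (S * (m + b′))) ^ b) ≡⟨ cong (Kp ^ S * (2 ^ S * (1 + C)) ^ b *_) powers ⟩
    Kp ^ S * (2 ^ S * (1 + C)) ^ b * (n ^ (S * (m + b))) ^ b′ ∎)
    where
    open ≤-Reasoning
    N = n ^ m
    P = ΣL (λ z → bin (d z) b) W
    P′ = ΣL (λ z → bin (d z) b′) W
    Kp = powerMeanConst b b′
    c = b′ ∸ b
    instance
      n≢0 : NonZero n
      n≢0 = >-nonZero n>0
    N>0 : 0 < N
    N>0 = m^n>0 n m
    e₁ : ∀ w b c → w * b * c ≡ w * c * b
    e₁ = solve-∀
    r₁ : ∀ a b c d → a * (b * c) * d ≡ a * (b * (c * d))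
    r₁ = solve-∀
    r₂ : ∀ a b c d → a * (b * (c * d)) ≡ a * c * (b * d)
    r₂ = solve-∀
    powers : (N ^ c) ^ S * (n ^ (S * (m + b′))) ^ b ≡ (n ^ (S * (m + b))) ^ b′
    powers = trans (cong₂ _*_ (trans (cong (_^ S) (^-*-assoc n m c)) (^-*-assoc n (m * c) S)) (^-*-assoc n (S * (m + b′)) b))
      (trans (sym (^-distribˡ-+-* n (m * c * S) (S * (m + b′) * b)))
        (trans (cong (n ^_) (trans (cong (λ z → m * c * S + S * (m + z) * b) (sym b′≡)) (trans (e₂ m c S b) (cong (λ z → S * (m + b) * z) b′≡)))) (sym (^-*-assoc n (S * (m + b)) b′))))
      where
      b′≡ : c + b ≡ b′
      b′≡ = m∸n+n≡m b≤b′
      e₂ : ∀ m c S b → m * c * S + S * (m + (c + b)) * b ≡ S * (m + b) * (c + b)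
      e₂ = solve-∀
    inner : (N + P′) ^ S * n ^ (w * b′) ≤ 2 ^ S * (1 + C) * n ^ (S * (m + b′))
    inner = begin
      (N + P′) ^ S * n ^ (w * b′)                             ≤⟨ *-monoˡ-≤ (n ^ (w * b′)) (sum-^ N P′ S) ⟩
      2 ^ S * (N ^ S + P′ ^ S) * n ^ (w * b′)                 ≡⟨ r₃ (2 ^ S) (N ^ S) (P′ ^ S) (n ^ (w * b′)) ⟩
      2 ^ S * (N ^ S * n ^ (w * b′) + P′ ^ S * n ^ (w * b′))  ≤⟨ *-monoʳ-≤ (2 ^ S) (+-mono-≤ first hyp) ⟩
      2 ^ S * (n ^ (S * (m + b′)) + C * n ^ (S * (m + b′)))   ≡⟨ *-assoc (2 ^ S) (1 + C) (n ^ (S * (m + b′))) ⟨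
      2 ^ S * (1 + C) * n ^ (S * (m + b′))                    ∎
      where
      r₃ : ∀ a b c d → a * (b + c) * d ≡ a * (b * d + c * d)
      r₃ = solve-∀
      first : N ^ S * n ^ (w * b′) ≤ n ^ (S * (m + b′))
      first = begin
        N ^ S * n ^ (w * b′)            ≤⟨ *-monoʳ-≤ (N ^ S) (^-monoʳ-≤ n (*-monoˡ-≤ b′ w≤S)) ⟩
        N ^ S * n ^ (S * b′)            ≡⟨ cong (_* n ^ (S * b′)) (trans (^-*-assoc n m S) (cong (n ^_) (*-comm m S))) ⟩
        n ^ (S * m) * n ^ (S * b′)      ≡⟨ ^-distribˡ-+-* n (S * m) (S * b′) ⟨
        n ^ (S * m + S * b′)            ≡⟨ cong (n ^_) (*-distribˡ-+ S m b′) ⟨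
        n ^ (S * (m + b′))              ∎

  upperConst : ∀ {r} → ℕ → Vec ℕ r → Vec ℕ r → ℕ → ℕ
  upperConst S [] [] C = C
  upperConst S (a ∷ as) (s ∷ ss) C = upperStepConst S a s (upperConst S as ss C)

  -- `w` is the product of the sizes of the parts fixed so far. The inequality `w * productV as ≤ S`
  -- is the condition `w≤S` of `upper-step` at the moment when the current part is changed and all
  -- later ones have already been lowered.
  Admissible : ∀ {r} → ℕ → ℕ → Vec ℕ r → Vec ℕ r → Set
  Admissible S w [] [] = ⊤
  Admissible S w (a ∷ as) (s ∷ ss) = 0 < s × a ≤ s × w * productV as ≤ S × Admissible S (w * s) as ss

  -- The last part is lowered first: the recursive call keeps the current part at size s inside
  -- `Zs`, and afterwards the same count, rearranged by `total-head`, is compared with the one for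
  -- size a.
  upper-descent : ∀ {r} (as ss : Vec ℕ r) S w C → Admissible S w as ss →
    ∀ (V : List A) n m (Zs : List Z) R → 0 < n → length V ≤ n → length Zs ≤ n ^ m → let open Counting V in
    total Zs R ss ^ S * n ^ (w * productV ss) ≤ C * n ^ (S * (m + Vec.sum ss)) →
    total Zs R as ^ S * n ^ (w * productV as) ≤ upperConst S as ss C * n ^ (S * (m + Vec.sum as))
  upper-descent [] [] S w C _ V n m Zs R n>0 V≤ Z≤ hyp = hyp
  upper-descent (a ∷ as) (s ∷ ss) S w C (s>0 , a≤s , w≤S , adm) V n m Zs R n>0 V≤ Z≤ hyp = subst₂ _≤_
    (cong₂ (λ u v → u ^ S * n ^ v) (sym (total-head Zs R a as)) (e₁ w (productV as) a))
    (cong (λ u → upperConst S (a ∷ as) (s ∷ ss) C * n ^ (S * u)) (e₂ m (Vec.sum as) a))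
    (upper-step (pairs Zs (tuples as V)) (degree R) S n (m + Vec.sum as) (w * productV as) (upperConst S as ss C) a s n>0 W≤ s>0 a≤s w≤S
      (subst₂ _≤_ (cong₂ (λ u v → u ^ S * n ^ v) (trans (sym (total-tail Zs R s as)) (total-head Zs R s as)) (e₁′ w s (productV as)))
        (cong (λ u → upperConst S as ss C * n ^ (S * u)) (e₂′ m s (Vec.sum as)))
        (upper-descent as ss S (w * s) C adm V n (m + s) (pairs Zs (combos s V)) (absorb R) n>0 V≤ Zs′≤
          (subst₂ _≤_ (cong₂ (λ u v → u ^ S * n ^ v) (total-tail Zs R s ss) (sym (*-assoc w s (productV ss))))
            (cong (λ u → C * n ^ (S * u)) (sym (+-assoc m s (Vec.sum ss)))) hyp))))
    where
    open Counting V
    e₁ : ∀ w p a → w * p * a ≡ w * (a * p)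
    e₁ = solve-∀
    e₂ : ∀ m p a → m + p + a ≡ m + (a + p)
    e₂ = solve-∀
    e₁′ : ∀ w s p → w * s * p ≡ w * p * s
    e₁′ = solve-∀
    e₂′ : ∀ m s p → m + s + p ≡ m + p + s
    e₂′ = solve-∀
    W≤ : length (pairs Zs (tuples as V)) ≤ n ^ (m + Vec.sum as)
    W≤ = subst₂ _≤_ (sym (length-pairs Zs (tuples as V))) (sym (^-distribˡ-+-* n m (Vec.sum as))) (*-mono-≤ Z≤ (length-tuples≤ as V n V≤))
    Zs′≤ : length (pairs Zs (combos s V)) ≤ n ^ (m + s)
    Zs′≤ = subst₂ _≤_ (sym (length-pairs Zs (combos s V))) (sym (^-distribˡ-+-* n m s)) (*-mono-≤ Z≤ (length-combos≤ s V n V≤))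

  lowerStepConst : ℕ → ℕ → ℕ
  lowerStepConst b κ = b ^ b * ((4 * κ) ^ (b ∸ 1) * (2 * κ))

  -- The threshold τ is about X / (2 κ Q), half of the average degree guaranteed by the hypothesis,
  -- so degrees below it carry at most half of the sum. The condition on X makes τ at least b, so
  -- that C(d, b) ≥ (d / b)^b holds for the remaining degrees.
  lower-step : ∀ (W : List A) (d : A → ℕ) X m κ Q b → 0 < b → 0 < κ → 0 < Q → length W ≤ X ^ m → 2 * κ * b * Q ≤ X →
    X ^ suc m ≤ κ * ΣL (λ z → bin (d z) 1) W * Q →
    X ^ (m + b) ≤ lowerStepConst b κ * ΣL (λ z → bin (d z) b) W * Q ^ b
  lower-step W d X m κ Q b@(suc b₁) _ κ>0 Q>0 W≤ X≥ hyp = begin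
    X ^ (m + suc b₁)                                        ≡⟨ cong (X ^_) (+-suc m b₁) ⟩
    X ^ (suc m + b₁)                                        ≡⟨ ^-distribˡ-+-* X (suc m) b₁ ⟩
    X ^ suc m * X ^ b₁                                      ≤⟨ *-monoʳ-≤ (X ^ suc m) (^-monoˡ-≤ b₁ X≤2τY) ⟩
    X ^ suc m * (τ * (2 * Y)) ^ b₁                          ≡⟨ cong (X ^ suc m *_) (*-^ τ (2 * Y) b₁) ⟩
    X ^ suc m * (τ ^ b₁ * (2 * Y) ^ b₁)                     ≡⟨ r₁ (X ^ suc m) (τ ^ b₁) ((2 * Y) ^ b₁) ⟩
    (2 * Y) ^ b₁ * (τ ^ b₁ * X ^ suc m)                     ≤⟨ *-monoʳ-≤ ((2 * Y) ^ b₁) key ⟩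
    (2 * Y) ^ b₁ * (Y * (b ^ b * P))                        ≡⟨ cong (λ u → u ^ b₁ * (Y * (b ^ b * P))) (r₂ κ Q) ⟩
    (4 * κ * Q) ^ b₁ * (2 * κ * Q * (b ^ b * P))            ≡⟨ cong (_* (2 * κ * Q * (b ^ b * P))) (*-^ (4 * κ) Q b₁) ⟩
    (4 * κ) ^ b₁ * Q ^ b₁ * (2 * κ * Q * (b ^ b * P))       ≡⟨ r₃ ((4 * κ) ^ b₁) (Q ^ b₁) (2 * κ) Q (b ^ b) P ⟩
    b ^ b * ((4 * κ) ^ b₁ * (2 * κ)) * P * (Q * Q ^ b₁)     ∎
    where
    open ≤-Reasoning
    Y = 2 * κ * Q
    P = ΣL (λ z → bin (d z) b) W
    P₁ = ΣL (λ z → bin (d z) 1) W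
    instance
      Y≢0 : NonZero Y
      Y≢0 = >-nonZero (*-mono-≤ (*-mono-≤ {1} {2} (s≤s z≤n) κ>0) Q>0)
    τ = X / Y
    r₁ : ∀ a b c → a * (b * c) ≡ c * (b * a)
    r₁ = solve-∀
    r₂ : ∀ k q → 2 * (2 * k * q) ≡ 4 * k * q
    r₂ = solve-∀
    r₃ : ∀ a b c q e p → a * b * (c * q * (e * p)) ≡ e * (a * c) * p * (q * b)
    r₃ = solve-∀
    b≤τ : b ≤ τ
    b≤τ = subst (_≤ τ) (m*n/n≡m b Y) (/-monoˡ-≤ Y (≤-trans (≤-reflexive (e₁ b κ Q)) X≥))
      where
      e₁ : ∀ b k q → b * (2 * k * q) ≡ 2 * k * b * q
      e₁ = solve-∀
    X≤2τY : X ≤ τ * (2 * Y)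
    X≤2τY = begin
      X                 ≤⟨ <⇒≤ (subst (_< Y + τ * Y) (sym (m≡m%n+[m/n]*n X Y)) (+-monoˡ-< (τ * Y) (m%n<n X Y))) ⟩
      Y + τ * Y         ≤⟨ +-monoˡ-≤ (τ * Y) (m≤n*m Y τ {{>-nonZero (≤-trans (s≤s z≤n) b≤τ)}}) ⟩
      τ * Y + τ * Y     ≡⟨ e₂ τ Y ⟩
      τ * (2 * Y)       ∎
      where
      e₂ : ∀ t y → t * y + t * y ≡ t * (2 * y)
      e₂ = solve-∀
    pointwise : ∀ z → τ ^ b₁ * bin (d z) 1 ≤ b ^ b * bin (d z) b + τ ^ b
    pointwise z with τ ≤? d z
    ... | yes τ≤d = begin
      τ ^ b₁ * bin (d z) 1                ≤⟨ *-mono-≤ (^-monoˡ-≤ b₁ τ≤d) (≤-trans (bin≤^ (d z) 1) (≤-reflexive (*-identityʳ (d z)))) ⟩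
      d z ^ b₁ * d z                      ≡⟨ *-comm (d z ^ b₁) (d z) ⟩
      d z ^ b                             ≤⟨ ^≤bin (d z) b (≤-trans b≤τ τ≤d) ⟩
      b ^ b * bin (d z) b                 ≤⟨ m≤m+n _ (τ ^ b) ⟩
      b ^ b * bin (d z) b + τ ^ b         ∎
    ... | no τ≰d = begin
      τ ^ b₁ * bin (d z) 1                ≤⟨ *-monoʳ-≤ (τ ^ b₁) (≤-trans (bin≤^ (d z) 1) (≤-trans (≤-reflexive (*-identityʳ (d z))) (<⇒≤ (≰⇒> τ≰d)))) ⟩
      τ ^ b₁ * τ                          ≡⟨ *-comm (τ ^ b₁) τ ⟩
      τ ^ b                               ≤⟨ m≤n+m (τ ^ b) _ ⟩
      b ^ b * bin (d z) b + τ ^ b         ∎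
    summed : τ ^ b₁ * P₁ ≤ b ^ b * P + X ^ m * τ ^ b
    summed = begin
      τ ^ b₁ * P₁                                           ≡⟨ ΣL-* (τ ^ b₁) (λ z → bin (d z) 1) W ⟨
      ΣL (λ z → τ ^ b₁ * bin (d z) 1) W                     ≤⟨ ΣL-mono pointwise W ⟩
      ΣL (λ z → b ^ b * bin (d z) b + τ ^ b) W              ≡⟨ ΣL-+ (λ z → b ^ b * bin (d z) b) (λ _ → τ ^ b) W ⟩
      ΣL (λ z → b ^ b * bin (d z) b) W + ΣL (λ _ → τ ^ b) W ≡⟨ cong₂ _+_ (ΣL-* (b ^ b) (λ z → bin (d z) b) W) (ΣL-const (τ ^ b) W) ⟩
      b ^ b * P + length W * τ ^ b                          ≤⟨ +-monoʳ-≤ (b ^ b * P) (*-monoˡ-≤ (τ ^ b) W≤) ⟩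
      b ^ b * P + X ^ m * τ ^ b                             ∎
    -- 2 τ^(b−1) X^(m+1) ≤ Y b^b P + X^m τ^b Y, and the last term is at most τ^(b−1) X^(m+1) because τ Y ≤ X.
    key : τ ^ b₁ * X ^ suc m ≤ Y * (b ^ b * P)
    key = +-cancelʳ-≤ (τ ^ b₁ * X ^ suc m) _ _ (begin
      τ ^ b₁ * X ^ suc m + τ ^ b₁ * X ^ suc m         ≤⟨ +-mono-≤ (*-monoʳ-≤ (τ ^ b₁) hyp) (*-monoʳ-≤ (τ ^ b₁) hyp) ⟩
      τ ^ b₁ * (κ * P₁ * Q) + τ ^ b₁ * (κ * P₁ * Q)   ≡⟨ e₃ (τ ^ b₁) κ P₁ Q ⟩
      Y * (τ ^ b₁ * P₁)                               ≤⟨ *-monoʳ-≤ Y summed ⟩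
      Y * (b ^ b * P + X ^ m * (τ * τ ^ b₁))          ≡⟨ e₄ Y (b ^ b * P) (X ^ m) τ (τ ^ b₁) ⟩
      Y * (b ^ b * P) + τ ^ b₁ * (τ * Y * X ^ m)      ≤⟨ +-monoʳ-≤ (Y * (b ^ b * P)) (*-monoʳ-≤ (τ ^ b₁) (*-monoˡ-≤ (X ^ m) (m/n*n≤m X Y))) ⟩
      Y * (b ^ b * P) + τ ^ b₁ * X ^ suc m            ∎)
      where
      e₃ : ∀ t k p q → t * (k * p * q) + t * (k * p * q) ≡ 2 * k * q * (t * p)
      e₃ = solve-∀
      e₄ : ∀ y b x t u → y * (b + x * (t * u)) ≡ y * b + u * (t * y * x)
      e₄ = solve-∀

  lowerConst : ∀ {r} → Vec ℕ r → ℕ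
  lowerConst [] = 1
  lowerConst (b ∷ bs) = lowerStepConst b (lowerConst bs)

  -- The source of the number B of constants: a part of size B q^S satisfies the size condition 2 κ
  -- b Q ≤ X of every `lower-step`, where Q is q raised to the product of the later part sizes and
  -- this product is at most S.
  partSizeConst : ∀ {r} → Vec ℕ r → ℕ
  partSizeConst [] = 1
  partSizeConst (b ∷ bs) = 2 * lowerConst bs * b + partSizeConst bs

  Positive : ∀ {r} → Vec ℕ r → Set
  Positive [] = ⊤
  Positive (b ∷ bs) = 0 < b × Positive bs

  TailsBounded : ∀ {r} → ℕ → Vec ℕ r → Set
  TailsBounded S [] = ⊤
  TailsBounded S (b ∷ bs) = productV bs ≤ S × TailsBounded S bs

  lowerConst>0 : ∀ {r} (bs : Vec ℕ r) → Positive bs → 0 < lowerConst bs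
  lowerConst>0 [] _ = s≤s z≤n
  lowerConst>0 (b ∷ bs) (b>0 , pos) = *-mono-≤ (m^n>0 b {{>-nonZero b>0}} b)
    (*-mono-≤ (m^n>0 (4 * κ) {{>-nonZero (*-mono-≤ {1} {4} (s≤s z≤n) κ>0)}} (b ∸ 1)) (*-mono-≤ {1} {2} (s≤s z≤n) κ>0))
    where
    κ = lowerConst bs
    κ>0 = lowerConst>0 bs pos

  ones : ∀ r → Vec ℕ r
  ones zero = []
  ones (suc r) = 1 ∷ ones r

  -- All parts start with size 1, where the hypothesis is that the edge density is at least 1 / q.
  -- Enlarging a part from 1 to b raises the density to the power b, so it ends at a constant times
  -- q^(-b₁⋯b_r), the value for a random relation. The last part is enlarged first.
  supersaturation : ∀ {r} (bs : Vec ℕ r) S → Positive bs → TailsBounded S bs →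
    ∀ (V : List A) q X m (Zs : List Z) R → 0 < q → partSizeConst bs * q ^ S ≤ X → length V ≤ X → length Zs ≤ X ^ m → let open Counting V in
    X ^ (m + r) ≤ total Zs R (ones r) * q →
    X ^ (m + Vec.sum bs) ≤ lowerConst bs * total Zs R bs * q ^ productV bs
  supersaturation [] S _ _ V q X m Zs R q>0 X≥ V≤ Z≤ hyp = ≤-trans hyp (≤-reflexive (e (Counting.total V Zs R []) q))
    where
    e : ∀ t q → t * q ≡ 1 * t * (q * 1)
    e = solve-∀
  supersaturation {r = suc r} (b ∷ bs) S (b>0 , pos) (ρ≤S , tails) V q X m Zs R q>0 X≥ V≤ Z≤ hyp = subst₂ _≤_
    (cong (X ^_) (e₁ m (Vec.sum bs) b))
    (cong₂ (λ u v → lowerConst (b ∷ bs) * u * v) (sym (total-head Zs R b bs)) (trans (^-*-assoc q (productV bs) b) (cong (q ^_) (*-comm (productV bs) b))))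
    (lower-step (pairs Zs (tuples bs V)) (degree R) X (m + Vec.sum bs) κ (q ^ productV bs) b b>0 κ>0 (m^n>0 q (productV bs)) W≤ X≥₁
      (subst₂ _≤_ (cong (X ^_) (e₂ m (Vec.sum bs)))
        (cong (λ u → κ * u * q ^ productV bs) (trans (sym (total-tail Zs R 1 bs)) (total-head Zs R 1 bs)))
        (supersaturation bs S pos tails V q X (m + 1) (pairs Zs (combos 1 V)) (absorb R) q>0 X≥₂ V≤ Zs′≤
          (subst₂ _≤_ (cong (X ^_) (sym (+-assoc m 1 r))) (cong (_* q) (total-tail Zs R 1 (ones r))) hyp))))
    where
    open Counting V
    κ = lowerConst bs
    κ>0 = lowerConst>0 bs pos
    instance
      q≢0 : NonZero q
      q≢0 = >-nonZero q>0
    e₁ : ∀ m s b → m + s + b ≡ m + (b + s)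
    e₁ = solve-∀
    e₂ : ∀ m s → m + 1 + s ≡ suc (m + s)
    e₂ = solve-∀
    X≥₁ : 2 * κ * b * q ^ productV bs ≤ X
    X≥₁ = ≤-trans (*-mono-≤ (m≤m+n (2 * κ * b) (partSizeConst bs)) (^-monoʳ-≤ q ρ≤S)) X≥
    X≥₂ : partSizeConst bs * q ^ S ≤ X
    X≥₂ = ≤-trans (*-monoˡ-≤ (q ^ S) (m≤n+m (partSizeConst bs) (2 * κ * b))) X≥
    W≤ : length (pairs Zs (tuples bs V)) ≤ X ^ (m + Vec.sum bs)
    W≤ = subst₂ _≤_ (sym (length-pairs Zs (tuples bs V))) (sym (^-distribˡ-+-* X m (Vec.sum bs))) (*-mono-≤ Z≤ (length-tuples≤ bs V X V≤))
    Zs′≤ : length (pairs Zs (combos 1 V)) ≤ X ^ (m + 1)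
    Zs′≤ = subst₂ _≤_ (sym (length-pairs Zs (combos 1 V))) (sym (^-distribˡ-+-* X m 1)) (*-mono-≤ Z≤ (length-combos≤ 1 V X V≤))

-- Boolean reflection, enumerations without repetitions, and sets as lists

module Sublists where

  open import Defs
  open import Data.Bool using (Bool; true; false; _∧_)
  open import Data.Bool.ListAction using (all; any)
  open import Data.Nat using (ℕ; zero; suc; _≤_)
  import Data.Nat.Properties as ℕ
  open import Data.Fin as Fin using (Fin; zero; suc; punchIn; punchOut)
  import Data.Fin.Properties as Fin
  open import Data.Fin.Subset using (Subset; ∣_∣)
  open import Data.List as List using (List; []; _∷_; map; concatMap; length; allFin)
  open import Data.List.Properties using (length-map; length-tabulate; ∷-injectiveʳ)
  open import Data.List.Membership.Propositional using (_∈_; _∉_)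
  open import Data.List.Membership.Propositional.Properties using (∈-map⁺; ∈-map⁻; ∈-++⁺ˡ; ∈-++⁺ʳ; ∈-++⁻; ∈-tabulate⁺; ∈-tabulate⁻; ∈-allFin)
  open import Data.List.Relation.Unary.Any using (here; there)
  open import Data.List.Relation.Unary.All as All using (All; []; _∷_)
  open import Data.List.Relation.Unary.AllPairs using ([]; _∷_)
  open import Data.List.Relation.Unary.Unique.Propositional using (Unique)
  open import Data.List.Relation.Unary.Unique.Propositional.Properties using (map⁺; ++⁺; tabulate⁺)
  open import Data.Vec as Vec using (Vec; []; _∷_; lookup; tabulate)
  open import Data.Vec.Properties using (lookup∘tabulate; tabulate∘lookup; tabulate-cong)
  open import Data.Product using (∃; _×_; _,_; proj₁; proj₂)
  open import Data.Sum using (inj₁; inj₂)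
  open import Data.Empty using (⊥-elim)
  open import Relation.Nullary using (¬_; Dec; yes; no)
  open import Relation.Nullary.Decidable using (⌊_⌋)
  open import Relation.Binary.PropositionalEquality hiding ([_])
  open import Function using (_∘_)
  open UniqueLists
  open TupleCounting

  private variable
    A B : Set

  bool-ext : ∀ {a b} → (a ≡ true → b ≡ true) → (b ≡ true → a ≡ true) → a ≡ b
  bool-ext {true} {b} f g = sym (f refl)
  bool-ext {false} {true} f g = g refl
  bool-ext {false} {false} f g = refl

  ∧⁻ : ∀ {a b} → a ∧ b ≡ true → a ≡ true × b ≡ true
  ∧⁻ {true} e = refl , e

  ∧⁺ : ∀ {a b} → a ≡ true → b ≡ true → a ∧ b ≡ true
  ∧⁺ refl e = e

  ⌊⌋⁺ : ∀ {P : Set} (d : Dec P) → P → ⌊ d ⌋ ≡ true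
  ⌊⌋⁺ (yes _) p = refl
  ⌊⌋⁺ (no ¬p) p = ⊥-elim (¬p p)

  ⌊⌋⁻ : ∀ {P : Set} (d : Dec P) → ⌊ d ⌋ ≡ true → P
  ⌊⌋⁻ (yes p) _ = p

  any⁺ : ∀ (p : A → Bool) {x xs} → x ∈ xs → p x ≡ true → any p xs ≡ true
  any⁺ p (here refl) e rewrite e = refl
  any⁺ p {xs = y ∷ xs} (there x∈) e with p y
  ... | true = refl
  ... | false = any⁺ p x∈ e

  any⁻ : ∀ (p : A → Bool) xs → any p xs ≡ true → ∃ λ x → x ∈ xs × p x ≡ true
  any⁻ p (x ∷ xs) e with p x in px
  ... | true = x , here refl , px
  ... | false with any⁻ p xs e
  ...   | y , y∈ , py = y , there y∈ , py

  all⁺ : ∀ (p : A → Bool) xs → (∀ x → x ∈ xs → p x ≡ true) → all p xs ≡ true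
  all⁺ p [] h = refl
  all⁺ p (x ∷ xs) h = ∧⁺ (h x (here refl)) (all⁺ p xs (λ y → h y ∘ there))

  all⁻ : ∀ (p : A → Bool) {x xs} → all p xs ≡ true → x ∈ xs → p x ≡ true
  all⁻ p e (here refl) = proj₁ (∧⁻ e)
  all⁻ p e (there x∈) = all⁻ p (proj₂ (∧⁻ e)) x∈

  filterᵇ⁺ : ∀ (p : A → Bool) {x xs} → x ∈ xs → p x ≡ true → x ∈ filterᵇ p xs
  filterᵇ⁺ p {xs = x ∷ xs} (here refl) e rewrite e = here refl
  filterᵇ⁺ p {xs = y ∷ xs} (there x∈) e with p y
  ... | true = there (filterᵇ⁺ p x∈ e)
  ... | false = filterᵇ⁺ p x∈ e

  filterᵇ⁻ : ∀ (p : A → Bool) {x} xs → x ∈ filterᵇ p xs → x ∈ xs × p x ≡ true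
  filterᵇ⁻ p (y ∷ xs) x∈ with p y in py
  filterᵇ⁻ p (y ∷ xs) (here refl) | true = here refl , py
  filterᵇ⁻ p (y ∷ xs) (there x∈) | true with filterᵇ⁻ p xs x∈
  ... | x∈xs , px = there x∈xs , px
  filterᵇ⁻ p (y ∷ xs) x∈ | false with filterᵇ⁻ p xs x∈
  ... | x∈xs , px = there x∈xs , px

  length-filterᵇ : ∀ (p : A → Bool) xs → length (filterᵇ p xs) ≡ countᵇ p xs
  length-filterᵇ p [] = refl
  length-filterᵇ p (x ∷ xs) with p x
  ... | true = cong suc (length-filterᵇ p xs)
  ... | false = length-filterᵇ p xs

  ∉⇒All≢ : ∀ {x : A} xs → x ∉ xs → All (λ y → ¬ x ≡ y) xs
  ∉⇒All≢ [] _ = []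
  ∉⇒All≢ (y ∷ xs) x∉ = (λ e → x∉ (here e)) ∷ ∉⇒All≢ xs (x∉ ∘ there)

  head∉ : ∀ {x : A} {xs} → Unique (x ∷ xs) → x ∉ xs
  head∉ (ne ∷ _) x∈ = All.lookup ne x∈ refl

  filterᵇ-unique : ∀ (p : A → Bool) {xs} → Unique xs → Unique (filterᵇ p xs)
  filterᵇ-unique p [] = []
  filterᵇ-unique p {x ∷ xs} u@(_ ∷ u′) with p x
  ... | true = ∉⇒All≢ _ (λ x∈ → head∉ u (proj₁ (filterᵇ⁻ p xs x∈))) ∷ filterᵇ-unique p u′
  ... | false = filterᵇ-unique p u′

  concatMap⁺ : ∀ (f : A → List B) {x xs y} → x ∈ xs → y ∈ f x → y ∈ concatMap f xs
  concatMap⁺ f (here refl) y∈ = ∈-++⁺ˡ y∈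
  concatMap⁺ f {xs = x ∷ xs} (there x∈) y∈ = ∈-++⁺ʳ (f x) (concatMap⁺ f x∈ y∈)

  concatMap⁻ : ∀ (f : A → List B) xs {y} → y ∈ concatMap f xs → ∃ λ x → x ∈ xs × y ∈ f x
  concatMap⁻ f (x ∷ xs) y∈ with ∈-++⁻ (f x) y∈
  ... | inj₁ y∈fx = x , here refl , y∈fx
  ... | inj₂ y∈′ with concatMap⁻ f xs y∈′
  ...   | x′ , x′∈ , y∈fx′ = x′ , there x′∈ , y∈fx′

  concatMap-unique : ∀ (f : A → List B) {xs} → Unique xs → (∀ x → x ∈ xs → Unique (f x)) →
    (∀ {x x′ y} → y ∈ f x → y ∈ f x′ → x ≡ x′) → Unique (concatMap f xs)
  concatMap-unique f [] uf inj = []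
  concatMap-unique f {x ∷ xs} u@(_ ∷ u′) uf inj = ++⁺ (uf x (here refl)) (concatMap-unique f u′ (λ y → uf y ∘ there) inj) disjoint
    where
    disjoint : ∀ {y} → ¬ (y ∈ f x × y ∈ concatMap f xs)
    disjoint (y∈ , y∈′) with concatMap⁻ f xs y∈′
    ... | x′ , x′∈ , y∈fx′ = head∉ u (subst (_∈ xs) (inj y∈fx′ y∈) x′∈)

  SameMembers : List A → List A → Set
  SameMembers xs ys = (∀ {x} → x ∈ xs → x ∈ ys) × (∀ {x} → x ∈ ys → x ∈ xs)

  same-members-length : ∀ {xs ys : List A} → Unique xs → Unique ys → SameMembers xs ys → length xs ≡ length ys
  same-members-length u v (f , g) = ℕ.≤-antisym (unique-⊆-length u f) (unique-⊆-length v g)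

  sublists-⊆ : ∀ (xs : List A) {F} → F ∈ sublists xs → ∀ {u} → u ∈ F → u ∈ xs
  sublists-⊆ [] (here refl) ()
  sublists-⊆ (x ∷ xs) F∈ u∈ with ∈-++⁻ (map (x ∷_) (sublists xs)) F∈
  ... | inj₂ F∈′ = there (sublists-⊆ xs F∈′ u∈)
  ... | inj₁ F∈′ with ∈-map⁻ (x ∷_) F∈′
  sublists-⊆ (x ∷ xs) F∈ (here refl) | inj₁ F∈′ | F₀ , F₀∈ , refl = here refl
  sublists-⊆ (x ∷ xs) F∈ (there u∈) | inj₁ F∈′ | F₀ , F₀∈ , refl = there (sublists-⊆ xs F₀∈ u∈)

  sublists-unique : ∀ {xs : List A} → Unique xs → Unique (sublists xs)
  sublists-unique [] = [] ∷ []
  sublists-unique {xs = x ∷ xs} u@(_ ∷ u′) = ++⁺ (map⁺ ∷-injectiveʳ (sublists-unique u′)) (sublists-unique u′) disjoint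
    where
    disjoint : ∀ {F} → ¬ (F ∈ map (x ∷_) (sublists xs) × F ∈ sublists xs)
    disjoint (F∈ , F∈′) with ∈-map⁻ (x ∷_) F∈
    ... | F₀ , _ , refl = head∉ u (sublists-⊆ xs F∈′ (here refl))

  sublists-members-unique : ∀ {xs : List A} → Unique xs → ∀ {F} → F ∈ sublists xs → Unique F
  sublists-members-unique [] (here refl) = []
  sublists-members-unique {xs = x ∷ xs} u@(_ ∷ u′) F∈ with ∈-++⁻ (map (x ∷_) (sublists xs)) F∈
  ... | inj₂ F∈′ = sublists-members-unique u′ F∈′
  ... | inj₁ F∈′ with ∈-map⁻ (x ∷_) F∈′
  ...   | F₀ , F₀∈ , refl = ∉⇒All≢ F₀ (λ x∈ → head∉ u (sublists-⊆ xs F₀∈ x∈)) ∷ sublists-members-unique u′ F₀∈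

  -- A sublist keeps the order of `xs`, so its members determine it. Edge sets of copies and parts
  -- of tuples thus have unique representatives.
  sublists-ext : ∀ {xs : List A} → Unique xs → ∀ {F F′} → F ∈ sublists xs → F′ ∈ sublists xs → SameMembers F F′ → F ≡ F′
  sublists-ext [] (here refl) (here refl) _ = refl
  sublists-ext {xs = x ∷ xs} u@(_ ∷ u′) F∈ F′∈ same@(to , from)
    with ∈-++⁻ (map (x ∷_) (sublists xs)) F∈ | ∈-++⁻ (map (x ∷_) (sublists xs)) F′∈
  ... | inj₂ F∈″ | inj₂ F′∈″ = sublists-ext u′ F∈″ F′∈″ same
  ... | inj₁ F∈″ | inj₂ F′∈″ with ∈-map⁻ (x ∷_) F∈″
  ...   | F₀ , F₀∈ , refl = ⊥-elim (head∉ u (sublists-⊆ xs F′∈″ (to (here refl))))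
  sublists-ext {xs = x ∷ xs} u@(_ ∷ u′) F∈ F′∈ same@(to , from) | inj₂ F∈″ | inj₁ F′∈″ with ∈-map⁻ (x ∷_) F′∈″
  ...   | F₀ , F₀∈ , refl = ⊥-elim (head∉ u (sublists-⊆ xs F∈″ (from (here refl))))
  sublists-ext {xs = x ∷ xs} u@(_ ∷ u′) F∈ F′∈ same@(to , from) | inj₁ F∈″ | inj₁ F′∈″
    with ∈-map⁻ (x ∷_) F∈″ | ∈-map⁻ (x ∷_) F′∈″
  ... | F₀ , F₀∈ , refl | F₁ , F₁∈ , refl = cong (x ∷_) (sublists-ext u′ F₀∈ F₁∈ (strip F₀∈ to , strip F₁∈ from))
    where
    strip : ∀ {F₀ F₁} → F₀ ∈ sublists xs → (∀ {u} → u ∈ x ∷ F₀ → u ∈ x ∷ F₁) → ∀ {u} → u ∈ F₀ → u ∈ F₁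
    strip F₀∈ to u∈ with to (there u∈)
    ... | here refl = ⊥-elim (head∉ u (sublists-⊆ xs F₀∈ u∈))
    ... | there u∈′ = u∈′

  filterᵇ∈sublists : ∀ (p : A → Bool) xs → filterᵇ p xs ∈ sublists xs
  filterᵇ∈sublists p [] = here refl
  filterᵇ∈sublists p (x ∷ xs) with p x
  ... | true = ∈-++⁺ˡ (∈-map⁺ (x ∷_) (filterᵇ∈sublists p xs))
  ... | false = ∈-++⁺ʳ (map (x ∷_) (sublists xs)) (filterᵇ∈sublists p xs)

  combos⊆sublists : ∀ b (xs : List A) {c} → c ∈ combos b xs → c ∈ sublists xs × length c ≡ b
  combos⊆sublists zero xs (here refl) = []∈ xs , refl
    where
    []∈ : ∀ (xs : List A) → [] ∈ sublists xs
    []∈ [] = here refl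
    []∈ (x ∷ xs) = ∈-++⁺ʳ (map (x ∷_) (sublists xs)) ([]∈ xs)
  combos⊆sublists (suc b) (x ∷ xs) c∈ with ∈-++⁻ (map (x ∷_) (combos b xs)) c∈
  ... | inj₂ c∈′ with combos⊆sublists (suc b) xs c∈′
  ...   | s∈ , len = ∈-++⁺ʳ (map (x ∷_) (sublists xs)) s∈ , len
  combos⊆sublists (suc b) (x ∷ xs) c∈ | inj₁ c∈′ with ∈-map⁻ (x ∷_) c∈′
  ... | c₀ , c₀∈ , refl with combos⊆sublists b xs c₀∈
  ...   | s∈ , len = ∈-++⁺ˡ (∈-map⁺ (x ∷_) s∈) , cong suc len

  sublists⊆combos : ∀ (xs : List A) {c} → c ∈ sublists xs → c ∈ combos (length c) xs
  sublists⊆combos [] (here refl) = here refl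
  sublists⊆combos (x ∷ xs) c∈ with ∈-++⁻ (map (x ∷_) (sublists xs)) c∈
  ... | inj₁ c∈′ with ∈-map⁻ (x ∷_) c∈′
  ...   | c₀ , c₀∈ , refl = ∈-++⁺ˡ (∈-map⁺ (x ∷_) (sublists⊆combos xs c₀∈))
  sublists⊆combos (x ∷ xs) {[]} c∈ | inj₂ c∈′ = here refl
  sublists⊆combos (x ∷ xs) {y ∷ c} c∈ | inj₂ c∈′ = ∈-++⁺ʳ (map (x ∷_) (combos (length c) xs)) (sublists⊆combos xs c∈′)

  combos-unique : ∀ b {xs : List A} → Unique xs → Unique (combos b xs)
  combos-unique zero u = [] ∷ []
  combos-unique (suc b) [] = []
  combos-unique (suc b) {x ∷ xs} u@(_ ∷ u′) = ++⁺ (map⁺ ∷-injectiveʳ (combos-unique b u′)) (combos-unique (suc b) u′) disjoint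
    where
    disjoint : ∀ {F} → ¬ (F ∈ map (x ∷_) (combos b xs) × F ∈ combos (suc b) xs)
    disjoint (F∈ , F∈′) with ∈-map⁻ (x ∷_) F∈
    ... | F₀ , _ , refl = head∉ u (sublists-⊆ xs (proj₁ (combos⊆sublists (suc b) xs F∈′)) (here refl))

  tuples-unique : ∀ {r} (bs : Vec ℕ r) {V : List A} → Unique V → Unique (tuples bs V)
  tuples-unique [] u = [] ∷ []
  tuples-unique (b ∷ bs) {V} u = concatMap-unique _ (combos-unique b u) (λ x _ → map⁺ (λ { refl → refl }) (tuples-unique bs u)) inj
    where
    inj : ∀ {x x′ y} → y ∈ map (x ∷_) (tuples bs V) → y ∈ map (x′ ∷_) (tuples bs V) → x ≡ x′
    inj {x} {x′} y∈ y∈′ with ∈-map⁻ (x ∷_) y∈ | ∈-map⁻ (x′ ∷_) y∈′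
    ... | _ , _ , refl | _ , _ , refl = refl

  tuples⁺ : ∀ {r} (bs : Vec ℕ r) (V : List A) t → (∀ i → lookup t i ∈ combos (lookup bs i) V) → t ∈ tuples bs V
  tuples⁺ [] V [] h = here refl
  tuples⁺ (b ∷ bs) V (x ∷ t) h = concatMap⁺ (λ x → map (x ∷_) (tuples bs V)) (h zero) (∈-map⁺ (x ∷_) (tuples⁺ bs V t (h ∘ suc)))

  tuples⁻ : ∀ {r} (bs : Vec ℕ r) (V : List A) {t} → t ∈ tuples bs V → ∀ i → lookup t i ∈ combos (lookup bs i) V
  tuples⁻ (b ∷ bs) V t∈ i with concatMap⁻ (λ x → map (x ∷_) (tuples bs V)) (combos b V) t∈
  ... | x , x∈ , t∈′ with ∈-map⁻ (x ∷_) t∈′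
  tuples⁻ (b ∷ bs) V t∈ zero | x , x∈ , t∈′ | t₀ , t₀∈ , refl = x∈
  tuples⁻ (b ∷ bs) V t∈ (suc i) | x , x∈ , t∈′ | t₀ , t₀∈ , refl = tuples⁻ bs V t₀∈ i

  _∈ᵗ_ : ∀ {r} → Vec A r → Vec (List A) r → Set
  w ∈ᵗ t = ∀ i → lookup w i ∈ lookup t i

  allR⁺ : ∀ {r} (R : Vec A r → Bool) t → (∀ w → w ∈ᵗ t → R w ≡ true) → allR R t ≡ true
  allR⁺ R [] h = h [] λ ()
  allR⁺ R (x ∷ t) h = allR⁺ _ t λ w w∈ → all⁺ _ x λ v v∈ → h (v ∷ w) λ { zero → v∈ ; (suc i) → w∈ i }

  allR⁻ : ∀ {r} (R : Vec A r → Bool) t → allR R t ≡ true → ∀ w → w ∈ᵗ t → R w ≡ true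
  allR⁻ R [] e [] _ = e
  allR⁻ R (x ∷ t) e (v ∷ w) w∈ = all⁻ (λ v → R (v ∷ w)) (allR⁻ _ t e w (w∈ ∘ suc)) (w∈ zero)

  vec-ext : ∀ {n} {u v : Vec A n} → (∀ i → lookup u i ≡ lookup v i) → u ≡ v
  vec-ext {u = u} {v} e = trans (sym (tabulate∘lookup u)) (trans (tabulate-cong e) (tabulate∘lookup v))

  elements : ∀ {n} → Subset n → List (Fin n)
  elements [] = []
  elements (true ∷ e) = zero ∷ map suc (elements e)
  elements (false ∷ e) = map suc (elements e)

  length-elements : ∀ {n} (e : Subset n) → length (elements e) ≡ ∣ e ∣
  length-elements [] = refl
  length-elements (true ∷ e) = cong suc (trans (length-map suc (elements e)) (length-elements e))
  length-elements (false ∷ e) = trans (length-map suc (elements e)) (length-elements e)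

  elements⁺ : ∀ {n} (e : Subset n) v → lookup e v ≡ true → v ∈ elements e
  elements⁺ (true ∷ e) zero _ = here refl
  elements⁺ (true ∷ e) (suc v) h = there (∈-map⁺ suc (elements⁺ e v h))
  elements⁺ (false ∷ e) (suc v) h = ∈-map⁺ suc (elements⁺ e v h)

  elements⁻ : ∀ {n} (e : Subset n) {v} → v ∈ elements e → lookup e v ≡ true
  elements⁻ (true ∷ e) (here refl) = refl
  elements⁻ (true ∷ e) (there v∈) with ∈-map⁻ suc v∈
  ... | v′ , v′∈ , refl = elements⁻ e v′∈
  elements⁻ (false ∷ e) v∈ with ∈-map⁻ suc v∈
  ... | v′ , v′∈ , refl = elements⁻ e v′∈

  elements-unique : ∀ {n} (e : Subset n) → Unique (elements e)
  elements-unique [] = []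
  elements-unique (true ∷ e) = ∉⇒All≢ _ zero∉ ∷ map⁺ Fin.suc-injective (elements-unique e)
    where
    zero∉ : zero ∉ map suc (elements e)
    zero∉ z∈ with ∈-map⁻ suc z∈
    ... | _ , _ , ()
  elements-unique (false ∷ e) = map⁺ Fin.suc-injective (elements-unique e)

  setOf : ∀ {n r} → Vec (Fin n) r → Subset n
  setOf {r = r} w = tabulate (λ v → any (λ i → ⌊ lookup w i Fin.≟ v ⌋) (allFin r))

  setOf⁺ : ∀ {n r} (w : Vec (Fin n) r) i → lookup (setOf w) (lookup w i) ≡ true
  setOf⁺ w i = trans (lookup∘tabulate _ (lookup w i)) (any⁺ _ (∈-allFin i) (⌊⌋⁺ (lookup w i Fin.≟ lookup w i) refl))

  setOf⁻ : ∀ {n r} (w : Vec (Fin n) r) v → lookup (setOf w) v ≡ true → ∃ λ i → lookup w i ≡ v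
  setOf⁻ w v e with any⁻ _ (allFin _) (trans (sym (lookup∘tabulate _ v)) e)
  ... | i , _ , h = i , ⌊⌋⁻ (lookup w i Fin.≟ v) h

  subset-ext : ∀ {n} {u v : Subset n} → (∀ i → lookup u i ≡ true → lookup v i ≡ true) → (∀ i → lookup v i ≡ true → lookup u i ≡ true) → u ≡ v
  subset-ext f g = vec-ext λ i → bool-ext (f i) (g i)

  setOf-ext : ∀ {n r s} (w : Vec (Fin n) r) (w′ : Vec (Fin n) s) → (∀ i → ∃ λ j → lookup w i ≡ lookup w′ j) →
    (∀ j → ∃ λ i → lookup w′ j ≡ lookup w i) → setOf w ≡ setOf w′
  setOf-ext w w′ f g = subset-ext (half w w′ f) (half w′ w g)
    where
    half : ∀ {n r s} (w : Vec (Fin n) r) (w′ : Vec (Fin n) s) → (∀ i → ∃ λ j → lookup w i ≡ lookup w′ j) →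
      ∀ v → lookup (setOf w) v ≡ true → lookup (setOf w′) v ≡ true
    half w w′ f v e with setOf⁻ w v e
    ... | i , refl with f i
    ...   | j , eq = subst (λ u → lookup (setOf w′) u ≡ true) (sym eq) (setOf⁺ w′ j)

  setOf-injective⇒card : ∀ {n r} (w : Vec (Fin n) r) → (∀ {i j} → lookup w i ≡ lookup w j → i ≡ j) → ∣ setOf w ∣ ≡ r
  setOf-injective⇒card {r = r} w inj = trans (sym (length-elements (setOf w)))
    (trans (same-members-length (elements-unique (setOf w)) (tabulate⁺ inj) (to , from)) (length-tabulate (lookup w)))
    where
    to : ∀ {v} → v ∈ elements (setOf w) → v ∈ List.tabulate (lookup w)
    to v∈ with setOf⁻ w _ (elements⁻ (setOf w) v∈)
    ... | i , refl = ∈-tabulate⁺ i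
    from : ∀ {v} → v ∈ List.tabulate (lookup w) → v ∈ elements (setOf w)
    from v∈ with ∈-tabulate⁻ v∈
    ... | i , refl = elements⁺ (setOf w) _ (setOf⁺ w i)

  -- If two entries agreed, one could be dropped and the remaining r - 1 would still cover a set of
  -- r elements.
  card⇒injective : ∀ {n r} (w : Vec (Fin n) r) → ∣ setOf w ∣ ≡ r → ∀ {i j} → lookup w i ≡ lookup w j → i ≡ j
  card⇒injective {r = suc r} w card {i} {j} e with i Fin.≟ j
  ... | yes i≡j = i≡j
  ... | no i≢j = ⊥-elim (ℕ.<-irrefl refl (subst₂ _≤_ (trans (length-elements (setOf w)) card) (length-tabulate rest)
      (unique-⊆-length (elements-unique (setOf w)) covered)))
    where
    rest : Fin r → _
    rest k = lookup w (punchIn i k)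
    covered : ∀ {v} → v ∈ elements (setOf w) → v ∈ List.tabulate rest
    covered v∈ with setOf⁻ w _ (elements⁻ (setOf w) v∈)
    ... | k , refl with i Fin.≟ k
    ...   | yes refl = subst (_∈ List.tabulate rest) (trans (cong (lookup w) (Fin.punchIn-punchOut i≢j)) (sym e)) (∈-tabulate⁺ (punchOut i≢j))
    ...   | no i≢k = subst (_∈ List.tabulate rest) (cong (lookup w) (Fin.punchIn-punchOut i≢k)) (∈-tabulate⁺ (punchOut i≢k))

-- Copies of complete partite hypergraphs versus tuples of vertex sets

module Copies where

  open import Defs
  open import Data.Bool using (Bool; true; false; _∧_; _∨_; not; T)
  open import Data.Bool.Properties using (T-≡) renaming (_≟_ to _≟ᵇ_)
  open import Data.Bool.ListAction using (any)
  open import Data.Nat using (ℕ; zero; suc; _≤_; _<_; _≡ᵇ_)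
  import Data.Nat.Properties as ℕ
  open import Data.Fin as Fin using (Fin; zero; suc; splitAt; _↑ˡ_; _↑ʳ_; cast)
  import Data.Fin.Properties as Fin
  open import Data.Fin.Subset using (Subset)
  open import Data.List as List using (List; []; _∷_; map; length; allFin)
  open import Data.List.Properties using (length-map; length-tabulate)
  open import Data.List.Membership.Propositional using (_∈_)
  open import Data.List.Membership.Propositional.Properties using (∈-map⁺; ∈-map⁻; ∈-++⁺ˡ; ∈-++⁺ʳ; ∈-tabulate⁺; ∈-tabulate⁻; ∈-allFin; ∈-lookup)
  open import Data.List.Relation.Unary.Any as Any using (here)
  open import Data.List.Relation.Unary.Any.Properties using (lookup-index)
  open import Data.List.Relation.Unary.AllPairs using ([]; _∷_)
  open import Data.List.Relation.Unary.All using ([])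
  open import Data.List.Relation.Unary.Unique.Propositional using (Unique)
  open import Data.List.Relation.Unary.Unique.Propositional.Properties using (map⁺; ++⁺; tabulate⁺; allFin⁺)
  open import Data.Vec as Vec using (Vec; []; _∷_; lookup; tabulate; sum)
  open import Data.Vec.Properties using (lookup∘tabulate; tabulate-cong; ≡-dec; ∷-injectiveʳ)
  open import Data.Product using (∃; ∃₂; _×_; _,_; proj₁; proj₂)
  open import Data.Sum using (inj₁; inj₂)
  open import Data.Empty using (⊥-elim)
  open import Relation.Nullary using (¬_; yes; no)
  open import Relation.Nullary.Decidable using (⌊_⌋)
  open import Relation.Binary.PropositionalEquality hiding ([_])
  open import Function using (_∘_)
  open import Function.Bundles using (Equivalence)
  open UniqueLists
  open TupleCounting
  open Sublists

  vertex : ∀ {r} (t : Vec ℕ r) i → Fin (lookup t i) → Fin (sum t)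
  vertex (a ∷ t) zero j = j ↑ˡ sum t
  vertex (a ∷ t) (suc i) j = a ↑ʳ vertex t i j

  partOf-vertex : ∀ {r} (t : Vec ℕ r) i j → partOf t (vertex t i j) ≡ i
  partOf-vertex (a ∷ t) zero j rewrite Fin.splitAt-↑ˡ a j (sum t) = refl
  partOf-vertex (a ∷ t) (suc i) j rewrite Fin.splitAt-↑ʳ a (sum t) (vertex t i j) = cong suc (partOf-vertex t i j)

  position : ∀ {r} (t : Vec ℕ r) v → ∃ λ j → vertex t (partOf t v) j ≡ v
  position (a ∷ t) v with splitAt a v in eq
  ... | inj₁ j = j , Fin.splitAt⁻¹-↑ˡ eq
  ... | inj₂ k with position t k
  ...   | j , e = j , trans (cong (a ↑ʳ_) e) (Fin.splitAt⁻¹-↑ʳ eq)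

  vertex-injective : ∀ {r} (t : Vec ℕ r) i {j j′} → vertex t i j ≡ vertex t i j′ → j ≡ j′
  vertex-injective (a ∷ t) zero e = Fin.↑ˡ-injective (sum t) _ _ e
  vertex-injective (a ∷ t) (suc i) e = vertex-injective t i (Fin.↑ʳ-injective a _ _ e)

  -- A transversal of the parts. By `K-section⁺` and `K-section⁻` the edges of `K t` are exactly the
  -- ranges of these maps, which replaces the counting definition of `K` in everything that follows.
  Section : ∀ {r} (t : Vec ℕ r) → (Fin r → Fin (sum t)) → Set
  Section t σ = ∀ i → partOf t (σ i) ≡ i

  edgeOf : ∀ {m r} → (Fin r → Fin m) → Subset m
  edgeOf σ = setOf (tabulate σ)

  setOf≡edgeOf : ∀ {m r} (w : Vec (Fin m) r) (σ : Fin r → Fin m) → (∀ i → lookup w i ≡ σ i) → setOf w ≡ edgeOf σ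
  setOf≡edgeOf w σ e = cong setOf (vec-ext {u = w} {v = tabulate σ} λ i → trans (e i) (sym (lookup∘tabulate σ i)))

  edgeOf⁺ : ∀ {m r} (σ : Fin r → Fin m) i → lookup (edgeOf σ) (σ i) ≡ true
  edgeOf⁺ σ i = subst (λ v → lookup (edgeOf σ) v ≡ true) (lookup∘tabulate σ i) (setOf⁺ (tabulate σ) i)

  edgeOf⁻ : ∀ {m r} (σ : Fin r → Fin m) v → lookup (edgeOf σ) v ≡ true → ∃ λ i → σ i ≡ v
  edgeOf⁻ σ v h with setOf⁻ (tabulate σ) v h
  ... | i , e = i , trans (sym (lookup∘tabulate σ i)) e

  inPart : ∀ {r} (t : Vec ℕ r) → Subset (sum t) → Fin r → Fin (sum t) → Bool
  inPart t e i v = lookup e v ∧ ⌊ partOf t v Fin.≟ i ⌋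

  K-section⁺ : ∀ {r} (t : Vec ℕ r) σ → Section t σ → K t (edgeOf σ) ≡ true
  K-section⁺ {r} t σ sec = all⁺ _ (allFin r) λ i _ → cong (_≡ᵇ 1) (count≡1 i)
    where
    count≡1 : ∀ i → length (filterᵇ (inPart t (edgeOf σ) i) (allFin (sum t))) ≡ 1
    count≡1 i = same-members-length {ys = σ i ∷ []} (filterᵇ-unique _ (allFin⁺ (sum t))) ([] ∷ []) (to , from)
      where
      to : ∀ {v} → v ∈ filterᵇ (inPart t (edgeOf σ) i) (allFin (sum t)) → v ∈ σ i ∷ []
      to {v} v∈ with ∧⁻ (proj₂ (filterᵇ⁻ (inPart t (edgeOf σ) i) (allFin (sum t)) v∈))
      ... | in-edge , part≡ with edgeOf⁻ σ v in-edge
      ...   | j , refl = here (cong σ (trans (sym (sec j)) (⌊⌋⁻ (partOf t (σ j) Fin.≟ i) part≡)))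
      from : ∀ {v} → v ∈ σ i ∷ [] → v ∈ filterᵇ (inPart t (edgeOf σ) i) (allFin (sum t))
      from (here refl) = filterᵇ⁺ (inPart t (edgeOf σ) i) (∈-allFin (σ i)) (∧⁺ (edgeOf⁺ σ i) (⌊⌋⁺ (partOf t (σ i) Fin.≟ i) (sec i)))

  K-section⁻ : ∀ {r} (t : Vec ℕ r) e → K t e ≡ true → ∃ λ σ → Section t σ × e ≡ edgeOf σ
  K-section⁻ {r} t e Ke = σ , (λ i → part i) , subset-ext to from
    where
    members : Fin r → List (Fin (sum t))
    members i = filterᵇ (inPart t e i) (allFin (sum t))
    singleton : ∀ {A : Set} (xs : List A) → length xs ≡ 1 → ∃ λ x → xs ≡ x ∷ []
    singleton (x ∷ []) _ = x , refl
    single : ∀ i → ∃ λ v → members i ≡ v ∷ []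
    single i = singleton (members i) (ℕ.≡ᵇ⇒≡ _ 1 (Equivalence.from T-≡ (all⁻ (λ i → length (members i) ≡ᵇ 1) Ke (∈-allFin i))))
    σ : Fin r → Fin (sum t)
    σ i = proj₁ (single i)
    spec : ∀ i → lookup e (σ i) ≡ true × ⌊ partOf t (σ i) Fin.≟ i ⌋ ≡ true
    spec i = ∧⁻ (proj₂ (filterᵇ⁻ (inPart t e i) (allFin (sum t)) (subst (σ i ∈_) (sym (proj₂ (single i))) (here refl))))
    part : Section t σ
    part i = ⌊⌋⁻ (partOf t (σ i) Fin.≟ i) (proj₂ (spec i))
    to : ∀ v → lookup e v ≡ true → lookup (edgeOf σ) v ≡ true
    to v v∈e with subst (v ∈_) (proj₂ (single (partOf t v)))
        (filterᵇ⁺ (inPart t e (partOf t v)) (∈-allFin v) (∧⁺ v∈e (⌊⌋⁺ (partOf t v Fin.≟ partOf t v) refl)))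
    ... | here v≡ = subst (λ u → lookup (edgeOf σ) u ≡ true) (sym v≡) (edgeOf⁺ σ (partOf t v))
    from : ∀ v → lookup (edgeOf σ) v ≡ true → lookup e v ≡ true
    from v h with edgeOf⁻ σ v h
    ... | i , refl = proj₁ (spec i)

  image⁺ : ∀ {m n} (φ : Fin m → Fin n) e v → lookup e v ≡ true → lookup (image φ e) (φ v) ≡ true
  image⁺ φ e v h = trans (lookup∘tabulate _ (φ v)) (any⁺ _ (∈-allFin v) (∧⁺ h (⌊⌋⁺ (φ v Fin.≟ φ v) refl)))

  image⁻ : ∀ {m n} (φ : Fin m → Fin n) e u → lookup (image φ e) u ≡ true → ∃ λ v → lookup e v ≡ true × φ v ≡ u
  image⁻ φ e u h with any⁻ _ (allFin _) (trans (sym (lookup∘tabulate _ u)) h)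
  ... | v , _ , h′ with ∧⁻ h′
  ...   | v∈e , eq = v , v∈e , ⌊⌋⁻ (φ v Fin.≟ u) eq

  image-edgeOf : ∀ {m n r} (φ : Fin m → Fin n) (σ : Fin r → Fin m) → image φ (edgeOf σ) ≡ edgeOf (φ ∘ σ)
  image-edgeOf φ σ = subset-ext to from
    where
    to : ∀ u → lookup (image φ (edgeOf σ)) u ≡ true → lookup (edgeOf (φ ∘ σ)) u ≡ true
    to u h with image⁻ φ (edgeOf σ) u h
    ... | v , v∈ , refl with edgeOf⁻ σ v v∈
    ...   | i , refl = edgeOf⁺ (φ ∘ σ) i
    from : ∀ u → lookup (edgeOf (φ ∘ σ)) u ≡ true → lookup (image φ (edgeOf σ)) u ≡ true
    from u h with edgeOf⁻ (φ ∘ σ) u h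
    ... | i , refl = image⁺ φ (edgeOf σ) (σ i) (edgeOf⁺ σ i)

  image-injective : ∀ {m n} (φ : Fin m → Fin n) → (∀ {i j} → φ i ≡ φ j → i ≡ j) → ∀ {e e′} → image φ e ≡ image φ e′ → e ≡ e′
  image-injective φ inj {e} {e′} eq = subset-ext (half e e′ eq) (half e′ e (sym eq))
    where
    half : ∀ e e′ → image φ e ≡ image φ e′ → ∀ v → lookup e v ≡ true → lookup e′ v ≡ true
    half e e′ eq v h with image⁻ φ e′ (φ v) (subst (λ s → lookup s (φ v) ≡ true) eq (image⁺ φ e v h))
    ... | v′ , v′∈ , φ≡ = subst (λ v → lookup e′ v ≡ true) (inj φ≡) v′∈

  eqSub⁺ : ∀ {n} {u v : Subset n} → u ≡ v → eqSub u v ≡ true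
  eqSub⁺ {u = u} {v} = ⌊⌋⁺ (≡-dec _≟ᵇ_ u v)

  eqSub⁻ : ∀ {n} {u v : Subset n} → eqSub u v ≡ true → u ≡ v
  eqSub⁻ {u = u} {v} = ⌊⌋⁻ (≡-dec _≟ᵇ_ u v)

  memb⁺ : ∀ {n} {u : Subset n} {F} → u ∈ F → memb u F ≡ true
  memb⁺ {u = u} u∈ = any⁺ (eqSub u) u∈ (eqSub⁺ {u = u} refl)

  memb⁻ : ∀ {n} (u : Subset n) F → memb u F ≡ true → u ∈ F
  memb⁻ u F h with any⁻ (eqSub u) F h
  ... | v , v∈ , eq = subst (_∈ F) (sym (eqSub⁻ eq)) v∈

  implies⁺ : ∀ {a b} → (a ≡ true → b ≡ true) → not a ∨ b ≡ true
  implies⁺ {true} f = f refl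
  implies⁺ {false} f = refl

  implies⁻ : ∀ {a b} → not a ∨ b ≡ true → a ≡ true → b ≡ true
  implies⁻ {true} h refl = h

  allSubsets-complete : ∀ {n} (e : Subset n) → e ∈ allSubsets n
  allSubsets-complete [] = here refl
  allSubsets-complete {suc n} (true ∷ e) = ∈-++⁺ˡ (∈-map⁺ (true ∷_) (allSubsets-complete e))
  allSubsets-complete {suc n} (false ∷ e) = ∈-++⁺ʳ (map (true ∷_) (allSubsets n)) (∈-map⁺ (false ∷_) (allSubsets-complete e))

  allSubsets-unique : ∀ n → Unique (allSubsets n)
  allSubsets-unique zero = [] ∷ []
  allSubsets-unique (suc n) = ++⁺ (map⁺ ∷-injectiveʳ (allSubsets-unique n)) (map⁺ ∷-injectiveʳ (allSubsets-unique n)) disjoint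
    where
    disjoint : ∀ {e} → ¬ (e ∈ map (true ∷_) (allSubsets n) × e ∈ map (false ∷_) (allSubsets n))
    disjoint (e∈ , e∈′) with ∈-map⁻ (true ∷_) e∈ | ∈-map⁻ (false ∷_) e∈′
    ... | _ , _ , refl | _ , _ , ()

  -- Membership holds only up to pointwise equality, in the absence of function extensionality;
  -- statements about a given map are therefore transported to its listed twin.
  allFuns-complete : ∀ {m n} (φ : Fin m → Fin n) → ∃ λ φ′ → φ′ ∈ allFuns m n × (∀ i → φ′ i ≡ φ i)
  allFuns-complete {zero} φ = _ , here refl , λ ()
  allFuns-complete {suc m} {n} φ with allFuns-complete (φ ∘ suc)
  ... | ψ , ψ∈ , eq = extend (φ zero) ψ , concatMap⁺ (λ f → map (λ j → extend j f) (allFin n)) ψ∈ (∈-map⁺ (λ j → extend j ψ) (∈-allFin (φ zero))) ,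
    λ { zero → refl ; (suc i) → eq i }

  edges : ∀ {n} → Hypergraph n → List (Subset n)
  edges {n} G = filterᵇ G (allSubsets n)

  subhypergraphs⁺ : ∀ {n} (G : Hypergraph n) W F → F ∈ sublists (edges G) → (W , F) ∈ subhypergraphs G
  subhypergraphs⁺ G W F F∈ = concatMap⁺ (λ W → map (λ F → (W , F)) (sublists (edges G))) (allSubsets-complete W) (∈-map⁺ (W ,_) F∈)

  subhypergraphs⁻ : ∀ {n} (G : Hypergraph n) {W F} → (W , F) ∈ subhypergraphs G → F ∈ sublists (edges G)
  subhypergraphs⁻ {n} G WF∈ with concatMap⁻ (λ W → map (λ F → (W , F)) (sublists (edges G))) (allSubsets n) WF∈
  ... | W′ , _ , WF∈′ with ∈-map⁻ (W′ ,_) WF∈′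
  ...   | F′ , F∈ , refl = F∈

  subhypergraphs-unique : ∀ {n} (G : Hypergraph n) → Unique (subhypergraphs G)
  subhypergraphs-unique {n} G = concatMap-unique _ (allSubsets-unique n)
    (λ W _ → map⁺ (λ { refl → refl }) (sublists-unique (filterᵇ-unique G (allSubsets-unique n)))) inj
    where
    inj : ∀ {W W′ WF} → WF ∈ map (W ,_) (sublists (edges G)) → WF ∈ map (W′ ,_) (sublists (edges G)) → W ≡ W′
    inj {W} {W′} h h′ with ∈-map⁻ (W ,_) h | ∈-map⁻ (W′ ,_) h′
    ... | _ , _ , refl | _ , _ , refl = refl

  isCopyPair : ∀ {m n} → Hypergraph m → Subset n × List (Subset n) → Bool
  isCopyPair T (W , F) = isCopyᵇ T W F

  copyList : ∀ {m n} → Hypergraph m → Hypergraph n → List (Subset n × List (Subset n))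
  copyList T G = filterᵇ (isCopyPair T) (subhypergraphs G)

  copies≡length : ∀ {m n} (T : Hypergraph m) (G : Hypergraph n) → copies T G ≡ length (copyList T G)
  copies≡length T G = cong length (filterᵇ-cong (λ { (W , F) → refl }) (subhypergraphs G))
    where
    filterᵇ-cong : ∀ {A : Set} {p q : A → Bool} → (∀ x → p x ≡ q x) → ∀ xs → filterᵇ p xs ≡ filterᵇ q xs
    filterᵇ-cong e [] = refl
    filterᵇ-cong {p = p} {q} e (x ∷ xs) with p x | q x | e x
    ... | true | true | _ = cong (x ∷_) (filterᵇ-cong e xs)
    ... | false | false | _ = filterᵇ-cong e xs

  IsEmbedding : ∀ {m n} → Hypergraph m → (Fin m → Fin n) → Hypergraph n → Set
  IsEmbedding T φ G = (∀ {i j} → φ i ≡ φ j → i ≡ j) × (∀ e → T e ≡ true → G (image φ e) ≡ true)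

  record IsCopy {m n} (T : Hypergraph m) (φ : Fin m → Fin n) (W : Subset n) (F : List (Subset n)) : Set where
    field
      injective : ∀ {i j} → φ i ≡ φ j → i ≡ j
      range⁺ : ∀ v → lookup W (φ v) ≡ true
      range⁻ : ∀ u → lookup W u ≡ true → ∃ λ v → φ v ≡ u
      within : ∀ f → f ∈ F → ∀ u → lookup f u ≡ true → lookup W u ≡ true
      edge⁺ : ∀ e → T e ≡ true → image φ e ∈ F
      edge⁻ : ∀ e → image φ e ∈ F → T e ≡ true

  fullSet-true : ∀ m v → lookup (fullSet m) v ≡ true
  fullSet-true m v = lookup∘tabulate _ v

  isIso⁻ : ∀ {m n} (T : Hypergraph m) (φ : Fin m → Fin n) W F → isIsoᵇ T φ W F ≡ true → IsCopy T φ W F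
  isIso⁻ {m} {n} T φ W F h with ∧⁻ h
  ... | h₁ , h′ with ∧⁻ h′
  ...   | h₂ , h″ with ∧⁻ h″
  ...     | h₃ , h₄ = record
    { injective = λ {i} {j} e → ⌊⌋⁻ (i Fin.≟ j) (not-or (all⁻ _ (all⁻ _ h₁ (∈-allFin i)) (∈-allFin j)) (⌊⌋⁺ (φ i Fin.≟ φ j) e))
    ; range⁺ = λ v → subst (λ W → lookup W (φ v) ≡ true) W≡ (image⁺ φ (fullSet m) v (fullSet-true m v))
    ; range⁻ = λ u u∈ → range u (image⁻ φ (fullSet m) u (subst (λ W → lookup W u ≡ true) (sym W≡) u∈))
    ; within = λ f f∈ u → implies⁻ (all⁻ _ (all⁻ (λ f → subsetOf f W) h₃ f∈) (∈-allFin u))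
    ; edge⁺ = λ e Te → memb⁻ (image φ e) F (trans (sym (agree e)) Te)
    ; edge⁻ = λ e e∈ → trans (agree e) (memb⁺ e∈) }
    where
    not-or : ∀ {a b} → not a ∨ b ≡ true → a ≡ true → b ≡ true
    not-or = implies⁻
    W≡ : image φ (fullSet m) ≡ W
    W≡ = eqSub⁻ h₂
    range : ∀ u → (∃ λ v → lookup (fullSet m) v ≡ true × φ v ≡ u) → ∃ λ v → φ v ≡ u
    range u (v , _ , e) = v , e
    agree : ∀ e → T e ≡ memb (image φ e) F
    agree e = ⌊⌋⁻ (T e ≟ᵇ memb (image φ e) F) (all⁻ _ h₄ (allSubsets-complete e))

  isIso⁺ : ∀ {m n} (T : Hypergraph m) (φ : Fin m → Fin n) W F → IsCopy T φ W F → isIsoᵇ T φ W F ≡ true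
  isIso⁺ {m} {n} T φ W F c = ∧⁺
    (all⁺ _ (allFin m) λ i _ → all⁺ _ (allFin m) λ j _ → implies⁺ λ h → ⌊⌋⁺ (i Fin.≟ j) (injective (⌊⌋⁻ (φ i Fin.≟ φ j) h)))
    (∧⁺ (eqSub⁺ {u = image φ (fullSet m)} {v = W} (subset-ext to from)) (∧⁺
      (all⁺ _ F λ f f∈ → all⁺ _ (allFin n) λ u _ → implies⁺ (within f f∈ u))
      (all⁺ _ (allSubsets m) λ e _ → ⌊⌋⁺ (T e ≟ᵇ memb (image φ e) F) (bool-ext (λ Te → memb⁺ (edge⁺ e Te)) (λ h → edge⁻ e (memb⁻ (image φ e) F h))))))
    where
    open IsCopy c
    to : ∀ u → lookup (image φ (fullSet m)) u ≡ true → lookup W u ≡ true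
    to u h with image⁻ φ (fullSet m) u h
    ... | v , _ , refl = range⁺ v
    from : ∀ u → lookup W u ≡ true → lookup (image φ (fullSet m)) u ≡ true
    from u h with range⁻ u h
    ... | v , refl = image⁺ φ (fullSet m) v (fullSet-true m v)

  embedding-of-copy : ∀ {m n} (T : Hypergraph m) (G : Hypergraph n) W F → (W , F) ∈ copyList T G →
    F ∈ sublists (edges G) × ∃ λ φ → IsCopy T φ W F × IsEmbedding T φ G
  embedding-of-copy {m} {n} T G W F WF∈ with filterᵇ⁻ (isCopyPair T) (subhypergraphs G) WF∈
  ... | sub , h with any⁻ (λ φ → isIsoᵇ T φ W F) (allFuns m n) h
  ...   | φ , _ , iso = F∈ , φ , c , IsCopy.injective c , λ e Te → proj₂ (filterᵇ⁻ G (allSubsets n) (sublists-⊆ (edges G) F∈ (IsCopy.edge⁺ c e Te)))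
    where
    c = isIso⁻ T φ W F iso
    F∈ = subhypergraphs⁻ G sub

  -- The edge list is filtered out of `edges G`, not mapped from the edges of `T`; this makes it one
  -- of the enumerated sublists. The range is returned as well, since it is what later distinguishes
  -- copies.
  copy-of-embedding : ∀ {m n} (T : Hypergraph m) (G : Hypergraph n) φ → IsEmbedding T φ G →
    ∃₂ λ W F → (W , F) ∈ copyList T G × (∀ v → lookup W (φ v) ≡ true) × (∀ u → lookup W u ≡ true → ∃ λ v → φ v ≡ u)
  copy-of-embedding {m} {n} T G φ₀ (inj₀ , edge₀) with allFuns-complete φ₀
  ... | φ , φ∈ , φ≗ = W , F ,
      filterᵇ⁺ (isCopyPair T) (subhypergraphs⁺ G W F (filterᵇ∈sublists isImage (edges G)))
        (any⁺ (λ φ → isIsoᵇ T φ W F) φ∈ (isIso⁺ T φ W F record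
          { injective = inj
          ; range⁺ = λ v → image⁺ φ (fullSet m) v (fullSet-true m v)
          ; range⁻ = λ u u∈ → range u (image⁻ φ (fullSet m) u u∈)
          ; within = within
          ; edge⁺ = λ e Te → filterᵇ⁺ isImage (filterᵇ⁺ G (allSubsets-complete (image φ e)) (edge e Te))
              (any⁺ _ (allSubsets-complete e) (∧⁺ Te (eqSub⁺ {u = image φ e} refl)))
          ; edge⁻ = edge⁻ })) ,
      (λ v → subst (λ u → lookup W u ≡ true) (φ≗ v) (image⁺ φ (fullSet m) v (fullSet-true m v))) ,
      λ u u∈ → range₀ u (image⁻ φ (fullSet m) u u∈)
    where
    W = image φ (fullSet m)
    isImage : Subset n → Bool
    isImage f = any (λ e → T e ∧ eqSub (image φ e) f) (allSubsets m)
    F = filterᵇ isImage (edges G)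
    inj : ∀ {i j} → φ i ≡ φ j → i ≡ j
    inj {i} {j} e = inj₀ (trans (sym (φ≗ i)) (trans e (φ≗ j)))
    range : ∀ u → (∃ λ v → lookup (fullSet m) v ≡ true × φ v ≡ u) → ∃ λ v → φ v ≡ u
    range u (v , _ , e) = v , e
    range₀ : ∀ u → (∃ λ v → lookup (fullSet m) v ≡ true × φ v ≡ u) → ∃ λ v → φ₀ v ≡ u
    range₀ u (v , _ , e) = v , trans (sym (φ≗ v)) e
    preimage : ∀ f → f ∈ F → ∃ λ e → T e ≡ true × image φ e ≡ f
    preimage f f∈ with any⁻ (λ e → T e ∧ eqSub (image φ e) f) (allSubsets m) (proj₂ (filterᵇ⁻ isImage (edges G) f∈))
    ... | e , _ , h = e , proj₁ (∧⁻ h) , eqSub⁻ (proj₂ (∧⁻ {T e} h))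
    within : ∀ f → f ∈ F → ∀ u → lookup f u ≡ true → lookup W u ≡ true
    within f f∈ u u∈ with preimage f f∈
    ... | e , _ , refl with image⁻ φ e u u∈
    ...   | v , _ , refl = image⁺ φ (fullSet m) v (fullSet-true m v)
    edge : ∀ e → T e ≡ true → G (image φ e) ≡ true
    edge e Te = subst (λ s → G s ≡ true) (tabulate-cong λ u → any-cong u) (edge₀ e Te)
      where
      any-cong : ∀ u → any (λ i → lookup e i ∧ ⌊ φ₀ i Fin.≟ u ⌋) (allFin m) ≡ any (λ i → lookup e i ∧ ⌊ φ i Fin.≟ u ⌋) (allFin m)
      any-cong u = cong (λ bs → List.foldr _∨_ false bs) (Data.List.Properties.map-cong (λ i → cong (λ w → lookup e i ∧ ⌊ w Fin.≟ u ⌋) (sym (φ≗ i))) (allFin m))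
    edge⁻ : ∀ e → image φ e ∈ F → T e ≡ true
    edge⁻ e e∈ with preimage (image φ e) e∈
    ... | e′ , Te′ , eq = subst (λ s → T s ≡ true) (image-injective φ inj eq) Te′

  free⇒no-embedding : ∀ {m n} (T : Hypergraph m) (G : Hypergraph n) → Free T G → ∀ φ → ¬ IsEmbedding T φ G
  free⇒no-embedding T G free φ emb = finish (copy-of-embedding T G φ emb)
    where
    nonempty : ∀ {A : Set} (xs : List A) {x} → x ∈ xs → ¬ length xs ≡ 0
    nonempty (x ∷ xs) _ ()
    finish : ¬ (∃₂ λ W F → (W , F) ∈ copyList T G × (∀ v → lookup W (φ v) ≡ true) × (∀ u → lookup W u ≡ true → ∃ λ v → φ v ≡ u))
    finish (W , F , WF∈ , _) = nonempty (copyList T G) WF∈ (trans (sym (copies≡length T G)) free)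

  no-embedding⇒free : ∀ {m n} (T : Hypergraph m) (G : Hypergraph n) → (∀ φ → ¬ IsEmbedding T φ G) → Free T G
  no-embedding⇒free T G none = trans (copies≡length T G) (empty (copyList T G) λ { {W , F} WF∈ → none _ (proj₂ (proj₂ (proj₂ (embedding-of-copy T G W F WF∈)))) })
    where
    empty : ∀ {A : Set} (xs : List A) → (∀ {x} → ¬ x ∈ xs) → length xs ≡ 0
    empty [] _ = refl
    empty (x ∷ xs) h = ⊥-elim (h (here refl))

  section-vertex : ∀ {r} (t : Vec ℕ r) σ → Section t σ → ∀ i → ∃ λ j → vertex t i j ≡ σ i
  section-vertex t σ sec i with position t (σ i)
  ... | j , e rewrite sec i = j , e

  embedding-edges : ∀ {r n} (t : Vec ℕ r) (G : Hypergraph n) φ → IsEmbedding (K t) φ G → ∀ σ → Section t σ → G (edgeOf (φ ∘ σ)) ≡ true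
  embedding-edges t G φ (_ , edge) σ sec = subst (λ s → G s ≡ true) (image-edgeOf φ σ) (edge (edgeOf σ) (K-section⁺ t σ sec))

  -- Each copy is assigned the tuple of the images of its parts under some isomorphism. The tuple
  -- determines the copy, whichever isomorphism was used: the vertex set is the union of the lists,
  -- and the edges are the transversals.
  copies≤tuples : ∀ {r n} (a : Vec ℕ r) (G : Hypergraph n) → copies (K a) G ≤ countᵇ (allR (G ∘ setOf)) (tuples a (allFin n))
  copies≤tuples {r} {n} a G = subst₂ _≤_ (sym (copies≡length (K a) G)) (length-filterᵇ _ (tuples a (allFin n)))
    (length-≤-injective-relation Rel (filterᵇ-unique _ (subhypergraphs-unique G)) total (λ {x} {x′} {t} → inj {x} {x′} {t}))
    where
    Rel : Subset n × List (Subset n) → Vec (List (Fin n)) r → Set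
    Rel (W , F) t = ((∀ u → lookup W u ≡ true → ∃ λ i → u ∈ lookup t i) × (∀ u → (∃ λ i → u ∈ lookup t i) → lookup W u ≡ true)) ×
      ((∀ {f} → f ∈ F → ∃ λ w → w ∈ᵗ t × f ≡ setOf w) × (∀ {f} → (∃ λ w → w ∈ᵗ t × f ≡ setOf w) → f ∈ F))
    inj : ∀ {x x′ t} → x ∈ copyList (K a) G → x′ ∈ copyList (K a) G → Rel x t → Rel x′ t → x ≡ x′
    inj {W , F} {W′ , F′} x∈ x′∈ ((p , q) , (f , g)) ((p′ , q′) , (f′ , g′)) = cong₂ _,_
      (subset-ext (λ u → q′ u ∘ p u) (λ u → q u ∘ p′ u))
      (sublists-ext (filterᵇ-unique G (allSubsets-unique n)) (proj₁ (embedding-of-copy (K a) G W F x∈)) (proj₁ (embedding-of-copy (K a) G W′ F′ x′∈))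
        (g′ ∘ f , g ∘ f′))
    module Parts (W : Subset n) (F : List (Subset n)) (φ : Fin (sum a) → Fin n) (c : IsCopy (K a) φ W F) (emb : IsEmbedding (K a) φ G) where
      open IsCopy c
      inImage : (i : Fin r) → Fin n → Bool
      inImage i u = any (λ j → ⌊ φ (vertex a i j) Fin.≟ u ⌋) (allFin (lookup a i))
      part : Fin r → List (Fin n)
      part i = filterᵇ (inImage i) (allFin n)
      t : Vec (List (Fin n)) r
      t = tabulate part
      part⁺ : ∀ i j → φ (vertex a i j) ∈ lookup t i
      part⁺ i j = subst (φ (vertex a i j) ∈_) (sym (lookup∘tabulate part i))
        (filterᵇ⁺ (inImage i) (∈-allFin _) (any⁺ _ (∈-allFin j) (⌊⌋⁺ (φ (vertex a i j) Fin.≟ φ (vertex a i j)) refl)))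
      part⁻ : ∀ i {u} → u ∈ lookup t i → ∃ λ j → φ (vertex a i j) ≡ u
      part⁻ i {u} u∈ with any⁻ _ (allFin (lookup a i)) (proj₂ (filterᵇ⁻ (inImage i) (allFin n) (subst (u ∈_) (lookup∘tabulate part i) u∈)))
      ... | j , _ , h = j , ⌊⌋⁻ (φ (vertex a i j) Fin.≟ u) h
      combo : ∀ i → lookup t i ∈ combos (lookup a i) (allFin n)
      combo i = subst₂ (λ k xs → xs ∈ combos k (allFin n)) len (sym (lookup∘tabulate part i)) (sublists⊆combos (allFin n) (filterᵇ∈sublists (inImage i) (allFin n)))
        where
        len : length (part i) ≡ lookup a i
        len = trans (same-members-length (filterᵇ-unique (inImage i) (allFin⁺ n)) (tabulate⁺ (λ e → vertex-injective a i (injective e)))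
            ((λ {u} u∈ → to (part⁻ i {u} (subst (u ∈_) (sym (lookup∘tabulate part i)) u∈))) , from)) (length-tabulate (φ ∘ vertex a i))
          where
          to : ∀ {u} → (∃ λ j → φ (vertex a i j) ≡ u) → u ∈ List.tabulate (φ ∘ vertex a i)
          to (j , refl) = ∈-tabulate⁺ j
          from : ∀ {u} → u ∈ List.tabulate (φ ∘ vertex a i) → u ∈ part i
          from u∈ with ∈-tabulate⁻ u∈
          ... | j , refl = subst (_ ∈_) (lookup∘tabulate part i) (part⁺ i j)
      cover : ∀ {u} → (∃ λ v → φ v ≡ u) → ∃ λ i → u ∈ lookup t i
      cover (v , refl) with position a v
      ... | j , e = partOf a v , subst (λ v′ → φ v′ ∈ lookup t (partOf a v)) e (part⁺ (partOf a v) j)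
      covered : ∀ i {u} → u ∈ lookup t i → lookup W u ≡ true
      covered i u∈ with part⁻ i u∈
      ... | j , refl = range⁺ _
      sectionOf : ∀ w → w ∈ᵗ t → ∃ λ σ → Section a σ × setOf w ≡ edgeOf (φ ∘ σ)
      sectionOf w w∈ = (λ i → vertex a i (proj₁ (part⁻ i (w∈ i)))) , (λ i → partOf-vertex a i _) ,
        setOf≡edgeOf w _ (λ i → sym (proj₂ (part⁻ i (w∈ i))))
      edge : ∀ w → w ∈ᵗ t → G (setOf w) ≡ true
      edge w w∈ with sectionOf w w∈
      ... | σ , sec , e = subst (λ s → G s ≡ true) (sym e) (embedding-edges a G φ emb σ sec)
      edgeFrom : ∀ w → w ∈ᵗ t → setOf w ∈ F
      edgeFrom w w∈ with sectionOf w w∈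
      ... | σ , sec , e = subst (_∈ F) (trans (image-edgeOf φ σ) (sym e)) (edge⁺ (edgeOf σ) (K-section⁺ a σ sec))
      -- An edge of the copy lies within the range of φ, so it is the image of its preimage; the
      -- preimage is an edge of `K a` and hence the range of a section.
      pullback : Subset n → Subset (sum a)
      pullback f = tabulate (λ v → lookup f (φ v))
      pullback≡ : ∀ f v → lookup (pullback f) v ≡ lookup f (φ v)
      pullback≡ f = lookup∘tabulate (λ v → lookup f (φ v))
      image-pullback : ∀ f → f ∈ F → image φ (pullback f) ≡ f
      image-pullback f f∈ = subset-ext to from
        where
        to : ∀ u → lookup (image φ (pullback f)) u ≡ true → lookup f u ≡ true
        to u h = forth (image⁻ φ (pullback f) u h)
          where
          forth : (∃ λ v → lookup (pullback f) v ≡ true × φ v ≡ u) → lookup f u ≡ true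
          forth (v , v∈ , refl) = trans (sym (pullback≡ f v)) v∈
        from : ∀ u → lookup f u ≡ true → lookup (image φ (pullback f)) u ≡ true
        from u h = back (range⁻ u (within f f∈ u h))
          where
          back : (∃ λ v → φ v ≡ u) → lookup (image φ (pullback f)) u ≡ true
          back (v , refl) = image⁺ φ (pullback f) v (trans (pullback≡ f v) h)
      edgeTo : ∀ {f} → f ∈ F → ∃ λ w → w ∈ᵗ t × f ≡ setOf w
      edgeTo {f} f∈ = finish (K-section⁻ a (pullback f) (edge⁻ (pullback f) (subst (_∈ F) (sym (image-pullback f f∈)) f∈)))
        where
        finish : (∃ λ σ → Section a σ × pullback f ≡ edgeOf σ) → ∃ λ w → w ∈ᵗ t × f ≡ setOf w
        finish (σ , sec , e≡) = tabulate (φ ∘ σ) , member , trans (sym (image-pullback f f∈)) (trans (cong (image φ) e≡) (image-edgeOf φ σ))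
          where
          member : tabulate (φ ∘ σ) ∈ᵗ t
          member i with section-vertex a σ sec i
          ... | j , v≡ = subst (_∈ lookup t i) (trans (cong φ v≡) (sym (lookup∘tabulate (φ ∘ σ) i))) (part⁺ i j)

      rel : Rel (W , F) t
      rel = ((λ u u∈ → cover (range⁻ u u∈)) , (λ { u (i , u∈) → covered i u∈ })) , (edgeTo , λ { (w , w∈ , refl) → edgeFrom w w∈ })
      member : t ∈ filterᵇ (allR (G ∘ setOf)) (tuples a (allFin n))
      member = filterᵇ⁺ (allR (G ∘ setOf)) (tuples⁺ a (allFin n) t combo) (allR⁺ (G ∘ setOf) t edge)
    total : ∀ x → x ∈ copyList (K a) G → ∃ λ t → t ∈ filterᵇ (allR (G ∘ setOf)) (tuples a (allFin n)) × Rel x t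
    total (W , F) x∈ = finish (embedding-of-copy (K a) G W F x∈)
      where
      finish : (F ∈ sublists (edges G) × ∃ λ φ → IsCopy (K a) φ W F × IsEmbedding (K a) φ G) →
        ∃ λ t → t ∈ filterᵇ (allR (G ∘ setOf)) (tuples a (allFin n)) × Rel (W , F) t
      finish (_ , φ , c , emb) = Parts.t W F φ c emb , Parts.member W F φ c emb , Parts.rel W F φ c emb

  -- Lists of the right lengths whose transversals are all edges span an embedded complete partite
  -- hypergraph. The only point to prove is injectivity across different lists, which comes from
  -- uniformity; positive sizes are needed there to complete a transversal.
  module FromLists {r n} (t : Vec ℕ r) (G : Hypergraph n) (uniform : Uniform r G)
    (x : Vec (List (Fin n)) r) (len : ∀ i → length (lookup x i) ≡ lookup t i) (uniq : ∀ i → Unique (lookup x i))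
    (pos : ∀ i → 0 < lookup t i) (edges : ∀ w → w ∈ᵗ x → G (setOf w) ≡ true) where

    entry : ∀ i → Fin (lookup t i) → Fin n
    entry i j = List.lookup (lookup x i) (cast (sym (len i)) j)

    entry∈ : ∀ i j → entry i j ∈ lookup x i
    entry∈ i j = ∈-lookup {xs = lookup x i} (cast (sym (len i)) j)

    entry-cong : ∀ {i i′ j j′} → vertex t i j ≡ vertex t i′ j′ → entry i j ≡ entry i′ j′
    entry-cong {i} {i′} {j} {j′} e with trans (sym (partOf-vertex t i j)) (trans (cong (partOf t) e) (partOf-vertex t i′ j′))
    ... | refl = cong (entry i) (vertex-injective t i e)

    embedding : Fin (sum t) → Fin n
    embedding v = entry (partOf t v) (proj₁ (position t v))

    embedding-vertex : ∀ i j → embedding (vertex t i j) ≡ entry i j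
    embedding-vertex i j = entry-cong (proj₂ (position t (vertex t i j)))

    onto : ∀ i {u} → u ∈ lookup x i → ∃ λ v → embedding v ≡ u
    onto i u∈ = vertex t i (cast (len i) (Any.index u∈)) , trans (embedding-vertex i _)
      (trans (cong (List.lookup (lookup x i)) (Fin.cast-involutive (sym (len i)) (len i) (Any.index u∈))) (sym (lookup-index u∈)))

    -- An element common to two lists would give an edge with fewer than r vertices.
    disjoint : ∀ {u i i′} → u ∈ lookup x i → u ∈ lookup x i′ → i ≡ i′
    disjoint {u} {i} {i′} u∈ u∈′ = card⇒injective w (uniform (setOf w) (edges w w∈))
      (trans (w≡ i (pick-i i refl)) (sym (w≡ i′ (pick-i′ i′ refl))))
      where
      pick : ∀ k → ∃ λ v → v ∈ lookup x k × ((k ≡ i → v ≡ u) × (k ≡ i′ → v ≡ u))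
      pick k with k Fin.≟ i | k Fin.≟ i′
      ... | yes refl | _ = u , u∈ , (λ _ → refl) , (λ _ → refl)
      ... | no _ | yes refl = u , u∈′ , (λ _ → refl) , (λ _ → refl)
      ... | no ¬p | no ¬q = entry k (Fin.fromℕ< (pos k)) , entry∈ k _ , (λ e → ⊥-elim (¬p e)) , (λ e → ⊥-elim (¬q e))
      w = tabulate (λ k → proj₁ (pick k))
      w∈ : w ∈ᵗ x
      w∈ k = subst (_∈ lookup x k) (sym (lookup∘tabulate (λ k → proj₁ (pick k)) k)) (proj₁ (proj₂ (pick k)))
      pick-i : ∀ k → k ≡ i → proj₁ (pick k) ≡ u
      pick-i k = proj₁ (proj₂ (proj₂ (pick k)))
      pick-i′ : ∀ k → k ≡ i′ → proj₁ (pick k) ≡ u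
      pick-i′ k = proj₂ (proj₂ (proj₂ (pick k)))
      w≡ : ∀ k → proj₁ (pick k) ≡ u → lookup w k ≡ u
      w≡ k e = trans (lookup∘tabulate (λ k → proj₁ (pick k)) k) e

    embedding-injective : ∀ {v v′} → embedding v ≡ embedding v′ → v ≡ v′
    embedding-injective {v} {v′} e = trans (sym (proj₂ (position t v))) (trans (same (disjoint (entry∈ _ _) (subst (_∈ lookup x (partOf t v′)) (sym e) (entry∈ _ _))) e) (proj₂ (position t v′)))
      where
      cast-injective : ∀ {m n} (eq : m ≡ n) (j j′ : Fin m) → cast eq j ≡ cast eq j′ → j ≡ j′
      cast-injective eq j j′ e = trans (sym (Fin.cast-involutive (sym eq) eq j)) (trans (cong (cast (sym eq)) e) (Fin.cast-involutive (sym eq) eq j′))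
      same : ∀ {i i′ j j′} → i ≡ i′ → entry i j ≡ entry i′ j′ → vertex t i j ≡ vertex t i′ j′
      same {i} {j = j} {j′} refl e = cong (vertex t i) (cast-injective (sym (len i)) j j′ (lookup-injective (uniq i) e))

    isEmbedding : IsEmbedding (K t) embedding G
    isEmbedding = embedding-injective , edge
      where
      edge : ∀ e → K t e ≡ true → G (image embedding e) ≡ true
      edge e Ke with K-section⁻ t e Ke
      ... | σ , sec , refl = subst (λ s → G s ≡ true) (sym (image-edgeOf embedding σ)) (edges (tabulate (embedding ∘ σ)) member)
        where
        member : tabulate (embedding ∘ σ) ∈ᵗ x
        member i = subst₂ (λ u k → u ∈ lookup x k) (sym (lookup∘tabulate (embedding ∘ σ) i)) (sec i) (entry∈ _ _)

  -- The converse comparison for a host with labelled blocks. As part i is taken from the block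
  -- `ι i` and blocks are disjoint, each list is recovered from the vertex set of the copy alone.
  -- Different tuples therefore give different copies, and no symmetry has to be divided out.
  tuples≤copies : ∀ {r n X} (a : Vec ℕ r) (G : Hypergraph n) → Uniform r G → (∀ i → 0 < lookup a i) →
    (ι : Fin r → Fin X → Fin n) → (∀ {i i′ v v′} → ι i v ≡ ι i′ v′ → i ≡ i′ × v ≡ v′) →
    (R : Vec (Fin X) r → Bool) → (∀ w → R w ≡ true → G (edgeOf (λ i → ι i (lookup w i))) ≡ true) →
    countᵇ (allR R) (tuples a (allFin X)) ≤ copies (K a) G
  tuples≤copies {r} {n} {X} a G uniform pos ι ι-inj R R⇒G = subst₂ _≤_ (length-filterᵇ _ (tuples a (allFin X))) (sym (copies≡length (K a) G))
    (length-≤-injective-relation Rel (filterᵇ-unique _ (tuples-unique a (allFin⁺ X))) total (λ {t} {t′} {c} → inj {t} {t′} {c}))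
    where
    Rel : Vec (List (Fin X)) r → Subset n × List (Subset n) → Set
    Rel t (W , F) = (∀ i v → v ∈ lookup t i → lookup W (ι i v) ≡ true) × (∀ u → lookup W u ≡ true → ∃₂ λ i v → v ∈ lookup t i × ι i v ≡ u)
    inTuples : ∀ {t} → t ∈ filterᵇ (allR R) (tuples a (allFin X)) → ∀ i → lookup t i ∈ sublists (allFin X) × length (lookup t i) ≡ lookup a i
    inTuples t∈ i = combos⊆sublists (lookup a i) (allFin X) (tuples⁻ a (allFin X) (proj₁ (filterᵇ⁻ _ (tuples a (allFin X)) t∈)) i)
    inj : ∀ {t t′ c} → t ∈ filterᵇ (allR R) (tuples a (allFin X)) → t′ ∈ filterᵇ (allR R) (tuples a (allFin X)) → Rel t c → Rel t′ c → t ≡ t′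
    inj {t} {t′} {c} t∈ t′∈ rel rel′ = vec-ext λ i → sublists-ext (allFin⁺ X) (proj₁ (inTuples t∈ i)) (proj₁ (inTuples t′∈ i)) (half t t′ c rel rel′ i , half t′ t c rel′ rel i)
      where
      half : ∀ t t′ c → Rel t c → Rel t′ c → ∀ i {v} → v ∈ lookup t i → v ∈ lookup t′ i
      half t t′ c (p , _) (_ , q) i {v} v∈ with q (ι i v) (p i v v∈)
      ... | i′ , v′ , v′∈ , e with ι-inj e
      ...   | refl , refl = v′∈
    module Embed (t : Vec (List (Fin X)) r) (t∈ : t ∈ filterᵇ (allR R) (tuples a (allFin X))) where
      parts : Fin r → List (Fin n)
      parts i = map (ι i) (lookup t i)
      x : Vec (List (Fin n)) r
      x = tabulate parts
      x≡ : ∀ i → lookup x i ≡ parts i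
      x≡ = lookup∘tabulate parts
      x⁻ : ∀ i {u} → u ∈ lookup x i → ∃ λ v → v ∈ lookup t i × u ≡ ι i v
      x⁻ i u∈ = ∈-map⁻ (ι i) (subst (_ ∈_) (x≡ i) u∈)
      x⁺ : ∀ i {v} → v ∈ lookup t i → ι i v ∈ lookup x i
      x⁺ i v∈ = subst (_ ∈_) (sym (x≡ i)) (∈-map⁺ (ι i) v∈)
      edge : ∀ w → w ∈ᵗ x → G (setOf w) ≡ true
      edge w w∈ = subst (λ s → G s ≡ true) (sym (setOf≡edgeOf w (λ i → ι i (lookup w₀ i)) (λ i → trans (proj₂ (proj₂ (x⁻ i (w∈ i)))) (cong (ι i) (sym (w₀≡ i))))))
        (R⇒G w₀ (allR⁻ R t (proj₂ (filterᵇ⁻ (allR R) (tuples a (allFin X)) t∈)) w₀ λ i → subst (_∈ lookup t i) (sym (w₀≡ i)) (proj₁ (proj₂ (x⁻ i (w∈ i))))))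
        where
        base : Fin r → Fin X
        base i = proj₁ (x⁻ i (w∈ i))
        w₀ : Vec (Fin X) r
        w₀ = tabulate base
        w₀≡ : ∀ i → lookup w₀ i ≡ base i
        w₀≡ = lookup∘tabulate base
      open FromLists a G uniform x (λ i → trans (cong length (x≡ i)) (trans (length-map (ι i) (lookup t i)) (proj₂ (inTuples t∈ i))))
        (λ i → subst Unique (sym (x≡ i)) (map⁺ (λ e → proj₂ (ι-inj e)) (sublists-members-unique (allFin⁺ X) (proj₁ (inTuples t∈ i))))) pos edge public
      finish : (∃₂ λ W F → (W , F) ∈ copyList (K a) G × (∀ v → lookup W (embedding v) ≡ true) × (∀ u → lookup W u ≡ true → ∃ λ v → embedding v ≡ u)) →
        ∃ λ c → c ∈ copyList (K a) G × Rel t c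
      finish (W , F , WF∈ , range⁺ , range⁻) = (W , F) , WF∈ , hits , λ u u∈ → covers u (range⁻ u u∈)
        where
        hits : ∀ i v → v ∈ lookup t i → lookup W (ι i v) ≡ true
        hits i v v∈ with onto i (x⁺ i v∈)
        ... | p , e = subst (λ u → lookup W u ≡ true) e (range⁺ p)
        covers : ∀ u → (∃ λ p → embedding p ≡ u) → ∃₂ λ i v → v ∈ lookup t i × ι i v ≡ u
        covers u (p , e) with x⁻ (partOf a p) (entry∈ (partOf a p) (proj₁ (position a p)))
        ... | v , v∈ , e′ = partOf a p , v , v∈ , trans (sym e′) e
    total : ∀ t → t ∈ filterᵇ (allR R) (tuples a (allFin X)) → ∃ λ c → c ∈ copyList (K a) G × Rel t c
    total t t∈ = Embed.finish t t∈ (copy-of-embedding (K a) G (Embed.embedding t t∈) (Embed.isEmbedding t t∈))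

-- Hypergraphs with r blocks, and how complete partite subhypergraphs sit in them

module PartiteHypergraphs where

  open import Defs
  open import Data.Bool using (Bool; true; _∧_)
  open import Data.Nat as ℕ using (ℕ; zero; suc; _≤_; _<_; z≤n)
  import Data.Nat.Properties as ℕ
  open import Data.Fin as Fin using (Fin; zero; suc; fromℕ; inject₁; inject≤; combine; remQuot)
  import Data.Fin.Properties as Fin
  open import Data.List as List using (List; []; _∷_; map; concatMap; length; allFin)
  open import Data.List.Properties using (length-tabulate)
  open import Data.List.Membership.Propositional using (_∈_)
  open import Data.List.Membership.Propositional.Properties using (∈-map⁺; ∈-allFin; ∈-lookup)
  open import Data.List.Relation.Unary.Any using (here; there)
  open import Data.List.Relation.Unary.Unique.Propositional.Properties using (allFin⁺)
  open import Data.Vec as Vec using (Vec; []; _∷_; lookup; tabulate; sum; _∷ʳ_)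
  open import Data.Vec.Properties using (lookup∘tabulate)
  open import Data.Product using (∃; ∃₂; _×_; _,_; proj₁; proj₂)
  open import Data.Sum using (_⊎_; inj₁; inj₂)
  open import Data.Bool.ListAction using (any)
  open import Data.Empty using (⊥-elim)
  open import Relation.Nullary using (¬_; Dec; yes; no)
  open import Relation.Nullary.Decidable using (⌊_⌋)
  open import Relation.Binary.PropositionalEquality hiding ([_])
  open import Function using (_∘_; id)
  open UniqueLists
  open FiniteFields
  open QuadraticTowers
  open TupleCounting
  open Sublists
  open Copies

  ∈⇒≤ΣL : ∀ {A : Set} (f : A → ℕ) {x xs} → x ∈ xs → f x ≤ ΣL f xs
  ∈⇒≤ΣL f (here refl) = ℕ.m≤m+n _ _
  ∈⇒≤ΣL f {xs = y ∷ xs} (there x∈) = ℕ.≤-trans (∈⇒≤ΣL f x∈) (ℕ.m≤n+m _ (f y))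

  ΣL-mono-∈ : ∀ {A : Set} {f g : A → ℕ} xs → (∀ x → x ∈ xs → f x ≤ g x) → ΣL f xs ≤ ΣL g xs
  ΣL-mono-∈ [] h = z≤n
  ΣL-mono-∈ (x ∷ xs) h = ℕ.+-mono-≤ (h x (here refl)) (ΣL-mono-∈ xs (λ y → h y ∘ there))

  averaging : ∀ {A : Set} (f : A → ℕ) xs q M → 0 < q → 0 < M → length xs ≤ q → M ≤ ΣL f xs → ∃ λ x → x ∈ xs × M ≤ f x ℕ.* q
  averaging {A} f xs q M@(suc M′) q>0 M>0 len M≤ = decide (search xs)
    where
    search : ∀ ys → (∃ λ x → x ∈ ys × M ≤ f x ℕ.* q) ⊎ (∀ x → x ∈ ys → q ℕ.* f x ≤ M′)
    search [] = inj₂ λ _ ()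
    search (y ∷ ys) with M ℕ.≤? f y ℕ.* q | search ys
    ... | yes le | _ = inj₁ (y , here refl , le)
    ... | no _ | inj₁ (x , x∈ , le) = inj₁ (x , there x∈ , le)
    ... | no ¬le | inj₂ none = inj₂ λ { x (here refl) → ℕ.s≤s⁻¹ (subst (_< M) (ℕ.*-comm (f x) q) (ℕ.≰⇒> ¬le)) ; x (there x∈) → none x x∈ }
    decide : (∃ λ x → x ∈ xs × M ≤ f x ℕ.* q) ⊎ (∀ x → x ∈ xs → q ℕ.* f x ≤ M′) → ∃ λ x → x ∈ xs × M ≤ f x ℕ.* q
    decide (inj₁ r) = r
    decide (inj₂ none) = ⊥-elim (ℕ.<-irrefl refl (ℕ.<-≤-trans (ℕ.*-monoʳ-< q {{ℕ.>-nonZero q>0}} (ℕ.n<1+n M′)) (begin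
      q ℕ.* M                            ≤⟨ ℕ.*-monoʳ-≤ q M≤ ⟩
      q ℕ.* ΣL f xs                      ≡⟨ ΣL-* q f xs ⟨
      ΣL (λ x → q ℕ.* f x) xs            ≤⟨ ΣL-mono-∈ xs none ⟩
      ΣL (λ _ → M′) xs                   ≡⟨ ΣL-const M′ xs ⟩
      length xs ℕ.* M′                   ≤⟨ ℕ.*-monoˡ-≤ M′ len ⟩
      q ℕ.* M′                           ∎)))
      where open ℕ.≤-Reasoning

  large-fibre : ∀ {p B} (f : Fin p → Fin B) M → B ℕ.* M < p →
    ∃₂ λ l (g : Fin (suc M) → Fin p) → (∀ {z z′} → g z ≡ g z′ → z ≡ z′) × (∀ z → f (g z) ≡ l)
  large-fibre {p} {B} f M BM<p with Fin.any? (λ l → suc M ℕ.≤? length (fibre l))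
    where
    fibre : Fin B → List (Fin p)
    fibre l = filterᵇ (λ j → ⌊ f j Fin.≟ l ⌋) (allFin p)
  ... | yes (l , big) = l , g , inj , label
    where
    fibre = filterᵇ (λ j → ⌊ f j Fin.≟ l ⌋) (allFin p)
    g : Fin (suc M) → Fin p
    g z = List.lookup fibre (inject≤ z big)
    inj : ∀ {z z′} → g z ≡ g z′ → z ≡ z′
    inj e = Fin.inject≤-injective big big _ _ (lookup-injective (filterᵇ-unique _ (allFin⁺ p)) e)
    label : ∀ z → f (g z) ≡ l
    label z = ⌊⌋⁻ (f (g z) Fin.≟ l) (proj₂ (filterᵇ⁻ (λ j → ⌊ f j Fin.≟ l ⌋) (allFin p) (∈-lookup {xs = fibre} (inject≤ z big))))
  ... | no none = ⊥-elim (ℕ.<-irrefl refl (ℕ.<-≤-trans BM<p (begin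
    p                                                             ≡⟨ length-tabulate {n = p} id ⟨
    length (allFin p)                                             ≡⟨ length-ΣL (allFin p) ⟩
    ΣL (λ _ → 1) (allFin p)                                       ≤⟨ ΣL-mono covered (allFin p) ⟩
    ΣL (λ j → ΣL (λ l → ⟦ ⌊ f j Fin.≟ l ⌋ ⟧) (allFin B)) (allFin p) ≡⟨ ΣL-swap (λ j l → ⟦ ⌊ f j Fin.≟ l ⌋ ⟧) (allFin p) (allFin B) ⟩
    ΣL (λ l → countᵇ (λ j → ⌊ f j Fin.≟ l ⌋) (allFin p)) (allFin B) ≤⟨ ΣL-mono small (allFin B) ⟩
    ΣL (λ _ → M) (allFin B)                                       ≡⟨ ΣL-const M (allFin B) ⟩
    length (allFin B) ℕ.* M                                       ≡⟨ cong (ℕ._* M) (length-tabulate {n = B} id) ⟩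
    B ℕ.* M                                                       ∎)))
    where
    open ℕ.≤-Reasoning
    covered : ∀ j → 1 ≤ ΣL (λ l → ⟦ ⌊ f j Fin.≟ l ⌋ ⟧) (allFin B)
    covered j = ℕ.≤-trans (ℕ.≤-reflexive (cong ⟦_⟧ (sym (⌊⌋⁺ (f j Fin.≟ f j) refl)))) (∈⇒≤ΣL (λ l → ⟦ ⌊ f j Fin.≟ l ⌋ ⟧) (∈-allFin (f j)))
    small : ∀ l → countᵇ (λ j → ⌊ f j Fin.≟ l ⌋) (allFin p) ≤ M
    small l = ℕ.≤-trans (ℕ.≤-reflexive (sym (length-filterᵇ _ (allFin p)))) (ℕ.s≤s⁻¹ (ℕ.≰⇒> λ big → none (l , big)))

  allVecs : ∀ X r → List (Vec (Fin X) r)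
  allVecs X zero = [] ∷ []
  allVecs X (suc r) = concatMap (λ v → map (v ∷_) (allVecs X r)) (allFin X)

  allVecs-complete : ∀ {X r} (w : Vec (Fin X) r) → w ∈ allVecs X r
  allVecs-complete [] = here refl
  allVecs-complete {X} {suc r} (v ∷ w) = concatMap⁺ (λ v → map (v ∷_) (allVecs X r)) (∈-allFin v) (∈-map⁺ (v ∷_) (allVecs-complete w))

  -- The r blocks of X vertices occupy the first r X of the n vertices; the others are isolated.
  -- This is how a construction tied to a prime serves every n.
  module Partite {r X n} (R : Vec (Fin X) r → Bool) (rX≤n : r ℕ.* X ≤ n) where

    ι : Fin r → Fin X → Fin n
    ι i v = inject≤ (combine i v) rX≤n

    ι-injective : ∀ {i i′ v v′} → ι i v ≡ ι i′ v′ → i ≡ i′ × v ≡ v′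
    ι-injective {i} {i′} {v} {v′} e = Fin.combine-injective i v i′ v′ (Fin.inject≤-injective rX≤n rX≤n (combine i v) (combine i′ v′) e)

    spread : Vec (Fin X) r → Fin r → Fin n
    spread w i = ι i (lookup w i)

    partite : Hypergraph n
    partite e = any (λ w → R w ∧ eqSub (edgeOf (spread w)) e) (allVecs X r)

    partite⁺ : ∀ w → R w ≡ true → partite (edgeOf (spread w)) ≡ true
    partite⁺ w Rw = any⁺ _ (allVecs-complete w) (∧⁺ Rw (eqSub⁺ {u = edgeOf (spread w)} refl))

    partite⁻ : ∀ e → partite e ≡ true → ∃ λ w → R w ≡ true × edgeOf (spread w) ≡ e
    partite⁻ e h with any⁻ (λ w → R w ∧ eqSub (edgeOf (spread w)) e) (allVecs X r) h
    ... | w , _ , h′ = w , proj₁ (∧⁻ h′) , eqSub⁻ (proj₂ (∧⁻ {R w} h′))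

    uniform : Uniform r partite
    uniform e h with partite⁻ e h
    ... | w , _ , refl = setOf-injective⇒card (tabulate (spread w))
      λ {i} {j} eq → proj₁ (ι-injective (trans (sym (lookup∘tabulate (spread w) i)) (trans eq (lookup∘tabulate (spread w) j))))

    -- An embedded complete r-partite hypergraph respects the partition: part i goes to block π i.
    module Alignment (t : Vec ℕ r) (pos : ∀ i → 0 < lookup t i) (φ : Fin (sum t) → Fin n) (emb : IsEmbedding (K t) φ partite) where

      Choice : Set
      Choice = ∀ i → Fin (lookup t i)

      point : ∀ i → Fin (lookup t i) → Fin n
      point i j = φ (vertex t i j)

      point-part : ∀ {i i′ j j′} → point i j ≡ point i′ j′ → i ≡ i′
      point-part {i} {i′} e = trans (sym (partOf-vertex t i _)) (trans (cong (partOf t) (proj₁ emb e)) (partOf-vertex t i′ _))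

      abstract
        witness : ∀ (c : Choice) → ∃ λ w → R w ≡ true × edgeOf (spread w) ≡ edgeOf (λ i → point i (c i))
        witness c = partite⁻ _ (embedding-edges t partite φ emb (λ i → vertex t i (c i)) (λ i → partOf-vertex t i (c i)))

      word : Choice → Vec (Fin X) r
      word c = proj₁ (witness c)

      abstract
        block : ∀ c i → ∃ λ j → spread (word c) j ≡ point i (c i)
        block c i = edgeOf⁻ (spread (word c)) (point i (c i))
          (subst (λ s → lookup s (point i (c i)) ≡ true) (sym (proj₂ (proj₂ (witness c)))) (edgeOf⁺ (λ i → point i (c i)) i))

      base : Choice
      base i = Fin.fromℕ< (pos i)

      π : Fin r → Fin r
      π i = proj₁ (block base i)

      π-point : ∀ i → spread (word base) (π i) ≡ point i (base i)
      π-point i = proj₂ (block base i)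

      π-injective : ∀ {i i′} → π i ≡ π i′ → i ≡ i′
      π-injective {i} {i′} e = point-part (trans (sym (π-point i)) (trans (cong (spread (word base)) e) (π-point i′)))

      abstract
        modified : ∀ i → Fin (lookup t i) → Choice
        modified i j i′ with i Fin.≟ i′
        ... | yes refl = j
        ... | no _ = base i′

        modified-same : ∀ i j → modified i j i ≡ j
        modified-same i j with i Fin.≟ i
        ... | yes refl = refl
        ... | no ne = ⊥-elim (ne refl)

        modified-other : ∀ i j i′ → ¬ i ≡ i′ → modified i j i′ ≡ base i′
        modified-other i j i′ ne with i Fin.≟ i′
        ... | yes e = ⊥-elim (ne e)
        ... | no _ = refl

      block-of-other : ∀ i j i′ → ¬ i ≡ i′ → π i′ ≡ proj₁ (block (modified i j) i′)
      block-of-other i j i′ ne = proj₁ (ι-injective {v = lookup (word base) (π i′)} {v′ = lookup (word (modified i j)) (proj₁ (block (modified i j) i′))}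
        (trans (π-point i′) (trans (cong (point i′) (sym (modified-other i j i′ ne))) (sym (proj₂ (block (modified i j) i′))))))

      -- Replacing the vertex in part i leaves the other vertices of the edge in their blocks, by
      -- `block-of-other`. An edge meets every block exactly once, so the new vertex must take the
      -- one block that is left, and that is `π i`.
      block-of-modified : ∀ i j → proj₁ (block (modified i j) i) ≡ π i
      block-of-modified i j = conclude (injective⇒surjective π π-injective k)
        where
        c = modified i j
        k = proj₁ (block c i)
        conclude : (∃ λ i′ → π i′ ≡ k) → k ≡ π i
        conclude (i′ , π≡) = cases (i Fin.≟ i′)
          where
          cases : Dec (i ≡ i′) → k ≡ π i
          cases (yes i≡i′) = trans (sym π≡) (cong π (sym i≡i′))
          cases (no ne) = ⊥-elim (ne (point-part (trans (sym (proj₂ (block c i)))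
            (trans (cong (spread (word c)) (trans (sym π≡) (block-of-other i j i′ ne))) (proj₂ (block c i′))))))

      same-block : ∀ i j → ∃ λ v → ι (π i) v ≡ point i j
      same-block i j = lookup (word (modified i j)) (π i) ,
        trans (cong (spread (word (modified i j))) (sym (block-of-modified i j))) (trans (proj₂ (block (modified i j) i)) (cong (point i) (modified-same i j)))

      coordinate : ∀ i → Fin (lookup t i) → Fin X
      coordinate i j = proj₁ (same-block i j)

      coordinate-injective : ∀ i {j j′} → coordinate i j ≡ coordinate i j′ → j ≡ j′
      coordinate-injective i {j} {j′} e = vertex-injective t i (proj₁ emb (trans (sym (proj₂ (same-block i j))) (trans (cong (ι (π i)) e) (proj₂ (same-block i j′)))))

      word-coordinate : ∀ c i → lookup (word c) (π i) ≡ coordinate i (c i)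
      word-coordinate c i = from-block (block c i)
        where
        from-block : (∃ λ j → spread (word c) j ≡ point i (c i)) → lookup (word c) (π i) ≡ coordinate i (c i)
        from-block (j , e) = trans (cong (lookup (word c)) (sym (proj₁ aligned))) (proj₂ aligned)
          where
          aligned : j ≡ π i × lookup (word c) j ≡ coordinate i (c i)
          aligned = ι-injective (trans e (sym (proj₂ (same-block i (c i)))))

      word-edge : ∀ c → R (word c) ≡ true
      word-edge c = proj₁ (proj₂ (witness c))

  -- Elimination by initial indices and the last one, fitting `s ∷ʳ p`, where the part of size p
  -- comes at the end.
  snocΠ : ∀ {r} {P : Fin (suc r) → Set} → (∀ i → P (inject₁ i)) → P (fromℕ r) → ∀ i → P i
  snocΠ {zero} f x zero = x
  snocΠ {suc r} f x zero = f zero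
  snocΠ {suc r} {P} f x (suc i) = snocΠ {P = P ∘ suc} (f ∘ suc) x i

  snocΠ-inject₁ : ∀ {r} {P : Fin (suc r) → Set} (f : ∀ i → P (inject₁ i)) (x : P (fromℕ r)) i → snocΠ {P = P} f x (inject₁ i) ≡ f i
  snocΠ-inject₁ {suc r} f x zero = refl
  snocΠ-inject₁ {suc r} {P} f x (suc i) = snocΠ-inject₁ {P = P ∘ suc} (f ∘ suc) x i

  snocΠ-fromℕ : ∀ {r} {P : Fin (suc r) → Set} (f : ∀ i → P (inject₁ i)) (x : P (fromℕ r)) → snocΠ {P = P} f x (fromℕ r) ≡ x
  snocΠ-fromℕ {zero} f x = refl
  snocΠ-fromℕ {suc r} {P} f x = snocΠ-fromℕ {P = P ∘ suc} (f ∘ suc) x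

  lookup-∷ʳ-inject₁ : ∀ {A : Set} {r} (xs : Vec A r) x i → lookup (xs ∷ʳ x) (inject₁ i) ≡ lookup xs i
  lookup-∷ʳ-inject₁ (y ∷ xs) x zero = refl
  lookup-∷ʳ-inject₁ (y ∷ xs) x (suc i) = lookup-∷ʳ-inject₁ xs x i

  lookup-∷ʳ-fromℕ : ∀ {A : Set} {r} (xs : Vec A r) x → lookup (xs ∷ʳ x) (fromℕ r) ≡ x
  lookup-∷ʳ-fromℕ [] x = refl
  lookup-∷ʳ-fromℕ (y ∷ xs) x = lookup-∷ʳ-fromℕ xs x

  -- Numbers the s₁ ⋯ s_(r-1) ways of choosing one vertex from each of the parts of these sizes;
  -- each choice supplies one norm equation for the vertices of the last part.
  decode : ∀ {r} (s : Vec ℕ r) → Fin (productV s) → ∀ i → Fin (lookup s i)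
  decode (a ∷ s) x zero = proj₁ (remQuot {a} (productV s) x)
  decode (a ∷ s) x (suc i) = decode s (proj₂ (remQuot {a} (productV s) x)) i

  decode-injective : ∀ {r} (s : Vec ℕ r) {x y} → (∀ i → decode s x i ≡ decode s y i) → x ≡ y
  decode-injective [] {zero} {zero} e = refl
  decode-injective (a ∷ s) {x} {y} e = trans (sym (Fin.combine-remQuot {a} (productV s) x))
    (trans (cong₂ combine (e zero) (decode-injective s (e ∘ suc))) (Fin.combine-remQuot {a} (productV s) y))

-- The norm hypergraph: its density and the absence of the forbidden subhypergraph

module NormHypergraph where

  open import Defs
  open import Data.Bool using (Bool; true)
  open import Data.Nat as ℕ using (ℕ; zero; suc; _∸_; _≤_; _<_; z≤n)
  import Data.Nat.Properties as ℕ
  open import Data.Nat.Divisibility using (_∣_; ∣⇒≤)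
  open import Data.Nat.Primality using (Prime)
  open import Data.Fin as Fin using (Fin; zero; suc; toℕ; fromℕ; inject₁; inject≤; combine; remQuot; finToFun; cast)
  import Data.Fin.Properties as Fin
  open import Data.Fin.Relation.Unary.Top using (view; ‵fromℕ; ‵inject₁)
  open import Data.List as List using (List; []; _∷_; length; allFin)
  open import Data.List.Properties using (length-tabulate)
  open import Data.List.Membership.Propositional using (_∈_)
  open import Data.List.Membership.Propositional.Properties using (∈-tabulate⁺; ∈-lookup)
  open import Data.List.Relation.Unary.Any using (here)
  open import Data.List.Relation.Unary.Unique.Propositional.Properties using (tabulate⁺)
  open import Data.Vec as Vec using (Vec; []; _∷_; lookup; tabulate; sum; _∷ʳ_; _++_)
  open import Data.Vec.Properties using (lookup∘tabulate; ∷-injective; ++-injective)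
  open import Data.Product using (∃; ∃₂; _×_; _,_; proj₁; proj₂)
  open import Data.Empty using (⊥-elim)
  open import Relation.Nullary using (¬_)
  open import Relation.Nullary.Decidable using (⌊_⌋)
  open import Relation.Binary.PropositionalEquality hiding ([_])
  open import Function using (_∘_; id)
  open UniqueLists
  open Primes
  open FiniteFields
  open QuadraticTowers
  open FrobeniusConjugates
  open NormEquations
  open TupleCounting
  open Sublists
  open Copies
  open PartiteHypergraphs

  module Construction (F : FiniteField) {q} (q-prime : Prime q) (q≡0 : FiniteField.nat F q ≡ FiniteField.0# F)
    (characteristic : ∀ n → FiniteField.nat F n ≡ FiniteField.0# F → q ∣ n)
    (κ : ℕ) (size≡ : FiniteField.size F ≡ q ℕ.^ (2 ℕ.^ suc κ)) (fixed : ∀ x → FiniteField._^_ F x (q ℕ.^ (2 ℕ.^ suc κ)) ≡ x)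
    (S B : ℕ) (B≤q : B ≤ q) where

    open FiniteField F
    open Products F
    open Conjugates F q-prime q≡0 κ size≡ fixed

    X : ℕ
    X = B ℕ.* q ℕ.^ S

    label : Fin X → Fin B
    label v = proj₁ (remQuot {B} (q ℕ.^ S) v)

    digit : Fin X → Fin S → Fin q
    digit v = finToFun (proj₂ (remQuot {B} (q ℕ.^ S) v))

    label-digit-injective : ∀ {v v′} → label v ≡ label v′ → (∀ j → digit v j ≡ digit v′ j) → v ≡ v′
    label-digit-injective {v} {v′} e d = trans (sym (Fin.combine-remQuot {B} (q ℕ.^ S) v))
      (trans (cong₂ combine e (finToFun-injective (proj₂ (remQuot {B} (q ℕ.^ S) v)) (proj₂ (remQuot {B} (q ℕ.^ S) v′)) d)) (Fin.combine-remQuot {B} (q ℕ.^ S) v′))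

    digits : Fin X → Vec Carrier S
    digits v = tabulate (λ j → nat (toℕ (digit v j)))

    chunk : Fin X → Vec Carrier (suc S)
    chunk v = nat (toℕ (label v)) ∷ digits v

    private
      nat-distinct : ∀ i j → i < j → j < q → ¬ nat i ≡ nat j
      nat-distinct i j i<j j<q e = ℕ.<-irrefl refl (ℕ.<-≤-trans (ℕ.≤-<-trans (ℕ.m∸n≤m j i) j<q)
        (∣⇒≤ {{ℕ.>-nonZero (ℕ.m<n⇒0<n∸m i<j)}} (characteristic (j ∸ i) (+-cancelˡ (nat i)
          (trans (sym (nat-+ i (j ∸ i))) (trans (cong nat (ℕ.m+[n∸m]≡n (ℕ.<⇒≤ i<j))) (trans (sym e) (sym (+-identityʳ (nat i))))))))))

    nat-injective : ∀ {i j} → i < q → j < q → nat i ≡ nat j → i ≡ j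
    nat-injective {i} {j} i<q j<q e = ℕ.≤-antisym (ℕ.≮⇒≥ λ lt → nat-distinct j i lt i<q (sym e)) (ℕ.≮⇒≥ λ lt → nat-distinct i j lt j<q e)

    digits-injective : ∀ {v v′} → digits v ≡ digits v′ → ∀ j → digit v j ≡ digit v′ j
    digits-injective {v} {v′} e j = Fin.toℕ-injective (nat-injective (Fin.toℕ<n (digit v j)) (Fin.toℕ<n (digit v′ j))
      (trans (sym (lookup∘tabulate (λ j → nat (toℕ (digit v j))) j)) (trans (cong (λ cs → lookup cs j) e) (lookup∘tabulate (λ j → nat (toℕ (digit v′ j))) j))))

    chunk-injective : ∀ {v v′} → chunk v ≡ chunk v′ → v ≡ v′
    chunk-injective {v} {v′} e = label-digit-injective
      (Fin.toℕ-injective (nat-injective (ℕ.<-≤-trans (Fin.toℕ<n (label v)) B≤q) (ℕ.<-≤-trans (Fin.toℕ<n (label v′)) B≤q) (proj₁ (∷-injective e))))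
      (digits-injective (proj₂ (∷-injective e)))

    -- Being fixed by the Frobenius powers is the form in which coefficients from the prime field
    -- are used: applying `Fr j` to a value then only moves the evaluation point to a conjugate.
    Rational : ∀ {n} → Vec Carrier n → Set
    Rational cs = ∀ j i → Fr j (lookup cs i) ≡ lookup cs i

    digits-rational : ∀ v → Rational (digits v)
    digits-rational v j i = subst (λ c → Fr j c ≡ c) (sym (lookup∘tabulate (λ j → nat (toℕ (digit v j))) i)) (Fr-nat j (toℕ (digit v i)))

    chunk-rational : ∀ v → Rational (chunk v)
    chunk-rational v j zero = Fr-nat j (toℕ (label v))
    chunk-rational v j (suc i) = digits-rational v j i

    Fr-eval : ∀ {n} (cs : Vec Carrier n) → Rational cs → ∀ j x → Fr j (eval cs x) ≡ eval cs (Fr j x)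
    Fr-eval [] rat j x = Fr-0 j
    Fr-eval (c ∷ cs) rat j x = trans (Fr-+ j c (x * eval cs x)) (cong₂ _+_ (rat j zero)
      (trans (Fr-* j x (eval cs x)) (cong (Fr j x *_) (Fr-eval cs (λ j i → rat j (suc i)) j x))))

    -- Linear independence of 1, θ, ..., θ^(D-1) over the prime field. Equality at θ carries over to
    -- the conjugates of θ, and two polynomials with n ≤ D coefficients that agree at n distinct
    -- points coincide.
    independent : ∀ {n} → n ≤ D → (cs ds : Vec Carrier n) → Rational cs → Rational ds → eval cs θ ≡ eval ds θ → cs ≡ ds
    independent {n} n≤D cs ds rat rat′ e = vec-ext (eval-injective F cs ds (λ i → conjugate (inject≤ i n≤D))
      (λ e → Fin.inject≤-injective n≤D n≤D _ _ (conjugate-injective e))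
      (λ i → trans (sym (Fr-eval cs rat (toℕ (inject≤ i n≤D)) θ)) (trans (cong (Fr (toℕ (inject≤ i n≤D))) e) (Fr-eval ds rat′ (toℕ (inject≤ i n≤D)) θ))))

    eval-++ : ∀ {m n} (cs : Vec Carrier m) (ds : Vec Carrier n) x → eval (cs ++ ds) x ≡ eval cs x + x ^ m * eval ds x
    eval-++ [] ds x = sym (trans (+-identityˡ _) (*-identityˡ _))
    eval-++ {suc m} (c ∷ cs) ds x = trans (cong (λ u → c + x * u) (eval-++ cs ds x))
      (trans (cong (c +_) (trans (distribˡ x _ _) (cong (x * eval cs x +_) (sym (*-assoc x (x ^ m) _))))) (sym (+-assoc c _ _)))

    coefficients : ∀ {r} → Vec (Fin X) r → Vec Carrier (r ℕ.* suc S)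
    coefficients [] = []
    coefficients (v ∷ w) = chunk v ++ coefficients w

    coefficients-injective : ∀ {r} (w w′ : Vec (Fin X) r) → coefficients w ≡ coefficients w′ → w ≡ w′
    coefficients-injective [] [] e = refl
    coefficients-injective (v ∷ w) (v′ ∷ w′) e with ++-injective (chunk v) (chunk v′) e
    ... | e₁ , e₂ = cong₂ _∷_ (chunk-injective e₁) (coefficients-injective w w′ e₂)

    ++-rational : ∀ {m n} (cs : Vec Carrier m) (ds : Vec Carrier n) → Rational cs → Rational ds → Rational (cs ++ ds)
    ++-rational [] ds rat rat′ = rat′
    ++-rational (c ∷ cs) ds rat rat′ j zero = rat j zero
    ++-rational (c ∷ cs) ds rat rat′ j (suc i) = ++-rational cs ds (λ j i → rat j (suc i)) rat′ j i

    coefficients-rational : ∀ {r} (w : Vec (Fin X) r) → Rational (coefficients w)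
    coefficients-rational [] j ()
    coefficients-rational (v ∷ w) = ++-rational (chunk v) (coefficients w) (chunk-rational v) (coefficients-rational w)

    value : ∀ {r} → Vec (Fin X) r → Carrier
    value w = eval (coefficients w) θ

    value-injective : ∀ {r} → r ℕ.* suc S ≤ D → (w w′ : Vec (Fin X) r) → value w ≡ value w′ → w ≡ w′
    value-injective room w w′ e = coefficients-injective w w′ (independent room (coefficients w) (coefficients w′) (coefficients-rational w) (coefficients-rational w′) e)

    -- The power θ^(k (S + 1)) at which the k-th block of exponents begins.
    weight : ∀ {r} → Fin r → Carrier
    weight zero = 1#
    weight (suc k) = θ ^ suc S * weight k

    θ≢0 : ¬ θ ≡ 0#
    θ≢0 e = proj₂ ∃generator (trans (cong (Fr (2 ℕ.^ κ)) e) (trans (Fr-0 (2 ℕ.^ κ)) (sym e)))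

    nonzero-* : ∀ {x y} → ¬ x ≡ 0# → ¬ y ≡ 0# → ¬ x * y ≡ 0#
    nonzero-* {x} x≢0 y≢0 e = y≢0 (integral x x≢0 e)

    nonzero-^ : ∀ {x} n → ¬ x ≡ 0# → ¬ x ^ n ≡ 0#
    nonzero-^ zero x≢0 e = 0≢1 (sym e)
    nonzero-^ (suc n) x≢0 = nonzero-* x≢0 (nonzero-^ n x≢0)

    weight≢0 : ∀ {r} (k : Fin r) → ¬ weight k ≡ 0#
    weight≢0 zero e = 0≢1 (sym e)
    weight≢0 (suc k) = nonzero-* (nonzero-^ (suc S) θ≢0) (weight≢0 k)

    contribution : ∀ {r} → Fin r → Fin X → Carrier
    contribution k v = weight k * eval (chunk v) θ

    -- The value is a sum of one contribution per part, so words differing only at `k` have values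
    -- differing by their contributions at `k`; the terms are moved across to avoid subtraction.
    value-exchange : ∀ {r} (k : Fin r) (w w′ : Vec (Fin X) r) → (∀ j → ¬ j ≡ k → lookup w j ≡ lookup w′ j) →
      value w + contribution k (lookup w′ k) ≡ value w′ + contribution k (lookup w k)
    value-exchange zero (v ∷ w) (v′ ∷ w′) agree with vec-ext {u = w} {v = w′} (λ j → agree (suc j) (λ ()))
    ... | refl = begin
      value (v ∷ w) + 1# * E′            ≡⟨ cong₂ _+_ (eval-++ (chunk v) (coefficients w) θ) (*-identityˡ E′) ⟩
      (E + R) + E′                       ≡⟨ trans (+-assoc E R E′) (trans (cong (E +_) (+-comm R E′)) (+-comm E (E′ + R))) ⟩
      (E′ + R) + E                       ≡⟨ cong₂ _+_ (eval-++ (chunk v′) (coefficients w) θ) (*-identityˡ E) ⟨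
      value (v′ ∷ w) + 1# * E            ∎
      where
      open ≡-Reasoning
      E = eval (chunk v) θ
      E′ = eval (chunk v′) θ
      R = θ ^ suc S * eval (coefficients w) θ
    value-exchange (suc k) (v ∷ w) (v′ ∷ w′) agree with agree zero (λ ())
    ... | refl = begin
      value (v ∷ w) + contribution (suc k) (lookup w′ k)          ≡⟨ cong₂ _+_ (eval-++ (chunk v) (coefficients w) θ) (*-assoc T (weight k) _) ⟩
      (E + T * value w) + T * contribution k (lookup w′ k)         ≡⟨ combine-terms (value w) (contribution k (lookup w′ k)) ⟩
      E + T * (value w + contribution k (lookup w′ k))             ≡⟨ cong (λ u → E + T * u) (value-exchange k w w′ (λ j ne → agree (suc j) (ne ∘ Fin.suc-injective))) ⟩
      E + T * (value w′ + contribution k (lookup w k))             ≡⟨ combine-terms (value w′) (contribution k (lookup w k)) ⟨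
      (E + T * value w′) + T * contribution k (lookup w k)         ≡⟨ cong₂ _+_ (eval-++ (chunk v) (coefficients w′) θ) (*-assoc T (weight k) _) ⟨
      value (v ∷ w′) + contribution (suc k) (lookup w k)          ∎
      where
      open ≡-Reasoning
      E = eval (chunk v) θ
      T = θ ^ suc S
      combine-terms : ∀ a b → (E + T * a) + T * b ≡ E + T * (a + b)
      combine-terms a b = trans (+-assoc E _ _) (cong (E +_) (sym (distribˡ T a b)))

    norm : Carrier → Carrier
    norm x = Π {D} (λ j → Fr (toℕ j) x)

    -- A box of S words in the remaining parts gives S norm equations for the part k.
    module Box {r} (room : r ℕ.* suc S ≤ D) (S≤D : S ≤ D) (k : Fin r) (c : Carrier) (M : ℕ)
      (words : Fin S → Fin (suc M) → Vec (Fin X) r) (v : Fin (suc M) → Fin X) (l : Fin B)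
      (at-k : ∀ b z → lookup (words b z) k ≡ v z)
      (off-k : ∀ b z z′ j → ¬ j ≡ k → lookup (words b z) j ≡ lookup (words b z′) j)
      (label≡ : ∀ z → label (v z) ≡ l)
      (v-injective : ∀ {z z′} → v z ≡ v z′ → z ≡ z′)
      (words-injective : ∀ {b b′} z → words b z ≡ words b′ z → b ≡ b′)
      (norms : ∀ b z → norm (value (words b z)) ≡ c) where

      private
        W : Carrier
        W = weight k

        -- The common factor of the digits in block k; the additional θ skips the coefficient that
        -- holds the label.
        u : Carrier
        u = W * θ

        u≢0 : ¬ u ≡ 0#
        u≢0 = nonzero-* (weight≢0 k) θ≢0

        Y : Fin (suc M) → Carrier
        Y z = u * eval (digits (v z)) θ

        a : Carrier
        a = W * nat (toℕ l)

        -- Takes the vertex of part k out of the word for z = 0 but leaves its label term, which all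
        -- vertices considered have in common. What remains, `H b`, does not depend on z.
        shift : Carrier
        shift = - contribution k (v zero) + a

        H : Fin S → Carrier
        H b = value (words b zero) + shift

        contribution≡ : ∀ z → contribution k (v z) ≡ a + Y z
        contribution≡ z = trans (distribˡ W _ _) (cong₂ _+_ (cong (λ l → W * nat (toℕ l)) (label≡ z)) (sym (*-assoc W θ _)))

        value≡ : ∀ b z → value (words b z) ≡ Y z + H b
        value≡ b z = +-cancelʳ (contribution k (v zero)) (begin
          value (words b z) + C₀                              ≡⟨ cong (λ t → value (words b z) + contribution k t) (at-k b zero) ⟨
          value (words b z) + contribution k (lookup (words b zero) k) ≡⟨ value-exchange k (words b z) (words b zero) (off-k b z zero) ⟩
          value (words b zero) + contribution k (lookup (words b z) k) ≡⟨ cong (λ t → value (words b zero) + contribution k t) (at-k b z) ⟩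
          V₀ + contribution k (v z)                           ≡⟨ cong (V₀ +_) (contribution≡ z) ⟩
          V₀ + (a + Y z)                                      ≡⟨ cong (λ t → V₀ + (t + Y z)) (trans (sym (+-identityˡ a)) (cong (_+ a) (sym (-‿inverseˡ C₀)))) ⟩
          V₀ + (((- C₀) + C₀ + a) + Y z)                      ≡⟨ rearrange V₀ (- C₀) C₀ a (Y z) ⟩
          (Y z + (V₀ + (- C₀ + a))) + C₀                      ∎)
          where
          open ≡-Reasoning
          C₀ = contribution k (v zero)
          V₀ = value (words b zero)
          rearrange : ∀ p n c a y → p + ((n + c + a) + y) ≡ (y + (p + (n + a))) + c
          rearrange = SemiringIdentities.rearrange commutativeSemiring

        y : Fin D → Fin (suc M) → Carrier
        y j z = Fr (toℕ j) (Y z)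

        h : Fin S → Fin D → Carrier
        h b j = Fr (toℕ j) (H b)

        equations : ∀ b z → Π (λ j → y j z + h b j) ≡ c
        equations b z = trans (Π-cong {D} (λ j → sym (trans (cong (Fr (toℕ j)) (value≡ b z)) (Fr-+ (toℕ j) (Y z) (H b))))) (norms b z)

        -- Equal shifts at one conjugate give equal values of two words with the same vertex in part
        -- k, hence equal words; here the blocks of exponents must fit into D.
        distinct : ∀ j {b b′} → h b j ≡ h b′ j → b ≡ b′
        distinct j e = words-injective zero (value-injective room _ _ (+-cancelʳ shift (Fr-injective (toℕ j) (ℕ.<⇒≤ (Fin.toℕ<n j)) e)))

        u-conj : Fin D → Carrier
        u-conj j = Fr (toℕ j) u

        u-conj≢0 : ∀ j → ¬ u-conj j ≡ 0#
        u-conj≢0 j e = u≢0 (Fr-injective (toℕ j) (ℕ.<⇒≤ (Fin.toℕ<n j)) (trans e (sym (Fr-0 (toℕ j)))))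

        y≡ : ∀ j z → y j z ≡ u-conj j * eval (digits (v z)) (conjugate j)
        y≡ j z = trans (Fr-* (toℕ j) u _) (cong (u-conj j *_) (Fr-eval (digits (v z)) (digits-rational (v z)) (toℕ j) θ))

        -- Up to the factor `u-conj j`, the j-th conjugate is the value at the j-th conjugate of θ
        -- of a polynomial with S coefficients. S of these values determine the polynomial, and
        -- interpolation makes this a linear relation with weights independent of z.
        dependent : ∀ (U : Fin S → Fin D) → (∀ {s s′} → U s ≡ U s′ → s ≡ s′) → ∀ j →
          ∃ λ (m : Fin S → Carrier) → ∀ z → y j z ≡ FiniteField.sum F (λ t → m t * y (U t) z)
        dependent U U-injective j = m , relation
          where
          interp = interpolation S (conjugate ∘ U) (U-injective ∘ conjugate-injective) (conjugate j)
          inv : Fin S → Carrier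
          inv t = proj₁ (inverse (u-conj (U t)) (u-conj≢0 (U t)))
          m : Fin S → Carrier
          m t = u-conj j * (proj₁ interp t * inv t)
          open ≡-Reasoning
          relation : ∀ z → y j z ≡ FiniteField.sum F (λ t → m t * y (U t) z)
          relation z = begin
            y j z                                                          ≡⟨ y≡ j z ⟩
            u-conj j * eval (digits (v z)) (conjugate j)                   ≡⟨ cong (u-conj j *_) (proj₂ interp (digits (v z))) ⟩
            u-conj j * FiniteField.sum F (λ t → proj₁ interp t * e t)      ≡⟨ *-distribˡ-sum (u-conj j) (λ t → proj₁ interp t * e t) ⟩
            FiniteField.sum F (λ t → u-conj j * (proj₁ interp t * e t))    ≡⟨ sum-cong term≡ ⟩
            FiniteField.sum F (λ t → m t * y (U t) z)                      ∎
            where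
            e : Fin S → Carrier
            e t = eval (digits (v z)) (conjugate (U t))
            term≡ : ∀ t → u-conj j * (proj₁ interp t * e t) ≡ m t * y (U t) z
            term≡ t = sym (begin
              m t * y (U t) z                                        ≡⟨ cong (m t *_) (y≡ (U t) z) ⟩
              u-conj j * (proj₁ interp t * inv t) * (u-conj (U t) * e t) ≡⟨ SemiringIdentities.regroup commutativeSemiring (u-conj j) (proj₁ interp t) (inv t) (u-conj (U t)) (e t) ⟩
              (u-conj (U t) * inv t) * (u-conj j * (proj₁ interp t * e t)) ≡⟨ cong (_* (u-conj j * (proj₁ interp t * e t))) (proj₂ (inverse (u-conj (U t)) (u-conj≢0 (U t)))) ⟩
              1# * (u-conj j * (proj₁ interp t * e t))               ≡⟨ *-identityˡ _ ⟩
              u-conj j * (proj₁ interp t * e t)                      ∎)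

        first : Fin D
        first = Fin.fromℕ< (ℕ.m^n>0 2 (suc κ))

        y-injective : ∀ {z z′} → y first z ≡ y first z′ → z ≡ z′
        y-injective {z} {z′} e = v-injective (label-digit-injective (trans (label≡ z) (sym (label≡ z′)))
          (digits-injective (independent S≤D (digits (v z)) (digits (v z′)) (digits-rational (v z)) (digits-rational (v z′))
            (*-cancelˡ u u≢0 (Fr-injective (toℕ first) (ℕ.<⇒≤ (Fin.toℕ<n first)) e)))))

      few : suc M ≤ solutionBound D S
      few = number-of-solutions F (suc M) D S y h (λ _ → c) equations distinct dependent first y-injective

    Π-^ : ∀ {n} (f : Fin n → Carrier) m → Π f ^ m ≡ Π (λ i → f i ^ m)
    Π-^ {zero} f m = 1^ m
    Π-^ {suc n} f m = trans (^-distrib-* (f zero) (Π (f ∘ suc)) m) (cong (f zero ^ m *_) (Π-^ (f ∘ suc) m))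

    Π-last : ∀ n (f : ℕ → Carrier) → Π {suc n} (f ∘ toℕ) ≡ Π {n} (f ∘ toℕ) * f n
    Π-last zero f = trans (*-identityʳ (f 0)) (sym (*-identityˡ (f 0)))
    Π-last (suc n) f = trans (cong (f 0 *_) (Π-last n (f ∘ suc))) (sym (*-assoc (f 0) _ _))

    Π-rotate : ∀ n (f : ℕ → Carrier) → 0 < n → f n ≡ f 0 → Π {n} (f ∘ suc ∘ toℕ) ≡ Π {n} (f ∘ toℕ)
    Π-rotate (suc n) f _ e = trans (Π-last n (f ∘ suc)) (trans (cong (Π {n} (f ∘ suc ∘ toℕ) *_) e) (*-comm _ (f 0)))

    -- Raising to the power q permutes the factors of the norm cyclically. Norms are thus roots of
    -- X^q - X, of which there are at most q.
    norm-fixed : ∀ x → norm x ^ q ≡ norm x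
    norm-fixed x = trans (Π-^ {D} (λ j → Fr (toℕ j) x) q) (trans (Π-cong {D} (λ j → sym (Fr-suc (toℕ j) x)))
      (Π-rotate D (λ j → Fr j x) (ℕ.m^n>0 2 (suc κ)) (trans (Fr-D x) (sym (Fr-zero x)))))

    normValues : List Carrier
    normValues = filterᵇ (λ c → ⌊ c ^ q ≟ c ⌋) (List.tabulate element)

    norm∈normValues : ∀ x → norm x ∈ normValues
    norm∈normValues x = filterᵇ⁺ (λ c → ⌊ c ^ q ≟ c ⌋) (subst (_∈ List.tabulate element) (element-index (norm x)) (∈-tabulate⁺ (index (norm x))))
      (⌊⌋⁺ (norm x ^ q ≟ norm x) (norm-fixed x))

    normValues≤q : length normValues ≤ q
    normValues≤q = fixed-points-bound q (length normValues) (prime>1 q-prime) (List.lookup normValues)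
      (lookup-injective (filterᵇ-unique _ (tabulate⁺ element-injective)))
      (λ i → ⌊⌋⁻ (List.lookup normValues i ^ q ≟ List.lookup normValues i) (proj₂ (filterᵇ⁻ (λ c → ⌊ c ^ q ≟ c ⌋) (List.tabulate element) (∈-lookup {xs = normValues} i))))

    relation : ∀ {r} → Carrier → Vec (Fin X) r → Bool
    relation c w = ⌊ norm (value w) ≟ c ⌋

    length-tuples-ones : ∀ {A : Set} r (V : List A) → length (tuples (ones r) V) ≡ length V ℕ.^ r
    length-tuples-ones zero V = refl
    length-tuples-ones (suc r) V = begin
      length (tuples (ones (suc r)) V)                          ≡⟨ length-ΣL (tuples (ones (suc r)) V) ⟩
      ΣL (λ _ → 1) (tuples (ones (suc r)) V)                    ≡⟨ ΣL-tuples (λ _ → 1) 1 (ones r) V ⟩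
      ΣL (λ x → ΣL (λ t → 1) (tuples (ones r) V)) (combos 1 V)  ≡⟨ ΣL-const _ (combos 1 V) ⟩
      length (combos 1 V) ℕ.* ΣL (λ t → 1) (tuples (ones r) V)  ≡⟨ cong₂ ℕ._*_ (trans (length-combos 1 V) (bin-1 (length V))) (trans (sym (length-ΣL (tuples (ones r) V))) (length-tuples-ones r V)) ⟩
      length V ℕ.* length V ℕ.^ r                               ∎
      where
      open ≡-Reasoning
      bin-1 : ∀ n → bin n 1 ≡ n
      bin-1 zero = refl
      bin-1 (suc n) = cong suc (bin-1 n)

    singleton-relation : ∀ {r} t → t ∈ tuples (ones r) (allFin X) → ∃ λ c → c ∈ normValues × allR (relation c) t ≡ true
    singleton-relation {r} t t∈ = norm (value w) , norm∈normValues (value w) ,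
        allR⁺ _ t λ w′ w′∈ → ⌊⌋⁺ (norm (value w′) ≟ norm (value w)) (cong (norm ∘ value) (vec-ext {u = w′} {v = w} λ i → unique i (w′∈ i)))
      where
      length≡1 : ∀ i → length (lookup t i) ≡ 1
      length≡1 i = trans (proj₂ (combos⊆sublists (lookup (ones r) i) (allFin X) (tuples⁻ (ones r) (allFin X) t∈ i))) (lookup-ones r i)
        where
        lookup-ones : ∀ r (i : Fin r) → lookup (ones r) i ≡ 1
        lookup-ones (suc r) zero = refl
        lookup-ones (suc r) (suc i) = lookup-ones r i
      single : ∀ {A : Set} (xs : List A) → length xs ≡ 1 → ∃ λ x → xs ≡ x ∷ []
      single (x ∷ []) _ = x , refl
      the : Fin r → Fin X
      the i = proj₁ (single (lookup t i) (length≡1 i))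
      w : Vec (Fin X) r
      w = tabulate the
      unique : ∀ i {x} → x ∈ lookup t i → x ≡ lookup w i
      unique i {x} x∈ = trans (only (subst (x ∈_) (proj₂ (single (lookup t i) (length≡1 i))) x∈)) (sym (lookup∘tabulate the i))
        where
        only : ∀ {A : Set} {x y : A} → x ∈ y ∷ [] → x ≡ y
        only (here e) = e

    popular-norm : ∀ r → 0 < X → ∃ λ c → X ℕ.^ r ≤ countᵇ (allR (relation c)) (tuples (ones r) (allFin X)) ℕ.* q
    popular-norm r X>0 = finish (averaging (λ c → countᵇ (allR (relation c)) Ts) normValues q (X ℕ.^ r) (prime>0 q-prime)
        (ℕ.m^n>0 X {{ℕ.>-nonZero X>0}} r) normValues≤q enough)
      where
      Ts = tuples (ones r) (allFin X)
      finish : (∃ λ c → c ∈ normValues × X ℕ.^ r ≤ countᵇ (allR (relation c)) Ts ℕ.* q) → ∃ λ c → X ℕ.^ r ≤ countᵇ (allR (relation c)) Ts ℕ.* q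
      finish (c , _ , le) = c , le
      open ℕ.≤-Reasoning
      hit : ∀ t → t ∈ Ts → 1 ≤ ΣL (λ c → ⟦ allR (relation c) t ⟧) normValues
      hit t t∈ = from-witness (singleton-relation t t∈)
        where
        from-witness : (∃ λ c → c ∈ normValues × allR (relation c) t ≡ true) → 1 ≤ ΣL (λ c → ⟦ allR (relation c) t ⟧) normValues
        from-witness (c , c∈ , e) = ℕ.≤-trans (ℕ.≤-reflexive (cong ⟦_⟧ (sym e))) (∈⇒≤ΣL (λ c → ⟦ allR (relation c) t ⟧) c∈)
      enough : X ℕ.^ r ≤ ΣL (λ c → countᵇ (allR (relation c)) Ts) normValues
      enough = begin
        X ℕ.^ r                                                          ≡⟨ cong (ℕ._^ r) (length-tabulate {n = X} id) ⟨
        length (allFin X) ℕ.^ r                                          ≡⟨ length-tuples-ones r (allFin X) ⟨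
        length Ts                                                        ≡⟨ length-ΣL Ts ⟩
        ΣL (λ _ → 1) Ts                                                  ≤⟨ ΣL-mono-∈ Ts hit ⟩
        ΣL (λ t → ΣL (λ c → ⟦ allR (relation c) t ⟧) normValues) Ts      ≡⟨ ΣL-swap (λ t c → ⟦ allR (relation c) t ⟧) Ts normValues ⟩
        ΣL (λ c → countᵇ (allR (relation c)) Ts) normValues              ∎

    module _ {k n} (s : Vec ℕ (suc k)) (S≡ : productV s ≡ S) (s-pos : ∀ i → 0 < lookup s i) (p : ℕ)
      (room : suc (suc k) ℕ.* suc S ≤ D) (S≤D : S ≤ D) (p-large : B ℕ.* solutionBound D S < p) (c : Carrier)
      (rX≤n : suc (suc k) ℕ.* X ≤ n) where

      open Partite {suc (suc k)} {X} {n} (relation c) rX≤n using (partite; module Alignment)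

      -- Among the p vertices of the last part more than `solutionBound D S` share a label, by the
      -- choice of p. The S choices in the other parts make all of them solutions of one system,
      -- which is too many. The last part may lie in any block of the host, which is why `Box` is
      -- stated for an arbitrary k.
      no-embedding : ∀ φ → ¬ IsEmbedding (K (s ∷ʳ p)) φ partite
      no-embedding φ emb = ℕ.<-irrefl refl (conclude (large-fibre (label ∘ last-coordinate) (solutionBound D S) p-large))
        where
        t = s ∷ʳ p
        pos : ∀ i → 0 < lookup t i
        pos = snocΠ {P = λ i → 0 < lookup t i} (λ i → subst (0 <_) (sym (lookup-∷ʳ-inject₁ s p i)) (s-pos i))
          (subst (0 <_) (sym (lookup-∷ʳ-fromℕ s p)) (ℕ.≤-<-trans z≤n p-large))
        open Alignment t pos φ emb
        top : Fin (suc (suc k))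
        top = fromℕ (suc k)
        inner : Fin (productV s) → ∀ i → Fin (lookup t (inject₁ i))
        inner b i = cast (sym (lookup-∷ʳ-inject₁ s p i)) (decode s b i)
        outer : Fin p → Fin (lookup t top)
        outer = cast (sym (lookup-∷ʳ-fromℕ s p))
        choice : Fin (productV s) → Fin p → Choice
        choice b j = snocΠ {P = λ i → Fin (lookup t i)} (inner b) (outer j)
        cast-injective : ∀ {m n} (eq : m ≡ n) {i j : Fin m} → cast eq i ≡ cast eq j → i ≡ j
        cast-injective eq {i} {j} e = trans (sym (Fin.cast-involutive (sym eq) eq i)) (trans (cong (cast (sym eq)) e) (Fin.cast-involutive (sym eq) eq j))
        last-coordinate : Fin p → Fin X
        last-coordinate j = coordinate top (outer j)
        at-top : ∀ b j → lookup (word (choice b j)) (π top) ≡ last-coordinate j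
        at-top b j = trans (word-coordinate (choice b j) top) (cong (coordinate top) (snocΠ-fromℕ {P = λ i → Fin (lookup t i)} (inner b) (outer j)))
        at-inner : ∀ b j i → lookup (word (choice b j)) (π (inject₁ i)) ≡ coordinate (inject₁ i) (inner b i)
        at-inner b j i = trans (word-coordinate (choice b j) (inject₁ i)) (cong (coordinate (inject₁ i)) (snocΠ-inject₁ {P = λ i → Fin (lookup t i)} (inner b) (outer j) i))
        off-top : ∀ b j j′ m → ¬ m ≡ π top → lookup (word (choice b j)) m ≡ lookup (word (choice b j′)) m
        off-top b j j′ m m≢ = from-preimage (injective⇒surjective π π-injective m)
          where
          from-preimage : (∃ λ i → π i ≡ m) → lookup (word (choice b j)) m ≡ lookup (word (choice b j′)) m
          from-preimage (i , e) with view i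
          ... | ‵fromℕ = ⊥-elim (m≢ (sym e))
          ... | ‵inject₁ i′ = subst (λ m → lookup (word (choice b j)) m ≡ lookup (word (choice b j′)) m) e (trans (at-inner b j i′) (sym (at-inner b j′ i′)))
        conclude : (∃₂ λ l (g : Fin (suc (solutionBound D S)) → Fin p) → (∀ {z z′} → g z ≡ g z′ → z ≡ z′) × (∀ z → label (last-coordinate (g z)) ≡ l)) →
          solutionBound D S < solutionBound D S
        conclude (l , g , g-injective , g-label) = Box.few room S≤D (π top) c (solutionBound D S)
          (λ b z → word (choice (box b) (g z))) (last-coordinate ∘ g) l (λ b z → at-top (box b) (g z))
          (λ b z z′ m → off-top (box b) (g z) (g z′) m) g-label
          (λ e → g-injective (cast-injective (sym (lookup-∷ʳ-fromℕ s p)) (coordinate-injective top e)))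
          (λ {b} {b′} z e → cast-injective (sym S≡) (decode-injective s λ i → cast-injective (sym (lookup-∷ʳ-inject₁ s p i)) (coordinate-injective (inject₁ i)
            (trans (sym (at-inner (box b) (g z) i)) (trans (cong (λ w → lookup w (π (inject₁ i))) e) (at-inner (box b′) (g z) i))))))
          (λ b z → ⌊⌋⁻ (norm (value (word (choice (box b) (g z)))) ≟ c) (word-edge (choice (box b) (g z))))
          where
          box : Fin S → Fin (productV s)
          box = cast (sym S≡)

      partite-free : Free (K (s ∷ʳ p)) partite
      partite-free = no-embedding⇒free (K (s ∷ʳ p)) partite no-embedding

-- The two bounds, the choice of the prime, and the theorem

open import Defs
open import Data.Bool using (Bool; true)
open import Data.Nat using (ℕ; zero; suc; _+_; _*_; _∸_; _^_; _≤_; _<_; z≤n; s≤s; NonZero; >-nonZero; _<?_)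
open import Data.Nat.Properties
open import Data.Nat.Primality using (Prime)
open import Data.Fin using (Fin; zero; suc; fromℕ; inject₁) renaming (_≤_ to _≤ᶠ_)
open import Data.List as List using (List; []; _∷_; length; allFin; take)
open import Data.List.Properties using (length-tabulate; length-take)
open import Data.List.Membership.Propositional using (_∈_)
open import Data.List.Membership.Propositional.Properties using (∈-map⁻)
open import Data.List.Relation.Unary.Any using (here; there)
open import Data.List.Relation.Unary.Unique.Propositional using (Unique)
open import Data.List.Relation.Unary.Unique.Propositional.Properties using (allFin⁺; take⁺)
open import Data.Vec using (Vec; []; _∷_; lookup; tabulate; sum; _∷ʳ_)
open import Data.Vec.Properties using (lookup∘tabulate)
open import Data.Product using (Σ; ∃; _×_; _,_; proj₁; proj₂)
open import Data.Empty using (⊥-elim)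
open import Data.Unit using (⊤; tt)
open import Relation.Nullary using (yes; no)
open import Relation.Binary.PropositionalEquality hiding ([_])
open import Function using (_∘_; id)
open Primes
open QuadraticTowers
open NormEquations
open TupleCounting
open Sublists
open Copies
open PartiteHypergraphs
open NormHypergraph

productV-mono : ∀ {r} (as ss : Vec ℕ r) → (∀ i → lookup as i ≤ lookup ss i) → productV as ≤ productV ss
productV-mono [] [] _ = ≤-refl
productV-mono (a ∷ as) (s ∷ ss) le = *-mono-≤ (le zero) (productV-mono as ss (le ∘ suc))

productV>0 : ∀ {r} (ss : Vec ℕ r) → (∀ i → 0 < lookup ss i) → 0 < productV ss
productV>0 [] _ = s≤s z≤n
productV>0 (s ∷ ss) pos = *-mono-≤ (pos zero) (productV>0 ss (pos ∘ suc))

-- `u` is the product of those s that belong to the parts already fixed. In the weight a₁ stands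
-- where the current s stands in the product S, so a₁ ≤ s yields a₁ u Π `as` ≤ u s Π `ss` ≤ S; this
-- is the only comparison of a₁ with the s_i that the upper bound makes.
admissible : ∀ {r} (as ss : Vec ℕ r) a₁ u S → (∀ i → 0 < lookup ss i) → (∀ i → lookup as i ≤ lookup ss i) → (∀ i → a₁ ≤ lookup ss i) →
  u * productV ss ≤ S → Admissible S (a₁ * u) as ss
admissible [] [] a₁ u S _ _ _ _ = tt
admissible (a ∷ as) (s ∷ ss) a₁ u S pos as≤ a₁≤ u≤ = pos zero , as≤ zero , weight≤ ,
  subst (λ w → Admissible S w as ss) (sym (*-assoc a₁ u s)) (admissible as ss a₁ (u * s) S (pos ∘ suc) (as≤ ∘ suc) (a₁≤ ∘ suc) (subst (_≤ S) (sym (*-assoc u s (productV ss))) u≤))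
  where
  open ≤-Reasoning
  weight≤ : a₁ * u * productV as ≤ S
  weight≤ = begin
    a₁ * u * productV as    ≤⟨ *-mono-≤ (*-monoˡ-≤ u (a₁≤ zero)) (productV-mono as ss (as≤ ∘ suc)) ⟩
    s * u * productV ss     ≡⟨ cong (_* productV ss) (*-comm s u) ⟩
    u * s * productV ss     ≡⟨ *-assoc u s (productV ss) ⟩
    u * (s * productV ss)   ≤⟨ u≤ ⟩
    S                       ∎

tailsBounded : ∀ {r} (as ss : Vec ℕ r) S → (∀ i → 0 < lookup ss i) → (∀ i → lookup as i ≤ lookup ss i) → productV ss ≤ S → TailsBounded S as
tailsBounded [] [] S _ _ _ = tt
tailsBounded (a ∷ as) (s ∷ ss) S pos le bound = ≤-trans (productV-mono as ss (le ∘ suc)) tail≤ , tailsBounded as ss S (pos ∘ suc) (le ∘ suc) tail≤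
  where
  tail≤ : productV ss ≤ S
  tail≤ = ≤-trans (m≤n*m (productV ss) s {{>-nonZero (pos zero)}}) bound

positive : ∀ {r} (bs : Vec ℕ r) → (∀ i → 0 < lookup bs i) → Positive bs
positive [] _ = tt
positive (b ∷ bs) pos = pos zero , positive bs (pos ∘ suc)

1≤partSizeConst : ∀ {r} (bs : Vec ℕ r) → 1 ≤ partSizeConst bs
1≤partSizeConst [] = ≤-refl
1≤partSizeConst (b ∷ bs) = ≤-trans (1≤partSizeConst bs) (m≤n+m _ _)

∈-take⁻ : ∀ {A : Set} n (xs : List A) {x} → x ∈ take n xs → x ∈ xs
∈-take⁻ (suc n) (x ∷ xs) (here e) = here e
∈-take⁻ (suc n) (x ∷ xs) (there x∈) = there (∈-take⁻ n xs x∈)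

-- p common neighbours of a box would complete a copy of K (ss ∷ʳ p).
common-neighbours<p : ∀ {r n} (ss : Vec ℕ r) p (G : Hypergraph n) → Uniform (suc r) G → Free (K (ss ∷ʳ p)) G →
  (∀ i → 0 < lookup ss i) → 0 < p → ∀ t → t ∈ tuples ss (allFin n) →
  countᵇ (λ v → allR (λ w → G (setOf (v ∷ w))) t) (allFin n) < p
common-neighbours<p {r} {n} ss p G uniform free pos p>0 t t∈ = ≰⇒> λ p≤ → free⇒no-embedding (K (ss ∷ʳ p)) G free _ (embed p≤)
  where
  adjacent : Fin n → Bool
  adjacent v = allR (λ w → G (setOf (v ∷ w))) t
  common : List (Fin n)
  common = filterᵇ adjacent (allFin n)
  x : Vec (List (Fin n)) (suc r)
  x = t ∷ʳ take p common
  in-combos : ∀ i → lookup t i ∈ sublists (allFin n) × length (lookup t i) ≡ lookup ss i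
  in-combos i = combos⊆sublists (lookup ss i) (allFin n) (tuples⁻ ss (allFin n) t∈ i)
  uniq : ∀ i → Unique (lookup x i)
  uniq = snocΠ {P = λ i → Unique (lookup x i)}
    (λ i → subst Unique (sym (lookup-∷ʳ-inject₁ t (take p common) i)) (sublists-members-unique (allFin⁺ n) (proj₁ (in-combos i))))
    (subst Unique (sym (lookup-∷ʳ-fromℕ t (take p common))) (take⁺ p (filterᵇ-unique adjacent (allFin⁺ n))))
  pos′ : ∀ i → 0 < lookup (ss ∷ʳ p) i
  pos′ = snocΠ {P = λ i → 0 < lookup (ss ∷ʳ p) i} (λ i → subst (0 <_) (sym (lookup-∷ʳ-inject₁ ss p i)) (pos i)) (subst (0 <_) (sym (lookup-∷ʳ-fromℕ ss p)) p>0)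
  edge : ∀ w → w ∈ᵗ x → G (setOf w) ≡ true
  edge w w∈ = subst (λ s → G s ≡ true) (sym same) (allR⁻ (λ w → G (setOf (v ∷ w))) t
      (proj₂ (filterᵇ⁻ adjacent (allFin n) (∈-take⁻ p common (subst (v ∈_) (lookup-∷ʳ-fromℕ t (take p common)) (w∈ (fromℕ r)))))) w′
      λ i → subst₂ _∈_ (sym (w′≡ i)) (lookup-∷ʳ-inject₁ t (take p common) i) (w∈ (inject₁ i)))
    where
    v : Fin n
    v = lookup w (fromℕ r)
    w′ : Vec (Fin n) r
    w′ = tabulate (lookup w ∘ inject₁)
    w′≡ : ∀ i → lookup w′ i ≡ lookup w (inject₁ i)
    w′≡ = lookup∘tabulate (lookup w ∘ inject₁)
    -- The common neighbour comes first in the count of tuples but last in `ss ∷ʳ p`; as edges are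
    -- sets, the order is immaterial.
    same : setOf w ≡ setOf (v ∷ w′)
    same = setOf-ext w (v ∷ w′)
      (snocΠ {P = λ i → ∃ λ j → lookup w i ≡ lookup (v ∷ w′) j} (λ i → suc i , sym (w′≡ i)) (zero , refl))
      (λ { zero → fromℕ r , refl ; (suc i) → inject₁ i , w′≡ i })
  module _ (p≤ : p ≤ countᵇ adjacent (allFin n)) where
    len : ∀ i → length (lookup x i) ≡ lookup (ss ∷ʳ p) i
    len = snocΠ {P = λ i → length (lookup x i) ≡ lookup (ss ∷ʳ p) i}
      (λ i → trans (cong length (lookup-∷ʳ-inject₁ t (take p common) i)) (trans (proj₂ (in-combos i)) (sym (lookup-∷ʳ-inject₁ ss p i))))
      (trans (cong length (lookup-∷ʳ-fromℕ t (take p common))) (trans (length-take p common)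
        (trans (m≤n⇒m⊓n≡m (subst (p ≤_) (sym (length-filterᵇ adjacent (allFin n))) p≤)) (sym (lookup-∷ʳ-fromℕ ss p)))))
    embed : IsEmbedding (K (ss ∷ʳ p)) _ G
    embed = FromLists.isEmbedding (ss ∷ʳ p) G uniform x len uniq pos′ edge

private
  single-total : ∀ {r n} (bs : Vec ℕ r) (R : Vec (Fin n) r → Bool) →
    Counting.total (allFin n) (tt ∷ []) (λ _ → R) bs ≡ countᵇ (allR R) (tuples bs (allFin n))
  single-total bs R = +-identityʳ _

-- The first part keeps the size a₁ throughout, and the descent starts from the sizes `ss` in the
-- others. There the first part is chosen last, from fewer than p common neighbours, so there are at
-- most n^(sum `ss`) p^a₁ such tuples; the S-th power explains the constant `p ^ (a₁ * S)`.
upper-bound : ∀ {r n} a₁ (as ss : Vec ℕ r) p (G : Hypergraph n) → Uniform (suc r) G → Free (K (ss ∷ʳ p)) G → 0 < n → 0 < p →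
  (∀ i → 0 < lookup ss i) → (∀ i → lookup as i ≤ lookup ss i) → (∀ i → a₁ ≤ lookup ss i) → let S = productV ss in
  copies (K (a₁ ∷ as)) G ^ S * n ^ (a₁ * productV as) ≤ upperConst S as ss (p ^ (a₁ * S)) * n ^ (S * (a₁ + sum as))
upper-bound {r} {n} a₁ as ss p G uniform free n>0 p>0 pos as≤ a₁≤ = begin
  copies (K (a₁ ∷ as)) G ^ S * n ^ (a₁ * productV as)     ≤⟨ *-monoˡ-≤ (n ^ (a₁ * productV as)) (^-monoˡ-≤ S (≤-trans (copies≤tuples (a₁ ∷ as) G) (≤-reflexive (sym total≡)))) ⟩
  total Zs R as ^ S * n ^ (a₁ * productV as)              ≤⟨ upper-descent as ss S a₁ (p ^ (a₁ * S)) adm V n a₁ Zs R n>0 V≤ Zs≤ base ⟩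
  upperConst S as ss (p ^ (a₁ * S)) * n ^ (S * (a₁ + sum as)) ∎
  where
  open ≤-Reasoning
  S = productV ss
  V = allFin n
  open Counting V
  R₀ : ⊤ → Vec (Fin n) (suc r) → Bool
  R₀ _ = G ∘ setOf
  Zs = pairs (tt ∷ []) (combos a₁ V)
  R = absorb R₀
  V≤ : length V ≤ n
  V≤ = ≤-reflexive (length-tabulate {n = n} id)
  Zs≤ : length Zs ≤ n ^ a₁
  Zs≤ = ≤-trans (≤-reflexive (trans (length-pairs (tt ∷ []) (combos a₁ V)) (*-identityˡ _))) (length-combos≤ a₁ V n V≤)
  total≡ : total Zs R as ≡ countᵇ (allR (G ∘ setOf)) (tuples (a₁ ∷ as) V)
  total≡ = trans (sym (total-tail (tt ∷ []) R₀ a₁ as)) (single-total (a₁ ∷ as) (G ∘ setOf))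
  adm : Admissible S a₁ as ss
  adm = subst (λ w → Admissible S w as ss) (*-identityʳ a₁) (admissible as ss a₁ 1 S pos as≤ a₁≤ (≤-reflexive (*-identityˡ S)))
  degree≤ : ∀ zt → zt ∈ pairs (tt ∷ []) (tuples ss V) → bin (degree R₀ zt) a₁ ≤ p ^ a₁
  degree≤ (tt , t) zt∈ = ≤-trans (bin≤^ (degree R₀ (tt , t)) a₁) (^-monoˡ-≤ a₁ (<⇒≤ (common-neighbours<p ss p G uniform free pos p>0 t (member zt∈))))
    where
    member : (tt , t) ∈ pairs (tt ∷ []) (tuples ss V) → t ∈ tuples ss V
    member zt∈ with concatMap⁻ (λ z → List.map (z ,_) (tuples ss V)) (tt ∷ []) zt∈
    ... | z , _ , zt∈′ with ∈-map⁻ (z ,_) zt∈′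
    ...   | t′ , t′∈ , refl = t′∈
  total≤ : total Zs R ss ≤ n ^ sum ss * p ^ a₁
  total≤ = begin
    total Zs R ss                                                       ≡⟨ total-tail (tt ∷ []) R₀ a₁ ss ⟨
    total (tt ∷ []) R₀ (a₁ ∷ ss)                                        ≡⟨ total-head (tt ∷ []) R₀ a₁ ss ⟩
    ΣL (λ zt → bin (degree R₀ zt) a₁) (pairs (tt ∷ []) (tuples ss V))   ≤⟨ ΣL-mono-∈ (pairs (tt ∷ []) (tuples ss V)) degree≤ ⟩
    ΣL (λ _ → p ^ a₁) (pairs (tt ∷ []) (tuples ss V))                   ≡⟨ ΣL-const (p ^ a₁) (pairs (tt ∷ []) (tuples ss V)) ⟩
    length (pairs (tt ∷ []) (tuples ss V)) * p ^ a₁                     ≡⟨ cong (_* p ^ a₁) (trans (length-pairs (tt ∷ []) (tuples ss V)) (*-identityˡ _)) ⟩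
    length (tuples ss V) * p ^ a₁                                       ≤⟨ *-monoˡ-≤ (p ^ a₁) (length-tuples≤ ss V n V≤) ⟩
    n ^ sum ss * p ^ a₁                                                 ∎
  base : total Zs R ss ^ S * n ^ (a₁ * S) ≤ p ^ (a₁ * S) * n ^ (S * (a₁ + sum ss))
  base = begin
    total Zs R ss ^ S * n ^ (a₁ * S)                    ≤⟨ *-monoˡ-≤ (n ^ (a₁ * S)) (^-monoˡ-≤ S total≤) ⟩
    (n ^ sum ss * p ^ a₁) ^ S * n ^ (a₁ * S)            ≡⟨ cong (_* n ^ (a₁ * S)) (trans (*-^ (n ^ sum ss) (p ^ a₁) S) (cong₂ _*_ (^-*-assoc n (sum ss) S) (^-*-assoc p a₁ S))) ⟩
    n ^ (sum ss * S) * p ^ (a₁ * S) * n ^ (a₁ * S)      ≡⟨ trans (cong (_* n ^ (a₁ * S)) (*-comm (n ^ (sum ss * S)) (p ^ (a₁ * S)))) (*-assoc (p ^ (a₁ * S)) _ _) ⟩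
    p ^ (a₁ * S) * (n ^ (sum ss * S) * n ^ (a₁ * S))    ≡⟨ cong (p ^ (a₁ * S) *_) (^-distribˡ-+-* n (sum ss * S) (a₁ * S)) ⟨
    p ^ (a₁ * S) * n ^ (sum ss * S + a₁ * S)            ≡⟨ cong (λ e → p ^ (a₁ * S) * n ^ e) (trans (sym (*-distribʳ-+ S (sum ss) a₁)) (trans (*-comm (sum ss + a₁) S) (cong (S *_) (+-comm (sum ss) a₁)))) ⟩
    p ^ (a₁ * S) * n ^ (S * (a₁ + sum ss))              ∎

lower-bound : ∀ {k n} a₁ (as s : Vec ℕ (suc k)) κ q p → let a = a₁ ∷ as ; S = productV s ; B = partSizeConst a in
  Prime q → 2 < q → B ≤ q → suc (suc k) * suc S ≤ 2 ^ suc κ → 0 < a₁ → (∀ i → 0 < lookup as i) → (∀ i → 0 < lookup s i) → (∀ i → lookup as i ≤ lookup s i) →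
  B * solutionBound (2 ^ suc κ) S < p → suc (suc k) * (B * q ^ S) ≤ n →
  Σ (Hypergraph n) λ G → Uniform (suc (suc k)) G × Free (K (s ∷ʳ p)) G ×
    (B * q ^ S) ^ sum a ≤ lowerConst a * copies (K a) G * q ^ productV a
lower-bound {k} {n} a₁ as s κ q p q-prime q>2 B≤q room a₁>0 as>0 s>0 as≤s p-large X≤n =
  partite , uniform , C.partite-free s refl s>0 p room S≤D p-large c X≤n , (begin
    X ^ sum a                                                                     ≤⟨ supersaturation a S (a₁>0 , positive as as>0) tails V q X 0 (tt ∷ []) (λ _ → C.relation c) q>0 ≤-refl V≤ ≤-refl many-edges ⟩
    lowerConst a * Counting.total V (tt ∷ []) (λ _ → C.relation c) a * q ^ productV a ≤⟨ *-monoˡ-≤ (q ^ productV a) (*-monoʳ-≤ (lowerConst a) found) ⟩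
    lowerConst a * copies (K a) partite * q ^ productV a                          ∎)
  where
  open ≤-Reasoning
  a = a₁ ∷ as
  S = productV s
  B = partSizeConst a
  X = B * q ^ S
  V = allFin X
  T : Tower q (suc κ)
  T = tower q-prime q>2 (suc κ)
  module C = Construction (Tower.field′ T) q-prime (Tower.q≡0 T) (Tower.characteristic T) κ (Tower.size≡ T) (Tower.fixed T) S B B≤q
  q>0 : 0 < q
  q>0 = prime>0 q-prime
  S≤D : S ≤ 2 ^ suc κ
  S≤D = ≤-trans (≤-trans (n≤1+n S) (m≤n*m (suc S) (suc (suc k)))) room
  V≤ : length V ≤ X
  V≤ = ≤-reflexive (length-tabulate {n = X} id)
  popular = C.popular-norm (suc (suc k)) (*-mono-≤ (1≤partSizeConst a) (m^n>0 q {{>-nonZero q>0}} S))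
  c = proj₁ popular
  open Partite {suc (suc k)} {X} {n} (C.relation c) X≤n
  tails : TailsBounded S a
  tails = productV-mono as s as≤s , tailsBounded as s S s>0 as≤s ≤-refl
  many-edges : X ^ suc (suc k) ≤ Counting.total V (tt ∷ []) (λ _ → C.relation c) (ones (suc (suc k))) * q
  many-edges = subst (λ e → X ^ suc (suc k) ≤ e * q) (sym (single-total (ones (suc (suc k))) (C.relation c))) (proj₂ popular)
  pos : ∀ i → 0 < lookup a i
  pos zero = a₁>0
  pos (suc i) = as>0 i
  found : Counting.total V (tt ∷ []) (λ _ → C.relation c) a ≤ copies (K a) partite
  found = subst (_≤ copies (K a) partite) (sym (single-total a (C.relation c))) (tuples≤copies a partite uniform pos ι ι-injective (C.relation c) partite⁺)

bracket : ∀ (f : ℕ → ℕ) n h₀ → f h₀ ≤ n → ∀ fuel → n < f (h₀ + fuel) → ∃ λ h → h₀ ≤ h × f h ≤ n × n < f (suc h)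
bracket f n h₀ le zero lt = ⊥-elim (<-irrefl refl (≤-<-trans le (subst (λ z → n < f z) (+-identityʳ h₀) lt)))
bracket f n h₀ le (suc fuel) lt with n <? f (h₀ + fuel)
... | yes lt′ = bracket f n h₀ le fuel lt′
... | no ¬lt = h₀ + fuel , m≤m+n h₀ fuel , ≮⇒≥ ¬lt , subst (λ z → n < f z) (+-suc h₀ fuel) lt

-- Let h be such that A 4^((h+1) S) ≤ n < A 4^((h+2) S), and take a prime q with 4^h < q ≤ 4^(h+1).
-- Then 4^(h+2) ≤ 16 q, which is the origin of `16 ^ S`. Starting the search at h = b + 5 secures
-- both q ≥ b and the range in which primes have been found.
suitable-prime : ∀ A S → 0 < A → 0 < S → ∀ b n → A * (4 ^ suc (b + 5)) ^ S ≤ n →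
  ∃ λ q → Prime q × 2 < q × b ≤ q × A * q ^ S ≤ n × n ≤ A * 16 ^ S * q ^ S
suitable-prime A S A>0 S>0 b n N≤n = finish (bracket f n (b + 5) N≤n n n<f)
  where
  open ≤-Reasoning
  f : ℕ → ℕ
  f h = A * (4 ^ suc h) ^ S
  n<f : n < f (b + 5 + n)
  n<f = begin-strict
    n                                 <⟨ n<p^n 4 (s≤s (s≤s z≤n)) n ⟩
    4 ^ n                             ≤⟨ ^-monoʳ-≤ 4 (≤-trans (m≤n+m n (b + 5)) (n≤1+n (b + 5 + n))) ⟩
    4 ^ suc (b + 5 + n)               ≡⟨ *-identityʳ (4 ^ suc (b + 5 + n)) ⟨
    (4 ^ suc (b + 5 + n)) ^ 1         ≤⟨ ^-monoʳ-≤ (4 ^ suc (b + 5 + n)) {{m^n≢0 4 (suc (b + 5 + n))}} S>0 ⟩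
    (4 ^ suc (b + 5 + n)) ^ S         ≤⟨ m≤n*m _ A {{>-nonZero A>0}} ⟩
    f (b + 5 + n)                     ∎
  finish : (∃ λ h → b + 5 ≤ h × f h ≤ n × n < f (suc h)) → ∃ λ q → Prime q × 2 < q × b ≤ q × A * q ^ S ≤ n × n ≤ A * 16 ^ S * q ^ S
  finish (h , b+5≤h , fh≤n , n<f) = with-prime (subst (λ z → ∃ λ q → Prime q × 4 ^ z < q × q ≤ 4 ^ suc z) (m∸n+n≡m (≤-trans (m≤n+m 5 b) b+5≤h)) (∃prime-between-powers-of-4 (h ∸ 5)))
    where
    with-prime : (∃ λ q → Prime q × 4 ^ h < q × q ≤ 4 ^ suc h) → ∃ λ q → Prime q × 2 < q × b ≤ q × A * q ^ S ≤ n × n ≤ A * 16 ^ S * q ^ S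
    with-prime (q , q-prime , 4^h<q , q≤) = q , q-prime , ≤-<-trans (≤-trans (≤-trans (s≤s (s≤s z≤n)) (m≤n+m 5 b)) (≤-trans b+5≤h h≤4^h)) 4^h<q ,
      ≤-trans (≤-trans (m≤m+n b 5) (≤-trans b+5≤h h≤4^h)) (<⇒≤ 4^h<q) ,
      ≤-trans (*-monoʳ-≤ A (^-monoˡ-≤ S q≤)) fh≤n , (begin
        n                               ≤⟨ <⇒≤ n<f ⟩
        A * (4 ^ suc (suc h)) ^ S       ≡⟨ cong (λ z → A * z ^ S) (*-assoc 4 4 (4 ^ h)) ⟨
        A * (16 * 4 ^ h) ^ S            ≤⟨ *-monoʳ-≤ A (^-monoˡ-≤ S (*-monoʳ-≤ 16 (<⇒≤ 4^h<q))) ⟩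
        A * (16 * q) ^ S                ≡⟨ trans (cong (A *_) (*-^ 16 q S)) (sym (*-assoc A (16 ^ S) (q ^ S))) ⟩
        A * 16 ^ S * q ^ S              ∎)
      where
      h≤4^h : h ≤ 4 ^ h
      h≤4^h = <⇒≤ (n<p^n 4 (s≤s (s≤s z≤n)) h)

theorem1p1 : (k : ℕ) (a : Vec ℕ (suc (suc k))) (s : Vec ℕ (suc k))
    → (∀ i → 0 < lookup a i) → (∀ i → 0 < lookup s i)
    → lookup a zero < lookup s zero
    → (∀ (i j : Fin (suc k)) → i ≤ᶠ j → lookup s i ≤ lookup s j)
    → (∀ (i : Fin (suc k)) → lookup a (suc i) ≤ lookup s i)
    → Σ ℕ λ c → 0 < c × (∀ (p : ℕ) → c ≤ p →
    Σ ℕ λ C₁ → Σ ℕ λ C₂ → Σ ℕ λ N → 0 < C₁ × (∀ (n : ℕ) → N ≤ n →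
    ((∀ (G : Hypergraph n) → Uniform (suc (suc k)) G → Free (K (s ∷ʳ p)) G
    → copies (K a) G ^ productV s
    ≤ C₂ * n ^ (sum a * productV s ∸ productV a))
    × (Σ (Hypergraph n) λ G → Uniform (suc (suc k)) G × Free (K (s ∷ʳ p)) G
    × n ^ (sum a * productV s ∸ productV a)
    ≤ C₁ * copies (K a) G ^ productV s))))
theorem1p1 k (a₁ ∷ as) s a>0 s>0 a₁<s₀ s-mono as≤s = suc threshold , s≤s z≤n , λ p c≤p →
  suc (Λ ^ E * L ^ S) , upperConst S as s (p ^ (a₁ * S)) , A * (4 ^ suc (B + 5)) ^ S , s≤s z≤n , λ n N≤n → upper p c≤p n N≤n , lower p c≤p n N≤n
  where
  a = a₁ ∷ as
  S = productV s
  B = partSizeConst a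
  L = lowerConst a
  -- The degree D = 2^(κ+1) must be at least r (S + 1); taking κ equal to that number suffices, as κ
  -- < 2^κ.
  κ = suc (suc k) * suc S
  A = suc (suc k) * B
  -- An upper bound for n / q^S; this loss, raised to the power E, enters the constant of the lower
  -- bound.
  Λ = A * 16 ^ S
  E = sum a * S ∸ productV a
  -- Each of the B labels occurs at most `solutionBound` times among the common neighbours. The
  -- value depends on r, a and s alone, so the same threshold serves all p and n.
  threshold = B * solutionBound (2 ^ suc κ) S
  open ≤-Reasoning
  S>0 : 0 < S
  S>0 = productV>0 s s>0
  A>0 : 0 < A
  A>0 = *-mono-≤ {1} {suc (suc k)} (s≤s z≤n) (1≤partSizeConst a)
  a₁≤s : ∀ i → a₁ ≤ lookup s i
  a₁≤s i = ≤-trans (<⇒≤ a₁<s₀) (s-mono zero i z≤n)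
  -- The truncated subtraction in the exponent is exact: a₁ is at most `sum a` and the product of
  -- the other a_i is at most S.
  E≡ : E + productV a ≡ sum a * S
  E≡ = m∸n+n≡m (begin
    a₁ * productV as      ≤⟨ *-mono-≤ (m≤m+n a₁ (sum as)) (productV-mono as s as≤s) ⟩
    sum a * S             ∎)
  N>0 : 0 < A * (4 ^ suc (B + 5)) ^ S
  N>0 = *-mono-≤ A>0 (m^n>0 (4 ^ suc (B + 5)) {{m^n≢0 4 (suc (B + 5))}} S)
  upper : ∀ p → suc threshold ≤ p → ∀ n → A * (4 ^ suc (B + 5)) ^ S ≤ n → (G : Hypergraph n) → Uniform (suc (suc k)) G → Free (K (s ∷ʳ p)) G →
    copies (K a) G ^ S ≤ upperConst S as s (p ^ (a₁ * S)) * n ^ E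
  upper p c≤p n N≤n G uniform free = *-cancelʳ-≤ _ _ (n ^ productV a) {{m^n≢0 n (productV a) {{>-nonZero n>0}}}} (begin
    copies (K a) G ^ S * n ^ productV a          ≤⟨ upper-bound a₁ as s p G uniform free n>0 (≤-trans (s≤s z≤n) c≤p) s>0 as≤s a₁≤s ⟩
    C₂ * n ^ (S * sum a)                         ≡⟨ cong (λ e → C₂ * n ^ e) (trans (*-comm S (sum a)) (sym E≡)) ⟩
    C₂ * n ^ (E + productV a)                    ≡⟨ trans (cong (C₂ *_) (^-distribˡ-+-* n E (productV a))) (sym (*-assoc C₂ (n ^ E) (n ^ productV a))) ⟩
    C₂ * n ^ E * n ^ productV a                  ∎)
    where
    C₂ = upperConst S as s (p ^ (a₁ * S))
    n>0 : 0 < n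
    n>0 = ≤-trans N>0 N≤n
  lower : ∀ p → suc threshold ≤ p → ∀ n → A * (4 ^ suc (B + 5)) ^ S ≤ n →
    Σ (Hypergraph n) λ G → Uniform (suc (suc k)) G × Free (K (s ∷ʳ p)) G × n ^ E ≤ suc (Λ ^ E * L ^ S) * copies (K a) G ^ S
  lower p c≤p n N≤n = with-prime (suitable-prime A S A>0 S>0 B n N≤n)
    where
    with-prime : (∃ λ q → Prime q × 2 < q × B ≤ q × A * q ^ S ≤ n × n ≤ Λ * q ^ S) →
      Σ (Hypergraph n) λ G → Uniform (suc (suc k)) G × Free (K (s ∷ʳ p)) G × n ^ E ≤ suc (Λ ^ E * L ^ S) * copies (K a) G ^ S
    with-prime (q , q-prime , q>2 , B≤q , Aq≤n , n≤Λq) = finish (lower-bound a₁ as s κ q p q-prime q>2 B≤q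
        (<⇒≤ (<-≤-trans (n<p^n 2 ≤-refl κ) (^-monoʳ-≤ 2 (n≤1+n κ)))) (a>0 zero) (a>0 ∘ suc) s>0 as≤s c≤p
        (≤-trans (≤-reflexive (sym (*-assoc (suc (suc k)) B (q ^ S)))) Aq≤n))
      where
      instance
        q≢0 : NonZero q
        q≢0 = >-nonZero (prime>0 q-prime)
      finish : (Σ (Hypergraph n) λ G → Uniform (suc (suc k)) G × Free (K (s ∷ʳ p)) G × (B * q ^ S) ^ sum a ≤ L * copies (K a) G * q ^ productV a) →
        Σ (Hypergraph n) λ G → Uniform (suc (suc k)) G × Free (K (s ∷ʳ p)) G × n ^ E ≤ suc (Λ ^ E * L ^ S) * copies (K a) G ^ S
      finish (G , uniform , free , many) = G , uniform , free , (begin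
        n ^ E                                   ≤⟨ ^-monoˡ-≤ E n≤Λq ⟩
        (Λ * q ^ S) ^ E                         ≡⟨ trans (*-^ Λ (q ^ S) E) (cong (Λ ^ E *_) (^-comm q S E)) ⟩
        Λ ^ E * (q ^ E) ^ S                     ≤⟨ *-monoʳ-≤ (Λ ^ E) (^-monoˡ-≤ S q^E≤) ⟩
        Λ ^ E * (L * X) ^ S                     ≡⟨ trans (cong (Λ ^ E *_) (*-^ L X S)) (sym (*-assoc (Λ ^ E) (L ^ S) (X ^ S))) ⟩
        Λ ^ E * L ^ S * X ^ S                   ≤⟨ *-monoˡ-≤ (X ^ S) (n≤1+n (Λ ^ E * L ^ S)) ⟩
        suc (Λ ^ E * L ^ S) * X ^ S             ∎)
        where
        X = copies (K a) G
        q^E≤ : q ^ E ≤ L * X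
        q^E≤ = *-cancelʳ-≤ (q ^ E) (L * X) (q ^ productV a) {{m^n≢0 q (productV a)}} (begin
          q ^ E * q ^ productV a      ≡⟨ ^-distribˡ-+-* q E (productV a) ⟨
          q ^ (E + productV a)        ≡⟨ cong (q ^_) (trans E≡ (*-comm (sum a) S)) ⟩
          q ^ (S * sum a)             ≡⟨ ^-*-assoc q S (sum a) ⟨
          (q ^ S) ^ sum a             ≤⟨ ^-monoˡ-≤ (sum a) (m≤n*m (q ^ S) B {{>-nonZero (1≤partSizeConst a)}}) ⟩
          (B * q ^ S) ^ sum a         ≤⟨ many ⟩
          L * X * q ^ productV a      ∎)
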